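{- Let $r,s\ge1$ be integers and $n=r+s$. The number of realizations of quivers in $\mathcal{Q}_{n-1}$ with parameters $r_1+2r_2=r$ and $s_1+2s_2=s$ is $$\frac12\sum_{k|r,\,k|s}\frac{\phi(k)}{r+s}\binom{2r/k}{r/k}\binom{2s/k}{s/k}.$$ Moreover, for integers $r_2,s_2\ge0$ with $r=r_1+2r_2$, $s=s_1+2s_2$ ($r_1,s_1\ge0$), the number of realizations of quivers in $\mathcal{Q}_{n-1}$ with parameters $(r_1,r_2,s_1,s_2)$ is $$\sum_{k|r,\,k|r_2,\,k|s,\,k|s_2}\frac{\phi(k)}k(-1)^{(r+r_2+s+s_2)/k}\sum_{\substack{i,j\geq0\\(i,j)\neq(0,0)}}\frac{(-1)^{i+j}}{2(i+j)}\binom{2i}{i,\,2i-r/k,\,r_2/k,\,(r-r_2)/k-i}\binom{2j}{j,\,2j-s/k,\,s_2/k,\,(s-s_2)/k-j}.$$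
   Context: $\phi$ is Euler's totient function ($\phi(k)=\#\{1\le d\le k:\gcd(d,k)=1\}$); $k$ runs over positive integers. Multinomial coefficients $\binom{m}{a_1,\dots,a_t}$ with $\sum a_i=m$ equal $m!/(a_1!\cdots a_t!)$ if all $a_i\ge0$ and $0$ otherwise. All quivers are finite, connected, without loops and without oriented 2-cycles, considered up to isomorphism. A rooted quiver of type $A$ is a quiver with a distinguished vertex (the root), defined recursively as one of: (i) a single vertex, the root; (ii) a root $\rho$, a rooted quiver of type $A$ with root $v\ne\rho$, and one arrow between $\rho$ and $v$ (either direction); (iii) a root $\rho$, an oriented 3-cycle $\rho\to u\to w\to\rho$, and two vertex-disjoint rooted quivers of type $A$ with roots $u$ and $w$. For $n\ge2$, $\mathcal{Q}_{n-1}$ is the class of quivers with $n$ vertices such that: (1) there is exactly one full subquiver which is a non-oriented cycle (underlying graph a cycle, arrows not all oriented the same way) of length $\ge2$ (length 2 = double arrow); its arrows are base arrows; (2) for each base arrow $\alpha:x\to y$ there may be a vertex $z_\alpha$ off the cycle with arrows $y\to z_\alpha\to x$ (an oriented 3-cycle; for a double arrow only one of its arrows is regarded as part of such a 3-cycle), and no other arrows are incident to cycle vertices; (3) removing the cycle vertices leaves a disjoint union of rooted quivers of type $A$, one with root $z_\alpha$ for each existing $z_\alpha$, attached to $\alpha$. (These are exactly the quivers mutation equivalent to a non-oriented $n$-cycle, i.e. of type $\tilde A_{n-1}$.) A realization of $Q\in\mathcal{Q}_{n-1}$ is $Q$ with an embedding of its non-oriented cycle in the plane (a choice of clockwise direction),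 realizations being identified if a quiver isomorphism maps one to the other preserving the clockwise direction. For a realization: $r_1$ = number of arrows in no oriented 3-cycle which are anti-clockwise base arrows or lie in a rooted quiver attached to an anti-clockwise base arrow; $r_2$ = number of oriented 3-cycles containing an anti-clockwise base arrow or lying in a rooted quiver attached to an anti-clockwise base arrow; $s_1,s_2$ likewise with "clockwise". Then $r_1+2r_2+s_1+2s_2=n$. -}

module Defs where

open import Data.Nat using (ℕ; zero; suc; _+_; _*_; _∸_; _≤_; _<_; _%_; _!)
import Data.Nat as ℕ
open import Data.Nat.Divisibility using (_∣?_)
open import Data.Nat.GCD using (gcd)
open import Data.Nat.Combinatorics using (_C_)
open import Data.Nat.DivMod using (_mod_)
open import Data.Integer as ℤ using (ℤ; +_)
import Data.Rational as ℚ
open import Data.Rational using (ℚ; 0ℚ; 1ℚ; ½)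
open import Data.Fin using (Fin; toℕ)
open import Data.Fin.Properties using () renaming (_≟_ to _≟ᶠ_)
open import Data.Bool using (Bool; true; false; _∧_; _∨_; not; if_then_else_)
open import Data.Maybe using (Maybe; just; nothing; is-just; is-nothing)
import Data.Maybe as Maybe
open import Data.Maybe.Properties using (≡-dec)
open import Data.List using (List; []; _∷_; length; map; filter; upTo; allFin; foldr)
open import Data.List.Relation.Unary.All using (All)
open import Data.List.Relation.Unary.Any using (Any)
open import Data.List.Relation.Unary.AllPairs using (AllPairs)
open import Data.Product using (Σ; ∃; ∃-syntax; _×_; _,_; proj₁)
open import Data.Sum using (_⊎_)
open import Function.Bundles using (_↔_; Inverse)
open import Relation.Binary.PropositionalEquality using (_≡_; _≢_)
open import Relation.Nullary using (¬_; Dec; does)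
open import Relation.Nullary.Decidable using (⌊_⌋)

𝟙 : Bool → ℕ
𝟙 true  = 1
𝟙 false = 0

∑ᶠ : ∀ {n} → (Fin n → ℕ) → ℕ
∑ᶠ {n} f = foldr _+_ 0 (map f (allFin n))

∑ℚ-from1 : ℕ → (ℕ → ℚ) → ℚ
∑ℚ-from1 N f = foldr ℚ._+_ 0ℚ (map (λ j → f (suc j)) (upTo N))

∑ℚ-from0 : ℕ → (ℕ → ℚ) → ℚ
∑ℚ-from0 N f = foldr ℚ._+_ 0ℚ (map f (upTo (suc N)))

⟦_⟧ : ℕ → ℚ
⟦ n ⟧ = + n ℚ./ 1

-- total division of naturals (only used when the divisor is positive)
_÷ₙ_ : ℕ → ℕ → ℕ
m ÷ₙ zero  = 0
m ÷ₙ suc d = m ℕ./ suc d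

-- total division of a rational by a natural (only used with positive divisor)
_÷ℚ_ : ℚ → ℕ → ℚ
q ÷ℚ zero  = 0ℚ
q ÷ℚ suc d = q ℚ.* (+ 1 ℚ./ suc d)

sgn : ℕ → ℚ
sgn zero    = 1ℚ
sgn (suc e) = ℚ.- sgn e

φ : ℕ → ℕ
φ k = length (filter (λ d → gcd d k ℕ.≟ 1) (map suc (upTo k)))

_∣ᵇ_ : ℕ → ℕ → Bool
k ∣ᵇ m = does (k ∣? m)

-- multinomial coefficient  (m ; a₁,…,a_t) = m!/(a₁!⋯a_t!) if all aᵢ ≥ 0, else 0
-- (only applied when ∑ aᵢ = m)
multinomial : ℕ → List ℤ → ℕ
multinomial m as =
  if foldr (λ a b → does (ℤ.+ 0 ℤ.≤? a) ∧ b) true as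
  then (m !) ÷ₙ foldr _*_ 1 (map (λ a → ℤ.∣ a ∣ !) as)
  else 0

-- Quivers: a quiver on the vertex set Fin n is given by its arrow
-- multiplicities  arr a b = number of arrows a → b.

Arrows : ℕ → Set
Arrows n = Fin n → Fin n → ℕ

data Reach {n} (arr : Arrows n) : Fin n → Fin n → Set where
  here : ∀ {a} → Reach arr a a
  fwd  : ∀ {a b c} → 1 ≤ arr a b → Reach arr b c → Reach arr a c
  bwd  : ∀ {a b c} → 1 ≤ arr b a → Reach arr b c → Reach arr a c

IsQuiver : ∀ {n} → Arrows n → Set
IsQuiver {n} arr =
  (∀ a → arr a a ≡ 0) ×
  (∀ a b → arr a b ≡ 0 ⊎ arr b a ≡ 0) ×
  (∀ a b → Reach arr a b)

_∈ₛ_ : ∀ {n} → Fin n → (Fin n → Bool) → Set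
v ∈ₛ S = S v ≡ true

-- Rooted quivers of type A: RootedA arr S ρ says that the full subquiver
-- of arr on the vertex set S is a rooted quiver of type A with root ρ.
data RootedA {n} (arr : Arrows n) : (Fin n → Bool) → Fin n → Set where
  single : ∀ {S ρ} → (∀ x → S x ≡ ⌊ x ≟ᶠ ρ ⌋) → RootedA arr S ρ
  edge   : ∀ {S S' ρ v} →
           RootedA arr S' v →
           S' ρ ≡ false →
           (∀ x → S x ≡ (⌊ x ≟ᶠ ρ ⌋ ∨ S' x)) →
           (∀ x → x ∈ₛ S' → arr ρ x + arr x ρ ≡ 𝟙 ⌊ x ≟ᶠ v ⌋) →
           RootedA arr S ρ
  tri    : ∀ {S S₁ S₂ ρ u w} →
           RootedA arr S₁ u → RootedA arr S₂ w →
           S₁ ρ ≡ false → S₂ ρ ≡ false → (∀ x → (S₁ x ∧ S₂ x) ≡ false) →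
           (∀ x → S x ≡ (⌊ x ≟ᶠ ρ ⌋ ∨ (S₁ x ∨ S₂ x))) →
           arr ρ u ≡ 1 → arr u ρ ≡ 0 →
           arr u w ≡ 1 → arr w u ≡ 0 →
           arr w ρ ≡ 1 → arr ρ w ≡ 0 →
           (∀ x → x ∈ₛ S₁ → x ≢ u → arr ρ x + arr x ρ ≡ 0) →
           (∀ x → x ∈ₛ S₂ → x ≢ w → arr ρ x + arr x ρ ≡ 0) →
           (∀ x y → x ∈ₛ S₁ → y ∈ₛ S₂ →
              arr x y + arr y x ≡ 𝟙 (⌊ x ≟ᶠ u ⌋ ∧ ⌊ y ≟ᶠ w ⌋)) →
           RootedA arr S ρ

-- Cycles.  A cycle of length m = 2 + m₀ is given by its vertices
-- c 0, c 1, …, c (m-1) in cyclic order and, for each position i, the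
-- orientation w i of the base arrow between c i and c (i+1 mod m):
-- w i = true means c i → c (i+1), w i = false means c (i+1) → c i.
-- For m = 2 the two base arrows are the two arrows of a double arrow.

next : ∀ {m₀} → Fin (suc (suc m₀)) → Fin (suc (suc m₀))
next {m₀} i = suc (toℕ i) mod suc (suc m₀)

tailB headB : ∀ {m₀} → (Fin (suc (suc m₀)) → Bool) → Fin (suc (suc m₀)) → Fin (suc (suc m₀))
tailB w i = if w i then i else next i
headB w i = if w i then next i else i

baseCount : ∀ {m₀} → (Fin (suc (suc m₀)) → Bool) → Fin (suc (suc m₀)) → Fin (suc (suc m₀)) → ℕ
baseCount w i j = ∑ᶠ (λ t → 𝟙 (⌊ tailB w t ≟ᶠ i ⌋ ∧ ⌊ headB w t ≟ᶠ j ⌋))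

IsNonOrientedCycle : ∀ {n} → Arrows n → (m₀ : ℕ) →
                     (Fin (suc (suc m₀)) → Fin n) → (Fin (suc (suc m₀)) → Bool) → Set
IsNonOrientedCycle arr m₀ c w =
  (∀ i j → c i ≡ c j → i ≡ j) ×
  (∃[ i ] ∃[ j ] w i ≢ w j) ×
  (∀ i j → arr (c i) (c j) ≡ baseCount w i j)

-- Realizations of quivers in 𝒬_{n-1}.
--   arr   : the quiver
--   cyc   : the vertices of the non-oriented cycle, in clockwise order
--   cw    : cw i = true iff base arrow i is clockwise
--   att   : att i = just z  iff  z = z_α for the base arrow α = i
--   part  : part v = nothing if v is on the cycle, and  just i  if v lies in
--           the rooted quiver of type A attached to base arrow i.

record RData (n : ℕ) : Set where
  field
    arr  : Arrows n
    m₀   : ℕ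
    cyc  : Fin (suc (suc m₀)) → Fin n
    cw   : Fin (suc (suc m₀)) → Bool
    att  : Fin (suc (suc m₀)) → Maybe (Fin n)
    part : Fin n → Maybe (Fin (suc (suc m₀)))

  inPart : Fin (suc (suc m₀)) → Fin n → Bool
  inPart i v = ⌊ ≡-dec _≟ᶠ_ (part v) (just i) ⌋

open RData public

IsRealization : ∀ {n} → RData n → Set
IsRealization {n} R =
  IsQuiver (arr R) ×
  IsNonOrientedCycle (arr R) (m₀ R) (cyc R) (cw R) ×
  (∀ m₀' c' w' → IsNonOrientedCycle (arr R) m₀' c' w' →
     (∀ j → ∃[ i ] c' j ≡ cyc R i) × (∀ i → ∃[ j ] cyc R i ≡ c' j)) ×
  (∀ i → part R (cyc R i) ≡ nothing) ×
  (∀ v → part R v ≡ nothing → ∃[ i ] cyc R i ≡ v) ×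
  (∀ i z → att R i ≡ just z → part R z ≡ just i) ×
  (∀ v i → part R v ≡ just i → ∃[ z ] att R i ≡ just z) ×
  (∀ v i j → part R v ≡ just i →
     arr R (cyc R j) v ≡ 𝟙 (⌊ ≡-dec _≟ᶠ_ (att R i) (just v) ⌋ ∧ ⌊ headB (cw R) i ≟ᶠ j ⌋) ×
     arr R v (cyc R j) ≡ 𝟙 (⌊ ≡-dec _≟ᶠ_ (att R i) (just v) ⌋ ∧ ⌊ tailB (cw R) i ≟ᶠ j ⌋)) ×
  (∀ u v i j → part R u ≡ just i → part R v ≡ just j → i ≢ j → arr R u v ≡ 0) ×
  (∀ i z → att R i ≡ just z → RootedA (arr R) (inPart R i) z)

Realization : ℕ → Set
Realization n = Σ (RData n) IsRealization

-- Identification of realizations: a quiver isomorphism σ together with a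
-- rotation of the cycle (preserving the clockwise direction).
Identified : ∀ {n} → Realization n → Realization n → Set
Identified {n} (R , _) (R' , _) =
  m₀ R ≡ m₀ R' ×
  Σ (Fin n ↔ Fin n) λ σ →
  Σ (Fin (suc (suc (m₀ R))) → Fin (suc (suc (m₀ R')))) λ τ →
  Σ ℕ λ t →
    (∀ i → toℕ (τ i) ≡ (toℕ i + t) % suc (suc (m₀ R))) ×
    (∀ a b → arr R' (Inverse.to σ a) (Inverse.to σ b) ≡ arr R a b) ×
    (∀ i → Inverse.to σ (cyc R i) ≡ cyc R' (τ i)) ×
    (∀ i → cw R' (τ i) ≡ cw R i) ×
    (∀ i → att R' (τ i) ≡ Maybe.map (Inverse.to σ) (att R i))

module Params {n} (R : RData n) where
  no3cyc : Fin n → Fin n → Bool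
  no3cyc a b = not (foldr (λ c acc → (⌊ 1 ℕ.≤? arr R b c ⌋ ∧ ⌊ 1 ℕ.≤? arr R c a ⌋) ∨ acc) false (allFin n))

  freeArrows : Fin (suc (suc (m₀ R))) → ℕ
  freeArrows i = ∑ᶠ λ a → ∑ᶠ λ b →
    𝟙 (inPart R i a ∧ inPart R i b ∧ no3cyc a b) * arr R a b

  -- number of oriented 3-cycles inside the rooted quiver of part i
  -- (ordered triples (a,b,c) with a → b → c → a, divided by the 3 rotations)
  triangles : Fin (suc (suc (m₀ R))) → ℕ
  triangles i = (∑ᶠ λ a → ∑ᶠ λ b → ∑ᶠ λ c →
    𝟙 (inPart R i a ∧ inPart R i b ∧ inPart R i c ∧
       ⌊ 1 ℕ.≤? arr R a b ⌋ ∧ ⌊ 1 ℕ.≤? arr R b c ⌋ ∧ ⌊ 1 ℕ.≤? arr R c a ⌋)) ℕ./ 3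

  -- o = true : clockwise, o = false : anti-clockwise.
  -- arrows in no oriented 3-cycle: base arrows of orientation o without z_α
  -- (a base arrow with z_α lies in the 3-cycle through z_α), plus arrows of
  -- the rooted quivers attached to base arrows of orientation o.
  free : Bool → ℕ
  free o = ∑ᶠ λ i → 𝟙 ⌊ Data.Bool._≟_ (cw R i) o ⌋ *
    (𝟙 (is-nothing (att R i)) + freeArrows i)

  -- oriented 3-cycles: those through a base arrow of orientation o (one per
  -- existing z_α), plus those in the attached rooted quivers.
  cycles3 : Bool → ℕ
  cycles3 o = ∑ᶠ λ i → 𝟙 ⌊ Data.Bool._≟_ (cw R i) o ⌋ *
    (𝟙 (is-just (att R i)) + triangles i)

  r₁ r₂ s₁ s₂ : ℕ
  r₁ = free false
  r₂ = cycles3 false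
  s₁ = free true
  s₂ = cycles3 true

open Params public using (r₁; r₂; s₁; s₂)

HasCount : (n : ℕ) → (RData n → Set) → ℚ → Set
HasCount n P q =
  Σ (List (Realization n)) λ L →
    All (λ R → P (proj₁ R)) L ×
    AllPairs (λ R R' → ¬ Identified R R') L ×
    (∀ R → P (proj₁ R) → Any (Identified R) L) ×
    ⟦ length L ⟧ ≡ q

formula₁ : ℕ → ℕ → ℚ
formula₁ r s = ½ ℚ.* ∑ℚ-from1 (r + s) λ k →
  if (k ∣ᵇ r) ∧ (k ∣ᵇ s)
  then (⟦ φ k ⟧ ÷ℚ (r + s)) ℚ.* ⟦ (2 * (r ÷ₙ k)) C (r ÷ₙ k) ⟧ ℚ.* ⟦ (2 * (s ÷ₙ k)) C (s ÷ₙ k) ⟧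
  else 0ℚ

mult : ℕ → ℕ → ℕ → ℕ → ℕ
mult k r r₂ i = multinomial (2 * i)
  (+ i ∷ (+ (2 * i) ℤ.- + (r ÷ₙ k)) ∷ + (r₂ ÷ₙ k) ∷ (+ ((r ∸ r₂) ÷ₙ k) ℤ.- + i) ∷ [])

-- ∑_{k|r,k|r₂,k|s,k|s₂} φ(k)/k (-1)^{(r+r₂+s+s₂)/k}
--   ∑_{i,j ≥ 0, (i,j) ≠ (0,0)} (-1)^{i+j}/(2(i+j)) · mult · mult
-- (terms with i > r or j > s vanish, so i ranges over 0..r, j over 0..s)
formula₂ : ℕ → ℕ → ℕ → ℕ → ℚ
formula₂ r r₂ s s₂ = ∑ℚ-from1 (r + s) λ k →
  if (k ∣ᵇ r) ∧ (k ∣ᵇ r₂) ∧ (k ∣ᵇ s) ∧ (k ∣ᵇ s₂)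
  then (⟦ φ k ⟧ ÷ℚ k) ℚ.* sgn ((r + r₂ + s + s₂) ÷ₙ k) ℚ.*
       (∑ℚ-from0 r λ i → ∑ℚ-from0 s λ j →
          if ⌊ i + j ℕ.≟ 0 ⌋ then 0ℚ
          else (sgn (i + j) ÷ℚ (2 * (i + j))) ℚ.* ⟦ mult k r r₂ i ⟧ ℚ.* ⟦ mult k s s₂ j ⟧)
  else 0ℚ

{-# OPTIONS --safe #-}

-- A base arrow together with what is attached to it is encoded by a bead: its
-- orientation and a full binary tree, a leaf meaning that there is no z_α. The
-- internal nodes of the tree are the vertices of the attached rooted quiver, and
-- a realization amounts to a cyclic word of beads. In each orientation the leaves
-- number r₁ + 2 r₂ (resp. s₁ + 2 s₂) and the cherries, i.e. nodes with two leaves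
-- as children, number r₂ (resp. s₂).
--
-- Burnside's lemma for the rotations of words of length m, summed over m, gives
-- ∑_k φ(k)/k Λ(r/k, s/k), where Λ(i, j) is the coefficient of t^i u^j in
-- log 1/(1 - B(t) - B(u)) and B = t + B^2 enumerates binary trees by leaves. Since
-- 1 - 2 B(t) = √(1 - 4t), the Euler derivative of this logarithm is
-- ½ (1/√((1 - 4t)(1 - 4u)) - 1), so Λ(i, j) = C(2i,i) C(2j,j) / (2(i + j)).
-- Marking cherries by y and the other leaves by x turns the equation for B into
-- B = x - x^2 + y + B^2, i.e. replaces t by x - x^2 + y.
--
-- That the non-oriented cycle is the only one follows by eliminating the vertices
-- of the attached trees from the leaves up: each has at most two remaining
-- neighbours, and these form an oriented 3-cycle with it.


module Submission where

-- The generating functions stay in the background: every identity is proved for coefficients, as a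
-- finite sum. This is possible because each bead carries a leaf, so a word has at most r + s beads.
-- Leaves also count vertices: a tree with l leaves has l - 1 internal nodes, and its base arrow
-- accounts for one cycle vertex, whence n = r + s. The trees are ordered because orientation tells
-- the two children of a node apart. An isomorphism of rooted quivers therefore leaves no freedom in
-- the tree, and identification of realizations becomes rotation of words. The hypothesis r, s ≥ 1
-- puts both orientations into every word, so the cycle has length at least 2 and is not oriented.
-- The term y - x^2 in the marked equation exchanges the x^2 that B^2 assigns to a node with two
-- leaves for the mark y of a cherry. Both formulas come from one count in which the cherries of
-- each orientation are either prescribed or left free.

open import Defs
open import Data.Bool using (Bool; _∧_; false; if_then_else_; true)
open import Data.Empty using (⊥; ⊥-elim)
open import Data.List using (List; []; _++_; _∷_; allFin; concatMap; length; tabulate; upTo)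
open import Data.List.Membership.Propositional using (_∈_)
open import Data.List.Membership.Propositional.Properties using (∈-allFin; ∈-filter⁺; ∈-filter⁻; ∈-map⁺; ∈-map⁻; ∈-upTo⁺; ∈-upTo⁻)
open import Data.List.Relation.Unary.Any using (here; there)
open import Data.List.Relation.Unary.Unique.Propositional using (Unique)
open import Data.Maybe using (Maybe; is-just; just; nothing)
open import Data.Maybe.Properties using (just-injective)
open import Data.Product using (_,_; _×_; proj₁; proj₂; ∃-syntax)
open import Data.Sum using ([_,_]′; _⊎_; inj₁; inj₂)
open import Function using (_∘_)
open import Relation.Nullary using (Dec; does; no; yes; ¬_)
open import Relation.Nullary.Decidable using (dec-false; dec-true; ⌊_⌋)
open import Relation.Binary.PropositionalEquality

-- Finite sums, and the naturals and their inverses inside the rationals.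

module Sums where

  open import Algebra.Structures using (IsCommutativeSemiring)
  open import Data.List using (map; filter; foldr; _∷ʳ_)
  import Data.List.Properties as Listₚ
  open import Data.List.Membership.Propositional.Properties.WithK using (unique∧set⇒bag)
  open import Data.List.Relation.Binary.BagAndSetEquality using (∼bag⇒↭)
  open import Data.List.Relation.Binary.Permutation.Propositional using (_↭_; ↭⇒↭ₛ)
  open import Data.List.Relation.Binary.Permutation.Setoid.Properties using (foldr-commMonoid)
  open import Data.List.Relation.Binary.Permutation.Propositional.Properties using () renaming (map⁺ to ↭-map⁺)
  open import Data.List.Relation.Unary.AllPairs using (_∷_)
  open import Data.List.Relation.Unary.Unique.Propositional.Properties using (Unique[x∷xs]⇒x∉xs)
  open import Data.Nat as ℕ using (ℕ; zero; suc)
  import Data.Nat.Properties as ℕₚ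
  import Data.Integer as ℤ
  import Data.Integer.Properties as ℤₚ
  open import Data.Rational as ℚ using (ℚ; 0ℚ; 1ℚ)
  import Data.Rational.Properties as ℚₚ
  import Data.Rational.Unnormalised as ℚᵘ
  import Data.Rational.Unnormalised.Properties as ℚᵘₚ
  open import Data.Rational.Solver using () renaming (module +-*-Solver to ℚS)
  open import Function using (id)
  open import Function.Bundles using (mk⇔)
  open import Relation.Unary using (Pred; Decidable)

  -- Stated for any commutative semiring, to be used over the naturals for counting and over the
  -- rationals for weighted sums.
  module Sum {A : Set} (_+_ _*_ : A → A → A) (0# 1# : A)
             (isCSR : IsCommutativeSemiring _≡_ _+_ _*_ 0# 1#) where

    open IsCommutativeSemiring isCSR
      using (+-identityˡ; +-identityʳ; +-assoc; +-comm; +-isCommutativeMonoid; distribˡ; distribʳ; zeroˡ; zeroʳ)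

    ∑ : {X : Set} → List X → (X → A) → A
    ∑ xs f = foldr _+_ 0# (map f xs)

    when : Bool → A → A
    when b a = if b then a else 0#

    module _ {X : Set} where

      ∑-cong : ∀ (xs : List X) {f g} → (∀ x → x ∈ xs → f x ≡ g x) → ∑ xs f ≡ ∑ xs g
      ∑-cong [] h = refl
      ∑-cong (x ∷ xs) h = cong₂ _+_ (h x (here refl)) (∑-cong xs (λ y y∈ → h y (there y∈)))

      ∑-cong′ : ∀ (xs : List X) {f g} → (∀ x → f x ≡ g x) → ∑ xs f ≡ ∑ xs g
      ∑-cong′ xs h = ∑-cong xs (λ x _ → h x)

      ∑-zero : ∀ (xs : List X) {f} → (∀ x → x ∈ xs → f x ≡ 0#) → ∑ xs f ≡ 0#
      ∑-zero [] h = refl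
      ∑-zero (x ∷ xs) h = trans (cong₂ _+_ (h x (here refl)) (∑-zero xs (λ y y∈ → h y (there y∈)))) (+-identityˡ 0#)

      ∑-+ : ∀ (xs : List X) f g → ∑ xs (λ x → f x + g x) ≡ ∑ xs f + ∑ xs g
      ∑-+ [] f g = sym (+-identityˡ 0#)
      ∑-+ (x ∷ xs) f g = begin
        (f x + g x) + ∑ xs (λ x → f x + g x) ≡⟨ cong ((f x + g x) +_) (∑-+ xs f g) ⟩
        (f x + g x) + (∑ xs f + ∑ xs g) ≡⟨ +-assoc (f x) (g x) _ ⟩
        f x + (g x + (∑ xs f + ∑ xs g)) ≡⟨ cong (f x +_) (sym (+-assoc (g x) _ _)) ⟩
        f x + ((g x + ∑ xs f) + ∑ xs g) ≡⟨ cong (λ z → f x + (z + ∑ xs g)) (+-comm (g x) _) ⟩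
        f x + ((∑ xs f + g x) + ∑ xs g) ≡⟨ cong (f x +_) (+-assoc _ (g x) _) ⟩
        f x + (∑ xs f + (g x + ∑ xs g)) ≡⟨ sym (+-assoc (f x) _ _) ⟩
        (f x + ∑ xs f) + (g x + ∑ xs g) ∎
        where open ≡-Reasoning

      ∑-*ˡ : ∀ c (xs : List X) f → c * ∑ xs f ≡ ∑ xs (λ x → c * f x)
      ∑-*ˡ c [] f = zeroʳ c
      ∑-*ˡ c (x ∷ xs) f = trans (distribˡ c (f x) _) (cong ((c * f x) +_) (∑-*ˡ c xs f))

      ∑-*ʳ : ∀ c (xs : List X) f → ∑ xs f * c ≡ ∑ xs (λ x → f x * c)
      ∑-*ʳ c [] f = zeroˡ c
      ∑-*ʳ c (x ∷ xs) f = trans (distribʳ c (f x) _) (cong ((f x * c) +_) (∑-*ʳ c xs f))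

      ∑-++ : ∀ (xs ys : List X) f → ∑ (xs ++ ys) f ≡ ∑ xs f + ∑ ys f
      ∑-++ [] ys f = sym (+-identityˡ _)
      ∑-++ (x ∷ xs) ys f = trans (cong (f x +_) (∑-++ xs ys f)) (sym (+-assoc (f x) _ _))

      ∑-filter : ∀ {p} {P : Pred X p} (P? : Decidable P) xs f →
                 ∑ (filter P? xs) f ≡ ∑ xs (λ x → when (does (P? x)) (f x))
      ∑-filter P? [] f = refl
      ∑-filter P? (x ∷ xs) f with does (P? x)
      ... | true = cong (f x +_) (∑-filter P? xs f)
      ... | false = trans (∑-filter P? xs f) (sym (+-identityˡ _))

      ∑-↭ : ∀ {xs ys : List X} → xs ↭ ys → ∀ f → ∑ xs f ≡ ∑ ys f
      ∑-↭ p f = foldr-commMonoid (setoid A) +-isCommutativeMonoid (↭⇒↭ₛ (↭-map⁺ f p))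

      -- Duplicate-free lists with the same members are permutations of each other. Bijective
      -- counting arguments below end in this lemma.
      ∑-same : ∀ {xs ys : List X} → Unique xs → Unique ys →
               (∀ {x} → x ∈ xs → x ∈ ys) → (∀ {x} → x ∈ ys → x ∈ xs) → ∀ f → ∑ xs f ≡ ∑ ys f
      ∑-same u v to from = ∑-↭ (∼bag⇒↭ (unique∧set⇒bag u v (mk⇔ to from)))

      ∑-delta : ∀ {xs : List X} {x} → Unique xs → x ∈ xs → ∀ f →
                (∀ y → y ∈ xs → y ≢ x → f y ≡ 0#) → ∑ xs f ≡ f x
      ∑-delta {y ∷ ys} u (here refl) f z = trans
        (cong (f y +_) (∑-zero ys (λ w w∈ → z w (there w∈) (λ { refl → Unique[x∷xs]⇒x∉xs u w∈ }))))
        (+-identityʳ (f y))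
      ∑-delta {y ∷ ys} u@(_ ∷ u′) (there x∈) f z = trans
        (cong₂ _+_ (z y (here refl) (λ { refl → Unique[x∷xs]⇒x∉xs u x∈ })) (∑-delta u′ x∈ f (λ w w∈ → z w (there w∈))))
        (+-identityˡ _)

    module _ {X Y : Set} where

      ∑-map : ∀ (h : X → Y) xs f → ∑ (map h xs) f ≡ ∑ xs (f ∘ h)
      ∑-map h [] f = refl
      ∑-map h (x ∷ xs) f = cong (f (h x) +_) (∑-map h xs f)

      ∑-concatMap : ∀ (h : X → List Y) xs f → ∑ (concatMap h xs) f ≡ ∑ xs (λ x → ∑ (h x) f)
      ∑-concatMap h [] f = refl
      ∑-concatMap h (x ∷ xs) f = trans (∑-++ (h x) (concatMap h xs) f) (cong (∑ (h x) f +_) (∑-concatMap h xs f))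

      ∑-swap : ∀ (xs : List X) (ys : List Y) (f : X → Y → A) →
               ∑ xs (λ x → ∑ ys (f x)) ≡ ∑ ys (λ y → ∑ xs (λ x → f x y))
      ∑-swap [] ys f = sym (∑-zero ys (λ _ _ → refl))
      ∑-swap (x ∷ xs) ys f = trans (cong (∑ ys (f x) +_) (∑-swap xs ys f)) (sym (∑-+ ys (f x) _))

      ∑-*-∑ : ∀ (xs : List X) (ys : List Y) f g → ∑ xs f * ∑ ys g ≡ ∑ xs (λ x → ∑ ys (λ y → f x * g y))
      ∑-*-∑ xs ys f g = trans (∑-*ʳ (∑ ys g) xs f) (∑-cong′ xs (λ x → ∑-*ˡ (f x) ys g))

    ∑-upTo-first : ∀ n f → ∑ (upTo (suc n)) f ≡ f 0 + ∑ (upTo n) (f ∘ suc)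
    ∑-upTo-first n f = cong (f 0 +_) (trans (cong (λ xs → ∑ xs f) (sym (Listₚ.map-applyUpTo id suc n))) (∑-map suc (upTo n) f))

    ∑-upTo-last : ∀ n f → ∑ (upTo (suc n)) f ≡ ∑ (upTo n) f + f n
    ∑-upTo-last n f = begin
      ∑ (upTo (suc n)) f ≡⟨ cong (λ xs → ∑ xs f) (sym (Listₚ.applyUpTo-∷ʳ id n)) ⟩
      ∑ (upTo n ∷ʳ n) f ≡⟨ ∑-++ (upTo n) (n ∷ []) f ⟩
      ∑ (upTo n) f + (f n + 0#) ≡⟨ cong (∑ (upTo n) f +_) (+-identityʳ (f n)) ⟩
      ∑ (upTo n) f + f n ∎
      where open ≡-Reasoning

    ∑-upTo-+ : ∀ m n f → ∑ (upTo (m ℕ.+ n)) f ≡ ∑ (upTo m) f + ∑ (upTo n) (λ i → f (m ℕ.+ i))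
    ∑-upTo-+ zero n f = sym (+-identityˡ _)
    ∑-upTo-+ (suc m) n f = begin
      ∑ (upTo (suc (m ℕ.+ n))) f ≡⟨ ∑-upTo-first (m ℕ.+ n) f ⟩
      f 0 + ∑ (upTo (m ℕ.+ n)) (f ∘ suc) ≡⟨ cong (f 0 +_) (∑-upTo-+ m n (f ∘ suc)) ⟩
      f 0 + (∑ (upTo m) (f ∘ suc) + rest) ≡⟨ sym (+-assoc (f 0) _ _) ⟩
      (f 0 + ∑ (upTo m) (f ∘ suc)) + rest ≡⟨ cong (_+ rest) (sym (∑-upTo-first m f)) ⟩
      ∑ (upTo (suc m)) f + rest ∎
      where
      open ≡-Reasoning
      rest = ∑ (upTo n) (λ i → f (suc (m ℕ.+ i)))

    ∑-upTo-extend : ∀ {m n} → m ℕ.≤ n → ∀ f → (∀ i → m ℕ.≤ i → f i ≡ 0#) → ∑ (upTo n) f ≡ ∑ (upTo m) f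
    ∑-upTo-extend {m} {n} m≤n f z = begin
      ∑ (upTo n) f ≡⟨ cong (λ k → ∑ (upTo k) f) (sym (ℕₚ.m+[n∸m]≡n m≤n)) ⟩
      ∑ (upTo (m ℕ.+ (n ℕ.∸ m))) f ≡⟨ ∑-upTo-+ m (n ℕ.∸ m) f ⟩
      ∑ (upTo m) f + ∑ (upTo (n ℕ.∸ m)) (λ i → f (m ℕ.+ i))
        ≡⟨ cong (∑ (upTo m) f +_) (∑-zero (upTo (n ℕ.∸ m)) (λ i _ → z (m ℕ.+ i) (ℕₚ.m≤m+n m i))) ⟩
      ∑ (upTo m) f + 0# ≡⟨ +-identityʳ _ ⟩
      ∑ (upTo m) f ∎
      where open ≡-Reasoning

    when-*ˡ : ∀ b c x → c * when b x ≡ when b (c * x)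
    when-*ˡ true c x = refl
    when-*ˡ false c x = zeroʳ c

  open Sum ℕ._+_ ℕ._*_ 0 1 ℕₚ.+-*-isCommutativeSemiring public
  module ℚ∑ = Sum ℚ._+_ ℚ._*_ 0ℚ 1ℚ (Algebra.Structures.IsCommutativeRing.isCommutativeSemiring ℚₚ.+-*-isCommutativeRing)

  ∑-const : ∀ {X : Set} (xs : List X) c → ∑ xs (λ _ → c) ≡ length xs ℕ.* c
  ∑-const [] c = refl
  ∑-const (x ∷ xs) c = cong (c ℕ.+_) (∑-const xs c)

  length≡∑1 : ∀ {X : Set} (xs : List X) → length xs ≡ ∑ xs (λ _ → 1)
  length≡∑1 xs = trans (sym (ℕₚ.*-identityʳ (length xs))) (sym (∑-const xs 1))

  -- Goes through unnormalised rationals, where no common factor has to be cancelled.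
  ⟦⟧-+ : ∀ m n → ⟦ m ℕ.+ n ⟧ ≡ ⟦ m ⟧ ℚ.+ ⟦ n ⟧
  ⟦⟧-+ m n = ℚₚ.toℚᵘ-injective (begin
    ℚ.toℚᵘ ⟦ m ℕ.+ n ⟧ ≈⟨ ℚₚ.toℚᵘ-fromℚᵘ ((ℤ.+ (m ℕ.+ n)) ℚᵘ./ 1) ⟩
    (ℤ.+ (m ℕ.+ n)) ℚᵘ./ 1 ≈⟨ ℚᵘ.*≡* (cong (ℤ._* ℤ.+ 1) (cong₂ ℤ._+_ (sym (ℤₚ.*-identityʳ (ℤ.+ m))) (sym (ℤₚ.*-identityʳ (ℤ.+ n))))) ⟩
    ((ℤ.+ m) ℚᵘ./ 1) ℚᵘ.+ ((ℤ.+ n) ℚᵘ./ 1) ≈⟨ ℚᵘₚ.+-cong (ℚᵘₚ.≃-sym (ℚₚ.toℚᵘ-fromℚᵘ ((ℤ.+ m) ℚᵘ./ 1))) (ℚᵘₚ.≃-sym (ℚₚ.toℚᵘ-fromℚᵘ ((ℤ.+ n) ℚᵘ./ 1))) ⟩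
    ℚ.toℚᵘ ⟦ m ⟧ ℚᵘ.+ ℚ.toℚᵘ ⟦ n ⟧ ≈⟨ ℚᵘₚ.≃-sym (ℚₚ.toℚᵘ-homo-+ ⟦ m ⟧ ⟦ n ⟧) ⟩
    ℚ.toℚᵘ (⟦ m ⟧ ℚ.+ ⟦ n ⟧) ∎)
    where open ℚᵘₚ.≃-Reasoning

  ⟦⟧-* : ∀ m n → ⟦ m ℕ.* n ⟧ ≡ ⟦ m ⟧ ℚ.* ⟦ n ⟧
  ⟦⟧-* m n = ℚₚ.toℚᵘ-injective (begin
    ℚ.toℚᵘ ⟦ m ℕ.* n ⟧ ≈⟨ ℚₚ.toℚᵘ-fromℚᵘ ((ℤ.+ (m ℕ.* n)) ℚᵘ./ 1) ⟩
    (ℤ.+ (m ℕ.* n)) ℚᵘ./ 1 ≈⟨ ℚᵘ.*≡* (cong (ℤ._* ℤ.+ 1) (ℤₚ.pos-* m n)) ⟩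
    ((ℤ.+ m) ℚᵘ./ 1) ℚᵘ.* ((ℤ.+ n) ℚᵘ./ 1) ≈⟨ ℚᵘₚ.*-cong (ℚᵘₚ.≃-sym (ℚₚ.toℚᵘ-fromℚᵘ ((ℤ.+ m) ℚᵘ./ 1))) (ℚᵘₚ.≃-sym (ℚₚ.toℚᵘ-fromℚᵘ ((ℤ.+ n) ℚᵘ./ 1))) ⟩
    ℚ.toℚᵘ ⟦ m ⟧ ℚᵘ.* ℚ.toℚᵘ ⟦ n ⟧ ≈⟨ ℚᵘₚ.≃-sym (ℚₚ.toℚᵘ-homo-* ⟦ m ⟧ ⟦ n ⟧) ⟩
    ℚ.toℚᵘ (⟦ m ⟧ ℚ.* ⟦ n ⟧) ∎)
    where open ℚᵘₚ.≃-Reasoning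

  -- ι and inv are abstract so that rational arithmetic on them does not unfold.
  abstract

    ι : ℕ → ℚ
    ι n = ⟦ n ⟧

    ι-⟦⟧ : ∀ n → ι n ≡ ⟦ n ⟧
    ι-⟦⟧ n = refl

    ι-0 : ι 0 ≡ 0ℚ
    ι-0 = refl

    ι-1 : ι 1 ≡ 1ℚ
    ι-1 = refl

    ι-+ : ∀ m n → ι (m ℕ.+ n) ≡ ι m ℚ.+ ι n
    ι-+ = ⟦⟧-+

    ι-* : ∀ m n → ι (m ℕ.* n) ≡ ι m ℚ.* ι n
    ι-* = ⟦⟧-*

    inv : ℕ → ℚ
    inv k = 1ℚ ÷ℚ k

    -- This default value removes the terms with denominator 0: the empty word in the sum over
    -- lengths, and the excluded pair (0,0) of the second formula.
    inv-0 : inv 0 ≡ 0ℚ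
    inv-0 = refl

    ÷ℚ≡*inv : ∀ q k → q ÷ℚ k ≡ q ℚ.* inv k
    ÷ℚ≡*inv q zero = sym (ℚₚ.*-zeroʳ q)
    ÷ℚ≡*inv q (suc k) = cong (q ℚ.*_) (sym (ℚₚ.*-identityˡ _))

    ι*inv : ∀ k → ι (suc k) ℚ.* inv (suc k) ≡ 1ℚ
    ι*inv k = trans (cong (⟦ suc k ⟧ ℚ.*_) (ℚₚ.*-identityˡ _)) (ℚₚ.toℚᵘ-injective (begin
      ℚ.toℚᵘ (⟦ suc k ⟧ ℚ.* ((ℤ.+ 1) ℚ./ suc k)) ≈⟨ ℚₚ.toℚᵘ-homo-* ⟦ suc k ⟧ ((ℤ.+ 1) ℚ./ suc k) ⟩
      ℚ.toℚᵘ ⟦ suc k ⟧ ℚᵘ.* ℚ.toℚᵘ ((ℤ.+ 1) ℚ./ suc k) ≈⟨ ℚᵘₚ.*-cong (ℚₚ.toℚᵘ-fromℚᵘ ((ℤ.+ suc k) ℚᵘ./ 1)) (ℚₚ.toℚᵘ-fromℚᵘ ((ℤ.+ 1) ℚᵘ./ suc k)) ⟩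
      ((ℤ.+ suc k) ℚᵘ./ 1) ℚᵘ.* ((ℤ.+ 1) ℚᵘ./ suc k) ≈⟨ ℚᵘ.*≡* (trans (ℤₚ.*-identityʳ _) (trans (ℤₚ.*-comm (ℤ.+ suc k) (ℤ.+ 1)) (cong (λ z → ℤ.+ 1 ℤ.* ℤ.+ z) (sym (ℕₚ.*-identityˡ (suc k)))))) ⟩
      ℚᵘ.1ℚᵘ ∎))
      where open ℚᵘₚ.≃-Reasoning

  ι-∑ : ∀ {X : Set} (xs : List X) f → ι (∑ xs f) ≡ ℚ∑.∑ xs (λ x → ι (f x))
  ι-∑ [] f = ι-0
  ι-∑ (x ∷ xs) f = trans (ι-+ (f x) (∑ xs f)) (cong (ι (f x) ℚ.+_) (ι-∑ xs f))

  ι-cancelʳ : ∀ n {x y} → 1 ℕ.≤ n → x ℚ.* ι n ≡ y ℚ.* ι n → x ≡ y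
  ι-cancelʳ (suc n) {x} {y} _ e = trans (sym (undo x)) (trans (cong (ℚ._* inv (suc n)) e) (undo y))
    where
    undo : ∀ z → (z ℚ.* ι (suc n)) ℚ.* inv (suc n) ≡ z
    undo z = trans (ℚₚ.*-assoc z _ _) (trans (cong (z ℚ.*_) (ι*inv n)) (ℚₚ.*-identityʳ z))

  inv-* : ∀ j k → 1 ℕ.≤ j → 1 ℕ.≤ k → inv (j ℕ.* k) ≡ inv j ℚ.* inv k
  inv-* (suc j) (suc k) _ _ = ι-cancelʳ (suc j ℕ.* suc k) (ℕ.s≤s ℕ.z≤n) (begin
    inv (suc j ℕ.* suc k) ℚ.* ι (suc j ℕ.* suc k) ≡⟨ trans (ℚₚ.*-comm (inv (suc j ℕ.* suc k)) _) (ι*inv (k ℕ.+ j ℕ.* suc k)) ⟩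
    1ℚ ≡⟨ cong₂ ℚ._*_ (sym (ι*inv j)) (sym (ι*inv k)) ⟩
    (ι (suc j) ℚ.* inv (suc j)) ℚ.* (ι (suc k) ℚ.* inv (suc k)) ≡⟨ solve 4 (λ a b c d → (a :* b) :* (c :* d) := (b :* d) :* (a :* c)) refl (ι (suc j)) (inv (suc j)) (ι (suc k)) (inv (suc k)) ⟩
    (inv (suc j) ℚ.* inv (suc k)) ℚ.* (ι (suc j) ℚ.* ι (suc k)) ≡⟨ cong ((inv (suc j) ℚ.* inv (suc k)) ℚ.*_) (sym (ι-* (suc j) (suc k))) ⟩
    (inv (suc j) ℚ.* inv (suc k)) ℚ.* ι (suc j ℕ.* suc k) ∎)
    where
    open ≡-Reasoning
    open ℚS using (solve; _:=_; _:*_)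

-- Binary forests, two-coloured words of trees, and their enumeration.

module Forests where

  open Sums
  open import Data.List using (map)
  import Data.List.Properties as Listₚ
  open import Data.List.Membership.Propositional using (find; lose)
  open import Data.List.Membership.Propositional.Properties using (∈-++⁺ˡ; ∈-++⁺ʳ; ∈-++⁻; ∈-concatMap⁺; ∈-concatMap⁻)
  open import Data.List.Relation.Unary.All as All using (All; []; _∷_)
  open import Data.List.Relation.Unary.AllPairs using ([]; _∷_)
  import Data.List.Relation.Unary.Unique.Propositional.Properties as Uniqueₚ
  open import Data.Nat as ℕ using (ℕ; zero; suc; _+_; _*_; _∸_; _≤_; z≤n; s≤s; _≤?_)
  open import Data.Nat.Combinatorics using (_C_; nCk+nC[k+1]≡[n+1]C[k+1]; nCn≡1)
  open import Data.Nat.Properties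

  module _ {A B : Set} where

    -- Injectivity is asked only on members of the list because `graft` is not injective in general:
    -- it sends both a single node and the pair of its children to that node.
    map-unique : (f : A → B) {xs : List A} → (∀ {x y} → x ∈ xs → y ∈ xs → f x ≡ f y → x ≡ y) →
                 Unique xs → Unique (map f xs)
    map-unique f {[]} inj [] = []
    map-unique f {x ∷ xs} inj (p ∷ u) =
      All.tabulate (λ {b} b∈ eq → let (y , y∈ , b≡) = ∈-map⁻ f b∈ in
        All.lookup p y∈ (inj (here refl) (there y∈) (trans eq b≡)))
      ∷ map-unique f (λ x∈ y∈ → inj (there x∈) (there y∈)) u

    -- The function `k` recovers from a member the block it came from, which keeps different blocks
    -- disjoint.
    concatMap-unique : (h : A → List B) (k : B → A) {xs : List A} → Unique xs → (∀ x → x ∈ xs → Unique (h x)) →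
                       (∀ x → x ∈ xs → ∀ {z} → z ∈ h x → k z ≡ x) → Unique (concatMap h xs)
    concatMap-unique h k {[]} [] uh kh = []
    concatMap-unique h k {x ∷ xs} (p ∷ u) uh kh =
      Uniqueₚ.++⁺ (uh x (here refl)) (concatMap-unique h k u (λ y y∈ → uh y (there y∈)) (λ y y∈ → kh y (there y∈)))
        (λ (z∈ , z∈′) → let (y , y∈ , z∈hy) = find (∈-concatMap⁻ h {xs = xs} z∈′) in
          All.lookup p y∈ (trans (sym (kh x (here refl) z∈)) (kh y (there y∈) z∈hy)))

    ∈-concatMap⁺′ : (h : A → List B) {xs : List A} {x : A} {z : B} → x ∈ xs → z ∈ h x → z ∈ concatMap h xs
    ∈-concatMap⁺′ h x∈ z∈ = ∈-concatMap⁺ h (lose x∈ z∈)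

    ∈-concatMap⁻′ : (h : A → List B) {xs : List A} {z : B} → z ∈ concatMap h xs → ∃[ x ] x ∈ xs × z ∈ h x
    ∈-concatMap⁻′ h z∈ = find (∈-concatMap⁻ h z∈)

  data BT : Set where
    leaf : BT
    node : BT → BT → BT

  isLeaf : BT → Bool
  isLeaf leaf = true
  isLeaf (node _ _) = false

  leaves cherries : BT → ℕ
  leaves leaf = 1
  leaves (node l r) = leaves l + leaves r
  cherries leaf = 0
  cherries (node l r) = 𝟙 (isLeaf l ∧ isLeaf r) + (cherries l + cherries r)

  1≤leaves : ∀ t → 1 ≤ leaves t
  1≤leaves leaf = s≤s z≤n
  1≤leaves (node l r) = ≤-trans (1≤leaves l) (m≤m+n _ _)

  leavesF cherriesF : List BT → ℕ
  leavesF f = ∑ f leaves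
  cherriesF f = ∑ f cherries

  length≤leavesF : ∀ f → length f ≤ leavesF f
  length≤leavesF [] = z≤n
  length≤leavesF (t ∷ f) = +-mono-≤ (1≤leaves t) (length≤leavesF f)

  -- The inverse of replacing a leading node by its two children. The forests to which it is applied
  -- have at least two trees, so the second clause is only a default.
  graft : List BT → List BT
  graft (l ∷ r ∷ f) = node l r ∷ f
  graft f = f

  -- F e α lists the forests of α trees with e + α leaves.
  F : ℕ → ℕ → List (List BT)
  F zero zero = [] ∷ []
  F (suc e) zero = []
  F zero (suc α) = map (leaf ∷_) (F zero α)
  F (suc e) (suc α) = map (leaf ∷_) (F (suc e) α) ++ map graft (F e (suc (suc α)))

  graft-stats : ∀ {α e} f → length f ≡ suc (suc α) → leavesF f ≡ e + suc (suc α) →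
                length (graft f) ≡ suc α × leavesF (graft f) ≡ suc e + suc α
  graft-stats {α} {e} (l ∷ r ∷ f) p q = suc-injective p , trans (+-assoc (leaves l) _ _) (trans q (+-suc e (suc α)))
  graft-stats [] () q
  graft-stats (_ ∷ []) () q

  F-sound : ∀ e α {f} → f ∈ F e α → length f ≡ α × leavesF f ≡ e + α
  F-sound zero zero (here refl) = refl , refl
  F-sound zero (suc α) f∈ =
    let (f , f∈′ , eq) = ∈-map⁻ (leaf ∷_) f∈
        (p , q) = F-sound zero α f∈′
    in trans (cong length eq) (cong suc p) , trans (cong leavesF eq) (cong suc q)
  F-sound (suc e) (suc α) f∈ = [
    (λ f∈ →
      let (f , f∈′ , eq) = ∈-map⁻ (leaf ∷_) f∈
          (p , q) = F-sound (suc e) α f∈′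
      in trans (cong length eq) (cong suc p) , trans (cong leavesF eq) (trans (cong suc q) (cong suc (sym (+-suc e α))))) ,
    (λ f∈ →
      let (f , f∈′ , eq) = ∈-map⁻ graft f∈
          (p , q) = F-sound e (suc (suc α)) f∈′
          (p′ , q′) = graft-stats f p q
      in trans (cong length eq) p′ , trans (cong leavesF eq) q′) ]′
    (∈-++⁻ (map (leaf ∷_) (F (suc e) α)) f∈)

  -- A nonempty forest starts with a leaf, which is removed, or with a node, which is replaced by
  -- its children. The replacement adds a tree and keeps the leaves, so the excess of leaves over
  -- trees drops by one.
  F-complete : ∀ e α {f} → length f ≡ α → leavesF f ≡ e + α → f ∈ F e α
  F-complete zero zero {[]} p q = here refl
  F-complete (suc e) zero {[]} p ()
  F-complete zero (suc α) {leaf ∷ f} p q = ∈-map⁺ (leaf ∷_) (F-complete zero α (suc-injective p) (suc-injective q))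
  -- With as many leaves as trees no node can lead: splitting it would give more trees than leaves.
  F-complete zero (suc α) {node l r ∷ f} refl q = ⊥-elim (<-irrefl refl (begin
    suc (suc (length f)) ≤⟨ length≤leavesF (l ∷ r ∷ f) ⟩
    leavesF (l ∷ r ∷ f) ≡⟨ trans (sym (+-assoc (leaves l) _ _)) q ⟩
    suc (length f) ∎))
    where open ≤-Reasoning
  F-complete (suc e) (suc α) {leaf ∷ f} p q = ∈-++⁺ˡ (∈-map⁺ (leaf ∷_)
    (F-complete (suc e) α (suc-injective p) (trans (suc-injective q) (+-suc e α))))
  F-complete (suc e) (suc α) {node l r ∷ f} p q = ∈-++⁺ʳ _ (∈-map⁺ graft {x = l ∷ r ∷ f}
    (F-complete e (suc (suc α)) (cong suc p) (trans (sym (+-assoc (leaves l) _ _)) (trans q (sym (+-suc e (suc α)))))))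

  F-unique : ∀ e α → Unique (F e α)
  F-unique zero zero = [] ∷ []
  F-unique (suc e) zero = []
  F-unique zero (suc α) = Uniqueₚ.map⁺ Listₚ.∷-injectiveʳ (F-unique zero α)
  F-unique (suc e) (suc α) = Uniqueₚ.++⁺ (Uniqueₚ.map⁺ Listₚ.∷-injectiveʳ (F-unique (suc e) α))
    (map-unique graft (λ x∈ y∈ → graft-inj (proj₁ (F-sound e (suc (suc α)) x∈)) (proj₁ (F-sound e (suc (suc α)) y∈))) (F-unique e (suc (suc α))))
    (λ (p , q) → disj p q)
    where
    graft-inj : ∀ {x y : List BT} → length x ≡ suc (suc α) → length y ≡ suc (suc α) → graft x ≡ graft y → x ≡ y
    graft-inj {_ ∷ _ ∷ _} {_ ∷ _ ∷ _} p q refl = refl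
    graft-inj {_ ∷ []} () q eq
    graft-inj {_ ∷ _ ∷ _} {_ ∷ []} p () eq
    disj : ∀ {z} → z ∈ map (leaf ∷_) (F (suc e) α) → z ∈ map graft (F e (suc (suc α))) → Data.Empty.⊥
    disj p q with ∈-map⁻ (leaf ∷_) p | ∈-map⁻ graft q
    ... | f , _ , refl | g , g∈ , eq with g | F-sound e (suc (suc α)) g∈
    ... | [] | () , _
    ... | _ ∷ [] | () , _
    disj p q | f , _ , refl | g , g∈ , () | _ ∷ _ ∷ _ | _

  -- The comparison guards against truncated subtraction, which for α > r would list the forest of α
  -- leaves.
  forests : ℕ → ℕ → List (List BT)
  forests r α with α ≤? r
  ... | yes _ = F (r ∸ α) α
  ... | no _ = []

  forests-sound : ∀ r α {f} → f ∈ forests r α → length f ≡ α × leavesF f ≡ r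
  forests-sound r α f∈ with α ≤? r
  ... | yes α≤r = let (p , q) = F-sound (r ∸ α) α f∈ in p , trans q (m∸n+n≡m α≤r)
  forests-sound r α () | no _

  forests-complete : ∀ f → f ∈ forests (leavesF f) (length f)
  forests-complete f with length f ≤? leavesF f
  ... | yes α≤r = F-complete _ _ refl (sym (m∸n+n≡m α≤r))
  ... | no α≰r = ⊥-elim (α≰r (length≤leavesF f))

  forests-unique : ∀ r α → Unique (forests r α)
  forests-unique r α with α ≤? r
  ... | yes α≤r = F-unique (r ∸ α) α
  ... | no _ = []

  -- The colour follows `cw`: `false` is anticlockwise and belongs to r, `true` is clockwise and
  -- belongs to s.
  Bead : Set
  Bead = Bool × BT

  pick : Bool → List Bead → List BT
  pick c [] = []
  pick false ((false , t) ∷ w) = t ∷ pick false w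
  pick false ((true , t) ∷ w) = pick false w
  pick true ((false , t) ∷ w) = pick true w
  pick true ((true , t) ∷ w) = t ∷ pick true w

  shuffles : List BT → List BT → List (List Bead)
  shuffles [] [] = [] ∷ []
  shuffles (t ∷ f) [] = map ((false , t) ∷_) (shuffles f [])
  shuffles [] (u ∷ g) = map ((true , u) ∷_) (shuffles [] g)
  shuffles (t ∷ f) (u ∷ g) = map ((false , t) ∷_) (shuffles f (u ∷ g)) ++ map ((true , u) ∷_) (shuffles (t ∷ f) g)

  shuffles-sound : ∀ f g {w} → w ∈ shuffles f g → pick false w ≡ f × pick true w ≡ g
  shuffles-sound [] [] (here refl) = refl , refl
  shuffles-sound (t ∷ f) [] w∈ with ∈-map⁻ ((false , t) ∷_) w∈
  ... | _ , w∈′ , refl = let (p , q) = shuffles-sound f [] w∈′ in cong (t ∷_) p , q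
  shuffles-sound [] (u ∷ g) w∈ with ∈-map⁻ ((true , u) ∷_) w∈
  ... | _ , w∈′ , refl = let (p , q) = shuffles-sound [] g w∈′ in p , cong (u ∷_) q
  shuffles-sound (t ∷ f) (u ∷ g) w∈ with ∈-++⁻ (map ((false , t) ∷_) (shuffles f (u ∷ g))) w∈
  ... | inj₁ w∈₁ with ∈-map⁻ ((false , t) ∷_) w∈₁
  ... | _ , w∈′ , refl = let (p , q) = shuffles-sound f (u ∷ g) w∈′ in cong (t ∷_) p , q
  shuffles-sound (t ∷ f) (u ∷ g) w∈ | inj₂ w∈₂ with ∈-map⁻ ((true , u) ∷_) w∈₂
  ... | _ , w∈′ , refl = let (p , q) = shuffles-sound (t ∷ f) g w∈′ in p , cong (u ∷_) q

  shuffles-complete : ∀ w → w ∈ shuffles (pick false w) (pick true w)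
  shuffles-complete [] = here refl
  shuffles-complete ((false , t) ∷ w) with pick true w | shuffles-complete w
  ... | [] | ih = ∈-map⁺ ((false , t) ∷_) ih
  ... | u ∷ g | ih = ∈-++⁺ˡ (∈-map⁺ ((false , t) ∷_) ih)
  shuffles-complete ((true , u) ∷ w) with pick false w | shuffles-complete w
  ... | [] | ih = ∈-map⁺ ((true , u) ∷_) ih
  ... | t ∷ f | ih = ∈-++⁺ʳ (map ((false , t) ∷_) (shuffles f (u ∷ pick true w))) (∈-map⁺ ((true , u) ∷_) ih)

  shuffles-unique : ∀ f g → Unique (shuffles f g)
  shuffles-unique [] [] = [] ∷ []
  shuffles-unique (t ∷ f) [] = Uniqueₚ.map⁺ Listₚ.∷-injectiveʳ (shuffles-unique f [])
  shuffles-unique [] (u ∷ g) = Uniqueₚ.map⁺ Listₚ.∷-injectiveʳ (shuffles-unique [] g)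
  shuffles-unique (t ∷ f) (u ∷ g) = Uniqueₚ.++⁺
    (Uniqueₚ.map⁺ Listₚ.∷-injectiveʳ (shuffles-unique f (u ∷ g)))
    (Uniqueₚ.map⁺ Listₚ.∷-injectiveʳ (shuffles-unique (t ∷ f) g))
    (λ (p , q) → disj p q)
    where
    disj : ∀ {z} → z ∈ map ((false , t) ∷_) (shuffles f (u ∷ g)) → z ∈ map ((true , u) ∷_) (shuffles (t ∷ f) g) → Data.Empty.⊥
    disj p q with ∈-map⁻ ((false , t) ∷_) p | ∈-map⁻ ((true , u) ∷_) q
    ... | _ , _ , refl | _ , _ , ()

  -- The first bead comes from either forest, which is Pascal's rule.
  length-shuffles : ∀ f g → length (shuffles f g) ≡ (length f + length g) C length f
  length-shuffles [] [] = refl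
  length-shuffles (t ∷ f) [] = begin
    length (map ((false , t) ∷_) (shuffles f [])) ≡⟨ Listₚ.length-map _ (shuffles f []) ⟩
    length (shuffles f []) ≡⟨ length-shuffles f [] ⟩
    (length f + 0) C length f ≡⟨ cong (_C length f) (+-identityʳ _) ⟩
    length f C length f ≡⟨ trans (nCn≡1 (length f)) (sym (nCn≡1 (suc (length f)))) ⟩
    suc (length f) C suc (length f) ≡⟨ cong (_C suc (length f)) (sym (+-identityʳ (suc (length f)))) ⟩
    (suc (length f) + 0) C suc (length f) ∎
    where open ≡-Reasoning
  length-shuffles [] (u ∷ g) = trans (Listₚ.length-map _ (shuffles [] g)) (trans (length-shuffles [] g) refl)
  length-shuffles (t ∷ f) (u ∷ g) = begin
    length (map ((false , t) ∷_) (shuffles f (u ∷ g)) ++ map ((true , u) ∷_) (shuffles (t ∷ f) g))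
      ≡⟨ Listₚ.length-++ (map ((false , t) ∷_) (shuffles f (u ∷ g))) ⟩
    length (map ((false , t) ∷_) (shuffles f (u ∷ g))) + length (map ((true , u) ∷_) (shuffles (t ∷ f) g))
      ≡⟨ cong₂ _+_ (trans (Listₚ.length-map _ (shuffles f (u ∷ g))) (length-shuffles f (u ∷ g)))
                   (trans (Listₚ.length-map _ (shuffles (t ∷ f) g)) (length-shuffles (t ∷ f) g)) ⟩
    (a + suc b) C a + (suc a + b) C suc a ≡⟨ cong (λ n → (a + suc b) C a + n C suc a) (sym (+-suc a b)) ⟩
    (a + suc b) C a + (a + suc b) C suc a ≡⟨ nCk+nC[k+1]≡[n+1]C[k+1] (a + suc b) a ⟩
    (suc a + suc b) C suc a ∎
    where
    open ≡-Reasoning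
    a = length f
    b = length g

  module _ (m r s : ℕ) where

    words : List (List Bead)
    words = concatMap (λ α → concatMap (λ f → concatMap (shuffles f) (forests s (m ∸ α))) (forests r α)) (upTo (suc m))

  length-pick : ∀ w → length (pick false w) + length (pick true w) ≡ length w
  length-pick [] = refl
  length-pick ((false , t) ∷ w) = cong suc (length-pick w)
  length-pick ((true , t) ∷ w) = trans (+-suc _ _) (cong suc (length-pick w))

  words-sound : ∀ m r s {w} → w ∈ words m r s →
                length w ≡ m × leavesF (pick false w) ≡ r × leavesF (pick true w) ≡ s
  words-sound m r s {w} w∈ =
    let (α , α∈ , w∈₁) = ∈-concatMap⁻′ (λ α → concatMap (λ f → concatMap (shuffles f) (forests s (m ∸ α))) (forests r α)) {xs = upTo (suc m)} w∈
        (f , f∈ , w∈₂) = ∈-concatMap⁻′ (λ f → concatMap (shuffles f) (forests s (m ∸ α))) {xs = forests r α} w∈₁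
        (g , g∈ , w∈₃) = ∈-concatMap⁻′ (shuffles f) {xs = forests s (m ∸ α)} w∈₂
        (pf , pg) = shuffles-sound f g w∈₃
        (lf , vf) = forests-sound r α f∈
        (lg , vg) = forests-sound s (m ∸ α) g∈
    in trans (sym (length-pick w)) (trans (cong₂ _+_ (trans (cong length pf) lf) (trans (cong length pg) lg)) (m+[n∸m]≡n (≤-pred (∈-upTo⁻ α∈))))
     , trans (cong leavesF pf) vf , trans (cong leavesF pg) vg

  words-complete : ∀ w → w ∈ words (length w) (leavesF (pick false w)) (leavesF (pick true w))
  words-complete w =
    ∈-concatMap⁺′ _ {x = α} (∈-upTo⁺ (s≤s (subst (α ≤_) (length-pick w) (m≤m+n _ _))))
      (∈-concatMap⁺′ _ {x = pick false w} (forests-complete (pick false w))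
        (∈-concatMap⁺′ (shuffles (pick false w)) {x = pick true w}
          (subst (λ β → pick true w ∈ forests (leavesF (pick true w)) β) β≡ (forests-complete (pick true w)))
          (shuffles-complete w)))
    where
    α = length (pick false w)
    β≡ : length (pick true w) ≡ length w ∸ α
    β≡ = trans (sym (m+n∸m≡n α _)) (cong (_∸ α) (length-pick w))

  words-unique : ∀ m r s → Unique (words m r s)
  words-unique m r s = concatMap-unique _ (length ∘ pick false) (Uniqueₚ.upTo⁺ (suc m))
    (λ α _ → concatMap-unique _ (pick false) (forests-unique r α)
       (λ f _ → concatMap-unique (shuffles f) (pick true) (forests-unique s (m ∸ α)) (λ g _ → shuffles-unique f g)
         (λ g _ w∈ → proj₂ (shuffles-sound f g w∈)))
       (λ f _ w∈ → let (g , _ , w∈′) = ∈-concatMap⁻′ (shuffles f) {xs = forests s (m ∸ α)} w∈ in proj₁ (shuffles-sound f g w∈′)))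
    (λ α _ w∈ → let (f , f∈ , w∈₁) = ∈-concatMap⁻′ (λ f → concatMap (shuffles f) (forests s (m ∸ α))) {xs = forests r α} w∈
                    (g , _ , w∈₂) = ∈-concatMap⁻′ (shuffles f) {xs = forests s (m ∸ α)} w∈₁
                in trans (cong length (proj₁ (shuffles-sound f g w∈₂))) (proj₁ (forests-sound r α f∈)))

  -- The constraint "nothing" leaves the number of cherries free.
  match : Maybe ℕ → ℕ → Bool
  match nothing _ = true
  match (just z) n = does (n ℕ.≟ z)

  G : ℕ → ℕ → Maybe ℕ → ℕ
  G r α mz = ∑ (forests r α) (λ f → 𝟙 (match mz (cherriesF f)))

  ok : Maybe ℕ → Maybe ℕ → List Bead → Bool
  ok ma mb w = match ma (cherriesF (pick false w)) ∧ match mb (cherriesF (pick true w))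

  W : ℕ → ℕ → Maybe ℕ → ℕ → Maybe ℕ → ℕ
  W m r ma s mb = ∑ (words m r s) (λ w → 𝟙 (ok ma mb w))

  𝟙-∧ : ∀ a b → 𝟙 (a ∧ b) ≡ 𝟙 a * 𝟙 b
  𝟙-∧ true true = refl
  𝟙-∧ true false = refl
  𝟙-∧ false _ = refl

  -- Once the number α of anticlockwise beads is fixed, their positions and the two forests are
  -- chosen independently, and each cherry constraint sees only one forest.
  W-formula : ∀ m r ma s mb → W m r ma s mb ≡ ∑ (upTo (suc m)) (λ α → (m C α) * (G r α ma * G s (m ∸ α) mb))
  W-formula m r ma s mb = trans (∑-concatMap (λ α → concatMap (λ f → concatMap (shuffles f) (forests s (m ∸ α))) (forests r α)) (upTo (suc m)) ψ) (∑-cong (upTo (suc m)) (λ α α∈ → begin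
    ∑ (concatMap (λ f → concatMap (shuffles f) (forests s (m ∸ α))) (forests r α)) ψ
      ≡⟨ ∑-concatMap _ (forests r α) ψ ⟩
    ∑ (forests r α) (λ f → ∑ (concatMap (shuffles f) (forests s (m ∸ α))) ψ)
      ≡⟨ ∑-cong′ (forests r α) (λ f → ∑-concatMap (shuffles f) (forests s (m ∸ α)) ψ) ⟩
    ∑ (forests r α) (λ f → ∑ (forests s (m ∸ α)) (λ g → ∑ (shuffles f g) ψ))
      ≡⟨ ∑-cong (forests r α) (λ f f∈ → ∑-cong (forests s (m ∸ α)) (λ g g∈ → inner α f g (proj₁ (forests-sound r α f∈)) (proj₁ (forests-sound s (m ∸ α) g∈)) (≤-pred (∈-upTo⁻ α∈)))) ⟩
    ∑ (forests r α) (λ f → ∑ (forests s (m ∸ α)) (λ g → (m C α) * (p f * q g)))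
      ≡⟨ ∑-cong′ (forests r α) (λ f → sym (∑-*ˡ (m C α) (forests s (m ∸ α)) _)) ⟩
    ∑ (forests r α) (λ f → (m C α) * ∑ (forests s (m ∸ α)) (λ g → p f * q g))
      ≡⟨ sym (∑-*ˡ (m C α) (forests r α) _) ⟩
    (m C α) * ∑ (forests r α) (λ f → ∑ (forests s (m ∸ α)) (λ g → p f * q g))
      ≡⟨ cong ((m C α) *_) (sym (∑-*-∑ (forests r α) (forests s (m ∸ α)) p q)) ⟩
    (m C α) * (G r α ma * G s (m ∸ α) mb) ∎))
    where
    open ≡-Reasoning
    ψ : List Bead → ℕ
    ψ w = 𝟙 (ok ma mb w)
    p q : List BT → ℕ
    p f = 𝟙 (match ma (cherriesF f))
    q g = 𝟙 (match mb (cherriesF g))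
    inner : ∀ α f g → length f ≡ α → length g ≡ m ∸ α → α ≤ m → ∑ (shuffles f g) ψ ≡ (m C α) * (p f * q g)
    inner α f g refl lg α≤m = begin
      ∑ (shuffles f g) ψ ≡⟨ ∑-cong (shuffles f g) (λ w w∈ → let (e , e′) = shuffles-sound f g w∈ in
          trans (𝟙-∧ (match ma (cherriesF (pick false w))) (match mb (cherriesF (pick true w)))) (cong₂ _*_ (cong p e) (cong q e′))) ⟩
      ∑ (shuffles f g) (λ _ → p f * q g) ≡⟨ ∑-const (shuffles f g) _ ⟩
      length (shuffles f g) * (p f * q g) ≡⟨ cong (_* (p f * q g)) (length-shuffles f g) ⟩
      ((length f + length g) C length f) * (p f * q g)
        ≡⟨ cong (λ n → (n C length f) * (p f * q g)) (trans (cong (length f +_) lg) (m+[n∸m]≡n α≤m)) ⟩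
      (m C length f) * (p f * q g) ∎

-- Rotations and periods of words, and Burnside's lemma.

module Rotations where

  open Sums
  open import Data.List using (map; filter; applyUpTo)
  import Data.List.Properties as Listₚ
  open import Data.List.Relation.Unary.All as All using (All; []; _∷_)
  open import Data.List.Relation.Unary.AllPairs using (AllPairs; []; _∷_)
  import Data.List.Relation.Unary.AllPairs.Properties as AllPairsₚ
  open import Data.Nat using (ℕ; zero; suc; _+_; _*_; _∸_; _≤_; _<_; z≤n; s≤s; _≤?_; _%_; _/_)
  open import Data.Nat.DivMod
  open import Data.Nat.Divisibility using (divides)
  open import Data.Nat.Properties
  open import Relation.Binary using (DecidableEquality)
  open import Relation.Nullary using (¬?)

  -- junk value: n %% 0 = 0
  _%%_ : ℕ → ℕ → ℕ
  n %% zero = 0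
  n %% suc m = n % suc m

  %%-+ : ∀ i t m → ((i %% m) + t) %% m ≡ (i + t) %% m
  %%-+ i t zero = refl
  %%-+ i t (suc m) = begin
    ((i % suc m) + t) % suc m ≡⟨ %-distribˡ-+ (i % suc m) t (suc m) ⟩
    ((i % suc m % suc m) + (t % suc m)) % suc m ≡⟨ cong (λ z → (z + (t % suc m)) % suc m) (m%n%n≡m%n i (suc m)) ⟩
    ((i % suc m) + (t % suc m)) % suc m ≡⟨ sym (%-distribˡ-+ i t (suc m)) ⟩
    (i + t) % suc m ∎
    where open ≡-Reasoning

  %%-% : ∀ i m → (i %% m) %% m ≡ i %% m
  %%-% i zero = refl
  %%-% i (suc m) = m%n%n≡m%n i (suc m)

  <⇒%% : ∀ {i m} → i < m → i %% m ≡ i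
  <⇒%% {i} {suc m} i<m = m<n⇒m%n≡m i<m

  %%-< : ∀ i {m} → 1 ≤ m → i %% m < m
  %%-< i {suc m} _ = m%n<n i (suc m)

  +-%% : ∀ i m → (i + m) %% m ≡ i %% m
  +-%% i zero = refl
  +-%% i (suc m) = [m+n]%n≡m%n i (suc m)

  %%-*-%% : ∀ i k m → 1 ≤ k → (i %% (k * m)) %% m ≡ i %% m
  %%-*-%% i (suc k) zero _ = refl
  %%-*-%% i (suc k) (suc m) _ = m∣n⇒o%n%m≡o%m (suc m) (suc k * suc m) i (divides (suc k) refl)

  period-%% : ∀ {B : Set} (h : ℕ → B) m → (∀ i → h (i + m) ≡ h i) → 1 ≤ m → ∀ i → h (i %% m) ≡ h i
  period-%% h (suc m) per _ i = trans (sym (multiples (i / suc m) (i % suc m))) (cong h (sym (m≡m%n+[m/n]*n i (suc m))))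
    where
    multiples : ∀ q j → h (j + q * suc m) ≡ h j
    multiples zero j = cong h (+-identityʳ j)
    multiples (suc q) j = begin
      h (j + (suc m + q * suc m)) ≡⟨ cong h (trans (cong (j +_) (+-comm (suc m) (q * suc m))) (sym (+-assoc j _ _))) ⟩
      h ((j + q * suc m) + suc m) ≡⟨ per (j + q * suc m) ⟩
      h (j + q * suc m) ≡⟨ multiples q j ⟩
      h j ∎
      where open ≡-Reasoning

  -- Moving the window by one loses h(t) and gains h(m + t), which is the same value by periodicity.
  ∑-shift : ∀ m (h : ℕ → ℕ) → (∀ i → h (i + m) ≡ h i) → ∀ t → ∑ (upTo m) (λ i → h (i + t)) ≡ ∑ (upTo m) h
  ∑-shift m h per zero = ∑-cong′ (upTo m) (λ i → cong h (+-identityʳ i))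
  ∑-shift m h per (suc t) = trans (+-cancelˡ-≡ (h t) _ _ (begin
    h t + ∑ (upTo m) (λ i → h (i + suc t)) ≡⟨ cong (h t +_) (∑-cong′ (upTo m) (λ i → cong h (+-suc i t))) ⟩
    h t + ∑ (upTo m) (λ i → h (suc i + t)) ≡⟨ sym (∑-upTo-first m (λ i → h (i + t))) ⟩
    ∑ (upTo (suc m)) (λ i → h (i + t)) ≡⟨ ∑-upTo-last m (λ i → h (i + t)) ⟩
    ∑ (upTo m) (λ i → h (i + t)) + h (m + t) ≡⟨ cong (∑ (upTo m) (λ i → h (i + t)) +_) (trans (cong h (+-comm m t)) (per t)) ⟩
    ∑ (upTo m) (λ i → h (i + t)) + h t ≡⟨ +-comm _ (h t) ⟩
    h t + ∑ (upTo m) (λ i → h (i + t)) ∎)) (∑-shift m h per t)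
    where open ≡-Reasoning

  ∑-repeat : ∀ k m (h : ℕ → ℕ) → (∀ i → h (i + m) ≡ h i) → ∑ (upTo (k * m)) h ≡ k * ∑ (upTo m) h
  ∑-repeat zero m h per = refl
  ∑-repeat (suc k) m h per = trans (∑-upTo-+ m (k * m) h) (cong (∑ (upTo m) h +_)
    (trans (∑-cong′ (upTo (k * m)) (λ i → trans (cong h (+-comm m i)) (per i))) (∑-repeat k m h per)))

  module Rotation {A : Set} (d : A) where

    nth : List A → ℕ → A
    nth [] i = d
    nth (x ∷ xs) zero = x
    nth (x ∷ xs) (suc i) = nth xs i

    -- Reading a word as a periodic sequence turns rotation into a shift of the index, and `at-ext`
    -- brings equalities back to words.
    at : List A → ℕ → A
    at w i = nth w (i %% length w)

    nth-applyUpTo : ∀ f n {i} → i < n → nth (applyUpTo f n) i ≡ f i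
    nth-applyUpTo f (suc n) {zero} _ = refl
    nth-applyUpTo f (suc n) {suc i} (s≤s i<n) = nth-applyUpTo (f ∘ suc) n i<n

    applyUpTo-nth : ∀ w → applyUpTo (nth w) (length w) ≡ w
    applyUpTo-nth [] = refl
    applyUpTo-nth (x ∷ w) = cong (x ∷_) (applyUpTo-nth w)

    applyUpTo-cong : ∀ {f g : ℕ → A} n → (∀ i → i < n → f i ≡ g i) → applyUpTo f n ≡ applyUpTo g n
    applyUpTo-cong zero h = refl
    applyUpTo-cong (suc n) h = cong₂ _∷_ (h 0 (s≤s z≤n)) (applyUpTo-cong n (λ i i<n → h (suc i) (s≤s i<n)))

    at< : ∀ w {i} → i < length w → at w i ≡ nth w i
    at< w i<m = cong (nth w) (<⇒%% i<m)

    applyUpTo-at : ∀ w → applyUpTo (at w) (length w) ≡ w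
    applyUpTo-at w = trans (applyUpTo-cong (length w) (λ i → at< w)) (applyUpTo-nth w)

    at-ext : ∀ {w w′} → length w ≡ length w′ → (∀ i → at w i ≡ at w′ i) → w ≡ w′
    at-ext {w} {w′} l h = begin
      w ≡⟨ sym (applyUpTo-at w) ⟩
      applyUpTo (at w) (length w) ≡⟨ applyUpTo-cong (length w) (λ i _ → h i) ⟩
      applyUpTo (at w′) (length w) ≡⟨ cong (applyUpTo (at w′)) l ⟩
      applyUpTo (at w′) (length w′) ≡⟨ applyUpTo-at w′ ⟩
      w′ ∎
      where open ≡-Reasoning

    at-applyUpTo : ∀ f n → 1 ≤ n → (∀ i → f (i %% n) ≡ f i) → ∀ i → at (applyUpTo f n) i ≡ f i
    at-applyUpTo f n 1≤n per i = trans (cong (λ m → nth (applyUpTo f n) (i %% m)) (Listₚ.length-applyUpTo f n))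
      (trans (nth-applyUpTo f n (%%-< i 1≤n)) (per i))

    at-%% : ∀ w i → at w (i %% length w) ≡ at w i
    at-%% w i = cong (nth w) (%%-% i (length w))

    at-period : ∀ w i → at w (i + length w) ≡ at w i
    at-period w i = cong (nth w) (+-%% i (length w))

    rotate : ℕ → List A → List A
    rotate t w = applyUpTo (λ i → at w (i + t)) (length w)

    length-rotate : ∀ t w → length (rotate t w) ≡ length w
    length-rotate t w = Listₚ.length-applyUpTo _ (length w)

    at-rotate : ∀ t w i → at (rotate t w) i ≡ at w (i + t)
    at-rotate t [] i = refl
    at-rotate t w@(_ ∷ _) i = at-applyUpTo (λ i → at w (i + t)) (length w) (s≤s z≤n)
      (λ i → cong (nth w) (%%-+ i t (length w))) i

    rotate-0 : ∀ w → rotate 0 w ≡ w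
    rotate-0 w = at-ext (length-rotate 0 w) (λ i → trans (at-rotate 0 w i) (cong (at w) (+-identityʳ i)))

    rotate-+ : ∀ s t w → rotate s (rotate t w) ≡ rotate (s + t) w
    rotate-+ s t w = at-ext
      (trans (length-rotate s (rotate t w)) (trans (length-rotate t w) (sym (length-rotate (s + t) w))))
      (λ i → trans (at-rotate s (rotate t w) i) (trans (at-rotate t w (i + s))
        (trans (cong (at w) (+-assoc i s t)) (sym (at-rotate (s + t) w i)))))

    rotate-length : ∀ w → rotate (length w) w ≡ w
    rotate-length w = at-ext (length-rotate _ w) (λ i → trans (at-rotate (length w) w i) (at-period w i))

    rotate-* : ∀ q t w → rotate t w ≡ w → rotate (q * t) w ≡ w
    rotate-* zero t w e = rotate-0 w
    rotate-* (suc q) t w e = trans (sym (rotate-+ t (q * t) w)) (trans (cong (rotate t) (rotate-* q t w e)) e)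

    rotate-period : ∀ t w → rotate (t + length w) w ≡ rotate t w
    rotate-period t w = trans (sym (rotate-+ t (length w) w)) (cong (rotate t) (rotate-length w))

    rotate-%% : ∀ t w → 1 ≤ length w → rotate (t %% length w) w ≡ rotate t w
    rotate-%% t w 1≤m = period-%% (λ t → rotate t w) (length w) (λ i → rotate-period i w) 1≤m t

    -- undoing a rotation by completing t to a multiple of the length
    unrotate : ∀ t w → 1 ≤ length w → ∃[ s ] rotate s (rotate t w) ≡ w
    unrotate t w 1≤m = t * length w ∸ t , trans (rotate-+ _ t w)
      (trans (cong (λ s → rotate s w) (m∸n+n≡m (subst (_≤ t * length w) (*-identityʳ t) (*-monoʳ-≤ t 1≤m))))
             (rotate-* t (length w) w (rotate-length w)))

    repeat : ℕ → List A → List A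
    repeat k w = applyUpTo (at w) (k * length w)

    length-repeat : ∀ k w → length (repeat k w) ≡ k * length w
    length-repeat k w = Listₚ.length-applyUpTo _ (k * length w)

    at-repeat : ∀ k w → 1 ≤ k → 1 ≤ length w → ∀ i → at (repeat k w) i ≡ at w i
    at-repeat k w 1≤k 1≤m = at-applyUpTo (at w) (k * length w) (*-mono-≤ 1≤k 1≤m)
      (λ i → cong (nth w) (%%-*-%% i k (length w) 1≤k))

    rotate-repeat : ∀ k w → 1 ≤ k → 1 ≤ length w → rotate (length w) (repeat k w) ≡ repeat k w
    rotate-repeat k w 1≤k 1≤m = at-ext (length-rotate _ (repeat k w)) (λ i →
      trans (at-rotate (length w) (repeat k w) i) (trans (at-repeat k w 1≤k 1≤m (i + length w))
        (trans (at-period w i) (sym (at-repeat k w 1≤k 1≤m i)))))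

    -- If rotation by n fixes w and n divides its length, this prefix is the block of which w is a
    -- repetition.
    root : ℕ → List A → List A
    root n w = applyUpTo (at w) n

    at-root : ∀ n w → 1 ≤ n → rotate n w ≡ w → ∀ i → at (root n w) i ≡ at w i
    at-root n w 1≤n e = at-applyUpTo (at w) n 1≤n (period-%% (at w) n
      (λ i → trans (sym (at-rotate n w i)) (cong (λ v → at v i) e)) 1≤n)

    repeat-root : ∀ k n w → 1 ≤ k → 1 ≤ n → length w ≡ k * n → rotate n w ≡ w → repeat k (root n w) ≡ w
    repeat-root k n w 1≤k 1≤n l e = at-ext
      (trans (length-repeat k (root n w)) (trans (cong (k *_) (Listₚ.length-applyUpTo _ n)) (sym l)))
      (λ i → trans (at-repeat k (root n w) 1≤k (subst (1 ≤_) (sym (Listₚ.length-applyUpTo _ n)) 1≤n) i) (at-root n w 1≤n e i))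

    repeat-injective : ∀ k {w w′} → 1 ≤ k → 1 ≤ length w → length w ≡ length w′ → repeat k w ≡ repeat k w′ → w ≡ w′
    repeat-injective k {w} {w′} 1≤k 1≤m l e = at-ext l (λ i →
      trans (sym (at-repeat k w 1≤k 1≤m i)) (trans (cong (λ v → at v i) e) (at-repeat k w′ 1≤k (subst (1 ≤_) l 1≤m) i)))

    ∑-applyUpTo : ∀ (g : ℕ → A) n f → ∑ (applyUpTo g n) f ≡ ∑ (upTo n) (f ∘ g)
    ∑-applyUpTo g n f = trans (cong (λ xs → ∑ xs f) (sym (Listₚ.map-upTo g n))) (∑-map g (upTo n) f)

    ∑-at : ∀ w f → ∑ w f ≡ ∑ (upTo (length w)) (f ∘ at w)
    ∑-at w f = trans (cong (λ v → ∑ v f) (sym (applyUpTo-at w))) (∑-applyUpTo (at w) (length w) f)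

    ∑-rotate : ∀ t w f → ∑ (rotate t w) f ≡ ∑ w f
    ∑-rotate t w f = trans (∑-applyUpTo _ (length w) f)
      (trans (∑-shift (length w) (f ∘ at w) (λ i → cong f (at-period w i)) t) (sym (∑-at w f)))

    ∑-repeat-word : ∀ k w f → ∑ (repeat k w) f ≡ k * ∑ w f
    ∑-repeat-word k w f = trans (∑-applyUpTo (at w) (k * length w) f)
      (trans (∑-repeat k (length w) (f ∘ at w) (λ i → cong f (at-period w i))) (cong (k *_) (sym (∑-at w f))))

    module Burnside (_≟_ : DecidableEquality (List A)) (m : ℕ) (1≤m : 1 ≤ m) where

      infix 4 _~_
      _~_ : List A → List A → Set
      x ~ y = ∃[ t ] rotate t y ≡ x

      ~-sym : ∀ {x y} → length y ≡ m → x ~ y → y ~ x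
      ~-sym {x} {y} refl (t , refl) = unrotate t y 1≤m

      ~-trans : ∀ {x y z} → x ~ y → y ~ z → x ~ z
      ~-trans {z = z} (s , refl) (t , refl) = s + t , sym (rotate-+ s t z)

      -- Reducing the amount modulo the length leaves finitely many rotations to test. The empty
      -- word is treated apart, as no amount lies below its length.
      _~?_ : ∀ x y → Dec (x ~ y)
      x ~? y with 1 ≤? length y | anyUpTo? (λ t → rotate t y ≟ x) (length y)
      ... | _ | yes (t , _ , e) = yes (t , e)
      ... | yes p | no ¬p = no (λ (t , e) → ¬p (t %% length y , %%-< t p , trans (rotate-%% t y p) e))
      ... | no ¬1≤ | no ¬p with y | x
      ... | [] | [] = yes (0 , refl)
      ... | [] | _ ∷ _ = no λ ()
      ... | _ ∷ _ | _ = ⊥-elim (¬1≤ (s≤s z≤n))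

      reps : List (List A) → List (List A)
      reps [] = []
      reps (x ∷ xs) = x ∷ filter (λ y → ¬? (x ~? y)) (reps xs)

      reps⊆ : ∀ xs {x} → x ∈ reps xs → x ∈ xs
      reps⊆ (x ∷ xs) (here e) = here e
      reps⊆ (x ∷ xs) (there x∈) = there (reps⊆ xs (proj₁ (∈-filter⁻ (λ y → ¬? (x ~? y)) {xs = reps xs} x∈)))

      reps-pairs : ∀ xs → AllPairs (λ x y → ¬ (x ~ y)) (reps xs)
      reps-pairs [] = []
      reps-pairs (x ∷ xs) = All.tabulate (λ {y} y∈ → proj₂ (∈-filter⁻ (λ y → ¬? (x ~? y)) {xs = reps xs} y∈))
                            ∷ AllPairsₚ.filter⁺ (λ y → ¬? (x ~? y)) (reps-pairs xs)

      reps-cover : ∀ xs → (∀ {x} → x ∈ xs → length x ≡ m) → ∀ {x} → x ∈ xs → ∃[ y ] y ∈ reps xs × x ~ y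
      reps-cover (x ∷ xs) len (here refl) = x , here refl , 0 , rotate-0 x
      reps-cover (x ∷ xs) len (there {x = _} z∈) with reps-cover xs (λ p → len (there p)) z∈
      ... | y , y∈ , z~y with x ~? y
      ... | yes x~y = x , here refl , ~-trans {_} {y} {x} z~y (~-sym {x} {y} (len (there (reps⊆ xs y∈))) x~y)
      ... | no ¬x~y = y , there (∈-filter⁺ (λ y → ¬? (x ~? y)) y∈ ¬x~y) , z~y

      -- `AllPairs` separates members in list order only, so the relation is taken in both
      -- directions.
      pairs-≡ : ∀ {ys : List (List A)} → AllPairs (λ x y → ¬ (x ~ y)) ys → ∀ {x y} → x ∈ ys → y ∈ ys → x ~ y → y ~ x → x ≡ y
      pairs-≡ (p ∷ ps) (here refl) (here refl) r r′ = refl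
      pairs-≡ (p ∷ ps) (here refl) (there y∈) r r′ = ⊥-elim (All.lookup p y∈ r)
      pairs-≡ (p ∷ ps) (there x∈) (here refl) r r′ = ⊥-elim (All.lookup p x∈ r′)
      pairs-≡ (p ∷ ps) (there x∈) (there y∈) r r′ = pairs-≡ ps x∈ y∈ r r′

      fixed : ℕ → List A → ℕ
      fixed j x = 𝟙 (does (rotate j x ≟ x))

      -- The incidence between representatives and words whose double counting gives Burnside's
      -- lemma.
      hit : ℕ → List A → List A → ℕ
      hit j y x = 𝟙 (does (rotate j y ≟ x))

      hit≡0 : ∀ j y x → rotate j y ≢ x → hit j y x ≡ 0
      hit≡0 j y x ne with rotate j y ≟ x
      ... | yes e = ⊥-elim (ne e)
      ... | no _ = refl

      hit≡1 : ∀ j y → hit j y (rotate j y) ≡ 1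
      hit≡1 j y with rotate j y ≟ rotate j y
      ... | yes _ = refl
      ... | no ne = ⊥-elim (ne refl)

      module _ (X : List (List A)) (uX : Unique X) (len : ∀ {x} → x ∈ X → length x ≡ m)
               (closed : ∀ t {x} → x ∈ X → rotate t x ∈ X) where

        reps-unique : Unique (reps X)
        reps-unique = Data.List.Relation.Unary.AllPairs.map (λ {x} n e → n (0 , trans (rotate-0 _) (sym e))) (reps-pairs X)

        -- For y ∈ reps X, every j < m contributes exactly one x = rotate j y;
        -- for x ∈ X, exactly one y ∈ reps X contributes, as often as x has stabilisers.
        burnside : m * length (reps X) ≡ ∑ (upTo m) (λ j → ∑ X (fixed j))
        burnside = begin
          m * length (reps X) ≡⟨ *-comm m _ ⟩
          length (reps X) * m ≡⟨ sym (∑-const (reps X) m) ⟩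
          ∑ (reps X) (λ _ → m) ≡⟨ ∑-cong (reps X) (λ y y∈ → orbit y (reps⊆ X y∈)) ⟩
          ∑ (reps X) (λ y → ∑ (upTo m) (λ j → ∑ X (hit j y))) ≡⟨ ∑-cong′ (reps X) (λ y → ∑-swap (upTo m) X (λ j → hit j y)) ⟩
          ∑ (reps X) (λ y → ∑ X (λ x → ∑ (upTo m) (λ j → hit j y x))) ≡⟨ ∑-swap (reps X) X _ ⟩
          ∑ X (λ x → ∑ (reps X) (λ y → ∑ (upTo m) (λ j → hit j y x))) ≡⟨ ∑-cong X stabiliser ⟩
          ∑ X (λ x → ∑ (upTo m) (λ j → fixed j x)) ≡⟨ ∑-swap X (upTo m) (λ x j → fixed j x) ⟩
          ∑ (upTo m) (λ j → ∑ X (fixed j)) ∎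
          where
          open ≡-Reasoning
          orbit : ∀ y → y ∈ X → m ≡ ∑ (upTo m) (λ j → ∑ X (hit j y))
          orbit y y∈ = sym (begin
            ∑ (upTo m) (λ j → ∑ X (hit j y)) ≡⟨ ∑-cong′ (upTo m) (λ j → trans (∑-delta uX (closed j y∈) (hit j y) (λ x _ ne → hit≡0 j y x (ne ∘ sym))) (hit≡1 j y)) ⟩
            ∑ (upTo m) (λ _ → 1) ≡⟨ sym (length≡∑1 (upTo m)) ⟩
            length (upTo m) ≡⟨ Listₚ.length-upTo m ⟩
            m ∎)
          stabiliser : ∀ x → x ∈ X → ∑ (reps X) (λ y → ∑ (upTo m) (λ j → hit j y x)) ≡ ∑ (upTo m) (λ j → fixed j x)
          stabiliser x x∈ with reps-cover X len x∈
          ... | y , y∈ , t , refl = begin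
            ∑ (reps X) (λ y′ → ∑ (upTo m) (λ j → hit j y′ x)) ≡⟨ ∑-delta reps-unique y∈ _ (λ y′ y′∈ ne → ∑-zero (upTo m) (λ j _ → hit≡0 j y′ x (λ e → ne (y′≡y y′ y′∈ j e)))) ⟩
            -- As x is `rotate t y`, the amounts carrying y to x are those fixing x, translated by
            -- t.
            ∑ (upTo m) (λ j → hit j y x) ≡⟨ sym (∑-shift m (λ j → hit j y x) (λ i → cong (λ z → 𝟙 (does (z ≟ x))) (rot-m i)) t) ⟩
            ∑ (upTo m) (λ j → hit (j + t) y x) ≡⟨ ∑-cong′ (upTo m) (λ j → cong (λ z → 𝟙 (does (z ≟ x))) (sym (rotate-+ j t y))) ⟩
            ∑ (upTo m) (λ j → fixed j x) ∎
            where
            len-y : length y ≡ m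
            len-y = len (reps⊆ X y∈)
            rot-m : ∀ i → rotate (i + m) y ≡ rotate i y
            rot-m i = subst (λ k → rotate (i + k) y ≡ rotate i y) len-y (rotate-period i y)
            y′≡y : ∀ y′ → y′ ∈ reps X → ∀ j → rotate j y′ ≡ rotate t y → y′ ≡ y
            y′≡y y′ y′∈ j e = pairs-≡ (reps-pairs X) y′∈ y∈ y′~y (~-sym {y′} {y} len-y y′~y)
              where
              y′~y : y′ ~ y
              y′~y = ~-trans {y′} {rotate j y′} {y} (~-sym {rotate j y′} {y′} (len (reps⊆ X y′∈)) (j , refl)) (t , sym e)

-- Necklaces with prescribed statistics, and the totient form of Burnside's sum.

module Necklaces where

  open Sums
  open Forests
  open Rotations
  import Data.Bool.Properties as Boolₚ
  open import Data.List using (map; filter)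
  import Data.List.Properties as Listₚ
  open import Data.List.Relation.Unary.All using ([]; _∷_)
  open import Data.List.Relation.Unary.AllPairs using ([]; _∷_)
  import Data.List.Relation.Unary.Unique.Propositional.Properties as Uniqueₚ
  import Data.Maybe as Maybe
  open import Data.Nat as ℕ using (ℕ; zero; suc; _+_; _*_; _≤_; z≤n; s≤s)
  open import Data.Nat.Coprimality using (gcd≡1⇒coprime; coprime-Bézout)
  open import Data.Nat.DivMod
  open import Data.Nat.Divisibility
  open import Data.Nat.GCD
  open import Data.Nat.Properties
  open import Data.Product.Properties using () renaming (≡-dec to ×-≡-dec)
  open import Function using (case_of_; mk⇔)
  open import Relation.Binary using (DecidableEquality)
  open import Relation.Nullary.Decidable using (does-⇔)

  range : ℕ → List ℕ
  range m = map suc (upTo m)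

  ∈-range⁺ : ∀ {m j} → 1 ≤ j → j ≤ m → j ∈ range m
  ∈-range⁺ {j = suc j} _ j≤m = ∈-map⁺ suc (∈-upTo⁺ j≤m)

  ∈-range⁻ : ∀ {m j} → j ∈ range m → 1 ≤ j × j ≤ m
  ∈-range⁻ j∈ with ∈-map⁻ suc j∈
  ... | i , i∈ , refl = s≤s z≤n , ∈-upTo⁻ i∈

  range-unique : ∀ m → Unique (range m)
  range-unique m = Uniqueₚ.map⁺ suc-injective (Uniqueₚ.upTo⁺ m)

  *-÷ₙ : ∀ q k → 1 ≤ k → (q * k) ÷ₙ k ≡ q
  *-÷ₙ q (suc k) _ = m*n/n≡m q (suc k)

  ∣⇒÷ₙ : ∀ {k m} → 1 ≤ k → k ∣ m → (m ÷ₙ k) * k ≡ m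
  ∣⇒÷ₙ {suc k} _ k∣m = m/n*n≡m k∣m

  1≤÷ₙ : ∀ {k m} → 1 ≤ m → k ∣ m → 1 ≤ k → 1 ≤ m ÷ₙ k
  1≤÷ₙ {k} {m} 1≤m k∣m 1≤k with m ÷ₙ k | ∣⇒÷ₙ 1≤k k∣m
  ... | zero | refl = ⊥-elim (<-irrefl refl 1≤m)
  ... | suc _ | _ = s≤s z≤n

  gcd-*ʳ : ∀ d k q → gcd (d * q) (k * q) ≡ gcd d k * q
  gcd-*ʳ d k q = trans (cong₂ gcd (*-comm d q) (*-comm k q)) (trans (sym (c*gcd[m,n]≡gcd[cm,cn] q d k)) (*-comm q _))

  -- Write j/m in lowest terms as d/k; then j = d (m/k) and m/k = gcd j m.
  ∑-totient : ∀ m → 1 ≤ m → (f F : ℕ → ℕ) →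
              (∀ k d m′ → k * m′ ≡ m → gcd d k ≡ 1 → f (d * m′) ≡ F k) →
              ∑ (range m) f ≡ ∑ (range m) (λ k → when (k ∣ᵇ m) (φ k * F k))
  ∑-totient m 1≤m f F hyp = begin
    ∑ (range m) f ≡⟨ ∑-same (range-unique m) fractions-unique toFraction fromFraction f ⟩
    ∑ (concatMap h divisors) f ≡⟨ ∑-concatMap h divisors f ⟩
    ∑ divisors (λ k → ∑ (h k) f) ≡⟨ ∑-cong divisors block ⟩
    ∑ divisors (λ k → φ k * F k) ≡⟨ ∑-filter (_∣? m) (range m) _ ⟩
    ∑ (range m) (λ k → when (k ∣ᵇ m) (φ k * F k)) ∎
    where
    open ≡-Reasoning
    divisors : List ℕ
    divisors = filter (_∣? m) (range m)
    units : ℕ → List ℕ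
    units k = filter (λ d → gcd d k ℕ.≟ 1) (range k)
    h : ℕ → List ℕ
    h k = map (λ d → d * (m ÷ₙ k)) (units k)
    divisor : ∀ {k} → k ∈ divisors → 1 ≤ k × k ∣ m
    divisor k∈ = let (k∈′ , k∣m) = ∈-filter⁻ (_∣? m) {xs = range m} k∈ in proj₁ (∈-range⁻ k∈′) , k∣m
    unit : ∀ {k d} → d ∈ units k → (1 ≤ d × d ≤ k) × gcd d k ≡ 1
    unit {k} d∈ = let (d∈′ , e) = ∈-filter⁻ (λ d → gcd d k ℕ.≟ 1) {xs = range k} d∈ in ∈-range⁻ d∈′ , e
    block : ∀ k → k ∈ divisors → ∑ (h k) f ≡ φ k * F k
    block k k∈ = let (1≤k , k∣m) = divisor k∈ in begin
      ∑ (h k) f ≡⟨ ∑-map (λ d → d * (m ÷ₙ k)) (units k) f ⟩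
      ∑ (units k) (λ d → f (d * (m ÷ₙ k))) ≡⟨ ∑-cong (units k) (λ d d∈ → hyp k d (m ÷ₙ k) (trans (*-comm k _) (∣⇒÷ₙ 1≤k k∣m)) (proj₂ (unit {k} d∈))) ⟩
      ∑ (units k) (λ _ → F k) ≡⟨ ∑-const (units k) (F k) ⟩
      φ k * F k ∎
    -- The denominator of j/m in lowest terms, by which the blocks are told apart.
    κ : ℕ → ℕ
    κ j = m ÷ₙ gcd j m
    κ-h : ∀ k → k ∈ divisors → ∀ {j} → j ∈ h k → κ j ≡ k
    κ-h k k∈ {j} j∈ with ∈-map⁻ (λ d → d * (m ÷ₙ k)) j∈
    ... | d , d∈ , refl = let (1≤k , k∣m) = divisor k∈; q = m ÷ₙ k; m≡ = trans (*-comm k q) (∣⇒÷ₙ 1≤k k∣m) in begin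
      m ÷ₙ gcd (d * q) m ≡⟨ cong (λ n → m ÷ₙ gcd (d * q) n) (sym m≡) ⟩
      m ÷ₙ gcd (d * q) (k * q) ≡⟨ cong (m ÷ₙ_) (trans (gcd-*ʳ d k q) (trans (cong (_* q) (proj₂ (unit {k} d∈))) (*-identityˡ q))) ⟩
      m ÷ₙ q ≡⟨ cong (_÷ₙ q) (sym m≡) ⟩
      (k * q) ÷ₙ q ≡⟨ *-÷ₙ k q (1≤÷ₙ 1≤m k∣m 1≤k) ⟩
      k ∎
    fractions-unique : Unique (concatMap h divisors)
    fractions-unique = concatMap-unique h κ (Uniqueₚ.filter⁺ (_∣? m) (range-unique m))
      (λ k k∈ → let (1≤k , k∣m) = divisor k∈ in
        Uniqueₚ.map⁺ (λ {x} {y} → *-cancelʳ-≡ x y (m ÷ₙ k) {{ℕ.>-nonZero (1≤÷ₙ 1≤m k∣m 1≤k)}})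
                     (Uniqueₚ.filter⁺ (λ d → gcd d k ℕ.≟ 1) (range-unique k)))
      κ-h
    fromFraction : ∀ {j} → j ∈ concatMap h divisors → j ∈ range m
    fromFraction j∈ with ∈-concatMap⁻′ h {xs = divisors} j∈
    ... | k , k∈ , j∈′ with ∈-map⁻ (λ d → d * (m ÷ₙ k)) j∈′
    ... | d , d∈ , refl = let (1≤k , k∣m) = divisor k∈; ((1≤d , d≤k) , _) = unit {k} d∈ in
      ∈-range⁺ (*-mono-≤ 1≤d (1≤÷ₙ 1≤m k∣m 1≤k))
               (≤-trans (*-monoˡ-≤ (m ÷ₙ k) d≤k) (≤-reflexive (trans (*-comm k _) (∣⇒÷ₙ 1≤k k∣m))))
    toFraction : ∀ {j} → j ∈ range m → j ∈ concatMap h divisors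
    toFraction {j} j∈ = ∈-concatMap⁺′ h {x = k}
        (∈-filter⁺ (_∣? m) (∈-range⁺ 1≤k (subst (k ≤_) kg≡m (m≤m*n k g {{ℕ.>-nonZero 1≤g}}))) (divides g (trans (sym kg≡m) (*-comm k g))))
        (subst (_∈ h k) dg≡j (subst (λ q → d * q ∈ h k) q≡g (∈-map⁺ (λ d → d * (m ÷ₙ k))
          (∈-filter⁺ (λ d → gcd d k ℕ.≟ 1) (∈-range⁺ 1≤d d≤k) gcd≡1))))
      where
      g = gcd j m
      k = m ÷ₙ g
      d = j ÷ₙ g
      1≤j : 1 ≤ j
      1≤j = proj₁ (∈-range⁻ j∈)
      1≤g : 1 ≤ g
      1≤g = n≢0⇒n>0 (gcd[m,n]≢0 j m (inj₁ (m<n⇒n≢0 1≤j)))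
      kg≡m : k * g ≡ m
      kg≡m = ∣⇒÷ₙ 1≤g (gcd[m,n]∣n j m)
      dg≡j : d * g ≡ j
      dg≡j = ∣⇒÷ₙ 1≤g (gcd[m,n]∣m j m)
      1≤k : 1 ≤ k
      1≤k = 1≤÷ₙ 1≤m (gcd[m,n]∣n j m) 1≤g
      1≤d : 1 ≤ d
      1≤d = 1≤÷ₙ 1≤j (gcd[m,n]∣m j m) 1≤g
      d≤k : d ≤ k
      d≤k = *-cancelʳ-≤ d k g {{ℕ.>-nonZero 1≤g}} (subst₂ _≤_ (sym dg≡j) (sym kg≡m) (proj₂ (∈-range⁻ j∈)))
      q≡g : m ÷ₙ k ≡ g
      q≡g = trans (cong (_÷ₙ k) (trans (sym kg≡m) (*-comm k g))) (*-÷ₙ g k 1≤k)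
      gcd≡1 : gcd d k ≡ 1
      gcd≡1 = *-cancelʳ-≡ (gcd d k) 1 g {{ℕ.>-nonZero 1≤g}} (trans (sym (gcd-*ʳ d k g)) (trans (cong₂ gcd dg≡j kg≡m) (sym (*-identityˡ g))))

  _≟ᵗ_ : DecidableEquality BT
  leaf ≟ᵗ leaf = yes refl
  leaf ≟ᵗ node _ _ = no λ ()
  node _ _ ≟ᵗ leaf = no λ ()
  node l r ≟ᵗ node l′ r′ with l ≟ᵗ l′ | r ≟ᵗ r′
  ... | yes refl | yes refl = yes refl
  ... | no l≢ | _ = no λ { refl → l≢ refl }
  ... | _ | no r≢ = no λ { refl → r≢ refl }

  _≟ʷ_ : DecidableEquality (List Bead)
  _≟ʷ_ = Listₚ.≡-dec (×-≡-dec Boolₚ._≟_ _≟ᵗ_)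

  open Rotation {Bead} (false , leaf) public

  -- By Bézout some multiple of d is 1 modulo k, so some multiple of d m′ is m′ modulo the length k
  -- m′. Over the naturals the Bézout relation comes in two signs, hence the two cases.
  rotate-coprime : ∀ k d m′ w → k * m′ ≡ length w → gcd d k ≡ 1 → rotate (d * m′) w ≡ w → rotate m′ w ≡ w
  rotate-coprime k d m′ w l g e with coprime-Bézout (gcd≡1⇒coprime {d} {k} g)
  ... | Bézout.+- x y eq = begin
    rotate m′ w ≡⟨ cong (rotate m′) (sym (rotate-* y (length w) w (rotate-length w))) ⟩
    rotate m′ (rotate (y * length w) w) ≡⟨ rotate-+ m′ (y * length w) w ⟩
    rotate (m′ + y * length w) w ≡⟨ cong (λ n → rotate n w) arith ⟩
    rotate (x * (d * m′)) w ≡⟨ rotate-* x (d * m′) w e ⟩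
    w ∎
    where
    open ≡-Reasoning
    arith : m′ + y * length w ≡ x * (d * m′)
    arith = begin
      m′ + y * length w ≡⟨ cong₂ _+_ (sym (*-identityˡ m′)) (trans (cong (y *_) (sym l)) (sym (*-assoc y k m′))) ⟩
      1 * m′ + (y * k) * m′ ≡⟨ sym (*-distribʳ-+ m′ 1 (y * k)) ⟩
      (1 + y * k) * m′ ≡⟨ cong (_* m′) eq ⟩
      (x * d) * m′ ≡⟨ *-assoc x d m′ ⟩
      x * (d * m′) ∎
  ... | Bézout.-+ x y eq = begin
    rotate m′ w ≡⟨ cong (rotate m′) (sym (rotate-* x (d * m′) w e)) ⟩
    rotate m′ (rotate (x * (d * m′)) w) ≡⟨ rotate-+ m′ (x * (d * m′)) w ⟩
    rotate (m′ + x * (d * m′)) w ≡⟨ cong (λ n → rotate n w) arith ⟩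
    rotate (y * length w) w ≡⟨ rotate-* y (length w) w (rotate-length w) ⟩
    w ∎
    where
    open ≡-Reasoning
    arith : m′ + x * (d * m′) ≡ y * length w
    arith = begin
      m′ + x * (d * m′) ≡⟨ cong₂ _+_ (sym (*-identityˡ m′)) (sym (*-assoc x d m′)) ⟩
      1 * m′ + (x * d) * m′ ≡⟨ sym (*-distribʳ-+ m′ 1 (x * d)) ⟩
      (1 + x * d) * m′ ≡⟨ cong (_* m′) eq ⟩
      (y * k) * m′ ≡⟨ trans (*-assoc y k m′) (cong (y *_) l) ⟩
      y * length w ∎

  dvd : ℕ → Maybe ℕ → Bool
  dvd k nothing = true
  dvd k (just z) = k ∣ᵇ z

  quot : Maybe ℕ → ℕ → Maybe ℕ
  quot mz k = Maybe.map (_÷ₙ k) mz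

  -- A k-fold repetition has k times the cherries of its period, so it attains z exactly when k
  -- divides z and the period attains z/k.
  match-* : ∀ k mz c → 1 ≤ k → match mz (k * c) ≡ dvd k mz ∧ match (quot mz k) c
  match-* k nothing c _ = refl
  match-* k (just z) c 1≤k with k ∣? z
  ... | no ¬k∣z = dec-false (k * c ℕ.≟ z) (λ { refl → ¬k∣z (divides c (*-comm k c)) })
  ... | yes k∣z with c ℕ.≟ z ÷ₙ k
  ... | yes e = trans (dec-true (k * c ℕ.≟ z) (trans (*-comm k c) (trans (cong (_* k) e) (∣⇒÷ₙ 1≤k k∣z)))) (sym (dec-true (c ℕ.≟ z ÷ₙ k) e))
  ... | no ne = trans (dec-false (k * c ℕ.≟ z) (λ { refl → ne (sym (trans (cong (_÷ₙ k) (*-comm k c)) (*-÷ₙ c k 1≤k))) })) (sym (dec-false (c ℕ.≟ z ÷ₙ k) ne))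

  match-just : ∀ z n → match (just z) n ≡ true → n ≡ z
  match-just z n e with n ℕ.≟ z
  ... | yes p = p
  ... | no ¬p with trans (sym e) (dec-false (n ℕ.≟ z) ¬p)
  ... | ()

  match-just⁺ : ∀ z {n} → n ≡ z → match (just z) n ≡ true
  match-just⁺ z {n} = dec-true (n ℕ.≟ z)

  ∧-true⁻ : ∀ a {b} → a ∧ b ≡ true → a ≡ true × b ≡ true
  ∧-true⁻ true e = refl , e

  beadStat : Bool → (BT → ℕ) → Bead → ℕ
  beadStat false v (false , t) = v t
  beadStat false v (true , t) = 0
  beadStat true v (false , t) = 0
  beadStat true v (true , t) = v t

  -- Written as a sum over the whole word, a statistic of one colour falls under the general lemmas
  -- on rotation and repetition.
  ∑-pick : ∀ c v w → ∑ (pick c w) v ≡ ∑ w (beadStat c v)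
  ∑-pick c v [] = refl
  ∑-pick false v ((false , t) ∷ w) = cong (v t +_) (∑-pick false v w)
  ∑-pick false v ((true , t) ∷ w) = ∑-pick false v w
  ∑-pick true v ((false , t) ∷ w) = ∑-pick true v w
  ∑-pick true v ((true , t) ∷ w) = cong (v t +_) (∑-pick true v w)

  pick-rotate : ∀ c v t w → ∑ (pick c (rotate t w)) v ≡ ∑ (pick c w) v
  pick-rotate c v t w = trans (∑-pick c v (rotate t w)) (trans (∑-rotate t w (beadStat c v)) (sym (∑-pick c v w)))

  pick-repeat : ∀ c v k w → ∑ (pick c (repeat k w)) v ≡ k * ∑ (pick c w) v
  pick-repeat c v k w = trans (∑-pick c v (repeat k w)) (trans (∑-repeat-word k w (beadStat c v)) (cong (k *_) (sym (∑-pick c v w))))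

  fits : ℕ → Maybe ℕ → ℕ → Maybe ℕ → List Bead → Bool
  fits r ma s mb w = (match (just r) (leavesF (pick false w)) ∧ match ma (cherriesF (pick false w))) ∧
                     (match (just s) (leavesF (pick true w)) ∧ match mb (cherriesF (pick true w)))

  divides⁴ : ℕ → ℕ → Maybe ℕ → ℕ → Maybe ℕ → Bool
  divides⁴ k r ma s mb = (k ∣ᵇ r) ∧ dvd k ma ∧ (k ∣ᵇ s) ∧ dvd k mb

  ∧-interchange₈ : ∀ a b c d a′ b′ c′ d′ →
    ((a ∧ a′) ∧ (b ∧ b′)) ∧ ((c ∧ c′) ∧ (d ∧ d′)) ≡ (a ∧ b ∧ c ∧ d) ∧ ((a′ ∧ b′) ∧ (c′ ∧ d′))
  ∧-interchange₈ false b c d a′ b′ c′ d′ = refl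
  ∧-interchange₈ true b c d false b′ c′ d′ = sym (Boolₚ.∧-zeroʳ (b ∧ c ∧ d))
  ∧-interchange₈ true false c d true b′ c′ d′ = refl
  ∧-interchange₈ true true c d true false c′ d′ = sym (Boolₚ.∧-zeroʳ (c ∧ d))
  ∧-interchange₈ true true false d true true c′ d′ = refl
  ∧-interchange₈ true true true d true true false d′ = sym (Boolₚ.∧-zeroʳ d)
  ∧-interchange₈ true true true d true true true d′ = refl

  fits-repeat : ∀ k r ma s mb w → 1 ≤ k →
    fits r ma s mb (repeat k w) ≡ divides⁴ k r ma s mb ∧ fits (r ÷ₙ k) (quot ma k) (s ÷ₙ k) (quot mb k) w
  fits-repeat k r ma s mb w 1≤k = trans
    (cong₂ _∧_ (cong₂ _∧_ (step (just r) false leaves) (step ma false cherries))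
               (cong₂ _∧_ (step (just s) true leaves) (step mb true cherries)))
    (∧-interchange₈ (k ∣ᵇ r) (dvd k ma) (k ∣ᵇ s) (dvd k mb) _ _ _ _)
    where
    step : ∀ mz c v → match mz (∑ (pick c (repeat k w)) v) ≡ dvd k mz ∧ match (quot mz k) (∑ (pick c w) v)
    step mz c v = trans (cong (match mz) (pick-repeat c v k w)) (match-* k mz (∑ (pick c w) v) 1≤k)

  fits-rotate : ∀ r ma s mb t w → fits r ma s mb (rotate t w) ≡ fits r ma s mb w
  fits-rotate r ma s mb t w = cong₂ _∧_
    (cong₂ _∧_ (cong (match (just r)) (pick-rotate false leaves t w)) (cong (match ma) (pick-rotate false cherries t w)))
    (cong₂ _∧_ (cong (match (just s)) (pick-rotate true leaves t w)) (cong (match mb) (pick-rotate true cherries t w)))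

  module _ (m r : ℕ) (ma : Maybe ℕ) (s : ℕ) (mb : Maybe ℕ) where

    fitting : List (List Bead)
    fitting = filter (λ w → ok ma mb w Boolₚ.≟ true) (words m r s)

    fitting-unique : Unique fitting
    fitting-unique = Uniqueₚ.filter⁺ (λ w → ok ma mb w Boolₚ.≟ true) (words-unique m r s)

    fitting⁻ : ∀ {w} → w ∈ fitting → length w ≡ m × fits r ma s mb w ≡ true
    fitting⁻ {w} w∈ =
      let (w∈′ , okw) = ∈-filter⁻ (λ w → ok ma mb w Boolₚ.≟ true) {xs = words m r s} w∈
          (l , p , q) = words-sound m r s w∈′
          (pa , pb) = ∧-true⁻ (match ma (cherriesF (pick false w))) okw
      in l , cong₂ _∧_ (cong₂ _∧_ (match-just⁺ r p) pa) (cong₂ _∧_ (match-just⁺ s q) pb)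

    fitting⁺ : ∀ {w} → length w ≡ m → fits r ma s mb w ≡ true → w ∈ fitting
    fitting⁺ {w} refl fw =
      let (p , q) = ∧-true⁻ (match (just r) (leavesF (pick false w)) ∧ match ma (cherriesF (pick false w))) fw
          (pr , pa) = ∧-true⁻ (match (just r) (leavesF (pick false w))) p
          (ps , pb) = ∧-true⁻ (match (just s) (leavesF (pick true w))) q
      in ∈-filter⁺ (λ w → ok ma mb w Boolₚ.≟ true)
           (subst₂ (λ r s → w ∈ words m r s) (match-just r _ pr) (match-just s _ ps) (words-complete w))
           (cong₂ _∧_ pa pb)

    length-fitting : length fitting ≡ W m r ma s mb
    length-fitting = trans (length≡∑1 fitting) (trans (∑-filter (λ w → ok ma mb w Boolₚ.≟ true) (words m r s) (λ _ → 1))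
      (∑-cong′ (words m r s) (λ w → lem (ok ma mb w))))
      where
      lem : ∀ b → when (does (b Boolₚ.≟ true)) 1 ≡ 𝟙 b
      lem true = refl
      lem false = refl

  module _ (m r : ℕ) (ma : Maybe ℕ) (s : ℕ) (mb : Maybe ℕ) (1≤m : 1 ≤ m) where

    open Burnside _≟ʷ_ m 1≤m

    module _ (k m′ : ℕ) (1≤k : 1 ≤ k) (km′≡m : k * m′ ≡ m) where

      private
        r′ = r ÷ₙ k
        s′ = s ÷ₙ k
        ma′ = quot ma k
        mb′ = quot mb k
        X = fitting m r ma s mb
        Y = fitting m′ r′ ma′ s′ mb′

      1≤m′ : 1 ≤ m′
      1≤m′ = n≢0⇒n>0 (λ { refl → <-irrefl (trans (sym (*-zeroʳ k)) km′≡m) 1≤m })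

      fits-root : ∀ x → x ∈ X → rotate m′ x ≡ x →
                  repeat k (root m′ x) ≡ x × divides⁴ k r ma s mb ∧ fits r′ ma′ s′ mb′ (root m′ x) ≡ true
      fits-root x x∈ e = rr , trans (sym (fits-repeat k r ma s mb (root m′ x) 1≤k))
          (trans (cong (fits r ma s mb) rr) (proj₂ (fitting⁻ m r ma s mb x∈)))
        where rr = repeat-root k m′ x 1≤k 1≤m′ (trans (proj₁ (fitting⁻ m r ma s mb x∈)) (sym km′≡m)) e

      fixed-none : divides⁴ k r ma s mb ≡ false → ∀ x → x ∈ X → fixed m′ x ≡ 0
      fixed-none D x x∈ = cong 𝟙 (dec-false (rotate m′ x ≟ʷ x) (λ e →
        case trans (sym (cong (_∧ fits r′ ma′ s′ mb′ (root m′ x)) D)) (proj₂ (fits-root x x∈ e)) of λ ()))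

      repeat-inj : ∀ {x y} → x ∈ Y → y ∈ Y → repeat k x ≡ repeat k y → x ≡ y
      repeat-inj {x} {y} x∈ y∈ = repeat-injective k {x} {y} 1≤k (subst (1 ≤_) (sym lx) 1≤m′) (trans lx (sym ly))
        where
        lx = proj₁ (fitting⁻ m′ r′ ma′ s′ mb′ x∈)
        ly = proj₁ (fitting⁻ m′ r′ ma′ s′ mb′ y∈)

      fixed⇒repeat : ∀ {x} → x ∈ filter (λ x → rotate m′ x ≟ʷ x) X → x ∈ map (repeat k) Y
      fixed⇒repeat {x} x∈ = subst (_∈ map (repeat k) Y) (proj₁ fr) (∈-map⁺ (repeat k)
        (fitting⁺ m′ r′ ma′ s′ mb′ {root m′ x} (Listₚ.length-applyUpTo (at x) m′) (proj₂ (∧-true⁻ (divides⁴ k r ma s mb) (proj₂ fr)))))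
        where
        split = ∈-filter⁻ (λ x → rotate m′ x ≟ʷ x) {xs = X} x∈
        fr = fits-root x (proj₁ split) (proj₂ split)

      repeat⇒fixed : divides⁴ k r ma s mb ≡ true → ∀ y → y ∈ Y → repeat k y ∈ filter (λ x → rotate m′ x ≟ʷ x) X
      repeat⇒fixed D y y∈ = ∈-filter⁺ (λ x → rotate m′ x ≟ʷ x)
        (fitting⁺ m r ma s mb {repeat k y} (trans (length-repeat k y) (trans (cong (k *_) ly) km′≡m))
          (trans (fits-repeat k r ma s mb y 1≤k) (cong₂ _∧_ D (proj₂ (fitting⁻ m′ r′ ma′ s′ mb′ y∈)))))
        (subst (λ n → rotate n (repeat k y) ≡ repeat k y) ly (rotate-repeat k y 1≤k (subst (1 ≤_) (sym ly) 1≤m′)))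
        where ly = proj₁ (fitting⁻ m′ r′ ma′ s′ mb′ y∈)

      fixed-all : divides⁴ k r ma s mb ≡ true → ∑ X (fixed m′) ≡ W m′ r′ ma′ s′ mb′
      fixed-all D = begin
        ∑ X (fixed m′) ≡⟨ ∑-cong′ X (λ x → lem (does (rotate m′ x ≟ʷ x))) ⟩
        ∑ X (λ x → when (does (rotate m′ x ≟ʷ x)) 1) ≡⟨ sym (∑-filter (λ x → rotate m′ x ≟ʷ x) X (λ _ → 1)) ⟩
        ∑ (filter (λ x → rotate m′ x ≟ʷ x) X) (λ _ → 1) ≡⟨ ∑-same (Uniqueₚ.filter⁺ (λ x → rotate m′ x ≟ʷ x) (fitting-unique m r ma s mb))
                                                                        (map-unique (repeat k) repeat-inj (fitting-unique m′ r′ ma′ s′ mb′)) fixed⇒repeat from (λ _ → 1) ⟩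
        ∑ (map (repeat k) Y) (λ _ → 1) ≡⟨ ∑-map (repeat k) Y (λ _ → 1) ⟩
        ∑ Y (λ _ → 1) ≡⟨ sym (length≡∑1 Y) ⟩
        length Y ≡⟨ length-fitting m′ r′ ma′ s′ mb′ ⟩
        W m′ r′ ma′ s′ mb′ ∎
        where
        open ≡-Reasoning
        lem : ∀ b → 𝟙 b ≡ when b 1
        lem true = refl
        lem false = refl
        from : ∀ {x} → x ∈ map (repeat k) Y → x ∈ filter (λ x → rotate m′ x ≟ʷ x) X
        from {x} x∈ = let (y , y∈ , eq) = ∈-map⁻ (repeat k) x∈ in
          subst (_∈ filter (λ x → rotate m′ x ≟ʷ x) X) (sym eq) (repeat⇒fixed D y y∈)

      -- Words fixed by rotation through m′ = m/k are the k-fold repetitions of words of length m′.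
      -- Their statistics are k times those of the period, so there are none unless k divides all
      -- prescribed values.
      fixed-count : ∑ X (fixed m′) ≡ when (divides⁴ k r ma s mb) (W m′ r′ ma′ s′ mb′)
      fixed-count = cases (divides⁴ k r ma s mb) refl
        where
        cases : ∀ b → divides⁴ k r ma s mb ≡ b → ∑ X (fixed m′) ≡ when b (W m′ r′ ma′ s′ mb′)
        cases false D = ∑-zero X (fixed-none D)
        cases true D = fixed-all D

    necklaces : List (List Bead)
    necklaces = reps (fitting m r ma s mb)

    -- Burnside's sum over rotation amounts, grouped by the order k of the rotation: all φ(k)
    -- amounts of order k fix the same words.
    necklace-count : m * length necklaces ≡
      ∑ (range m) (λ k → when (k ∣ᵇ m) (φ k * when (divides⁴ k r ma s mb) (W (m ÷ₙ k) (r ÷ₙ k) (quot ma k) (s ÷ₙ k) (quot mb k))))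
    necklace-count = begin
      m * length (reps X) ≡⟨ burnside X (fitting-unique m r ma s mb) (proj₁ ∘ fitting⁻ m r ma s mb) closed ⟩
      -- The totient grouping runs over 1, ..., m instead of 0, ..., m - 1; rotation by m is
      -- rotation by 0.
      ∑ (upTo m) f ≡⟨ sym (∑-shift m f (λ j → ∑-cong X (λ x x∈ → cong (λ z → 𝟙 (does (z ≟ʷ x))) (rot-m j x x∈))) 1) ⟩
      ∑ (upTo m) (λ j → f (j + 1)) ≡⟨ ∑-cong′ (upTo m) (λ j → cong f (+-comm j 1)) ⟩
      ∑ (upTo m) (f ∘ suc) ≡⟨ sym (∑-map suc (upTo m) f) ⟩
      ∑ (range m) f ≡⟨ ∑-totient m 1≤m f (λ k → f (m ÷ₙ k)) coprimeFix ⟩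
      ∑ (range m) (λ k → when (k ∣ᵇ m) (φ k * f (m ÷ₙ k))) ≡⟨ ∑-cong (range m) (λ k k∈ → term k (proj₁ (∈-range⁻ k∈))) ⟩
      ∑ (range m) (λ k → when (k ∣ᵇ m) (φ k * when (divides⁴ k r ma s mb) (W (m ÷ₙ k) (r ÷ₙ k) (quot ma k) (s ÷ₙ k) (quot mb k)))) ∎
      where
      open ≡-Reasoning
      X = fitting m r ma s mb
      f : ℕ → ℕ
      f j = ∑ X (fixed j)
      closed : ∀ t {x} → x ∈ X → rotate t x ∈ X
      closed t {x} x∈ = let (l , fx) = fitting⁻ m r ma s mb x∈ in
        fitting⁺ m r ma s mb (trans (length-rotate t x) l) (trans (fits-rotate r ma s mb t x) fx)
      rot-m : ∀ j x → x ∈ X → rotate (j + m) x ≡ rotate j x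
      rot-m j x x∈ = subst (λ n → rotate (j + n) x ≡ rotate j x) (proj₁ (fitting⁻ m r ma s mb x∈)) (rotate-period j x)
      coprimeFix : ∀ k d m′ → k * m′ ≡ m → gcd d k ≡ 1 → f (d * m′) ≡ f (m ÷ₙ k)
      coprimeFix k d m′ e g = trans (∑-cong X same) (cong f (sym (trans (cong (_÷ₙ k) (trans (sym e) (*-comm k m′))) (*-÷ₙ m′ k 1≤k))))
        where
        1≤k : 1 ≤ k
        1≤k = n≢0⇒n>0 (λ { refl → <-irrefl e 1≤m })
        same : ∀ x → x ∈ X → fixed (d * m′) x ≡ fixed m′ x
        same x x∈ = cong 𝟙 (does-⇔ (mk⇔ (rotate-coprime k d m′ x (trans e (sym (proj₁ (fitting⁻ m r ma s mb x∈)))) g) (rotate-* d m′ x))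
                              (rotate (d * m′) x ≟ʷ x) (rotate m′ x ≟ʷ x))
      term : ∀ k → 1 ≤ k → when (k ∣ᵇ m) (φ k * f (m ÷ₙ k)) ≡
        when (k ∣ᵇ m) (φ k * when (divides⁴ k r ma s mb) (W (m ÷ₙ k) (r ÷ₙ k) (quot ma k) (s ÷ₙ k) (quot mb k)))
      term k 1≤k = cases (k ∣? m)
        where
        cases : (d : Dec (k ∣ m)) → when (does d) (φ k * f (m ÷ₙ k)) ≡
          when (does d) (φ k * when (divides⁴ k r ma s mb) (W (m ÷ₙ k) (r ÷ₙ k) (quot ma k) (s ÷ₙ k) (quot mb k)))
        cases (no _) = refl
        cases (yes k∣m) = cong (φ k *_) (fixed-count k (m ÷ₙ k) 1≤k (trans (*-comm k _) (∣⇒÷ₙ 1≤k k∣m)))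

-- Ballot numbers and the coefficients of the logarithm.

module LogIdentity where

  open Sums
  open Forests
  open import Data.List using (map)
  import Data.List.Properties as Listₚ
  open import Data.Nat as ℕ using (ℕ; zero; suc; _≤_; _<_; z≤n; s≤s; _≤?_; _!; _∸_; NonZero)
  open import Data.Nat.Combinatorics using (_C_; nCk+nC[k+1]≡[n+1]C[k+1]; nCn≡1)
  import Data.Nat.Properties as ℕₚ
  open import Data.Nat.Solver using () renaming (module +-*-Solver to ℕS)
  open import Data.Rational using (ℚ; 0ℚ; 1ℚ; _+_; _*_; _-_; -_)
  open import Data.Rational.Properties using (*-zeroˡ; *-zeroʳ; *-assoc; *-comm; *-identityˡ; *-identityʳ; +-identityˡ; +-identityʳ; *-distribˡ-+; *-distribʳ-+)
  open import Data.Rational.Solver using () renaming (module +-*-Solver to ℚS)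
  open import Relation.Binary using (tri<; tri≈; tri>)

  -- B a b is the binomial coefficient (a + b choose a).
  B : ℕ → ℕ → ℕ
  B zero b = 1
  B (suc a) zero = 1
  B (suc a) (suc b) = B a (suc b) ℕ.+ B (suc a) b

  B-sym : ∀ a b → B a b ≡ B b a
  B-sym zero zero = refl
  B-sym zero (suc b) = refl
  B-sym (suc a) zero = refl
  B-sym (suc a) (suc b) = trans (cong₂ ℕ._+_ (B-sym a (suc b)) (B-sym (suc a) b)) (ℕₚ.+-comm (B (suc b) a) (B b (suc a)))

  B≡C : ∀ a b → B a b ≡ (a ℕ.+ b) C a
  B≡C zero b = refl
  B≡C (suc a) zero = trans (sym (nCn≡1 (suc a))) (cong (_C suc a) (sym (ℕₚ.+-identityʳ (suc a))))
  B≡C (suc a) (suc b) = trans (cong₂ ℕ._+_ (B≡C a (suc b)) (trans (B≡C (suc a) b) (cong (_C suc a) (sym (ℕₚ.+-suc a b)))))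
    (nCk+nC[k+1]≡[n+1]C[k+1] (a ℕ.+ suc b) a)

  -- Multiplied by (a+1)! (b+1)!, the two summands of Pascal's rule become a + 1 and b + 1 copies of
  -- (a+b+1)!.
  B-! : ∀ a b → B a b ℕ.* (a ! ℕ.* b !) ≡ (a ℕ.+ b) !
  B-! zero b = trans (ℕₚ.*-identityˡ _) (ℕₚ.*-identityˡ (b !))
  B-! (suc a) zero = trans (ℕₚ.*-identityˡ _) (trans (ℕₚ.*-identityʳ _) (cong _! (sym (ℕₚ.+-identityʳ (suc a)))))
  B-! (suc a) (suc b) = begin
    (x ℕ.+ y) ℕ.* (suc a ! ℕ.* suc b !) ≡⟨ solve 6 (λ x y a b p κ₁ → (x :+ y) :* (((con 1 :+ a) :* p) :* ((con 1 :+ b) :* κ₁)) :=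
          (con 1 :+ a) :* (x :* (p :* ((con 1 :+ b) :* κ₁))) :+ (con 1 :+ b) :* (y :* (((con 1 :+ a) :* p) :* κ₁))) refl x y a b (a !) (b !) ⟩
    suc a ℕ.* (x ℕ.* (a ! ℕ.* suc b !)) ℕ.+ suc b ℕ.* (y ℕ.* (suc a ! ℕ.* b !))
      ≡⟨ cong₂ (λ u v → suc a ℕ.* u ℕ.+ suc b ℕ.* v) (B-! a (suc b)) (trans (B-! (suc a) b) (cong _! (sym (ℕₚ.+-suc a b)))) ⟩
    suc a ℕ.* ((a ℕ.+ suc b) !) ℕ.+ suc b ℕ.* ((a ℕ.+ suc b) !) ≡⟨ sym (ℕₚ.*-distribʳ-+ ((a ℕ.+ suc b) !) (suc a) (suc b)) ⟩
    (suc a ℕ.+ suc b) ! ∎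
    where
    open ≡-Reasoning
    open ℕS using (solve; _:=_; _:+_; _:*_; con)
    x = B a (suc b)
    y = B (suc a) b

  fact≢0 : ∀ n → NonZero (n !)
  fact≢0 n = n ℕₚ.!≢0

  absorb : ∀ a b → suc a ℕ.* B (suc a) b ≡ (suc a ℕ.+ b) ℕ.* B a b
  absorb a b = ℕₚ.*-cancelʳ-≡ _ _ (a ! ℕ.* b !) {{ℕₚ.m*n≢0 (a !) (b !) {{fact≢0 a}} {{fact≢0 b}}}} (begin
    suc a ℕ.* B (suc a) b ℕ.* (a ! ℕ.* b !) ≡⟨ solve 4 (λ a x p κ₁ → ((con 1 :+ a) :* x) :* (p :* κ₁) := x :* (((con 1 :+ a) :* p) :* κ₁)) refl a (B (suc a) b) (a !) (b !) ⟩
    B (suc a) b ℕ.* (suc a ! ℕ.* b !) ≡⟨ B-! (suc a) b ⟩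
    (suc a ℕ.+ b) ℕ.* ((a ℕ.+ b) !) ≡⟨ cong ((suc a ℕ.+ b) ℕ.*_) (sym (B-! a b)) ⟩
    (suc a ℕ.+ b) ℕ.* (B a b ℕ.* (a ! ℕ.* b !)) ≡⟨ sym (ℕₚ.*-assoc (suc a ℕ.+ b) (B a b) _) ⟩
    (suc a ℕ.+ b) ℕ.* B a b ℕ.* (a ! ℕ.* b !) ∎)
    where
    open ≡-Reasoning
    open ℕS using (solve; _:=_; _:+_; _:*_; con)

  absorbʳ : ∀ a b → suc b ℕ.* B a (suc b) ≡ (suc a ℕ.+ b) ℕ.* B a b
  absorbʳ a b = trans (cong (suc b ℕ.*_) (B-sym a (suc b))) (trans (absorb b a) (cong₂ ℕ._*_ (cong suc (ℕₚ.+-comm b a)) (B-sym b a)))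

  c : ℕ → ℕ → ℕ
  c e α = length (F e α)

  c-zero : ∀ α → c 0 α ≡ 1
  c-zero zero = refl
  c-zero (suc α) = trans (Listₚ.length-map (leaf ∷_) (F 0 α)) (c-zero α)

  c-suc : ∀ e α → c (suc e) (suc α) ≡ c (suc e) α ℕ.+ c e (suc (suc α))
  c-suc e α = trans (Listₚ.length-++ (map (leaf ∷_) (F (suc e) α)))
    (cong₂ ℕ._+_ (Listₚ.length-map (leaf ∷_) (F (suc e) α)) (Listₚ.length-map graft (F e (suc (suc α)))))

  -- The ballot number C(2e+α+1, e+1) - C(2e+α+1, e), written without subtraction. The recurrence
  -- `c-suc` also calls for the count at excess e, possibly 0, where this form does not apply;
  -- `c-double` is the variant that covers it, and the two are proved together.
  c-closed : ∀ e α → c (suc e) α ℕ.+ B e (suc e ℕ.+ α) ≡ B (suc e) (e ℕ.+ α)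
  c-double : ∀ e α → c e (suc (suc α)) ℕ.+ B e (suc (suc (e ℕ.+ α))) ≡ 2 ℕ.* B e (suc (e ℕ.+ α))

  -- Without trees there is no leaf to place, and the two binomials agree by symmetry.
  c-closed e zero rewrite ℕₚ.+-identityʳ e = B-sym e (suc e)
  c-closed e (suc α) = begin
    c (suc e) (suc α) ℕ.+ B e (suc e ℕ.+ suc α)
      ≡⟨ cong₂ ℕ._+_ (c-suc e α) (cong (B e ∘ suc) (ℕₚ.+-suc e α)) ⟩
    (c (suc e) α ℕ.+ c e (suc (suc α))) ℕ.+ B e (suc (suc (e ℕ.+ α)))
      ≡⟨ ℕₚ.+-assoc (c (suc e) α) _ _ ⟩
    c (suc e) α ℕ.+ (c e (suc (suc α)) ℕ.+ B e (suc (suc (e ℕ.+ α))))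
      ≡⟨ cong (c (suc e) α ℕ.+_) (c-double e α) ⟩
    c (suc e) α ℕ.+ 2 ℕ.* b
      ≡⟨ solve 2 (λ x b → x :+ con 2 :* b := b :+ (x :+ b)) refl (c (suc e) α) b ⟩
    b ℕ.+ (c (suc e) α ℕ.+ b)
      ≡⟨ cong (b ℕ.+_) (c-closed e α) ⟩
    B (suc e) (suc (e ℕ.+ α))
      ≡⟨ cong (B (suc e)) (sym (ℕₚ.+-suc e α)) ⟩
    B (suc e) (e ℕ.+ suc α) ∎
    where
    open ≡-Reasoning
    open ℕS using (solve; _:=_; _:+_; _:*_; con)
    b = B e (suc (e ℕ.+ α))

  c-double zero α = cong (ℕ._+ 1) (c-zero (suc (suc α)))
  c-double (suc e) α = begin
    x ℕ.+ (B e (suc (suc (suc (e ℕ.+ α)))) ℕ.+ y)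
      ≡⟨ sym (ℕₚ.+-assoc x _ y) ⟩
    (x ℕ.+ B e (suc (suc (suc (e ℕ.+ α))))) ℕ.+ y
      ≡⟨ cong (λ n → (x ℕ.+ B e n) ℕ.+ y) (cong suc (sym (trans (ℕₚ.+-suc e (suc α)) (cong suc (ℕₚ.+-suc e α))))) ⟩
    (x ℕ.+ B e (suc e ℕ.+ suc (suc α))) ℕ.+ y
      ≡⟨ cong (ℕ._+ y) (c-closed e (suc (suc α))) ⟩
    B (suc e) (e ℕ.+ suc (suc α)) ℕ.+ y
      ≡⟨ cong (λ n → B (suc e) n ℕ.+ y) (trans (ℕₚ.+-suc e (suc α)) (cong suc (ℕₚ.+-suc e α))) ⟩
    y ℕ.+ y
      ≡⟨ cong (y ℕ.+_) (sym (ℕₚ.+-identityʳ y)) ⟩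
    2 ℕ.* y ∎
    where
    open ≡-Reasoning
    x = c (suc e) (suc (suc α))
    y = B (suc e) (suc (suc (e ℕ.+ α)))

  -- Lagrange inversion for B = t + B^2: with i = e + 1 + α, it gives i times the coefficient of t^i
  -- in B^α as α C(2i-α-1, i-α).
  c-weight : ∀ e α → (suc e ℕ.+ α) ℕ.* c (suc e) α ≡ α ℕ.* B (suc e) (e ℕ.+ α)
  c-weight e α = ℕₚ.+-cancelʳ-≡ (suc e ℕ.* y) _ _ (begin
    i ℕ.* x ℕ.+ suc e ℕ.* y ≡⟨ cong (i ℕ.* x ℕ.+_) (trans (absorb e (e ℕ.+ α)) (sym (absorbʳ e (e ℕ.+ α)))) ⟩
    i ℕ.* x ℕ.+ i ℕ.* B e i ≡⟨ sym (ℕₚ.*-distribˡ-+ i x (B e i)) ⟩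
    i ℕ.* (x ℕ.+ B e i) ≡⟨ cong (i ℕ.*_) (c-closed e α) ⟩
    i ℕ.* y ≡⟨ trans (cong (ℕ._* y) (ℕₚ.+-comm (suc e) α)) (ℕₚ.*-distribʳ-+ y α (suc e)) ⟩
    α ℕ.* y ℕ.+ suc e ℕ.* y ∎)
    where
    open ≡-Reasoning
    i = suc e ℕ.+ α
    x = c (suc e) α
    y = B (suc e) (e ℕ.+ α)

  -- The coefficient of t^i in B(t)^α.
  cc : ℕ → ℕ → ℚ
  cc i α = ι (length (forests i α))

  -- dd i α is the coefficient of t^i in B(t)^α / (1 - 2 B(t)), where B(t) = t + B(t)^2.
  dd : ℕ → ℕ → ℚ
  dd i α with α ≤? i
  ... | yes _ = ι (B (i ∸ α) i)
  ... | no _ = 0ℚ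

  cc-yes : ∀ e α → cc (e ℕ.+ α) α ≡ ι (c e α)
  cc-yes e α with α ≤? e ℕ.+ α
  ... | yes _ = cong (λ n → ι (c n α)) (ℕₚ.m+n∸n≡m e α)
  ... | no ¬p = ⊥-elim (¬p (ℕₚ.m≤n+m α e))

  cc-no : ∀ {i α} → i < α → cc i α ≡ 0ℚ
  cc-no {i} {α} i<α with α ≤? i
  ... | yes p = ⊥-elim (ℕₚ.<⇒≱ i<α p)
  ... | no _ = ι-0

  dd-yes : ∀ e α → dd (e ℕ.+ α) α ≡ ι (B e (e ℕ.+ α))
  dd-yes e α with α ≤? e ℕ.+ α
  ... | yes _ = cong (λ n → ι (B n (e ℕ.+ α))) (ℕₚ.m+n∸n≡m e α)
  ... | no ¬p = ⊥-elim (¬p (ℕₚ.m≤n+m α e))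

  dd-no : ∀ {i α} → i < α → dd i α ≡ 0ℚ
  dd-no {i} {α} i<α with α ≤? i
  ... | yes p = ⊥-elim (ℕₚ.<⇒≱ i<α p)
  ... | no _ = refl

  dd-suc : ∀ e α → dd (suc e ℕ.+ α) (suc α) ≡ ι (B e (suc e ℕ.+ α))
  dd-suc e α = subst (λ i → dd i (suc α) ≡ ι (B e i)) (ℕₚ.+-suc e α) (dd-yes e (suc α))

  excess : ∀ i α → i < α ⊎ i ≡ α ⊎ ∃[ e ] i ≡ suc e ℕ.+ α
  excess i α with ℕₚ.<-cmp i α
  ... | tri< p _ _ = inj₁ p
  ... | tri≈ _ p _ = inj₂ (inj₁ p)
  ... | tri> _ _ p = inj₂ (inj₂ (i ∸ suc α , sym (trans (sym (ℕₚ.+-suc (i ∸ suc α) α)) (ℕₚ.m∸n+n≡m p))))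

  -- Coefficientwise, B^α = (1 - 2B) · B^α/(1 - 2B).
  cc-dd : ∀ i α → cc i α ≡ dd i α - (1ℚ + 1ℚ) * dd i (suc α)
  cc-dd i α with excess i α
  ... | inj₁ p rewrite cc-no p | dd-no p | dd-no (ℕₚ.m<n⇒m<1+n p) = refl
  ... | inj₂ (inj₁ refl) rewrite cc-yes 0 α | dd-yes 0 α | dd-no (ℕₚ.n<1+n α) | c-zero α =
    ℚS.solve 1 (λ x → x ℚS.:= x ℚS.:- (ℚS.con 1ℚ ℚS.:+ ℚS.con 1ℚ) ℚS.:* ℚS.con 0ℚ) refl (ι 1)
  ... | inj₂ (inj₂ (e , refl)) = begin
    cc (suc e ℕ.+ α) α ≡⟨ cc-yes (suc e) α ⟩
    ι x ≡⟨ solve 2 (λ x y → x := (y :+ (x :+ y)) :- (con 1ℚ :+ con 1ℚ) :* y) refl (ι x) (ι y) ⟩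
    (ι y + (ι x + ι y)) - (1ℚ + 1ℚ) * ι y ≡⟨ cong (λ z → (ι y + z) - (1ℚ + 1ℚ) * ι y) (trans (sym (ι-+ x y)) (cong ι (c-closed e α))) ⟩
    (ι y + ι (B (suc e) (e ℕ.+ α))) - (1ℚ + 1ℚ) * ι y ≡⟨ cong₂ (λ u v → u - (1ℚ + 1ℚ) * v) (trans (sym (ι-+ y _)) (sym (dd-yes (suc e) α))) (sym (dd-suc e α)) ⟩
    dd (suc e ℕ.+ α) α - (1ℚ + 1ℚ) * dd (suc e ℕ.+ α) (suc α) ∎
    where
    open ≡-Reasoning
    open ℚS using (solve; _:=_; _:+_; _:*_; _:-_; con)
    x = c (suc e) α
    y = B e (suc e ℕ.+ α)

  -- The Euler derivative of B^α is α B^(α-1) t B′. Since t = B - B^2 and B′ = 1/(1 - 2B), this is α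
  -- (B^α - B^(α+1))/(1 - 2B).
  cc-weight : ∀ i α → ι i * cc i α ≡ ι α * (dd i α - dd i (suc α))
  cc-weight i α with excess i α
  ... | inj₁ p rewrite cc-no p | dd-no p | dd-no (ℕₚ.m<n⇒m<1+n p) = trans (*-zeroʳ (ι i)) (sym (*-zeroʳ (ι α)))
  ... | inj₂ (inj₁ refl) rewrite cc-yes 0 α | dd-yes 0 α | dd-no (ℕₚ.n<1+n α) | c-zero α =
    ℚS.solve 2 (λ a x → a ℚS.:* x ℚS.:= a ℚS.:* (x ℚS.:- ℚS.con 0ℚ)) refl (ι α) (ι 1)
  ... | inj₂ (inj₂ (e , refl)) = begin
    ι i′ * cc i′ α ≡⟨ cong (ι i′ *_) (cc-yes (suc e) α) ⟩
    ι i′ * ι (c (suc e) α) ≡⟨ sym (ι-* i′ _) ⟩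
    ι (i′ ℕ.* c (suc e) α) ≡⟨ cong ι (c-weight e α) ⟩
    ι (α ℕ.* z) ≡⟨ ι-* α z ⟩
    ι α * ι z ≡⟨ cong (ι α *_) (solve 2 (λ y z → z := (y :+ z) :- y) refl (ι y) (ι z)) ⟩
    ι α * ((ι y + ι z) - ι y) ≡⟨ cong₂ (λ u v → ι α * (u - v)) (trans (sym (ι-+ y z)) (sym (dd-yes (suc e) α))) (sym (dd-suc e α)) ⟩
    ι α * (dd i′ α - dd i′ (suc α)) ∎
    where
    open ≡-Reasoning
    open ℚS using (solve; _:=_; _:+_; _:*_; _:-_; con)
    i′ = suc e ℕ.+ α
    y = B e i′
    z = B (suc e) (e ℕ.+ α)

  -- The coefficients of X^a Y^b in X/(1 - X - Y) and Y/(1 - X - Y), the two Euler derivatives of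
  -- log 1/(1 - X - Y).
  κ₁ κ₂ : ℕ → ℕ → ℚ
  κ₁ zero b = 0ℚ
  κ₁ (suc a) b = ι (B a b)
  κ₂ a zero = 0ℚ
  κ₂ a (suc b) = ι (B a b)

  -- the logarithmic kernel (a+b-1)!/(a! b!)
  ε : ℕ → ℕ → ℚ
  ε a b = ι (B a b) * inv (a ℕ.+ b)

  ε-q : ∀ a b → ι a * ε a b ≡ κ₁ a b
  ε-q zero b = trans (cong (_* ε 0 b) ι-0) (*-zeroˡ (ε 0 b))
  ε-q (suc a) b = begin
    ι (suc a) * (ι (B (suc a) b) * inv n) ≡⟨ sym (*-assoc (ι (suc a)) _ _) ⟩
    (ι (suc a) * ι (B (suc a) b)) * inv n ≡⟨ cong (_* inv n) (trans (sym (ι-* (suc a) _)) (trans (cong ι (absorb a b)) (ι-* n (B a b)))) ⟩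
    (ι n * ι (B a b)) * inv n ≡⟨ solve 3 (λ n b v → (n :* b) :* v := b :* (n :* v)) refl (ι n) (ι (B a b)) (inv n) ⟩
    ι (B a b) * (ι n * inv n) ≡⟨ cong (ι (B a b) *_) (ι*inv (a ℕ.+ b)) ⟩
    ι (B a b) * 1ℚ ≡⟨ *-identityʳ _ ⟩
    ι (B a b) ∎
    where
    open ≡-Reasoning
    open ℚS using (solve; _:=_; _:+_; _:*_; _:-_; con)
    n = suc a ℕ.+ b

  ε-sym : ∀ a b → ε a b ≡ ε b a
  ε-sym a b = cong₂ (λ x n → ι x * inv n) (B-sym a b) (ℕₚ.+-comm a b)

  q-sym : ∀ a b → κ₁ b a ≡ κ₂ a b
  q-sym a zero = refl
  q-sym a (suc b) = cong ι (B-sym b a)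

  ε-q′ : ∀ a b → ι b * ε a b ≡ κ₂ a b
  ε-q′ a b = trans (cong (ι b *_) (ε-sym a b)) (trans (ε-q b a) (q-sym a b))

  2ℚ : ℚ
  2ℚ = 1ℚ + 1ℚ

  -- Multiplication of a power series by its variable, on coefficients; `pre₁`, `pre₂` and `pre₁₂`
  -- multiply by X, Y and XY.
  pre : (ℕ → ℚ) → ℕ → ℚ
  pre f zero = 0ℚ
  pre f (suc n) = f n

  pre₁ pre₂ pre₁₂ : (ℕ → ℕ → ℚ) → ℕ → ℕ → ℚ
  pre₁ f a b = pre (λ a → f a b) a
  pre₂ f a = pre (f a)
  pre₁₂ f = pre₁ (pre₂ f)

  -- Summation by parts: the shift passes from d to f, with boundary terms 0 at index 0 by `pre` and
  -- at N by hypothesis.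
  ∑-pre : ∀ N (f d : ℕ → ℚ) → d N ≡ 0ℚ → ℚ∑.∑ (upTo N) (λ α → f α * d (suc α)) ≡ ℚ∑.∑ (upTo N) (λ α → pre f α * d α)
  ∑-pre N f d dN = begin
    Σ N (λ α → f α * d (suc α)) ≡⟨ sym (+-identityˡ _) ⟩
    0ℚ + Σ N (λ α → f α * d (suc α)) ≡⟨ cong (_+ Σ N (λ α → f α * d (suc α))) (sym (*-zeroˡ (d 0))) ⟩
    0ℚ * d 0 + Σ N (λ α → f α * d (suc α)) ≡⟨ sym (ℚ∑.∑-upTo-first N (λ α → pre f α * d α)) ⟩
    Σ (suc N) (λ α → pre f α * d α) ≡⟨ ℚ∑.∑-upTo-last N (λ α → pre f α * d α) ⟩
    Σ N (λ α → pre f α * d α) + pre f N * d N ≡⟨ cong (Σ N (λ α → pre f α * d α) +_) (trans (cong (pre f N *_) dN) (*-zeroʳ (pre f N))) ⟩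
    Σ N (λ α → pre f α * d α) + 0ℚ ≡⟨ +-identityʳ _ ⟩
    Σ N (λ α → pre f α * d α) ∎
    where
    open ≡-Reasoning
    Σ = λ n → ℚ∑.∑ (upTo n)

  module Bilinear (N : ℕ) (d d′ : ℕ → ℚ) (dN : d N ≡ 0ℚ) (d′N : d′ N ≡ 0ℚ) where

    S : (ℕ → ℕ → ℚ) → ℚ
    S h = ℚ∑.∑ (upTo N) (λ α → ℚ∑.∑ (upTo N) (h α))

    S-cong : ∀ {h k} → (∀ α β → h α β ≡ k α β) → S h ≡ S k
    S-cong e = ℚ∑.∑-cong′ (upTo N) (λ α → ℚ∑.∑-cong′ (upTo N) (e α))

    S-+ : ∀ h k → S (λ α β → h α β + k α β) ≡ S h + S k
    S-+ h k = trans (ℚ∑.∑-cong′ (upTo N) (λ α → ℚ∑.∑-+ (upTo N) (h α) (k α))) (ℚ∑.∑-+ (upTo N) _ _)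

    S-* : ∀ x h → S (λ α β → x * h α β) ≡ x * S h
    S-* x h = trans (ℚ∑.∑-cong′ (upTo N) (λ α → sym (ℚ∑.∑-*ˡ x (upTo N) (h α)))) (sym (ℚ∑.∑-*ˡ x (upTo N) _))

    shiftˡ : ∀ f (v : ℕ → ℚ) → S (λ α β → f α β * (d (suc α) * v β)) ≡ S (λ α β → pre₁ f α β * (d α * v β))
    shiftˡ f v = begin
      S (λ α β → f α β * (d (suc α) * v β)) ≡⟨ ℚ∑.∑-swap (upTo N) (upTo N) _ ⟩
      Σ (λ β → Σ (λ α → f α β * (d (suc α) * v β))) ≡⟨ ℚ∑.∑-cong′ (upTo N) (λ β → trans (ℚ∑.∑-cong′ (upTo N) (λ α → sym (*-assoc (f α β) (d (suc α)) (v β)))) (trans (sym (ℚ∑.∑-*ʳ (v β) (upTo N) (λ α → f α β * d (suc α))))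
           (trans (cong (_* v β) (∑-pre N (λ α → f α β) d dN)) (trans (ℚ∑.∑-*ʳ (v β) (upTo N) (λ α → pre₁ f α β * d α)) (ℚ∑.∑-cong′ (upTo N) (λ α → *-assoc (pre₁ f α β) (d α) (v β))))))) ⟩
      Σ (λ β → Σ (λ α → pre₁ f α β * (d α * v β))) ≡⟨ ℚ∑.∑-swap (upTo N) (upTo N) _ ⟩
      S (λ α β → pre₁ f α β * (d α * v β)) ∎
      where
      open ≡-Reasoning
      Σ = ℚ∑.∑ (upTo N)

    shiftʳ : ∀ f (u : ℕ → ℚ) → S (λ α β → f α β * (u α * d′ (suc β))) ≡ S (λ α β → pre₂ f α β * (u α * d′ β))
    shiftʳ f u = ℚ∑.∑-cong′ (upTo N) (λ α → trans (ℚ∑.∑-cong′ (upTo N) (λ β → rearr (f α β) (u α) (d′ (suc β))))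
      (trans (sym (ℚ∑.∑-*ˡ (u α) (upTo N) (λ β → f α β * d′ (suc β)))) (trans (cong (u α *_) (∑-pre N (f α) d′ d′N))
      (trans (ℚ∑.∑-*ˡ (u α) (upTo N) (λ β → pre₂ f α β * d′ β)) (ℚ∑.∑-cong′ (upTo N) (λ β → sym (rearr (pre₂ f α β) (u α) (d′ β))))))))
      where
      rearr : ∀ x y z → x * (y * z) ≡ y * (x * z)
      rearr = ℚS.solve 3 (λ x y z → x ℚS.:* (y ℚS.:* z) ℚS.:= y ℚS.:* (x ℚS.:* z)) refl

    -- The coefficients of (X(1 - X)(1 - 2Y) + Y(1 - 2X)(1 - Y))/(1 - X - Y). The factors with 1
    -- come from `cc-weight`, those with 2 from `cc-dd`.
    coef : ℕ → ℕ → ℚ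
    coef a b = (κ₁ a b - pre₁ κ₁ a b - 2ℚ * pre₂ κ₁ a b + 2ℚ * pre₁₂ κ₁ a b) +
               (κ₂ a b - 2ℚ * pre₁ κ₂ a b - pre₂ κ₂ a b + 2ℚ * pre₁₂ κ₂ a b)

    -- By summation by parts the differences of d and d′ become the factor (1 - xX)(1 - yY) on the
    -- series with coefficients f.
    expand : ∀ f x y →
      S (λ α β → f α β * ((d α - x * d (suc α)) * (d′ β - y * d′ (suc β)))) ≡
      S (λ α β → (f α β - x * pre₁ f α β - y * pre₂ f α β + (x * y) * pre₁₂ f α β) * (d α * d′ β))
    expand f x y = begin
      S (λ α β → f α β * ((d α - x * d (suc α)) * (d′ β - y * d′ (suc β))))
        ≡⟨ S-cong (λ α β → solve 7 (λ f x y d d⁺ e e⁺ → f :* ((d :- x :* d⁺) :* (e :- y :* e⁺)) :=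
             (f :* (d :* e) :+ (:- x) :* (f :* (d⁺ :* e))) :+ ((:- y) :* (f :* (d :* e⁺)) :+ (x :* y) :* (f :* (d⁺ :* e⁺))))
             refl (f α β) x y (d α) (d (suc α)) (d′ β) (d′ (suc β))) ⟩
      S (λ α β → (t₀ α β + (- x) * t₁ α β) + ((- y) * t₂ α β + (x * y) * t₃ α β))
        ≡⟨ split (λ α β → t₀ α β) t₁ t₂ t₃ ⟩
      (S t₀ + (- x) * S t₁) + ((- y) * S t₂ + (x * y) * S t₃)
        ≡⟨ cong₂ (λ u v → (S t₀ + (- x) * u) + v) (shiftˡ f d′) (cong₂ (λ u v → (- y) * u + (x * y) * v) (shiftʳ f d)
             (trans (shiftʳ f (λ α → d (suc α))) (shiftˡ (pre₂ f) d′))) ⟩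
      (S t₀ + (- x) * S u₁) + ((- y) * S u₂ + (x * y) * S u₃)
        ≡⟨ sym (split t₀ u₁ u₂ u₃) ⟩
      S (λ α β → (t₀ α β + (- x) * u₁ α β) + ((- y) * u₂ α β + (x * y) * u₃ α β))
        ≡⟨ S-cong (λ α β → solve 8 (λ f f₁ f₂ f₃ x y d e → (f :* (d :* e) :+ (:- x) :* (f₁ :* (d :* e))) :+ ((:- y) :* (f₂ :* (d :* e)) :+ (x :* y) :* (f₃ :* (d :* e))) :=
             (f :- x :* f₁ :- y :* f₂ :+ (x :* y) :* f₃) :* (d :* e)) refl (f α β) (pre₁ f α β) (pre₂ f α β) (pre₁₂ f α β) x y (d α) (d′ β)) ⟩
      S (λ α β → (f α β - x * pre₁ f α β - y * pre₂ f α β + (x * y) * pre₁₂ f α β) * (d α * d′ β)) ∎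
      where
      open ≡-Reasoning
      open ℚS using (solve; _:=_; _:+_; _:*_; _:-_; :-_; con)
      t₀ t₁ t₂ t₃ u₁ u₂ u₃ : ℕ → ℕ → ℚ
      t₀ α β = f α β * (d α * d′ β)
      t₁ α β = f α β * (d (suc α) * d′ β)
      t₂ α β = f α β * (d α * d′ (suc β))
      t₃ α β = f α β * (d (suc α) * d′ (suc β))
      u₁ α β = pre₁ f α β * (d α * d′ β)
      u₂ α β = pre₂ f α β * (d α * d′ β)
      u₃ α β = pre₁₂ f α β * (d α * d′ β)
      split : ∀ a b c e → S (λ α β → (a α β + (- x) * b α β) + ((- y) * c α β + (x * y) * e α β)) ≡
                          (S a + (- x) * S b) + ((- y) * S c + (x * y) * S e)
      split a b c e = trans (S-+ _ _) (cong₂ _+_ (trans (S-+ _ _) (cong (S a +_) (S-* (- x) b)))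
        (trans (S-+ _ _) (cong₂ _+_ (S-* (- y) c) (S-* (x * y) e))))

    -- The polynomial X + Y - 2XY.
    kernel : ℕ → ℕ → ℚ
    kernel 0 1 = 1ℚ
    kernel 1 0 = 1ℚ
    kernel 1 1 = - 2ℚ
    kernel _ _ = 0ℚ

    -- The numerator X(1 - X)(1 - 2Y) + Y(1 - 2X)(1 - Y) factors as (1 - X - Y)(X + Y - 2XY), so the
    -- denominator cancels. Coefficientwise this is Pascal's rule, with small indices apart because
    -- `B` and `pre` treat the border separately.
    coef≡kernel : ∀ a b → coef a b ≡ kernel a b
    coef≡kernel zero zero = refl
    coef≡kernel zero (suc zero) rewrite ι-1 = refl
    coef≡kernel zero (suc (suc b)) rewrite ι-1 = refl
    coef≡kernel (suc zero) zero rewrite ι-1 = refl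
    coef≡kernel (suc (suc a)) zero = lem a
      where
      lem : ∀ a → coef (suc (suc a)) zero ≡ 0ℚ
      lem zero rewrite ι-1 = refl
      lem (suc a) rewrite ι-1 = refl
    coef≡kernel (suc zero) (suc zero) rewrite ι-1 = refl
    coef≡kernel (suc zero) (suc (suc b)) rewrite ι-+ 1 (B 1 b) | ι-1 =
      solve 1 (λ x → (con 1ℚ :- con 0ℚ :- (con 1ℚ :+ con 1ℚ) :* con 1ℚ :+ (con 1ℚ :+ con 1ℚ) :* con 0ℚ) :+
        ((con 1ℚ :+ x) :- (con 1ℚ :+ con 1ℚ) :* con 1ℚ :- x :+ (con 1ℚ :+ con 1ℚ) :* con 1ℚ) := con 0ℚ) refl (ι (B 1 b))
      where open ℚS using (solve; _:=_; _:+_; _:*_; _:-_; con)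
    coef≡kernel (suc (suc a)) (suc zero) = lem a
      where
      open ℚS using (solve; _:=_; _:+_; _:*_; _:-_; con)
      main : ∀ x → ((x + 1ℚ) - x - 2ℚ * 1ℚ + 2ℚ * 1ℚ) + (1ℚ - 2ℚ * 1ℚ - 0ℚ + 2ℚ * 0ℚ) ≡ 0ℚ
      main = solve 1 (λ x → ((x :+ con 1ℚ) :- x :- (con 1ℚ :+ con 1ℚ) :* con 1ℚ :+ (con 1ℚ :+ con 1ℚ) :* con 1ℚ) :+
        (con 1ℚ :- (con 1ℚ :+ con 1ℚ) :* con 1ℚ :- con 0ℚ :+ (con 1ℚ :+ con 1ℚ) :* con 0ℚ) := con 0ℚ) refl
      lem : ∀ a → coef (suc (suc a)) (suc zero) ≡ 0ℚ
      lem zero rewrite ι-+ 1 1 | ι-1 = main 1ℚ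
      lem (suc a) rewrite ι-+ (B a 1 ℕ.+ 1) 1 | ι-1 = main (ι (B a 1 ℕ.+ 1))
    coef≡kernel (suc (suc a)) (suc (suc b)) = begin
      (ι (y ℕ.+ z) - ι y - 2ℚ * ι z + 2ℚ * ι x) + (ι (z ℕ.+ w) - 2ℚ * ι z - ι w + 2ℚ * ι v)
        ≡⟨ cong₂ (λ s t → (s - ι y - 2ℚ * ι z + 2ℚ * ι x) + (t - 2ℚ * ι z - ι w + 2ℚ * ι v)) (ι-+ y z) (ι-+ z w) ⟩
      ((ι y + ι z) - ι y - 2ℚ * ι z + 2ℚ * ι x) + ((ι z + ι w) - 2ℚ * ι z - ι w + 2ℚ * ι v)
        ≡⟨ cong (λ s → ((ι y + s) - ι y - 2ℚ * s + 2ℚ * ι x) + ((s + ι w) - 2ℚ * s - ι w + 2ℚ * ι v)) (ι-+ x v) ⟩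
      ((ι y + (ι x + ι v)) - ι y - 2ℚ * (ι x + ι v) + 2ℚ * ι x) + (((ι x + ι v) + ι w) - 2ℚ * (ι x + ι v) - ι w + 2ℚ * ι v)
        ≡⟨ solve 4 (λ x y v w → ((y :+ (x :+ v)) :- y :- (con 1ℚ :+ con 1ℚ) :* (x :+ v) :+ (con 1ℚ :+ con 1ℚ) :* x) :+
             (((x :+ v) :+ w) :- (con 1ℚ :+ con 1ℚ) :* (x :+ v) :- w :+ (con 1ℚ :+ con 1ℚ) :* v) := con 0ℚ) refl (ι x) (ι y) (ι v) (ι w) ⟩
      0ℚ ∎
      where
      open ≡-Reasoning
      open ℚS using (solve; _:=_; _:+_; _:*_; _:-_; con)
      x = B a (suc b)
      v = B (suc a) b
      y = B a (suc (suc b))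
      z = B (suc a) (suc b)
      w = B (suc (suc a)) b

    -- The cancellation leaves a polynomial that sees d and d′ only at the indices 0 and 1.
    bilinear : 2 ≤ N →
      S (λ α β → κ₁ α β * ((d α - 1ℚ * d (suc α)) * (d′ β - 2ℚ * d′ (suc β)))) +
      S (λ α β → κ₂ α β * ((d α - 2ℚ * d (suc α)) * (d′ β - 1ℚ * d′ (suc β)))) ≡
      d 1 * d′ 0 + d 0 * d′ 1 - 2ℚ * (d 1 * d′ 1)
    bilinear 2≤N = begin
      S (λ α β → κ₁ α β * ((d α - 1ℚ * d (suc α)) * (d′ β - 2ℚ * d′ (suc β)))) +
      S (λ α β → κ₂ α β * ((d α - 2ℚ * d (suc α)) * (d′ β - 1ℚ * d′ (suc β))))
        ≡⟨ cong₂ _+_ (expand κ₁ 1ℚ 2ℚ) (expand κ₂ 2ℚ 1ℚ) ⟩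
      S k₁ + S k₂
        ≡⟨ sym (S-+ k₁ k₂) ⟩
      S (λ α β → k₁ α β + k₂ α β)
        ≡⟨ S-cong (λ α β → trans (solve 10 (λ f f₁ f₂ f₃ g g₁ g₂ g₃ t e →
             (f :- con 1ℚ :* f₁ :- t :* f₂ :+ (con 1ℚ :* t) :* f₃) :* e :+ (g :- t :* g₁ :- con 1ℚ :* g₂ :+ (t :* con 1ℚ) :* g₃) :* e :=
             ((f :- f₁ :- t :* f₂ :+ t :* f₃) :+ (g :- t :* g₁ :- g₂ :+ t :* g₃)) :* e)
             refl (κ₁ α β) (pre₁ κ₁ α β) (pre₂ κ₁ α β) (pre₁₂ κ₁ α β) (κ₂ α β) (pre₁ κ₂ α β) (pre₂ κ₂ α β) (pre₁₂ κ₂ α β) 2ℚ (d α * d′ β))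
             (cong (_* (d α * d′ β)) (coef≡kernel α β))) ⟩
      S (λ α β → kernel α β * (d α * d′ β))
        ≡⟨ ℚ∑.∑-upTo-extend 2≤N (λ α → ℚ∑.∑ (upTo N) (λ β → kernel α β * (d α * d′ β))) (λ { (suc (suc α)) _ → ℚ∑.∑-zero (upTo N) (λ β _ → *-zeroˡ (d (suc (suc α)) * d′ β)) ; (suc zero) (s≤s ()) }) ⟩
      ℚ∑.∑ (upTo 2) (λ α → ℚ∑.∑ (upTo N) (λ β → kernel α β * (d α * d′ β)))
        ≡⟨ ℚ∑.∑-cong (upTo 2) (λ α α∈ → ℚ∑.∑-upTo-extend 2≤N (λ β → kernel α β * (d α * d′ β)) (λ β 2≤β → trans (cong (_* (d α * d′ β)) (kernel0 α β 2≤β)) (*-zeroˡ (d α * d′ β)))) ⟩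
      (0ℚ * (d 0 * d′ 0) + (1ℚ * (d 0 * d′ 1) + 0ℚ)) + ((1ℚ * (d 1 * d′ 0) + ((- 2ℚ) * (d 1 * d′ 1) + 0ℚ)) + 0ℚ)
        ≡⟨ solve 5 (λ d0 e0 d1 e1 t → (con 0ℚ :* (d0 :* e0) :+ (con 1ℚ :* (d0 :* e1) :+ con 0ℚ)) :+ ((con 1ℚ :* (d1 :* e0) :+ ((:- t) :* (d1 :* e1) :+ con 0ℚ)) :+ con 0ℚ) :=
             d1 :* e0 :+ d0 :* e1 :- t :* (d1 :* e1)) refl (d 0) (d′ 0) (d 1) (d′ 1) 2ℚ ⟩
      d 1 * d′ 0 + d 0 * d′ 1 - 2ℚ * (d 1 * d′ 1) ∎
      where
      open ≡-Reasoning
      open ℚS using (solve; _:=_; _:+_; _:*_; _:-_; :-_; con)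
      k₁ k₂ : ℕ → ℕ → ℚ
      k₁ α β = (κ₁ α β - 1ℚ * pre₁ κ₁ α β - 2ℚ * pre₂ κ₁ α β + (1ℚ * 2ℚ) * pre₁₂ κ₁ α β) * (d α * d′ β)
      k₂ α β = (κ₂ α β - 2ℚ * pre₁ κ₂ α β - 1ℚ * pre₂ κ₂ α β + (2ℚ * 1ℚ) * pre₁₂ κ₂ α β) * (d α * d′ β)
      kernel0 : ∀ α β → 2 ≤ β → kernel α β ≡ 0ℚ
      kernel0 zero (suc (suc β)) _ = refl
      kernel0 (suc zero) (suc (suc β)) _ = refl
      kernel0 (suc (suc α)) (suc (suc β)) _ = refl
      kernel0 _ (suc zero) (s≤s ())

  dd0 : ∀ i → dd i 0 ≡ ι (B i i)
  dd0 i = subst (λ k → dd k 0 ≡ ι (B i k)) (ℕₚ.+-identityʳ i) (dd-yes i 0)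

  -- 2B/(1 - 2B) and 1/(1 - 2B) differ by the constant 1 only.
  2*dd1 : ∀ i → 1 ≤ i → 2ℚ * dd i 1 ≡ dd i 0
  2*dd1 (suc e) _ = begin
    2ℚ * dd (suc e) 1 ≡⟨ cong (2ℚ *_) (subst (λ i → dd i 1 ≡ ι (B e (suc e))) (cong suc (ℕₚ.+-identityʳ e)) (trans (dd-suc e 0) (cong (λ i → ι (B e (suc i))) (ℕₚ.+-identityʳ e)))) ⟩
    2ℚ * ι (B e (suc e)) ≡⟨ ℚS.solve 1 (λ x → (ℚS.con 1ℚ ℚS.:+ ℚS.con 1ℚ) ℚS.:* x ℚS.:= x ℚS.:+ x) refl (ι (B e (suc e))) ⟩
    ι (B e (suc e)) + ι (B e (suc e)) ≡⟨ cong (λ n → ι (B e (suc e)) + ι n) (B-sym e (suc e)) ⟩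
    ι (B e (suc e)) + ι (B (suc e) e) ≡⟨ sym (ι-+ (B e (suc e)) (B (suc e) e)) ⟩
    ι (B (suc e) (suc e)) ≡⟨ sym (dd0 (suc e)) ⟩
    dd (suc e) 0 ∎
    where
    open ≡-Reasoning

  -- The coefficient identity behind log 1/(1 - B(t) - B(u)), where B = t + B^2.
  log-identity : ∀ N i j → 1 ≤ i → 1 ≤ j → i < N → j < N →
    ℚ∑.∑ (upTo N) (λ α → ℚ∑.∑ (upTo N) (λ β → ε α β * (cc i α * cc j β))) ≡
    (ι (B i i) * ι (B j j)) * inv (2 ℕ.* (i ℕ.+ j))
  log-identity N i j 1≤i 1≤j i<N j<N = ι-cancelʳ (2 ℕ.* (i ℕ.+ j)) (ℕₚ.*-mono-≤ {1} {2} (s≤s z≤n) (ℕₚ.≤-trans 1≤i (ℕₚ.m≤m+n i j))) (begin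
    L * ι (2 ℕ.* (i ℕ.+ j)) ≡⟨ trans (*-comm L _) (cong (_* L) (trans (ι-* 2 (i ℕ.+ j)) (cong₂ _*_ (trans (ι-+ 1 1) (cong₂ _+_ ι-1 ι-1)) (ι-+ i j)))) ⟩
    (2ℚ * (ι i + ι j)) * L ≡⟨ *-assoc 2ℚ (ι i + ι j) L ⟩
    2ℚ * ((ι i + ι j) * L) ≡⟨ cong (2ℚ *_) weighted ⟩
    -- For X = B(t) and Y = B(u), 2(X + Y - 2XY) = 1 - (1 - 2X)(1 - 2Y). Divided by (1 - 2X)(1 - 2Y)
    -- it becomes 1/((1 - 2X)(1 - 2Y)) - 1, and the constant is invisible for i, j ≥ 1.
    2ℚ * (dd i 1 * dd j 0 + dd i 0 * dd j 1 - 2ℚ * (dd i 1 * dd j 1))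
      ≡⟨ solve 5 (λ t x1 y0 x0 y1 → t :* (x1 :* y0 :+ x0 :* y1 :- t :* (x1 :* y1)) := (t :* x1) :* y0 :+ x0 :* (t :* y1) :- (t :* x1) :* (t :* y1)) refl 2ℚ (dd i 1) (dd j 0) (dd i 0) (dd j 1) ⟩
    (2ℚ * dd i 1) * dd j 0 + dd i 0 * (2ℚ * dd j 1) - (2ℚ * dd i 1) * (2ℚ * dd j 1)
      ≡⟨ cong₂ (λ u v → u * dd j 0 + dd i 0 * v - u * v) (2*dd1 i 1≤i) (2*dd1 j 1≤j) ⟩
    dd i 0 * dd j 0 + dd i 0 * dd j 0 - dd i 0 * dd j 0
      ≡⟨ solve 1 (λ x → x :+ x :- x := x) refl (dd i 0 * dd j 0) ⟩
    dd i 0 * dd j 0 ≡⟨ cong₂ _*_ (dd0 i) (dd0 j) ⟩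
    P ≡⟨ sym (*-identityʳ P) ⟩
    P * 1ℚ ≡⟨ cong (P *_) (sym (trans (*-comm (inv n) (ι n)) (ι*inv′ n (ℕₚ.*-mono-≤ {1} {2} (s≤s z≤n) (ℕₚ.≤-trans 1≤i (ℕₚ.m≤m+n i j)))))) ⟩
    P * (inv n * ι n) ≡⟨ sym (*-assoc P _ _) ⟩
    P * inv n * ι n ∎)
    where
    open ≡-Reasoning
    open ℚS using (solve; _:=_; _:+_; _:*_; _:-_; :-_; con)
    open Bilinear N (dd i) (dd j) (dd-no i<N) (dd-no j<N)
    n = 2 ℕ.* (i ℕ.+ j)
    P = ι (B i i) * ι (B j j)
    L = ℚ∑.∑ (upTo N) (λ α → ℚ∑.∑ (upTo N) (λ β → ε α β * (cc i α * cc j β)))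
    ι*inv′ : ∀ n → 1 ≤ n → ι n * inv n ≡ 1ℚ
    ι*inv′ (suc n) _ = ι*inv n
    -- The factor i + j is the Euler derivative in both variables. In each of its two parts the
    -- differentiated power is rewritten by `cc-weight` and the other one by `cc-dd`.
    weighted : (ι i + ι j) * L ≡ dd i 1 * dd j 0 + dd i 0 * dd j 1 - 2ℚ * (dd i 1 * dd j 1)
    weighted = begin
      (ι i + ι j) * L ≡⟨ sym (S-* (ι i + ι j) _) ⟩
      S (λ α β → (ι i + ι j) * (ε α β * (cc i α * cc j β)))
        ≡⟨ S-cong (λ α β → solve 5 (λ x y e u v → (x :+ y) :* (e :* (u :* v)) := e :* ((x :* u) :* v) :+ e :* (u :* (y :* v))) refl (ι i) (ι j) (ε α β) (cc i α) (cc j β)) ⟩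
      S (λ α β → ε α β * ((ι i * cc i α) * cc j β) + ε α β * (cc i α * (ι j * cc j β)))
        ≡⟨ S-+ _ _ ⟩
      S (λ α β → ε α β * ((ι i * cc i α) * cc j β)) + S (λ α β → ε α β * (cc i α * (ι j * cc j β)))
        ≡⟨ cong₂ _+_ (S-cong left) (S-cong right) ⟩
      S (λ α β → κ₁ α β * ((dd i α - 1ℚ * dd i (suc α)) * (dd j β - 2ℚ * dd j (suc β)))) +
      S (λ α β → κ₂ α β * ((dd i α - 2ℚ * dd i (suc α)) * (dd j β - 1ℚ * dd j (suc β))))
        ≡⟨ bilinear (ℕₚ.≤-trans (s≤s 1≤i) i<N) ⟩
      dd i 1 * dd j 0 + dd i 0 * dd j 1 - 2ℚ * (dd i 1 * dd j 1) ∎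
      where
      left : ∀ α β → ε α β * ((ι i * cc i α) * cc j β) ≡ κ₁ α β * ((dd i α - 1ℚ * dd i (suc α)) * (dd j β - 2ℚ * dd j (suc β)))
      left α β = begin
        ε α β * ((ι i * cc i α) * cc j β) ≡⟨ cong₂ (λ u v → ε α β * (u * v)) (cc-weight i α) (cc-dd j β) ⟩
        ε α β * ((ι α * (dd i α - dd i (suc α))) * v)
          ≡⟨ solve 5 (λ e a x x⁺ v → e :* ((a :* (x :- x⁺)) :* v) := (a :* e) :* ((x :- con 1ℚ :* x⁺) :* v)) refl (ε α β) (ι α) (dd i α) (dd i (suc α)) v ⟩
        (ι α * ε α β) * ((dd i α - 1ℚ * dd i (suc α)) * v) ≡⟨ cong (_* ((dd i α - 1ℚ * dd i (suc α)) * v)) (ε-q α β) ⟩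
        κ₁ α β * ((dd i α - 1ℚ * dd i (suc α)) * v) ∎
        where v = dd j β - 2ℚ * dd j (suc β)
      right : ∀ α β → ε α β * (cc i α * (ι j * cc j β)) ≡ κ₂ α β * ((dd i α - 2ℚ * dd i (suc α)) * (dd j β - 1ℚ * dd j (suc β)))
      right α β = begin
        ε α β * (cc i α * (ι j * cc j β)) ≡⟨ cong₂ (λ u v → ε α β * (u * v)) (cc-dd i α) (cc-weight j β) ⟩
        ε α β * (u * (ι β * (dd j β - dd j (suc β))))
          ≡⟨ solve 5 (λ e a x x⁺ v → e :* (v :* (a :* (x :- x⁺))) := (a :* e) :* (v :* (x :- con 1ℚ :* x⁺))) refl (ε α β) (ι β) (dd j β) (dd j (suc β)) u ⟩
        (ι β * ε α β) * (u * (dd j β - 1ℚ * dd j (suc β))) ≡⟨ cong (_* (u * (dd j β - 1ℚ * dd j (suc β)))) (ε-q′ α β) ⟩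
        κ₂ α β * (u * (dd j β - 1ℚ * dd j (suc β))) ∎
        where u = dd i α - 2ℚ * dd i (suc α)

-- Refinement by cherries: the substitution t = x - x^2 + y and its multinomial coefficients.

module CherryCounts where

  open Sums
  open Forests
  open Necklaces using (*-÷ₙ)
  open LogIdentity
  import Data.Bool.Properties as Boolₚ
  import Data.Integer as ℤ
  import Data.Integer.Properties as ℤₚ
  open import Data.List using (map)
  open import Data.Nat as ℕ using (ℕ; zero; suc; _≤_; _<_; z≤n; s≤s; _≤?_; _!; _∸_)
  import Data.Nat.Properties as ℕₚ
  open import Data.Nat.Solver using () renaming (module +-*-Solver to ℕS)
  open import Data.Rational using (ℚ; 0ℚ; 1ℚ; _+_; _*_; _-_; -_)
  open import Data.Rational.Properties using (*-zeroˡ; *-zeroʳ; *-assoc; *-identityˡ; *-identityʳ; +-identityˡ; +-identityʳ; *-distribˡ-+; *-distribʳ-+)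
  open import Data.Rational.Solver using () renaming (module +-*-Solver to ℚS)

  -- τ i a z is the coefficient of x^(a-2z) y^z in (x - x^2 + y)^i.
  τ : ℕ → ℕ → ℕ → ℚ
  τ zero zero zero = 1ℚ
  τ zero zero (suc _) = 0ℚ
  τ zero (suc _) _ = 0ℚ
  τ (suc i) zero z = 0ℚ
  τ (suc i) (suc zero) z = τ i zero z
  τ (suc i) (suc (suc a)) z = τ i (suc a) z - τ i a z + pre (τ i a) z

  neg-involutive : ∀ x → - (- x) ≡ x
  neg-involutive = ℚS.solve 1 (λ x → ℚS.:- (ℚS.:- x) ℚS.:= x) refl

  private
    zero-combination : ∀ {x y w} → x ≡ 0ℚ → y ≡ 0ℚ → w ≡ 0ℚ → x - y + w ≡ 0ℚ
    zero-combination refl refl refl = refl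

  -- The index a is the weight in which x counts 1 and y counts 2. A product of i terms, z of them
  -- y, weighs at least i + z.
  τ-high : ∀ i a z → a < i ℕ.+ z → τ i a z ≡ 0ℚ
  τ-high zero zero (suc z) _ = refl
  τ-high zero (suc a) z _ = refl
  τ-high (suc i) zero z _ = refl
  τ-high (suc i) (suc zero) z (s≤s p) = τ-high i zero z p
  τ-high (suc i) (suc (suc a)) z (s≤s p) = zero-combination
    (τ-high i (suc a) z p) (τ-high i a z (ℕₚ.<-trans (ℕₚ.n<1+n a) p)) (pre-high z p)
    where
    pre-high : ∀ z → suc a < i ℕ.+ z → pre (τ i a) z ≡ 0ℚ
    pre-high zero _ = refl
    pre-high (suc z) p = τ-high i a z (ℕₚ.≤-pred (subst (suc a <_) (ℕₚ.+-suc i z) p))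

  -- Each of the i factors contributes weight at most 2.
  τ-low : ∀ i a z → 2 ℕ.* i < a → τ i a z ≡ 0ℚ
  τ-low zero (suc a) z _ = refl
  τ-low (suc i) (suc zero) z (s≤s ())
  τ-low (suc i) (suc (suc a)) z p = zero-combination
    (τ-low i (suc a) z (ℕₚ.m<n⇒m<1+n q)) (τ-low i a z q) (pre-low z)
    where
    q : 2 ℕ.* i < a
    q = ℕₚ.≤-pred (ℕₚ.≤-pred (subst (_< suc (suc a)) (cong suc (ℕₚ.+-suc i (i ℕ.+ 0))) p))
    pre-low : ∀ z → pre (τ i a) z ≡ 0ℚ
    pre-low zero = refl
    pre-low (suc z) = τ-low i a z q

  δ : ℕ → ℕ → ℕ
  δ n z = 𝟙 (does (n ℕ.≟ z))

  g : ℕ → ℕ → ℕ → ℕ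
  g e α z = ∑ (F e α) (λ f → δ (cherriesF f) z)

  -- Marks the forests starting with two leaves, the only ones in which grafting creates a cherry.
  cherryHead : List BT → ℕ
  cherryHead (leaf ∷ leaf ∷ _) = 1
  cherryHead _ = 0

  graft-cherries : ∀ {α} f z → length f ≡ suc (suc α) →
    δ (cherriesF (graft f)) z ℕ.+ cherryHead f ℕ.* δ (cherriesF f) z ≡ δ (cherriesF f) z ℕ.+ cherryHead f ℕ.* δ (suc (cherriesF f)) z
  graft-cherries (leaf ∷ leaf ∷ f) z _ = trans (cong₂ ℕ._+_ (sym (ℕₚ.*-identityˡ (δ (suc (cherriesF f)) z))) (ℕₚ.*-identityˡ (δ (cherriesF f) z))) (ℕₚ.+-comm (1 ℕ.* δ (suc (cherriesF f)) z) (δ (cherriesF f) z))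
  graft-cherries (leaf ∷ node l r ∷ f) z _ = refl
  graft-cherries (node l r ∷ t ∷ f) z _ = cong (λ n → δ n z ℕ.+ 0) (ℕₚ.+-assoc (cherries (node l r)) (cherries t) (cherriesF f))
  graft-cherries (_ ∷ []) z ()

  cherryHead-graft : ∀ {α} f → length f ≡ suc (suc α) → cherryHead (graft f) ≡ 0
  cherryHead-graft (l ∷ r ∷ f) _ = refl
  cherryHead-graft (_ ∷ []) ()

  cherryHead-leaf-graft : ∀ {α} f → length f ≡ suc (suc α) → cherryHead (leaf ∷ graft f) ≡ 0
  cherryHead-leaf-graft (l ∷ r ∷ f) _ = refl
  cherryHead-leaf-graft (_ ∷ []) ()

  -- A marked forest is two leaves in front of an arbitrary forest with two trees fewer and the same
  -- excess.
  ∑-cherryHead : ∀ e α (h : List BT → ℕ) → ∑ (F e (suc (suc α))) (λ f → cherryHead f ℕ.* h f) ≡ ∑ (F e α) (λ f → h (leaf ∷ leaf ∷ f))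
  ∑-cherryHead zero α h = trans (∑-map (leaf ∷_) (map (leaf ∷_) (F 0 α)) _)
    (trans (∑-map (leaf ∷_) (F 0 α) _) (∑-cong′ (F 0 α) (λ f → ℕₚ.*-identityˡ (h (leaf ∷ leaf ∷ f)))))
  ∑-cherryHead (suc e) α h = begin
    ∑ (map (leaf ∷_) (F (suc e) (suc α)) ++ map graft (F e (suc (suc (suc α))))) k
      ≡⟨ ∑-++ (map (leaf ∷_) (F (suc e) (suc α))) _ k ⟩
    ∑ (map (leaf ∷_) (F (suc e) (suc α))) k ℕ.+ ∑ (map graft (F e (suc (suc (suc α))))) k
      ≡⟨ cong₂ ℕ._+_ (∑-map (leaf ∷_) (F (suc e) (suc α)) k) (trans (∑-map graft (F e (suc (suc (suc α)))) k)
           (∑-zero (F e (suc (suc (suc α)))) (λ f f∈ → cong (ℕ._* h (graft f)) (cherryHead-graft f (proj₁ (F-sound e _ f∈)))))) ⟩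
    ∑ (F (suc e) (suc α)) (k ∘ (leaf ∷_)) ℕ.+ 0
      ≡⟨ ℕₚ.+-identityʳ _ ⟩
    ∑ (map (leaf ∷_) (F (suc e) α) ++ map graft (F e (suc (suc α)))) (k ∘ (leaf ∷_))
      ≡⟨ ∑-++ (map (leaf ∷_) (F (suc e) α)) _ (k ∘ (leaf ∷_)) ⟩
    ∑ (map (leaf ∷_) (F (suc e) α)) (k ∘ (leaf ∷_)) ℕ.+ ∑ (map graft (F e (suc (suc α)))) (k ∘ (leaf ∷_))
      ≡⟨ cong₂ ℕ._+_ (∑-map (leaf ∷_) (F (suc e) α) (k ∘ (leaf ∷_))) (trans (∑-map graft (F e (suc (suc α))) (k ∘ (leaf ∷_)))
           (∑-zero (F e (suc (suc α))) (λ f f∈ → cong (ℕ._* h (leaf ∷ graft f)) (cherryHead-leaf-graft f (proj₁ (F-sound e _ f∈)))))) ⟩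
    ∑ (F (suc e) α) (λ f → 1 ℕ.* h (leaf ∷ leaf ∷ f)) ℕ.+ 0
      ≡⟨ trans (ℕₚ.+-identityʳ _) (∑-cong′ (F (suc e) α) (λ f → ℕₚ.*-identityˡ (h (leaf ∷ leaf ∷ f)))) ⟩
    ∑ (F (suc e) α) (λ f → h (leaf ∷ leaf ∷ f)) ∎
    where
    open ≡-Reasoning
    k : List BT → ℕ
    k f = cherryHead f ℕ.* h f

  -- The forests with z - 1 cherries, phrased so that there are none for z = 0.
  g⁻ : ℕ → ℕ → ℕ → ℕ
  g⁻ e α z = ∑ (F e α) (λ f → δ (suc (cherriesF f)) z)

  -- The grafted forests have the cherries of the original, except that a
  -- leading pair of leaves becomes a new cherry.
  g-suc : ∀ e α z → g (suc e) (suc α) z ℕ.+ g e α z ≡ g (suc e) α z ℕ.+ (g e (suc (suc α)) z ℕ.+ g⁻ e α z)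
  g-suc e α z = begin
    g (suc e) (suc α) z ℕ.+ g e α z
      ≡⟨ cong (ℕ._+ g e α z) (trans (∑-++ (map (leaf ∷_) (F (suc e) α)) _ k) (cong₂ ℕ._+_ (∑-map (leaf ∷_) (F (suc e) α) k) (∑-map graft F₂ k))) ⟩
    (g (suc e) α z ℕ.+ ∑ F₂ (k ∘ graft)) ℕ.+ g e α z
      ≡⟨ ℕₚ.+-assoc (g (suc e) α z) _ _ ⟩
    g (suc e) α z ℕ.+ (∑ F₂ (k ∘ graft) ℕ.+ g e α z)
      ≡⟨ cong (λ n → g (suc e) α z ℕ.+ (∑ F₂ (k ∘ graft) ℕ.+ n)) (sym (∑-cherryHead e α k)) ⟩
    g (suc e) α z ℕ.+ (∑ F₂ (k ∘ graft) ℕ.+ ∑ F₂ (λ f → cherryHead f ℕ.* k f))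
      ≡⟨ cong (g (suc e) α z ℕ.+_) (trans (sym (∑-+ F₂ (k ∘ graft) (λ f → cherryHead f ℕ.* k f))) (trans (∑-cong F₂ (λ f f∈ → graft-cherries f z (proj₁ (F-sound e _ f∈)))) (∑-+ F₂ k (λ f → cherryHead f ℕ.* k⁺ f)))) ⟩
    g (suc e) α z ℕ.+ (g e (suc (suc α)) z ℕ.+ ∑ F₂ (λ f → cherryHead f ℕ.* k⁺ f))
      ≡⟨ cong (λ n → g (suc e) α z ℕ.+ (g e (suc (suc α)) z ℕ.+ n)) (∑-cherryHead e α k⁺) ⟩
    g (suc e) α z ℕ.+ (g e (suc (suc α)) z ℕ.+ g⁻ e α z) ∎
    where
    open ≡-Reasoning
    F₂ = F e (suc (suc α))
    k k⁺ : List BT → ℕ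
    k f = δ (cherriesF f) z
    k⁺ f = δ (suc (cherriesF f)) z

  g⁻-pre : ∀ e α z → ι (g⁻ e α z) ≡ pre (λ z → ι (g e α z)) z
  g⁻-pre e α zero = trans (cong ι (∑-zero (F e α) (λ _ _ → refl))) ι-0
  g⁻-pre e α (suc z) = refl

  -- The coefficient of x^(e+α-2z) y^z in B^α after t = x - x^2 + y, where f is the excess of a
  -- forest before the substitution. Terms with f > e vanish by `τ-high`, so the cutoff N is
  -- harmless once it exceeds e.
  R : ℕ → ℕ → ℕ → ℕ → ℚ
  R e α z N = ℚ∑.∑ (upTo N) (λ f → ι (c f α) * τ (f ℕ.+ α) (e ℕ.+ α) z)

  -- The recurrence of `g-suc`. Splitting c(f, α+1) by `c-suc`, the part with α trees keeps one
  -- factor x - x^2 + y, which yields the three bracketed terms. The part with α + 2 trees is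
  -- shifted by one in f, which lowers the cutoff.
  R-step : ∀ e α z N → R (suc e) (suc α) z (suc N) ≡
    (R (suc e) α z (suc N) - R e α z (suc N) + pre (λ z → R e α z (suc N)) z) + R e (suc (suc α)) z N
  R-step e α z N = begin
    ℚ∑.∑ (upTo (suc N)) (λ f → ι (c f (suc α)) * T f)
      ≡⟨ ℚ∑.∑-upTo-first N (λ f → ι (c f (suc α)) * T f) ⟩
    ι (c 0 (suc α)) * T 0 + ℚ∑.∑ (upTo N) (λ f → ι (c (suc f) (suc α)) * T (suc f))
      ≡⟨ cong₂ (λ n s → ι n * T 0 + s) (trans (c-zero (suc α)) (sym (c-zero α))) (trans (ℚ∑.∑-cong′ (upTo N) (λ f →
           trans (cong (λ n → ι n * T (suc f)) (c-suc f α)) (trans (cong (_* T (suc f)) (ι-+ (c (suc f) α) (c f (suc (suc α))))) (*-distribʳ-+ (T (suc f)) (ι (c (suc f) α)) (ι (c f (suc (suc α)))))))) (ℚ∑.∑-+ (upTo N) (λ f → ι (c (suc f) α) * T (suc f)) (λ f → ι (c f (suc (suc α))) * T (suc f)))) ⟩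
    ι (c 0 α) * T 0 + (S₁ + S₂)
      ≡⟨ solve 3 (λ a b c → a :+ (b :+ c) := (a :+ b) :+ c) refl (ι (c 0 α) * T 0) S₁ S₂ ⟩
    (ι (c 0 α) * T 0 + S₁) + S₂
      ≡⟨ cong₂ _+_ (sym (ℚ∑.∑-upTo-first N (λ f → ι (c f α) * T f))) (ℚ∑.∑-cong′ (upTo N) (λ f → cong (ι (c f (suc (suc α))) *_) (T₂ f))) ⟩
    ℚ∑.∑ (upTo (suc N)) (λ f → ι (c f α) * T f) + R e (suc (suc α)) z N
      ≡⟨ cong (_+ R e (suc (suc α)) z N) (trans (ℚ∑.∑-cong′ (upTo (suc N)) (λ f → trans (cong (ι (c f α) *_) (T₁ f)) (dist f))) collect) ⟩
    (R (suc e) α z (suc N) - R e α z (suc N) + pre (λ z → R e α z (suc N)) z) + R e (suc (suc α)) z N ∎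
    where
    open ≡-Reasoning
    open ℚS using (solve; _:=_; _:+_; _:*_; _:-_; :-_; con)
    T : ℕ → ℚ
    T f = τ (f ℕ.+ suc α) (suc e ℕ.+ suc α) z
    S₁ = ℚ∑.∑ (upTo N) (λ f → ι (c (suc f) α) * T (suc f))
    S₂ = ℚ∑.∑ (upTo N) (λ f → ι (c f (suc (suc α))) * T (suc f))
    T₁ : ∀ f → T f ≡ τ (f ℕ.+ α) (suc e ℕ.+ α) z - τ (f ℕ.+ α) (e ℕ.+ α) z + pre (τ (f ℕ.+ α) (e ℕ.+ α)) z
    T₁ f rewrite ℕₚ.+-suc f α | ℕₚ.+-suc e α = refl
    T₂ : ∀ f → T (suc f) ≡ τ (f ℕ.+ suc (suc α)) (e ℕ.+ suc (suc α)) z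
    T₂ f rewrite ℕₚ.+-suc f (suc α) | ℕₚ.+-suc e (suc α) = refl
    x y w : ℕ → ℚ
    x f = ι (c f α) * τ (f ℕ.+ α) (suc e ℕ.+ α) z
    y f = ι (c f α) * τ (f ℕ.+ α) (e ℕ.+ α) z
    w f = ι (c f α) * pre (τ (f ℕ.+ α) (e ℕ.+ α)) z
    dist : ∀ f → ι (c f α) * (τ (f ℕ.+ α) (suc e ℕ.+ α) z - τ (f ℕ.+ α) (e ℕ.+ α) z + pre (τ (f ℕ.+ α) (e ℕ.+ α)) z) ≡ x f + ((- 1ℚ) * y f + w f)
    dist f = solve 4 (λ a x y w → a :* (x :- y :+ w) := a :* x :+ ((:- con 1ℚ) :* (a :* y) :+ a :* w)) refl
      (ι (c f α)) (τ (f ℕ.+ α) (suc e ℕ.+ α) z) (τ (f ℕ.+ α) (e ℕ.+ α) z) (pre (τ (f ℕ.+ α) (e ℕ.+ α)) z)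
    pre-R : ∀ z → ℚ∑.∑ (upTo (suc N)) (λ f → ι (c f α) * pre (τ (f ℕ.+ α) (e ℕ.+ α)) z) ≡ pre (λ z → R e α z (suc N)) z
    pre-R zero = ℚ∑.∑-zero (upTo (suc N)) (λ f _ → *-zeroʳ (ι (c f α)))
    pre-R (suc z) = refl
    collect : ℚ∑.∑ (upTo (suc N)) (λ f → x f + ((- 1ℚ) * y f + w f)) ≡ R (suc e) α z (suc N) - R e α z (suc N) + pre (λ z → R e α z (suc N)) z
    collect = begin
      Σ (λ f → x f + ((- 1ℚ) * y f + w f)) ≡⟨ trans (ℚ∑.∑-+ (upTo (suc N)) x _) (cong (Σ x +_) (ℚ∑.∑-+ (upTo (suc N)) (λ f → (- 1ℚ) * y f) w)) ⟩
      Σ x + (Σ (λ f → (- 1ℚ) * y f) + Σ w) ≡⟨ cong₂ (λ u v → Σ x + (u + v)) (sym (ℚ∑.∑-*ˡ (- 1ℚ) (upTo (suc N)) y)) (pre-R z) ⟩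
      Σ x + ((- 1ℚ) * Σ y + p) ≡⟨ solve 3 (λ x y p → x :+ ((:- con 1ℚ) :* y :+ p) := x :- y :+ p) refl (Σ x) (Σ y) p ⟩
      Σ x - Σ y + p ∎
      where
      Σ = ℚ∑.∑ (upTo (suc N))
      p = pre (λ z → R e α z (suc N)) z

  δ0 : ∀ z → ι (δ 0 z) ≡ τ 0 0 z
  δ0 zero = ι-1
  δ0 (suc z) = ι-0

  -- The least weight is reached only by taking x from every factor.
  τ-diagonal : ∀ α z → τ (suc α) (suc α) z ≡ τ α α z
  τ-diagonal zero z = refl
  τ-diagonal (suc α) z = trans (cong₂ (λ x y → τ (suc α) (suc α) z - x + y) (τ-high (suc α) α z (s≤s (ℕₚ.m≤m+n α z))) (pre0 z))
    (ℚS.solve 1 (λ x → x ℚS.:- ℚS.con 0ℚ ℚS.:+ ℚS.con 0ℚ ℚS.:= x) refl (τ (suc α) (suc α) z))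
    where
    pre0 : ∀ z → pre (τ (suc α) α) z ≡ 0ℚ
    pre0 zero = refl
    pre0 (suc z) = τ-high (suc α) α z (s≤s (ℕₚ.m≤m+n α z))

  -- Only the all-leaves summand f = 0 survives when the excess is 0.
  R-zero : ∀ α z N → R 0 α z (suc N) ≡ τ α α z
  R-zero α z N = begin
    R 0 α z (suc N) ≡⟨ ℚ∑.∑-upTo-extend {1} {suc N} (s≤s z≤n) (λ f → ι (c f α) * τ (f ℕ.+ α) α z) (λ { (suc f) _ →
                                          trans (cong (ι (c (suc f) α) *_) (τ-high (suc f ℕ.+ α) α z (s≤s (ℕₚ.≤-trans (ℕₚ.m≤n+m α f) (ℕₚ.m≤m+n (f ℕ.+ α) z))))) (*-zeroʳ (ι (c (suc f) α))) }) ⟩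
    ι (c 0 α) * τ α α z + 0ℚ ≡⟨ trans (+-identityʳ _) (trans (cong (λ n → ι n * τ α α z) (c-zero α)) (trans (cong (_* τ α α z) ι-1) (*-identityˡ _))) ⟩
    τ α α z ∎
    where open ≡-Reasoning

  -- Both sides satisfy the same recurrence, by `g-suc` and `R-step`. The condition e < N is
  -- preserved because e and N fall together.
  refined : ∀ e α z N → e < N → ι (g e α z) ≡ R e α z N
  refined zero zero z (suc N) _ = trans (cong ι (ℕₚ.+-identityʳ (δ 0 z))) (trans (δ0 z) (sym (R-zero 0 z N)))
  refined zero (suc α) z (suc N) 0<N = begin
    ι (g 0 (suc α) z) ≡⟨ cong ι (∑-map (leaf ∷_) (F 0 α) (λ f → δ (cherriesF f) z)) ⟩
    ι (g 0 α z) ≡⟨ refined zero α z (suc N) 0<N ⟩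
    R 0 α z (suc N) ≡⟨ R-zero α z N ⟩
    τ α α z ≡⟨ sym (τ-diagonal α z) ⟩
    τ (suc α) (suc α) z ≡⟨ sym (R-zero (suc α) z N) ⟩
    R 0 (suc α) z (suc N) ∎
    where open ≡-Reasoning
  refined (suc e) zero z (suc N) _ = begin
    ι 0 ≡⟨ ι-0 ⟩
    0ℚ ≡⟨ sym (ℚ∑.∑-zero (upTo (suc N)) term) ⟩
    R (suc e) 0 z (suc N) ∎
    where
    open ≡-Reasoning
    term : ∀ f → f ∈ upTo (suc N) → ι (c f 0) * τ (f ℕ.+ 0) (suc e ℕ.+ 0) z ≡ 0ℚ
    term zero _ = *-zeroʳ (ι 1)
    term (suc f) _ = trans (cong (_* τ (suc f ℕ.+ 0) (suc e ℕ.+ 0) z) ι-0) (*-zeroˡ (τ (suc f ℕ.+ 0) (suc e ℕ.+ 0) z))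
  refined (suc e) (suc α) z (suc N) (s≤s e<N) = begin
    ι (g (suc e) (suc α) z)
      ≡⟨ solve 2 (λ x y → x := (x :+ y) :- y) refl (ι (g (suc e) (suc α) z)) (ι (g e α z)) ⟩
    (ι (g (suc e) (suc α) z) + ι (g e α z)) - ι (g e α z)
      ≡⟨ cong (_- ι (g e α z)) (trans (sym (ι-+ (g (suc e) (suc α) z) (g e α z))) (trans (cong ι (g-suc e α z)) (trans (ι-+ (g (suc e) α z) _) (cong (ι (g (suc e) α z) +_) (ι-+ (g e (suc (suc α)) z) (g⁻ e α z)))))) ⟩
    (ι (g (suc e) α z) + (ι (g e (suc (suc α)) z) + ι (g⁻ e α z))) - ι (g e α z)
      ≡⟨ solve 4 (λ a b p y → (a :+ (b :+ p)) :- y := (a :- y :+ p) :+ b) refl (ι (g (suc e) α z)) (ι (g e (suc (suc α)) z)) (ι (g⁻ e α z)) (ι (g e α z)) ⟩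
    (ι (g (suc e) α z) - ι (g e α z) + ι (g⁻ e α z)) + ι (g e (suc (suc α)) z)
      ≡⟨ cong₂ _+_ (cong₂ _+_ (cong₂ _-_ (refined (suc e) α z (suc N) (s≤s e<N)) (refined e α z (suc N) (ℕₚ.m<n⇒m<1+n e<N)))
           (trans (g⁻-pre e α z) (pre-cong (λ z → refined e α z (suc N) (ℕₚ.m<n⇒m<1+n e<N)) z)))
           (refined e (suc (suc α)) z N e<N) ⟩
    (R (suc e) α z (suc N) - R e α z (suc N) + pre (λ z → R e α z (suc N)) z) + R e (suc (suc α)) z N
      ≡⟨ sym (R-step e α z N) ⟩
    R (suc e) (suc α) z (suc N) ∎
    where
    open ≡-Reasoning
    open ℚS using (solve; _:=_; _:+_; _:*_; _:-_; :-_; con)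
    pre-cong : ∀ {f h : ℕ → ℚ} → (∀ z → f z ≡ h z) → ∀ z → pre f z ≡ pre h z
    pre-cong e zero = refl
    pre-cong e (suc z) = e z

  -- τ′ i a nothing is the coefficient of t^a in t^i, the image of τ under x ↦ t, y ↦ t^2.
  τ′ : ℕ → ℕ → Maybe ℕ → ℚ
  τ′ i a nothing = ι (δ i a)
  τ′ i a (just z) = τ i a z

  τ′-zero : ∀ a mz → 1 ≤ a → τ′ 0 a mz ≡ 0ℚ
  τ′-zero (suc a) nothing _ = ι-0
  τ′-zero (suc a) (just z) _ = refl

  -- One expansion for both kinds of constraint: t^i is replaced by (x - x^2 + y)^i if cherries are
  -- prescribed and left unchanged otherwise.
  G-expand : ∀ r α mz → ι (G r α mz) ≡ ℚ∑.∑ (upTo (suc r)) (λ i → cc i α * τ′ i r mz)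
  G-expand r α nothing = begin
    ι (G r α nothing) ≡⟨ cong ι (sym (length≡∑1 (forests r α))) ⟩
    cc r α ≡⟨ sym (*-identityʳ _) ⟩
    cc r α * 1ℚ ≡⟨ cong (cc r α *_) (sym (trans (cong (λ b → ι (𝟙 b)) (dec-true (r ℕ.≟ r) refl)) ι-1)) ⟩
    cc r α * ι (δ r r) ≡⟨ sym (ℚ∑.∑-delta (Uniqueₚ.upTo⁺ (suc r)) (∈-upTo⁺ ℕₚ.≤-refl) (λ i → cc i α * ι (δ i r))
                                 (λ i _ i≢r → trans (cong (cc i α *_) (trans (cong (λ b → ι (𝟙 b)) (dec-false (i ℕ.≟ r) i≢r)) ι-0)) (*-zeroʳ (cc i α)))) ⟩
    ℚ∑.∑ (upTo (suc r)) (λ i → cc i α * ι (δ i r)) ∎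
    where
    open ≡-Reasoning
    import Data.List.Relation.Unary.Unique.Propositional.Properties as Uniqueₚ
  G-expand r α (just z) with α ≤? r
  ... | no α≰r = trans ι-0 (sym (ℚ∑.∑-zero (upTo (suc r)) (λ i i∈ →
    trans (cong (_* τ i r z) (cc-no (ℕₚ.<-≤-trans (∈-upTo⁻ i∈) (ℕₚ.≰⇒> α≰r)))) (*-zeroˡ (τ i r z)))))
  ... | yes α≤r = begin
    ι (g e α z) ≡⟨ refined e α z (suc e) ℕₚ.≤-refl ⟩
    ℚ∑.∑ (upTo (suc e)) (λ f → ι (c f α) * τ (f ℕ.+ α) (e ℕ.+ α) z) ≡⟨ ℚ∑.∑-cong′ (upTo (suc e)) (λ f → cong₂ _*_ (trans (sym (cc-yes f α)) (cong (λ i → cc i α) (ℕₚ.+-comm f α)))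
                                                                           (cong₂ (λ i a → τ i a z) (ℕₚ.+-comm f α) (ℕₚ.m∸n+n≡m α≤r))) ⟩
    ℚ∑.∑ (upTo (suc e)) (λ f → h (α ℕ.+ f)) ≡⟨ sym (+-identityˡ _) ⟩
    0ℚ + ℚ∑.∑ (upTo (suc e)) (λ f → h (α ℕ.+ f)) ≡⟨ cong (_+ ℚ∑.∑ (upTo (suc e)) (λ f → h (α ℕ.+ f))) (sym (ℚ∑.∑-zero (upTo α) (λ i i∈ →
                                                                           trans (cong (_* τ i r z) (cc-no (∈-upTo⁻ i∈))) (*-zeroˡ (τ i r z))))) ⟩
    ℚ∑.∑ (upTo α) h + ℚ∑.∑ (upTo (suc e)) (λ f → h (α ℕ.+ f)) ≡⟨ sym (ℚ∑.∑-upTo-+ α (suc e) h) ⟩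
    ℚ∑.∑ (upTo (α ℕ.+ suc e)) h ≡⟨ cong (λ n → ℚ∑.∑ (upTo n) h) (trans (ℕₚ.+-suc α e) (cong suc (ℕₚ.m+[n∸m]≡n α≤r))) ⟩
    ℚ∑.∑ (upTo (suc r)) h ∎
    where
    open ≡-Reasoning
    e = r ∸ α
    h : ℕ → ℚ
    h i = cc i α * τ i r z

  -- Multiplied by p! q! z!, the three summands of the recurrence for τ become
  -- p, q and z copies of sgn q · (i-1)!.
  τ-closed : ∀ i p q z → i ≡ p ℕ.+ q ℕ.+ z →
    τ i (p ℕ.+ 2 ℕ.* q ℕ.+ 2 ℕ.* z) z * ι (p ! ℕ.* q ! ℕ.* z !) ≡ sgn q * ι (i !)
  τ-closed zero zero zero zero refl = refl
  τ-closed (suc i) p q z eq = body (p ℕ.+ 2 ℕ.* q ℕ.+ 2 ℕ.* z) refl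
    where
    open ≡-Reasoning
    open ℚS using (solve; _:=_; _:+_; _:*_; _:-_; :-_; con)
    D = p ! ℕ.* q ! ℕ.* z !
    I = ι (i !)
    termP : ∀ p q z → suc i ≡ p ℕ.+ q ℕ.+ z → ∀ a → suc a ≡ p ℕ.+ 2 ℕ.* q ℕ.+ 2 ℕ.* z →
            τ i a z * ι (p ! ℕ.* q ! ℕ.* z !) ≡ ι p * (sgn q * I)
    -- With p = 0 the remaining weight is 2i + 1, more than i factors can carry.
    termP zero q z eq a ea = trans (cong (_* _) (τ-low i a z (ℕₚ.≤-reflexive (ℕₚ.suc-injective (sym (trans ea
        (trans (sym (ℕₚ.*-distribˡ-+ 2 q z)) (trans (cong (2 ℕ.*_) (sym eq)) (cong suc (ℕₚ.+-suc i (i ℕ.+ 0)))))))))))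
      (trans (*-zeroˡ (ι (zero ! ℕ.* q ! ℕ.* z !))) (sym (trans (cong (_* (sgn q * I)) ι-0) (*-zeroˡ (sgn q * I)))))
    termP (suc p) q z eq a ea = begin
      τ i a z * ι (suc p ! ℕ.* q ! ℕ.* z !) ≡⟨ cong (λ n → τ i n z * ι (suc p ! ℕ.* q ! ℕ.* z !)) (ℕₚ.suc-injective ea) ⟩
      τ i a′ z * ι (suc p ! ℕ.* q ! ℕ.* z !) ≡⟨ cong (λ n → τ i a′ z * ι n) (trans (cong (ℕ._* z !) (ℕₚ.*-assoc (suc p) (p !) (q !))) (ℕₚ.*-assoc (suc p) (p ! ℕ.* q !) (z !))) ⟩
      τ i a′ z * ι (suc p ℕ.* (p ! ℕ.* q ! ℕ.* z !)) ≡⟨ trans (cong (τ i a′ z *_) (ι-* (suc p) _)) (rearr (τ i a′ z) (ι (suc p)) _) ⟩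
      ι (suc p) * (τ i a′ z * ι (p ! ℕ.* q ! ℕ.* z !)) ≡⟨ cong (ι (suc p) *_) (τ-closed i p q z (ℕₚ.suc-injective eq)) ⟩
      ι (suc p) * (sgn q * I) ∎
      where
      a′ = p ℕ.+ 2 ℕ.* q ℕ.+ 2 ℕ.* z
      rearr : ∀ x y w → x * (y * w) ≡ y * (x * w)
      rearr = solve 3 (λ x y w → x :* (y :* w) := y :* (x :* w)) refl
    termQ : ∀ p q z → suc i ≡ p ℕ.+ q ℕ.+ z → ∀ a → suc (suc a) ≡ p ℕ.+ 2 ℕ.* q ℕ.+ 2 ℕ.* z →
            τ i a z * ι (p ! ℕ.* q ! ℕ.* z !) ≡ - (ι q * (sgn q * I))
    -- With q = 0 the remaining weight is i + z - 1, below the minimum for i factors with z of them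
    -- y.
    termQ p zero z eq a ea = trans (cong (_* _) (τ-high i a z (ℕₚ.≤-reflexive (ℕₚ.suc-injective (trans ea
        (trans (ℕS.solve 2 (λ p z → p ℕS.:+ ℕS.con 0 ℕS.:+ ℕS.con 2 ℕS.:* z ℕS.:= (p ℕS.:+ ℕS.con 0 ℕS.:+ z) ℕS.:+ z) refl p z) (cong (ℕ._+ z) (sym eq))))))))
      (trans (*-zeroˡ (ι (p ! ℕ.* 1 ℕ.* z !))) (sym (trans (cong (λ x → - (x * (1ℚ * I))) ι-0) (cong -_ (*-zeroˡ (1ℚ * I))))))
    termQ p (suc q) z eq a ea = begin
      τ i a z * ι (p ! ℕ.* suc q ! ℕ.* z !) ≡⟨ cong (λ n → τ i n z * ι (p ! ℕ.* suc q ! ℕ.* z !)) (ℕₚ.suc-injective (ℕₚ.suc-injective (trans ea (ℕS.solve 3 (λ p q z →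
                                                               p ℕS.:+ ℕS.con 2 ℕS.:* (ℕS.con 1 ℕS.:+ q) ℕS.:+ ℕS.con 2 ℕS.:* z ℕS.:= ℕS.con 2 ℕS.:+ (p ℕS.:+ ℕS.con 2 ℕS.:* q ℕS.:+ ℕS.con 2 ℕS.:* z)) refl p q z)))) ⟩
      τ i a′ z * ι (p ! ℕ.* (suc q ℕ.* q !) ℕ.* z !) ≡⟨ cong (λ n → τ i a′ z * ι n) (ℕS.solve 4 (λ p s q z → p ℕS.:* (s ℕS.:* q) ℕS.:* z ℕS.:= s ℕS.:* (p ℕS.:* q ℕS.:* z)) refl (p !) (suc q) (q !) (z !)) ⟩
      τ i a′ z * ι (suc q ℕ.* (p ! ℕ.* q ! ℕ.* z !)) ≡⟨ cong (τ i a′ z *_) (ι-* (suc q) _) ⟩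
      τ i a′ z * (ι (suc q) * ι (p ! ℕ.* q ! ℕ.* z !)) ≡⟨ solve 3 (λ x y w → x :* (y :* w) := y :* (x :* w)) refl (τ i a′ z) (ι (suc q)) (ι (p ! ℕ.* q ! ℕ.* z !)) ⟩
      ι (suc q) * (τ i a′ z * ι (p ! ℕ.* q ! ℕ.* z !)) ≡⟨ cong (ι (suc q) *_) (τ-closed i p q z (ℕₚ.suc-injective (trans eq (cong (ℕ._+ z) (ℕₚ.+-suc p q))))) ⟩
      ι (suc q) * (sgn q * I) ≡⟨ solve 3 (λ x y w → x :* (y :* w) := :- (x :* ((:- y) :* w))) refl (ι (suc q)) (sgn q) I ⟩
      - (ι (suc q) * (- sgn q * I)) ∎
      where a′ = p ℕ.+ 2 ℕ.* q ℕ.+ 2 ℕ.* z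
    termZ : ∀ p q z → suc i ≡ p ℕ.+ q ℕ.+ z → ∀ a → suc (suc a) ≡ p ℕ.+ 2 ℕ.* q ℕ.+ 2 ℕ.* z →
            pre (τ i a) z * ι (p ! ℕ.* q ! ℕ.* z !) ≡ ι z * (sgn q * I)
    termZ p q zero eq a ea = trans (*-zeroˡ (ι (p ! ℕ.* q ! ℕ.* 1))) (sym (trans (cong (_* (sgn q * I)) ι-0) (*-zeroˡ (sgn q * I))))
    termZ p q (suc z) eq a ea = begin
      τ i a z * ι (p ! ℕ.* q ! ℕ.* suc z !) ≡⟨ cong (λ n → τ i n z * ι (p ! ℕ.* q ! ℕ.* suc z !)) (ℕₚ.suc-injective (ℕₚ.suc-injective (trans ea (ℕS.solve 3 (λ p q z →
                                                               p ℕS.:+ ℕS.con 2 ℕS.:* q ℕS.:+ ℕS.con 2 ℕS.:* (ℕS.con 1 ℕS.:+ z) ℕS.:= ℕS.con 2 ℕS.:+ (p ℕS.:+ ℕS.con 2 ℕS.:* q ℕS.:+ ℕS.con 2 ℕS.:* z)) refl p q z)))) ⟩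
      τ i a′ z * ι (p ! ℕ.* q ! ℕ.* (suc z ℕ.* z !)) ≡⟨ cong (λ n → τ i a′ z * ι n) (ℕS.solve 4 (λ p s q z → p ℕS.:* q ℕS.:* (s ℕS.:* z) ℕS.:= s ℕS.:* (p ℕS.:* q ℕS.:* z)) refl (p !) (suc z) (q !) (z !)) ⟩
      τ i a′ z * ι (suc z ℕ.* (p ! ℕ.* q ! ℕ.* z !)) ≡⟨ cong (τ i a′ z *_) (ι-* (suc z) _) ⟩
      τ i a′ z * (ι (suc z) * ι (p ! ℕ.* q ! ℕ.* z !)) ≡⟨ solve 3 (λ x y w → x :* (y :* w) := y :* (x :* w)) refl (τ i a′ z) (ι (suc z)) (ι (p ! ℕ.* q ! ℕ.* z !)) ⟩
      ι (suc z) * (τ i a′ z * ι (p ! ℕ.* q ! ℕ.* z !)) ≡⟨ cong (ι (suc z) *_) (τ-closed i p q z (ℕₚ.suc-injective (trans eq (ℕₚ.+-suc (p ℕ.+ q) z)))) ⟩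
      ι (suc z) * (sgn q * I) ∎
      where a′ = p ℕ.+ 2 ℕ.* q ℕ.+ 2 ℕ.* z
    total : (ι p * (sgn q * I) + ι q * (sgn q * I)) + ι z * (sgn q * I) ≡ sgn q * ι (suc i !)
    total = begin
      (ι p * (sgn q * I) + ι q * (sgn q * I)) + ι z * (sgn q * I)
        ≡⟨ solve 5 (λ p q z s i → (p :* (s :* i) :+ q :* (s :* i)) :+ z :* (s :* i) := s :* (((p :+ q) :+ z) :* i)) refl (ι p) (ι q) (ι z) (sgn q) I ⟩
      sgn q * (((ι p + ι q) + ι z) * I)
        ≡⟨ cong (λ x → sgn q * (x * I)) (trans (cong (_+ ι z) (sym (ι-+ p q))) (trans (sym (ι-+ (p ℕ.+ q) z)) (cong ι (sym eq)))) ⟩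
      sgn q * (ι (suc i) * I) ≡⟨ cong (sgn q *_) (sym (ι-* (suc i) (i !))) ⟩
      sgn q * ι (suc i !) ∎
    body : ∀ a → a ≡ p ℕ.+ 2 ℕ.* q ℕ.+ 2 ℕ.* z → τ (suc i) a z * ι D ≡ sgn q * ι (suc i !)
    body zero ea = ⊥-elim (ℕₚ.1+n≢0 (ℕₚ.n≤0⇒n≡0 (subst₂ _≤_ (sym eq) (sym ea)
      (ℕₚ.+-mono-≤ (ℕₚ.+-monoʳ-≤ p (ℕₚ.m≤m+n q _)) (ℕₚ.m≤m+n z _)))))
    -- Weight 1 has its own clause in `τ`, without the terms of x^2 and y. Here q = z = 0, so these
    -- count no copies anyway.
    body (suc zero) ea = begin
      τ i 0 z * ι D ≡⟨ termP p q z eq 0 ea ⟩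
      ι p * (sgn q * I)
        ≡⟨ solve 2 (λ x y → x :* y := (x :* y :+ con 0ℚ :* y) :+ con 0ℚ :* y) refl (ι p) (sgn q * I) ⟩
      (ι p * (sgn q * I) + 0ℚ * (sgn q * I)) + 0ℚ * (sgn q * I)
        ≡⟨ cong₂ (λ u v → (ι p * (sgn q * I) + u * (sgn q * I)) + v * (sgn q * I)) (small q (ℕₚ.≤-trans (ℕₚ.m≤n+m (2 ℕ.* q) p) (ℕₚ.m≤m+n (p ℕ.+ 2 ℕ.* q) _))) (small z (ℕₚ.m≤n+m (2 ℕ.* z) (p ℕ.+ 2 ℕ.* q))) ⟩
      (ι p * (sgn q * I) + ι q * (sgn q * I)) + ι z * (sgn q * I)
        ≡⟨ total ⟩
      sgn q * ι (suc i !) ∎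
      where
      small : ∀ n → 2 ℕ.* n ≤ p ℕ.+ 2 ℕ.* q ℕ.+ 2 ℕ.* z → 0ℚ ≡ ι n
      small zero _ = sym ι-0
      small (suc n) l with subst (2 ℕ.* suc n ≤_) (sym ea) l
      ... | s≤s l′ with subst (_≤ 0) (ℕₚ.+-suc n (n ℕ.+ 0)) l′
      ... | ()
    body (suc (suc a)) ea = begin
      (τ i (suc a) z - τ i a z + pre (τ i a) z) * ι D
        ≡⟨ solve 4 (λ x y w d → (x :- y :+ w) :* d := (x :* d :- y :* d) :+ w :* d) refl (τ i (suc a) z) (τ i a z) (pre (τ i a) z) (ι D) ⟩
      (τ i (suc a) z * ι D - τ i a z * ι D) + pre (τ i a) z * ι D
        ≡⟨ cong₂ _+_ (cong₂ _-_ (termP p q z eq (suc a) ea) (termQ p q z eq a ea)) (termZ p q z eq a ea) ⟩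
      (ι p * (sgn q * I) - - (ι q * (sgn q * I))) + ι z * (sgn q * I)
        ≡⟨ cong (λ x → (ι p * (sgn q * I) + x) + ι z * (sgn q * I)) (neg-involutive _) ⟩
      (ι p * (sgn q * I) + ι q * (sgn q * I)) + ι z * (sgn q * I)
        ≡⟨ total ⟩
      sgn q * ι (suc i !) ∎

  trinomial : ℕ → ℕ → ℕ → ℕ
  trinomial p q z = B (p ℕ.+ q) z ℕ.* B p q

  trinomial-! : ∀ p q z → trinomial p q z ℕ.* (p ! ℕ.* q ! ℕ.* z !) ≡ (p ℕ.+ q ℕ.+ z) !
  trinomial-! p q z = begin
    B (p ℕ.+ q) z ℕ.* B p q ℕ.* (p ! ℕ.* q ! ℕ.* z !) ≡⟨ ℕS.solve 5 (λ x y p q z → x ℕS.:* y ℕS.:* (p ℕS.:* q ℕS.:* z) ℕS.:= x ℕS.:* ((y ℕS.:* (p ℕS.:* q)) ℕS.:* z)) refl (B (p ℕ.+ q) z) (B p q) (p !) (q !) (z !) ⟩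
    B (p ℕ.+ q) z ℕ.* (B p q ℕ.* (p ! ℕ.* q !) ℕ.* z !) ≡⟨ cong (λ n → B (p ℕ.+ q) z ℕ.* (n ℕ.* z !)) (B-! p q) ⟩
    B (p ℕ.+ q) z ℕ.* ((p ℕ.+ q) ! ℕ.* z !) ≡⟨ B-! (p ℕ.+ q) z ⟩
    (p ℕ.+ q ℕ.+ z) ! ∎
    where open ≡-Reasoning

  1≤! : ∀ n → 1 ≤ n !
  1≤! n = ℕₚ.n≢0⇒n>0 (ℕ.≢-nonZero⁻¹ (n !) {{fact≢0 n}})

  -- The numbers p, q and z say how many factors contribute x, -x^2 and y.
  τ-trinomial : ∀ p q z → τ (p ℕ.+ q ℕ.+ z) (p ℕ.+ 2 ℕ.* q ℕ.+ 2 ℕ.* z) z ≡ sgn q * ι (trinomial p q z)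
  τ-trinomial p q z = ι-cancelʳ (p ! ℕ.* q ! ℕ.* z !) (ℕₚ.*-mono-≤ (ℕₚ.*-mono-≤ (1≤! p) (1≤! q)) (1≤! z))
    (trans (τ-closed (p ℕ.+ q ℕ.+ z) p q z refl) (trans (cong (λ n → sgn q * ι n) (sym (trinomial-! p q z)))
      (trans (cong (sgn q *_) (ι-* (trinomial p q z) _)) (sym (*-assoc (sgn q) _ _)))))

  -- The multinomial of `mult` with the quotients by k already taken.
  multi : ℕ → ℕ → ℕ → ℕ → ℕ
  multi i a z b = multinomial (2 ℕ.* i) (ℤ.+ i ∷ (ℤ.+ (2 ℕ.* i) ℤ.- ℤ.+ a) ∷ ℤ.+ z ∷ (ℤ.+ b ℤ.- ℤ.+ i) ∷ [])

  pos-sub : ∀ m n → n ≤ m → ℤ.+ m ℤ.- ℤ.+ n ≡ ℤ.+ (m ∸ n)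
  pos-sub m n n≤m = trans (ℤₚ.m-n≡m⊖n m n) (ℤₚ.⊖-≥ n≤m)

  neg-sub : ∀ m n → m < n → ∃[ k ] ℤ.+ m ℤ.- ℤ.+ n ≡ ℤ.-[1+ k ]
  neg-sub m n m<n with n ∸ m in eq
  ... | zero = ⊥-elim (ℕₚ.<⇒≢ (ℕₚ.m<n⇒0<n∸m m<n) (sym eq))
  ... | suc k = k , trans (ℤₚ.m-n≡m⊖n m n) (trans (ℤₚ.⊖-< m<n) (cong (λ x → ℤ.- (ℤ.+ x)) eq))

  sgn-even : ∀ q k → sgn (q ℕ.+ 2 ℕ.* k) ≡ sgn q
  sgn-even q zero = cong sgn (ℕₚ.+-identityʳ q)
  sgn-even q (suc k) = trans (cong sgn (ℕS.solve 2 (λ q k → q ℕS.:+ ℕS.con 2 ℕS.:* (ℕS.con 1 ℕS.:+ k) ℕS.:= ℕS.con 2 ℕS.:+ (q ℕS.:+ ℕS.con 2 ℕS.:* k)) refl q k))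
    (trans (neg-involutive (sgn (q ℕ.+ 2 ℕ.* k))) (sgn-even q k))

  -- As p + q + z = i, the multinomial of 2i over i, p, z, q is C(2i, i) times the trinomial of i
  -- over p, q, z; in particular the division is exact.
  multi-exact : ∀ p q z → let i = p ℕ.+ q ℕ.+ z in
    ((2 ℕ.* i) !) ÷ₙ (i ! ℕ.* (p ! ℕ.* (z ! ℕ.* (q ! ℕ.* 1)))) ≡ B i i ℕ.* trinomial p q z
  multi-exact p q z = trans (cong (_÷ₙ D) expand!) (*-÷ₙ (B i i ℕ.* trinomial p q z) D
    (ℕₚ.*-mono-≤ (1≤! i) (ℕₚ.*-mono-≤ (1≤! p) (ℕₚ.*-mono-≤ (1≤! z) (ℕₚ.*-mono-≤ (1≤! q) (ℕₚ.≤-refl {1}))))))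
    where
    open ≡-Reasoning
    i = p ℕ.+ q ℕ.+ z
    D = i ! ℕ.* (p ! ℕ.* (z ! ℕ.* (q ! ℕ.* 1)))
    expand! : (2 ℕ.* i) ! ≡ B i i ℕ.* trinomial p q z ℕ.* D
    expand! = begin
      (2 ℕ.* i) ! ≡⟨ cong (λ n → (i ℕ.+ n) !) (ℕₚ.+-identityʳ i) ⟩
      (i ℕ.+ i) ! ≡⟨ sym (B-! i i) ⟩
      B i i ℕ.* (i ! ℕ.* i !) ≡⟨ cong (λ n → B i i ℕ.* (i ! ℕ.* n)) (sym (trinomial-! p q z)) ⟩
      B i i ℕ.* (i ! ℕ.* (trinomial p q z ℕ.* (p ! ℕ.* q ! ℕ.* z !)))
        ≡⟨ ℕS.solve 6 (λ b i t p q z → b ℕS.:* (i ℕS.:* (t ℕS.:* (p ℕS.:* q ℕS.:* z))) ℕS.:= b ℕS.:* t ℕS.:* (i ℕS.:* (p ℕS.:* (z ℕS.:* (q ℕS.:* ℕS.con 1))))) refl (B i i) (i !) (trinomial p q z) (p !) (q !) (z !) ⟩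
      B i i ℕ.* trinomial p q z ℕ.* D ∎

  -- Solving p + q + z = i and p + 2q + 2z = a gives p = 2i - a and q = a - z - i, the entries of
  -- the multinomial; if one is negative, both sides vanish. The sign (-1)^q may be written with
  -- exponent a + z + i = q + 2(i + z).
  B*τ : ∀ i a z → z ≤ a → ι (B i i) * τ i a z ≡ sgn (a ℕ.+ z ℕ.+ i) * ι (multi i a z (a ∸ z))
  B*τ i a z z≤a with a ≤? 2 ℕ.* i | i ≤? a ∸ z
  ... | no a≰2i | _ = begin
    ι (B i i) * τ i a z ≡⟨ trans (cong (ι (B i i) *_) (τ-low i a z (ℕₚ.≰⇒> a≰2i))) (*-zeroʳ (ι (B i i))) ⟩
    0ℚ ≡⟨ sym (trans (cong (λ n → s * ι n) zeroM) (trans (cong (s *_) ι-0) (*-zeroʳ s))) ⟩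
    s * ι (multi i a z (a ∸ z)) ∎
    where
    open ≡-Reasoning
    s = sgn (a ℕ.+ z ℕ.+ i)
    zeroM : multi i a z (a ∸ z) ≡ 0
    zeroM with ℤ.+ (2 ℕ.* i) ℤ.- ℤ.+ a | neg-sub (2 ℕ.* i) a (ℕₚ.≰⇒> a≰2i)
    ... | _ | k , refl = refl
  ... | yes _ | no i≰ = begin
    ι (B i i) * τ i a z ≡⟨ trans (cong (ι (B i i) *_) (τ-high i a z (subst (_< i ℕ.+ z) (ℕₚ.m∸n+n≡m z≤a) (ℕₚ.+-monoˡ-< z (ℕₚ.≰⇒> i≰))))) (*-zeroʳ (ι (B i i))) ⟩
    0ℚ ≡⟨ sym (trans (cong (λ n → s * ι n) zeroM) (trans (cong (s *_) ι-0) (*-zeroʳ s))) ⟩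
    s * ι (multi i a z (a ∸ z)) ∎
    where
    open ≡-Reasoning
    s = sgn (a ℕ.+ z ℕ.+ i)
    zeroM : multi i a z (a ∸ z) ≡ 0
    zeroM with ℤ.+ (a ∸ z) ℤ.- ℤ.+ i | neg-sub (a ∸ z) i (ℕₚ.≰⇒> i≰)
    ... | _ | k , refl rewrite Boolₚ.∧-zeroʳ (does (ℤ.+ 0 ℤ.≤? (ℤ.+ (2 ℕ.* i) ℤ.- ℤ.+ a))) = refl
  ... | yes a≤2i | yes i≤ = begin
    ι (B i i) * τ i a z
      ≡⟨ cong₂ (λ i a → ι (B i i) * τ i a z) i≡ a≡ ⟩
    ι (B i′ i′) * τ i′ a′ z
      ≡⟨ cong (ι (B i′ i′) *_) (τ-trinomial p q z) ⟩
    ι (B i′ i′) * (sgn q * ι (trinomial p q z))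
      ≡⟨ solve 3 (λ x y w → x :* (y :* w) := y :* (x :* w)) refl (ι (B i′ i′)) (sgn q) (ι (trinomial p q z)) ⟩
    sgn q * (ι (B i′ i′) * ι (trinomial p q z))
      ≡⟨ cong₂ _*_ sign (sym (ι-* (B i′ i′) (trinomial p q z))) ⟩
    sgn (a ℕ.+ z ℕ.+ i) * ι (B i′ i′ ℕ.* trinomial p q z)
      ≡⟨ cong (λ n → sgn (a ℕ.+ z ℕ.+ i) * ι n) (sym M≡) ⟩
    sgn (a ℕ.+ z ℕ.+ i) * ι (multi i a z (a ∸ z)) ∎
    where
    open ≡-Reasoning
    open ℚS using (solve; _:=_; _:+_; _:*_; _:-_; :-_; con)
    p = 2 ℕ.* i ∸ a
    q = a ∸ z ∸ i
    i′ = p ℕ.+ q ℕ.+ z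
    a′ = p ℕ.+ 2 ℕ.* q ℕ.+ 2 ℕ.* z
    pa : p ℕ.+ a ≡ 2 ℕ.* i
    pa = ℕₚ.m∸n+n≡m a≤2i
    qz : q ℕ.+ i ℕ.+ z ≡ a
    qz = trans (cong (ℕ._+ z) (ℕₚ.m∸n+n≡m i≤)) (ℕₚ.m∸n+n≡m z≤a)
    i≡ : i ≡ i′
    i≡ = ℕₚ.+-cancelˡ-≡ i i i′ (trans (cong (i ℕ.+_) (sym (ℕₚ.+-identityʳ i))) (trans (sym pa) (trans (cong (p ℕ.+_) (sym qz))
      (ℕS.solve 4 (λ p q z i → p ℕS.:+ (q ℕS.:+ i ℕS.:+ z) ℕS.:= i ℕS.:+ (p ℕS.:+ q ℕS.:+ z)) refl p q z i))))
    a≡ : a ≡ a′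
    a≡ = trans (sym qz) (trans (cong (λ i → q ℕ.+ i ℕ.+ z) i≡) (ℕS.solve 3 (λ p q z → q ℕS.:+ (p ℕS.:+ q ℕS.:+ z) ℕS.:+ z ℕS.:= p ℕS.:+ ℕS.con 2 ℕS.:* q ℕS.:+ ℕS.con 2 ℕS.:* z) refl p q z))
    sign : sgn q ≡ sgn (a ℕ.+ z ℕ.+ i)
    sign = sym (trans (cong₂ (λ a i → sgn (a ℕ.+ z ℕ.+ i)) a≡ i≡) (trans (cong sgn (ℕS.solve 3 (λ p q z →
      p ℕS.:+ ℕS.con 2 ℕS.:* q ℕS.:+ ℕS.con 2 ℕS.:* z ℕS.:+ z ℕS.:+ (p ℕS.:+ q ℕS.:+ z) ℕS.:= q ℕS.:+ ℕS.con 2 ℕS.:* (p ℕS.:+ q ℕS.:+ ℕS.con 2 ℕS.:* z)) refl p q z))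
      (sgn-even q (p ℕ.+ q ℕ.+ 2 ℕ.* z))))
    M≡ : multi i a z (a ∸ z) ≡ B i′ i′ ℕ.* trinomial p q z
    M≡ = trans (cong₂ (λ x y → multinomial (2 ℕ.* i) (ℤ.+ i ∷ x ∷ ℤ.+ z ∷ y ∷ [])) (pos-sub (2 ℕ.* i) a a≤2i) (pos-sub (a ∸ z) i i≤))
      (trans (cong (λ i → ((2 ℕ.* i) !) ÷ₙ (i ! ℕ.* (p ! ℕ.* (z ! ℕ.* (q ! ℕ.* 1))))) i≡) (multi-exact p q z))

-- Summation over word lengths and rotation orders.

module Summation where

  open Sums
  open Forests
  open Necklaces
  open LogIdentity
  open CherryCounts
  open import Data.List using (map; filter)
  import Data.List.Relation.Unary.Unique.Propositional.Properties as Uniqueₚ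
  open import Data.Nat as ℕ using (ℕ; zero; suc; _≤_; _<_; z≤n; s≤s; _≤?_; _∸_)
  open import Data.Nat.Combinatorics using (_C_)
  open import Data.Nat.Divisibility using (_∣_; _∣?_; divides; ∣⇒≤)
  import Data.Nat.Properties as ℕₚ
  open import Data.Rational using (ℚ; 0ℚ; _+_; _*_)
  open import Data.Rational.Properties using (*-zeroˡ; *-zeroʳ; *-assoc; *-comm; *-identityˡ; +-identityˡ; +-identityʳ)
  open import Data.Rational.Solver using () renaming (module +-*-Solver to ℚS)

  -- The triangle of pairs with sum below K, read by diagonals and by rows.
  ∑-antidiagonal : ∀ K (h : ℕ → ℕ → ℚ) →
    ℚ∑.∑ (upTo K) (λ m → ℚ∑.∑ (upTo (suc m)) (λ α → h α (m ∸ α))) ≡ ℚ∑.∑ (upTo K) (λ α → ℚ∑.∑ (upTo (K ∸ α)) (h α))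
  ∑-antidiagonal zero h = refl
  ∑-antidiagonal (suc K) h = begin
    ℚ∑.∑ (upTo (suc K)) (λ m → ℚ∑.∑ (upTo (suc m)) (λ α → h α (m ∸ α)))
      ≡⟨ ℚ∑.∑-upTo-last K (λ m → ℚ∑.∑ (upTo (suc m)) (λ α → h α (m ∸ α))) ⟩
    ℚ∑.∑ (upTo K) (λ m → ℚ∑.∑ (upTo (suc m)) (λ α → h α (m ∸ α))) + D
      ≡⟨ cong (_+ D) (∑-antidiagonal K h) ⟩
    ℚ∑.∑ (upTo K) rows + D
      ≡⟨ cong (_+ D) (sym (trans (ℚ∑.∑-upTo-last K rows) (trans (cong (λ n → ℚ∑.∑ (upTo K) rows + ℚ∑.∑ (upTo n) (h K)) (ℕₚ.n∸n≡0 K)) (+-identityʳ (ℚ∑.∑ (upTo K) rows))))) ⟩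
    ℚ∑.∑ (upTo (suc K)) rows + D
      ≡⟨ sym (ℚ∑.∑-+ (upTo (suc K)) rows (λ α → h α (K ∸ α))) ⟩
    ℚ∑.∑ (upTo (suc K)) (λ α → rows α + h α (K ∸ α))
      ≡⟨ ℚ∑.∑-cong (upTo (suc K)) (λ α α∈ → trans (sym (ℚ∑.∑-upTo-last (K ∸ α) (h α)))
           (cong (λ n → ℚ∑.∑ (upTo n) (h α)) (sym (ℕₚ.+-∸-assoc 1 (ℕₚ.≤-pred (∈-upTo⁻ α∈)))))) ⟩
    ℚ∑.∑ (upTo (suc K)) (λ α → ℚ∑.∑ (upTo (suc K ∸ α)) (h α)) ∎
    where
    open ≡-Reasoning
    D = ℚ∑.∑ (upTo (suc K)) (λ α → h α (K ∸ α))
    rows : ℕ → ℚ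
    rows α = ℚ∑.∑ (upTo (K ∸ α)) (h α)

  G-zero : ∀ r α mz → r < α → G r α mz ≡ 0
  G-zero r α mz r<α = ∑-zero (forests r α) (λ f f∈ → let (l , v) = forests-sound r α f∈ in
    ⊥-elim (ℕₚ.<⇒≱ r<α (subst₂ _≤_ l v (length≤leavesF f))))

  W-zero : ∀ m r ma s mb → r ℕ.+ s < m → W m r ma s mb ≡ 0
  W-zero m r ma s mb r+s<m = ∑-zero (words m r s) (λ w w∈ → let (l , p , p′) = words-sound m r s w∈ in
    ⊥-elim (ℕₚ.<⇒≱ r+s<m (subst₂ _≤_ (trans (length-pick w) l) (cong₂ ℕ._+_ p p′) (ℕₚ.+-mono-≤ (length≤leavesF (pick false w)) (length≤leavesF (pick true w))))))

  -- The contribution of t^i u^j in the logarithm to the coefficient sought after the two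
  -- substitutions.
  logTerm : ℕ → Maybe ℕ → ℕ → Maybe ℕ → ℕ → ℕ → ℚ
  logTerm r ma s mb i j = (τ′ i r ma * τ′ j s mb) * ((ι (B i i) * ι (B j j)) * inv (2 ℕ.* (i ℕ.+ j)))

  -- The series log 1/(1 - z) is the sum of z^m/m, so dividing the number of words of length m by m
  -- turns C(m, α) into `ε`. The resulting sums over α and β are evaluated by `log-identity`.
  log-sum : ∀ r ma s mb M → 1 ≤ r → 1 ≤ s → r ℕ.+ s ≤ M →
    ℚ∑.∑ (upTo (suc M)) (λ m → inv m * ι (W m r ma s mb)) ≡
    ℚ∑.∑ (upTo (suc r)) (λ i → ℚ∑.∑ (upTo (suc s)) (logTerm r ma s mb i))
  log-sum r ma s mb M 1≤r 1≤s r+s≤M = begin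
    Σ K (λ m → inv m * ι (W m r ma s mb))
      ≡⟨ ℚ∑.∑-cong′ (upTo K) expandW ⟩
    Σ K (λ m → Σ (suc m) (λ α → h α (m ∸ α)))
      ≡⟨ ∑-antidiagonal K h ⟩
    Σ K (λ α → Σ (K ∸ α) (h α))
      ≡⟨ ℚ∑.∑-cong′ (upTo K) (λ α → sym (ℚ∑.∑-upTo-extend (ℕₚ.m∸n≤m K α) (h α) (vanish α))) ⟩
    Σ K (λ α → Σ K (h α))
      ≡⟨ ℚ∑.∑-cong′ (upTo K) (λ α → ℚ∑.∑-cong′ (upTo K) (expandG α)) ⟩
    Σ K (λ α → Σ K (λ β → Σ (suc r) (λ i → Σ (suc s) (λ j → t α β i j))))
      ≡⟨ ℚ∑.∑-cong′ (upTo K) (λ α → ℚ∑.∑-swap (upTo K) (upTo (suc r)) (λ β i → Σ (suc s) (t α β i))) ⟩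
    Σ K (λ α → Σ (suc r) (λ i → Σ K (λ β → Σ (suc s) (t α β i))))
      ≡⟨ ℚ∑.∑-swap (upTo K) (upTo (suc r)) (λ α i → Σ K (λ β → Σ (suc s) (t α β i))) ⟩
    Σ (suc r) (λ i → Σ K (λ α → Σ K (λ β → Σ (suc s) (t α β i))))
      ≡⟨ ℚ∑.∑-cong′ (upTo (suc r)) (λ i → trans (ℚ∑.∑-cong′ (upTo K) (λ α → ℚ∑.∑-swap (upTo K) (upTo (suc s)) (λ β → t α β i))) (ℚ∑.∑-swap (upTo K) (upTo (suc s)) (λ α j → Σ K (λ β → t α β i j)))) ⟩
    Σ (suc r) (λ i → Σ (suc s) (λ j → Σ K (λ α → Σ K (λ β → t α β i j))))
      ≡⟨ ℚ∑.∑-cong (upTo (suc r)) (λ i i∈ → ℚ∑.∑-cong (upTo (suc s)) (λ j j∈ → collapse i j (∈-upTo⁻ i∈) (∈-upTo⁻ j∈))) ⟩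
    Σ (suc r) (λ i → Σ (suc s) (logTerm r ma s mb i)) ∎
    where
    open ≡-Reasoning
    open ℚS using (solve; _:=_; _:+_; _:*_; _:-_; :-_; con)
    K = suc M
    Σ = λ n → ℚ∑.∑ (upTo n)
    h : ℕ → ℕ → ℚ
    h α β = ε α β * (ι (G r α ma) * ι (G s β mb))
    t : ℕ → ℕ → ℕ → ℕ → ℚ
    t α β i j = (τ′ i r ma * τ′ j s mb) * (ε α β * (cc i α * cc j β))
    expandW : ∀ m → inv m * ι (W m r ma s mb) ≡ Σ (suc m) (λ α → h α (m ∸ α))
    expandW m = begin
      inv m * ι (W m r ma s mb)
        ≡⟨ cong (λ n → inv m * ι n) (W-formula m r ma s mb) ⟩
      inv m * ι (∑ (upTo (suc m)) (λ α → (m C α) ℕ.* (G r α ma ℕ.* G s (m ∸ α) mb)))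
        ≡⟨ cong (inv m *_) (ι-∑ (upTo (suc m)) (λ α → (m C α) ℕ.* (G r α ma ℕ.* G s (m ∸ α) mb))) ⟩
      inv m * Σ (suc m) (λ α → ι ((m C α) ℕ.* (G r α ma ℕ.* G s (m ∸ α) mb)))
        ≡⟨ ℚ∑.∑-*ˡ (inv m) (upTo (suc m)) (λ α → ι ((m C α) ℕ.* (G r α ma ℕ.* G s (m ∸ α) mb))) ⟩
      Σ (suc m) (λ α → inv m * ι ((m C α) ℕ.* (G r α ma ℕ.* G s (m ∸ α) mb)))
        ≡⟨ ℚ∑.∑-cong (upTo (suc m)) (λ α α∈ → term α (ℕₚ.≤-pred (∈-upTo⁻ α∈))) ⟩
      Σ (suc m) (λ α → h α (m ∸ α)) ∎
      where
      term : ∀ α → α ≤ m → inv m * ι ((m C α) ℕ.* (G r α ma ℕ.* G s (m ∸ α) mb)) ≡ h α (m ∸ α)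
      term α α≤m = begin
        inv m * ι ((m C α) ℕ.* (x ℕ.* y)) ≡⟨ cong (inv m *_) (trans (ι-* (m C α) (x ℕ.* y)) (cong (ι (m C α) *_) (ι-* x y))) ⟩
        inv m * (ι (m C α) * (ι x * ι y)) ≡⟨ solve 3 (λ a b c → a :* (b :* c) := (b :* a) :* c) refl (inv m) (ι (m C α)) (ι x * ι y) ⟩
        (ι (m C α) * inv m) * (ι x * ι y) ≡⟨ cong (λ n → (ι (n C α) * inv n) * (ι x * ι y)) (sym (ℕₚ.m+[n∸m]≡n α≤m)) ⟩
        (ι ((α ℕ.+ (m ∸ α)) C α) * inv (α ℕ.+ (m ∸ α))) * (ι x * ι y) ≡⟨ cong (λ n → (ι n * inv (α ℕ.+ (m ∸ α))) * (ι x * ι y)) (sym (B≡C α (m ∸ α))) ⟩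
        h α (m ∸ α) ∎
        where
        x = G r α ma
        y = G s (m ∸ α) mb
    -- Outside the triangle α + β ≤ M one has α > r or β > s, that is, more trees than leaves in one
    -- colour.
    vanish : ∀ α β → K ∸ α ≤ β → h α β ≡ 0ℚ
    vanish α β K∸α≤β with ℕₚ.≤-<-connex α r
    ... | inj₂ r<α = trans (cong (λ n → ε α β * (ι n * ι (G s β mb))) (G-zero r α ma r<α))
      (trans (cong (λ x → ε α β * (x * ι (G s β mb))) ι-0) (trans (cong (ε α β *_) (*-zeroˡ (ι (G s β mb)))) (*-zeroʳ (ε α β))))
    ... | inj₁ α≤r = trans (cong (λ n → ε α β * (ι (G r α ma) * ι n)) (G-zero s β mb s<β))
      (trans (cong (λ x → ε α β * (ι (G r α ma) * x)) ι-0) (trans (cong (ε α β *_) (*-zeroʳ (ι (G r α ma)))) (*-zeroʳ (ε α β))))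
      where
      s<β : s < β
      s<β = ℕₚ.+-cancelˡ-≤ α (suc s) β (ℕₚ.≤-trans (ℕₚ.≤-reflexive (ℕₚ.+-suc α s))
        (ℕₚ.≤-trans (s≤s (ℕₚ.≤-trans (ℕₚ.+-monoˡ-≤ s α≤r) r+s≤M)) (ℕₚ.≤-trans (ℕₚ.m≤n+m∸n K α) (ℕₚ.+-monoʳ-≤ α K∸α≤β))))
    expandG : ∀ α β → h α β ≡ Σ (suc r) (λ i → Σ (suc s) (λ j → t α β i j))
    expandG α β = begin
      ε α β * (ι (G r α ma) * ι (G s β mb))
        ≡⟨ cong (ε α β *_) (trans (cong₂ _*_ (G-expand r α ma) (G-expand s β mb)) (ℚ∑.∑-*-∑ (upTo (suc r)) (upTo (suc s)) (λ i → cc i α * τ′ i r ma) (λ j → cc j β * τ′ j s mb))) ⟩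
      ε α β * Σ (suc r) (λ i → Σ (suc s) (λ j → (cc i α * τ′ i r ma) * (cc j β * τ′ j s mb)))
        ≡⟨ trans (ℚ∑.∑-*ˡ (ε α β) (upTo (suc r)) (λ i → Σ (suc s) (λ j → (cc i α * τ′ i r ma) * (cc j β * τ′ j s mb)))) (ℚ∑.∑-cong′ (upTo (suc r)) (λ i → ℚ∑.∑-*ˡ (ε α β) (upTo (suc s)) (λ j → (cc i α * τ′ i r ma) * (cc j β * τ′ j s mb)))) ⟩
      Σ (suc r) (λ i → Σ (suc s) (λ j → ε α β * ((cc i α * τ′ i r ma) * (cc j β * τ′ j s mb))))
        ≡⟨ ℚ∑.∑-cong′ (upTo (suc r)) (λ i → ℚ∑.∑-cong′ (upTo (suc s)) (λ j →
             solve 5 (λ e x t y u → e :* ((x :* t) :* (y :* u)) := (t :* u) :* (e :* (x :* y))) refl (ε α β) (cc i α) (τ′ i r ma) (cc j β) (τ′ j s mb))) ⟩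
      Σ (suc r) (λ i → Σ (suc s) (λ j → t α β i j)) ∎
    collapse : ∀ i j → i < suc r → j < suc s → Σ K (λ α → Σ K (λ β → t α β i j)) ≡ logTerm r ma s mb i j
    collapse i j i≤r j≤s = begin
      Σ K (λ α → Σ K (λ β → t α β i j))
        ≡⟨ trans (ℚ∑.∑-cong′ (upTo K) (λ α → sym (ℚ∑.∑-*ˡ T (upTo K) (λ β → ε α β * (cc i α * cc j β))))) (sym (ℚ∑.∑-*ˡ T (upTo K) (λ α → Σ K (λ β → ε α β * (cc i α * cc j β))))) ⟩
      T * Σ K (λ α → Σ K (λ β → ε α β * (cc i α * cc j β)))
        ≡⟨ value i j i≤r j≤s ⟩
      logTerm r ma s mb i j ∎
      where
      T = τ′ i r ma * τ′ j s mb
      -- `log-identity` asks for i, j ≥ 1. An exponent 0 contributes nothing, since a zeroth power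
      -- has only a constant term while r, s ≥ 1.
      value : ∀ i j → i < suc r → j < suc s → (τ′ i r ma * τ′ j s mb) * Σ K (λ α → Σ K (λ β → ε α β * (cc i α * cc j β))) ≡ logTerm r ma s mb i j
      value zero j _ _ = trans (cong (_* X) T≡0) (trans (*-zeroˡ X) (sym (trans (cong (_* Y) T≡0) (*-zeroˡ Y))))
        where
        X = Σ K (λ α → Σ K (λ β → ε α β * (cc 0 α * cc j β)))
        Y = (ι (B 0 0) * ι (B j j)) * inv (2 ℕ.* (0 ℕ.+ j))
        T≡0 = trans (cong (_* τ′ j s mb) (τ′-zero r ma 1≤r)) (*-zeroˡ (τ′ j s mb))
      value i@(suc _) zero _ _ = trans (cong (_* X) T≡0) (trans (*-zeroˡ X) (sym (trans (cong (_* Y) T≡0) (*-zeroˡ Y))))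
        where
        X = Σ K (λ α → Σ K (λ β → ε α β * (cc i α * cc 0 β)))
        Y = (ι (B i i) * ι (B 0 0)) * inv (2 ℕ.* (i ℕ.+ 0))
        T≡0 = trans (cong (τ′ i r ma *_) (τ′-zero s mb 1≤s)) (*-zeroʳ (τ′ i r ma))
      value i@(suc _) j@(suc _) i≤r j≤s = cong ((τ′ i r ma * τ′ j s mb) *_) (log-identity K i j (s≤s z≤n) (s≤s z≤n)
        (ℕₚ.≤-trans i≤r (s≤s (ℕₚ.≤-trans (ℕₚ.m≤m+n r s) r+s≤M))) (ℕₚ.≤-trans j≤s (s≤s (ℕₚ.≤-trans (ℕₚ.m≤n+m s r) r+s≤M))))

  -- Reindexing by m = k m′; the hypothesis on f lets m′ run up to M instead of M/k.
  ∑-multiples : ∀ M k → 1 ≤ k → (f : ℕ → ℕ → ℚ) → (∀ m′ → M < k ℕ.* m′ → f m′ (k ℕ.* m′) ≡ 0ℚ) →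
    ℚ∑.∑ (range M) (λ m → ℚ∑.when (k ∣ᵇ m) (f (m ÷ₙ k) m)) ≡ ℚ∑.∑ (range M) (λ m′ → f m′ (k ℕ.* m′))
  ∑-multiples M k 1≤k f z = begin
    ℚ∑.∑ (range M) (λ m → ℚ∑.when (k ∣ᵇ m) (f (m ÷ₙ k) m))
      ≡⟨ sym (ℚ∑.∑-filter (k ∣?_) (range M) (λ m → f (m ÷ₙ k) m)) ⟩
    ℚ∑.∑ (filter (k ∣?_) (range M)) (λ m → f (m ÷ₙ k) m)
      ≡⟨ ℚ∑.∑-same (Uniqueₚ.filter⁺ (k ∣?_) (range-unique M)) (Uniqueₚ.map⁺ (λ {x} {y} → ℕₚ.*-cancelˡ-≡ x y k {{ℕ.>-nonZero 1≤k}}) (Uniqueₚ.filter⁺ small? (range-unique M))) to from (λ m → f (m ÷ₙ k) m) ⟩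
    ℚ∑.∑ (map (k ℕ.*_) (filter small? (range M))) (λ m → f (m ÷ₙ k) m)
      ≡⟨ ℚ∑.∑-map (k ℕ.*_) (filter small? (range M)) (λ m → f (m ÷ₙ k) m) ⟩
    ℚ∑.∑ (filter small? (range M)) (λ m′ → f ((k ℕ.* m′) ÷ₙ k) (k ℕ.* m′))
      ≡⟨ ℚ∑.∑-cong′ (filter small? (range M)) (λ m′ → cong (λ n → f n (k ℕ.* m′)) (quotient m′)) ⟩
    ℚ∑.∑ (filter small? (range M)) (λ m′ → f m′ (k ℕ.* m′))
      ≡⟨ ℚ∑.∑-filter small? (range M) (λ m′ → f m′ (k ℕ.* m′)) ⟩
    ℚ∑.∑ (range M) (λ m′ → ℚ∑.when (does (small? m′)) (f m′ (k ℕ.* m′)))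
      ≡⟨ ℚ∑.∑-cong′ (range M) drop ⟩
    ℚ∑.∑ (range M) (λ m′ → f m′ (k ℕ.* m′)) ∎
    where
    open ≡-Reasoning
    small? : ∀ m′ → Dec (k ℕ.* m′ ≤ M)
    small? m′ = k ℕ.* m′ ≤? M
    quotient : ∀ m′ → (k ℕ.* m′) ÷ₙ k ≡ m′
    quotient m′ = trans (cong (_÷ₙ k) (ℕₚ.*-comm k m′)) (*-÷ₙ m′ k 1≤k)
    drop : ∀ m′ → ℚ∑.when (does (small? m′)) (f m′ (k ℕ.* m′)) ≡ f m′ (k ℕ.* m′)
    drop m′ with small? m′
    ... | yes p = cong (λ b → ℚ∑.when b (f m′ (k ℕ.* m′))) (dec-true (small? m′) p)
    ... | no ¬p = trans (cong (λ b → ℚ∑.when b (f m′ (k ℕ.* m′))) (dec-false (small? m′) ¬p)) (sym (z m′ (ℕₚ.≰⇒> ¬p)))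
    to : ∀ {m} → m ∈ filter (k ∣?_) (range M) → m ∈ map (k ℕ.*_) (filter small? (range M))
    to {m} m∈ with ∈-filter⁻ (k ∣?_) {xs = range M} m∈
    ... | m∈′ , divides q refl = subst (_∈ map (k ℕ.*_) (filter small? (range M))) (ℕₚ.*-comm k q)
      (∈-map⁺ (k ℕ.*_) (∈-filter⁺ small? (∈-range⁺ 1≤q (ℕₚ.≤-trans (ℕₚ.m≤m*n q k {{ℕ.>-nonZero 1≤k}}) qk≤M)) (subst (_≤ M) (ℕₚ.*-comm q k) qk≤M)))
      where
      qk≤M = proj₂ (∈-range⁻ m∈′)
      1≤q : 1 ≤ q
      1≤q = ℕₚ.n≢0⇒n>0 (λ { refl → ℕₚ.<-irrefl refl (proj₁ (∈-range⁻ m∈′)) })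
    from : ∀ {m} → m ∈ map (k ℕ.*_) (filter small? (range M)) → m ∈ filter (k ∣?_) (range M)
    from m∈ with ∈-map⁻ (k ℕ.*_) m∈
    ... | m′ , m′∈ , refl with ∈-filter⁻ small? {xs = range M} m′∈
    ... | m′∈r , p = ∈-filter⁺ (k ∣?_) (∈-range⁺ (ℕₚ.*-mono-≤ 1≤k (proj₁ (∈-range⁻ m′∈r))) p) (divides m′ (ℕₚ.*-comm k m′))

  module Totals (r : ℕ) (ma : Maybe ℕ) (s : ℕ) (mb : Maybe ℕ) (1≤r : 1 ≤ r) (1≤s : 1 ≤ s) where

    M : ℕ
    M = r ℕ.+ s

    -- Lengths up to M suffice, as every bead has at least one leaf.
    total : ℕ
    total = ∑ (upTo M) (λ i → length (necklaces (suc i) r ma s mb (s≤s z≤n)))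

    w : ℕ → ℕ → ℕ
    w k m′ = when (divides⁴ k r ma s mb) (W m′ (r ÷ₙ k) (quot ma k) (s ÷ₙ k) (quot mb k))

    Λ : ℕ → ℚ
    Λ k = ℚ∑.∑ (upTo (suc (r ÷ₙ k))) (λ i → ℚ∑.∑ (upTo (suc (s ÷ₙ k))) (logTerm (r ÷ₙ k) (quot ma k) (s ÷ₙ k) (quot mb k) i))

    divides⁴⁻ : ∀ k → divides⁴ k r ma s mb ≡ true → k ∣ r × k ∣ s
    divides⁴⁻ k D with k ∣? r | k ∣? s | dvd k ma
    ... | yes p | yes q | _ = p , q
    ... | yes p | no q | true with () ← D
    ... | yes p | no q | false with () ← D
    divides⁴⁻ k () | no p | _ | _

    w-sum : ∀ k → 1 ≤ k → ℚ∑.∑ (range M) (λ m′ → inv m′ * ι (w k m′)) ≡ ℚ∑.when (divides⁴ k r ma s mb) (Λ k)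
    w-sum k 1≤k = cases (divides⁴ k r ma s mb) refl
      where
      open ≡-Reasoning
      V : ℕ → ℕ
      V m′ = W m′ (r ÷ₙ k) (quot ma k) (s ÷ₙ k) (quot mb k)
      cases : ∀ b → divides⁴ k r ma s mb ≡ b → ℚ∑.∑ (range M) (λ m′ → inv m′ * ι (when b (V m′))) ≡ ℚ∑.when b (Λ k)
      cases false D = ℚ∑.∑-zero (range M) (λ m′ _ → trans (cong (inv m′ *_) ι-0) (*-zeroʳ (inv m′)))
      cases true D = begin
        ℚ∑.∑ (range M) (λ m′ → inv m′ * ι (V m′))
          ≡⟨ ℚ∑.∑-map suc (upTo M) (λ m′ → inv m′ * ι (V m′)) ⟩
        ℚ∑.∑ (upTo M) (λ i → inv (suc i) * ι (V (suc i)))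
          ≡⟨ sym (trans (cong (_+ ℚ∑.∑ (upTo M) (λ i → inv (suc i) * ι (V (suc i)))) (trans (cong (_* ι (V 0)) inv-0) (*-zeroˡ (ι (V 0))))) (+-identityˡ _)) ⟩
        inv 0 * ι (V 0) + ℚ∑.∑ (upTo M) (λ i → inv (suc i) * ι (V (suc i)))
          ≡⟨ sym (ℚ∑.∑-upTo-first M (λ m → inv m * ι (V m))) ⟩
        ℚ∑.∑ (upTo (suc M)) (λ m → inv m * ι (V m))
          ≡⟨ log-sum (r ÷ₙ k) (quot ma k) (s ÷ₙ k) (quot mb k) M (1≤÷ₙ 1≤r k∣r 1≤k) (1≤÷ₙ 1≤s k∣s 1≤k) (ℕₚ.+-mono-≤ (÷≤ k∣r) (÷≤ k∣s)) ⟩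
        Λ k ∎
        where
        k∣r = proj₁ (divides⁴⁻ k D)
        k∣s = proj₂ (divides⁴⁻ k D)
        ÷≤ : ∀ {n} → k ∣ n → n ÷ₙ k ≤ n
        ÷≤ {n} k∣n = subst (n ÷ₙ k ≤_) (∣⇒÷ₙ 1≤k k∣n) (ℕₚ.m≤m*n (n ÷ₙ k) k {{ℕ.>-nonZero 1≤k}})

    w-zero : ∀ k m′ → 1 ≤ k → M < k ℕ.* m′ → w k m′ ≡ 0
    w-zero k m′ 1≤k M<km′ = cases (divides⁴ k r ma s mb) refl
      where
      cases : ∀ b → divides⁴ k r ma s mb ≡ b → when b (W m′ (r ÷ₙ k) (quot ma k) (s ÷ₙ k) (quot mb k)) ≡ 0
      cases false D = refl
      cases true D = W-zero m′ (r ÷ₙ k) (quot ma k) (s ÷ₙ k) (quot mb k)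
        (ℕₚ.*-cancelˡ-< k _ _ (subst (_< k ℕ.* m′) (sym (trans (ℕₚ.*-comm k _) (trans (ℕₚ.*-distribʳ-+ k (r ÷ₙ k) (s ÷ₙ k))
          (cong₂ ℕ._+_ (∣⇒÷ₙ 1≤k (proj₁ (divides⁴⁻ k D))) (∣⇒÷ₙ 1≤k (proj₂ (divides⁴⁻ k D))))))) M<km′))

    -- After exchanging the sums and putting m = k m′, the weight φ(k)/m splits as (φ(k)/k) ·
    -- (1/m′), and the sum over m′ is a coefficient of the logarithm by `w-sum`.
    total-formula : ι total ≡ ℚ∑.∑ (range M) (λ k → ℚ∑.when (divides⁴ k r ma s mb) ((ι (φ k) * inv k) * Λ k))
    total-formula = begin
      ι total
        ≡⟨ ι-∑ (upTo M) (λ i → length (necklaces (suc i) r ma s mb (s≤s z≤n))) ⟩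
      ℚ∑.∑ (upTo M) (λ i → ι (length (necklaces (suc i) r ma s mb (s≤s z≤n))))
        ≡⟨ ℚ∑.∑-cong (upTo M) (λ i i∈ → count i (∈-upTo⁻ i∈)) ⟩
      ℚ∑.∑ (upTo M) (λ i → ℚ∑.∑ (range M) (t (suc i)))
        ≡⟨ sym (ℚ∑.∑-map suc (upTo M) (λ m → ℚ∑.∑ (range M) (t m))) ⟩
      ℚ∑.∑ (range M) (λ m → ℚ∑.∑ (range M) (t m))
        ≡⟨ ℚ∑.∑-swap (range M) (range M) t ⟩
      ℚ∑.∑ (range M) (λ k → ℚ∑.∑ (range M) (λ m → t m k))
        ≡⟨ ℚ∑.∑-cong (range M) (λ k k∈ → column k (proj₁ (∈-range⁻ k∈))) ⟩
      ℚ∑.∑ (range M) (λ k → ℚ∑.when (divides⁴ k r ma s mb) ((ι (φ k) * inv k) * Λ k)) ∎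
      where
      open ≡-Reasoning
      open ℚS using (solve; _:=_; _:+_; _:*_; _:-_; :-_; con)
      f : ℕ → ℕ → ℕ → ℚ
      f k m′ m = inv m * (ι (φ k) * ι (w k m′))
      t : ℕ → ℕ → ℚ
      t m k = ℚ∑.when (k ∣ᵇ m) (f k (m ÷ₙ k) m)
      count : ∀ i → i < M → ι (length (necklaces (suc i) r ma s mb (s≤s z≤n))) ≡ ℚ∑.∑ (range M) (t (suc i))
      count i i<M = begin
        ι N
          ≡⟨ sym (trans (cong (_* ι N) (trans (*-comm (inv m) (ι m)) (ι*inv i))) (*-identityˡ (ι N))) ⟩
        (inv m * ι m) * ι N
          ≡⟨ trans (*-assoc (inv m) (ι m) (ι N)) (cong (inv m *_) (sym (ι-* m N))) ⟩
        inv m * ι (m ℕ.* N)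
          ≡⟨ cong (λ n → inv m * ι n) (necklace-count m r ma s mb (s≤s z≤n)) ⟩
        inv m * ι (∑ (range m) (λ k → when (k ∣ᵇ m) (φ k ℕ.* w k (m ÷ₙ k))))
          ≡⟨ trans (cong (inv m *_) (ι-∑ (range m) (λ k → when (k ∣ᵇ m) (φ k ℕ.* w k (m ÷ₙ k))))) (ℚ∑.∑-*ˡ (inv m) (range m) (λ k → ι (when (k ∣ᵇ m) (φ k ℕ.* w k (m ÷ₙ k))))) ⟩
        ℚ∑.∑ (range m) (λ k → inv m * ι (when (k ∣ᵇ m) (φ k ℕ.* w k (m ÷ₙ k))))
          ≡⟨ ℚ∑.∑-cong′ (range m) (λ k → push (k ∣ᵇ m) k) ⟩
        ℚ∑.∑ (range m) (t m)
          ≡⟨ ℚ∑.∑-map suc (upTo m) (t m) ⟩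
        ℚ∑.∑ (upTo m) (t m ∘ suc)
          ≡⟨ sym (ℚ∑.∑-upTo-extend i<M (t m ∘ suc) (λ k m≤k → cong (λ b → ℚ∑.when b (f (suc k) (m ÷ₙ suc k) m)) (dec-false (suc k ∣? m) (λ d → ℕₚ.<⇒≱ (s≤s m≤k) (∣⇒≤ d))))) ⟩
        ℚ∑.∑ (upTo M) (t m ∘ suc)
          ≡⟨ sym (ℚ∑.∑-map suc (upTo M) (t m)) ⟩
        ℚ∑.∑ (range M) (t m) ∎
        where
        m = suc i
        N = length (necklaces m r ma s mb (s≤s z≤n))
        push : ∀ b k → inv m * ι (when b (φ k ℕ.* w k (m ÷ₙ k))) ≡ ℚ∑.when b (f k (m ÷ₙ k) m)
        push true k = cong (inv m *_) (ι-* (φ k) (w k (m ÷ₙ k)))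
        push false k = trans (cong (inv m *_) ι-0) (*-zeroʳ (inv m))
      column : ∀ k → 1 ≤ k → ℚ∑.∑ (range M) (λ m → t m k) ≡ ℚ∑.when (divides⁴ k r ma s mb) ((ι (φ k) * inv k) * Λ k)
      column k 1≤k = begin
        ℚ∑.∑ (range M) (λ m → ℚ∑.when (k ∣ᵇ m) (f k (m ÷ₙ k) m))
          ≡⟨ ∑-multiples M k 1≤k (f k) (λ m′ p → trans (cong (λ n → inv (k ℕ.* m′) * (ι (φ k) * ι n)) (w-zero k m′ 1≤k p))
               (trans (cong (λ x → inv (k ℕ.* m′) * (ι (φ k) * x)) ι-0) (trans (cong (inv (k ℕ.* m′) *_) (*-zeroʳ (ι (φ k)))) (*-zeroʳ (inv (k ℕ.* m′)))))) ⟩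
        ℚ∑.∑ (range M) (λ m′ → inv (k ℕ.* m′) * (ι (φ k) * ι (w k m′)))
          ≡⟨ ℚ∑.∑-cong (range M) (λ m′ m′∈ → trans (cong (_* (ι (φ k) * ι (w k m′))) (inv-* k m′ 1≤k (proj₁ (∈-range⁻ m′∈))))
               (solve 4 (λ a b c d → (a :* b) :* (c :* d) := (c :* a) :* (b :* d)) refl (inv k) (inv m′) (ι (φ k)) (ι (w k m′)))) ⟩
        ℚ∑.∑ (range M) (λ m′ → (ι (φ k) * inv k) * (inv m′ * ι (w k m′)))
          ≡⟨ sym (ℚ∑.∑-*ˡ (ι (φ k) * inv k) (range M) (λ m′ → inv m′ * ι (w k m′))) ⟩
        (ι (φ k) * inv k) * ℚ∑.∑ (range M) (λ m′ → inv m′ * ι (w k m′))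
          ≡⟨ cong ((ι (φ k) * inv k) *_) (w-sum k 1≤k) ⟩
        (ι (φ k) * inv k) * ℚ∑.when (divides⁴ k r ma s mb) (Λ k)
          ≡⟨ ℚ∑.when-*ˡ (divides⁴ k r ma s mb) (ι (φ k) * inv k) (Λ k) ⟩
        ℚ∑.when (divides⁴ k r ma s mb) ((ι (φ k) * inv k) * Λ k) ∎

-- The two closed formulas.

module Formulas where

  open Sums
  open Forests
  open Necklaces
  open LogIdentity
  open CherryCounts
  open Summation
  import Data.List.Relation.Unary.Unique.Propositional.Properties as Uniqueₚ
  open import Data.Nat as ℕ using (ℕ; zero; suc; _≤_; z≤n; s≤s; _∸_)
  open import Data.Nat.Combinatorics using (_C_)
  open import Data.Nat.Divisibility using (_∣_; _∣?_; ∣m∣n⇒∣m+n)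
  import Data.Nat.Properties as ℕₚ
  open import Data.Rational using (ℚ; 0ℚ; 1ℚ; _+_; _*_; _-_; -_; ½)
  open import Data.Rational.Properties using (*-zeroˡ; *-zeroʳ; *-assoc; *-identityˡ; +-identityʳ)
  open import Data.Rational.Solver using () renaming (module +-*-Solver to ℚS)

  open ℚS using (solve; _:=_; _:+_; _:*_; _:-_; :-_; con)

  δ-refl : ∀ n → δ n n ≡ 1
  δ-refl n = cong 𝟙 (dec-true (n ℕ.≟ n) refl)

  δ-≢ : ∀ {m n} → m ≢ n → δ m n ≡ 0
  δ-≢ {m} {n} ne = cong 𝟙 (dec-false (m ℕ.≟ n) ne)

  inv-2 : inv 2 ≡ ½
  inv-2 = trans (sym (*-identityˡ (inv 2))) (sym (÷ℚ≡*inv 1ℚ 2))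

  logTerm-zeroˡ : ∀ r ma s mb i j → τ′ i r ma ≡ 0ℚ → logTerm r ma s mb i j ≡ 0ℚ
  logTerm-zeroˡ r ma s mb i j e = trans (cong (λ x → (x * τ′ j s mb) * X) e) (trans (cong (_* X) (*-zeroˡ (τ′ j s mb))) (*-zeroˡ X))
    where X = (ι (B i i) * ι (B j j)) * inv (2 ℕ.* (i ℕ.+ j))

  logTerm-zeroʳ : ∀ r ma s mb i j → τ′ j s mb ≡ 0ℚ → logTerm r ma s mb i j ≡ 0ℚ
  logTerm-zeroʳ r ma s mb i j e = trans (cong (λ x → (τ′ i r ma * x) * X) e) (trans (cong (_* X) (*-zeroʳ (τ′ i r ma))) (*-zeroˡ X))
    where X = (ι (B i i) * ι (B j j)) * inv (2 ℕ.* (i ℕ.+ j))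

  -- Without a cherry constraint only the term i = r, j = s survives.
  logTerm-free : ∀ r s → ℚ∑.∑ (upTo (suc r)) (λ i → ℚ∑.∑ (upTo (suc s)) (logTerm r nothing s nothing i)) ≡
                 (ι (B r r) * ι (B s s)) * inv (2 ℕ.* (r ℕ.+ s))
  logTerm-free r s = begin
    ℚ∑.∑ (upTo (suc r)) (λ i → ℚ∑.∑ (upTo (suc s)) (logTerm r nothing s nothing i))
      ≡⟨ ℚ∑.∑-delta (Uniqueₚ.upTo⁺ (suc r)) (∈-upTo⁺ ℕₚ.≤-refl) (λ i → ℚ∑.∑ (upTo (suc s)) (logTerm r nothing s nothing i))
           (λ i _ i≢r → ℚ∑.∑-zero (upTo (suc s)) (λ j _ → logTerm-zeroˡ r nothing s nothing i j (trans (cong ι (δ-≢ i≢r)) ι-0))) ⟩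
    ℚ∑.∑ (upTo (suc s)) (logTerm r nothing s nothing r)
      ≡⟨ ℚ∑.∑-delta (Uniqueₚ.upTo⁺ (suc s)) (∈-upTo⁺ ℕₚ.≤-refl) (logTerm r nothing s nothing r)
           (λ j _ j≢s → logTerm-zeroʳ r nothing s nothing r j (trans (cong ι (δ-≢ j≢s)) ι-0)) ⟩
    (ι (δ r r) * ι (δ s s)) * X
      ≡⟨ cong (_* X) (trans (cong₂ _*_ (trans (cong ι (δ-refl r)) ι-1) (trans (cong ι (δ-refl s)) ι-1)) (*-identityˡ 1ℚ)) ⟩
    1ℚ * X
      ≡⟨ *-identityˡ X ⟩
    X ∎
    where
    open ≡-Reasoning
    X = (ι (B r r) * ι (B s s)) * inv (2 ℕ.* (r ℕ.+ s))

  B-central : ∀ n → B n n ≡ (2 ℕ.* n) C n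
  B-central n = trans (B≡C n n) (cong (λ m → (n ℕ.+ m) C n) (sym (ℕₚ.+-identityʳ n)))

  ÷ₙ-+ : ∀ {m n k} → 1 ≤ k → k ∣ m → k ∣ n → (m ℕ.+ n) ÷ₙ k ≡ (m ÷ₙ k) ℕ.+ (n ÷ₙ k)
  ÷ₙ-+ {m} {n} {k} 1≤k k∣m k∣n = trans (cong (_÷ₙ k) (trans (cong₂ ℕ._+_ (sym (∣⇒÷ₙ 1≤k k∣m)) (sym (∣⇒÷ₙ 1≤k k∣n))) (sym (ℕₚ.*-distribʳ-+ k (m ÷ₙ k) (n ÷ₙ k)))))
    (*-÷ₙ ((m ÷ₙ k) ℕ.+ (n ÷ₙ k)) k 1≤k)

  ÷ₙ-∸ : ∀ {m n k} → 1 ≤ k → k ∣ m → k ∣ n → (m ∸ n) ÷ₙ k ≡ (m ÷ₙ k) ∸ (n ÷ₙ k)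
  ÷ₙ-∸ {m} {n} {k} 1≤k k∣m k∣n = trans (cong (_÷ₙ k) (trans (cong₂ _∸_ (sym (∣⇒÷ₙ 1≤k k∣m)) (sym (∣⇒÷ₙ 1≤k k∣n))) (sym (ℕₚ.*-distribʳ-∸ k (m ÷ₙ k) (n ÷ₙ k)))))
    (*-÷ₙ ((m ÷ₙ k) ∸ (n ÷ₙ k)) k 1≤k)

  -- The factor 1/k and the denominator 2(r/k + s/k) of the logarithm merge into 2(r + s), free of
  -- k.
  formula₁-total : ∀ r s (1≤r : 1 ≤ r) (1≤s : 1 ≤ s) → ι (Totals.total r nothing s nothing 1≤r 1≤s) ≡ formula₁ r s
  formula₁-total r s 1≤r 1≤s = begin
    ι total
      ≡⟨ total-formula ⟩
    ℚ∑.∑ (range M) (λ k → ℚ∑.when (divides⁴ k r nothing s nothing) ((ι (φ k) * inv k) * Λ k))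
      ≡⟨ ℚ∑.∑-map suc (upTo M) _ ⟩
    ℚ∑.∑ (upTo M) (λ j → ℚ∑.when (divides⁴ (suc j) r nothing s nothing) ((ι (φ (suc j)) * inv (suc j)) * Λ (suc j)))
      ≡⟨ ℚ∑.∑-cong′ (upTo M) (λ j → term (suc j) (s≤s z≤n)) ⟩
    ℚ∑.∑ (upTo M) (λ j → ½ * f (suc j))
      ≡⟨ sym (ℚ∑.∑-*ˡ ½ (upTo M) (λ j → f (suc j))) ⟩
    formula₁ r s ∎
    where
    open ≡-Reasoning
    open Totals r nothing s nothing 1≤r 1≤s
    f : ℕ → ℚ
    f k = if (k ∣ᵇ r) ∧ (k ∣ᵇ s)
          then (⟦ φ k ⟧ ÷ℚ (r ℕ.+ s)) * ⟦ (2 ℕ.* (r ÷ₙ k)) C (r ÷ₙ k) ⟧ * ⟦ (2 ℕ.* (s ÷ₙ k)) C (s ÷ₙ k) ⟧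
          else 0ℚ
    term : ∀ k → 1 ≤ k → ℚ∑.when (divides⁴ k r nothing s nothing) ((ι (φ k) * inv k) * Λ k) ≡ ½ * f k
    term k 1≤k = cases (k ∣? r) (k ∣? s)
      where
      a = r ÷ₙ k
      b = s ÷ₙ k
      X = (⟦ φ k ⟧ ÷ℚ (r ℕ.+ s)) * ⟦ (2 ℕ.* a) C a ⟧ * ⟦ (2 ℕ.* b) C b ⟧
      cases : (p : Dec (k ∣ r)) (q : Dec (k ∣ s)) →
        ℚ∑.when (does p ∧ true ∧ does q ∧ true) ((ι (φ k) * inv k) * Λ k) ≡ ½ * (if does p ∧ does q then X else 0ℚ)
      cases (no _) _ = sym (*-zeroʳ ½)
      cases (yes _) (no _) = sym (*-zeroʳ ½)
      cases (yes k∣r) (yes k∣s) = begin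
        (ι (φ k) * inv k) * Λ k
          ≡⟨ cong ((ι (φ k) * inv k) *_) (logTerm-free a b) ⟩
        (ι (φ k) * inv k) * ((ι (B a a) * ι (B b b)) * inv (2 ℕ.* (a ℕ.+ b)))
          ≡⟨ solve 5 (λ f v x y u → (f :* v) :* ((x :* y) :* u) := (v :* u) :* (f :* (x :* y))) refl (ι (φ k)) (inv k) (ι (B a a)) (ι (B b b)) (inv (2 ℕ.* (a ℕ.+ b))) ⟩
        (inv k * inv (2 ℕ.* (a ℕ.+ b))) * (ι (φ k) * (ι (B a a) * ι (B b b)))
          ≡⟨ cong (_* (ι (φ k) * (ι (B a a) * ι (B b b)))) inverses ⟩
        (½ * inv (r ℕ.+ s)) * (ι (φ k) * (ι (B a a) * ι (B b b)))
          ≡⟨ solve 5 (λ h v f x y → (h :* v) :* (f :* (x :* y)) := h :* (((f :* v) :* x) :* y)) refl ½ (inv (r ℕ.+ s)) (ι (φ k)) (ι (B a a)) (ι (B b b)) ⟩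
        ½ * (((ι (φ k) * inv (r ℕ.+ s)) * ι (B a a)) * ι (B b b))
          ≡⟨ cong (½ *_) (cong₂ _*_ (cong₂ _*_ (trans (cong (_* inv (r ℕ.+ s)) (ι-⟦⟧ (φ k))) (sym (÷ℚ≡*inv ⟦ φ k ⟧ (r ℕ.+ s))))
               (trans (cong ι (B-central a)) (ι-⟦⟧ ((2 ℕ.* a) C a)))) (trans (cong ι (B-central b)) (ι-⟦⟧ ((2 ℕ.* b) C b)))) ⟩
        ½ * X ∎
        where
        1≤a+b : 1 ≤ a ℕ.+ b
        1≤a+b = ℕₚ.≤-trans (1≤÷ₙ 1≤r k∣r 1≤k) (ℕₚ.m≤m+n a b)
        inverses : inv k * inv (2 ℕ.* (a ℕ.+ b)) ≡ ½ * inv (r ℕ.+ s)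
        inverses = begin
          inv k * inv (2 ℕ.* (a ℕ.+ b)) ≡⟨ cong (inv k *_) (inv-* 2 (a ℕ.+ b) (s≤s z≤n) 1≤a+b) ⟩
          inv k * (inv 2 * inv (a ℕ.+ b)) ≡⟨ solve 3 (λ x y z → x :* (y :* z) := y :* (z :* x)) refl (inv k) (inv 2) (inv (a ℕ.+ b)) ⟩
          inv 2 * (inv (a ℕ.+ b) * inv k) ≡⟨ cong₂ _*_ inv-2 (sym (inv-* (a ℕ.+ b) k 1≤a+b 1≤k)) ⟩
          ½ * inv ((a ℕ.+ b) ℕ.* k) ≡⟨ cong (λ n → ½ * inv n) (trans (ℕₚ.*-distribʳ-+ k a b) (cong₂ ℕ._+_ (∣⇒÷ₙ 1≤k k∣r) (∣⇒÷ₙ 1≤k k∣s))) ⟩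
          ½ * inv (r ℕ.+ s) ∎

  sgn-+ : ∀ m n → sgn (m ℕ.+ n) ≡ sgn m * sgn n
  sgn-+ zero n = sym (*-identityˡ (sgn n))
  sgn-+ (suc m) n = trans (cong -_ (sgn-+ m n)) (solve 2 (λ x y → :- (x :* y) := (:- x) :* y) refl (sgn m) (sgn n))

  -- The two signs supplied by `B*τ` split into one with exponent (r + r₂ + s + s₂)/k, common to all
  -- terms, and (-1)^(i+j).
  formula₂-total : ∀ r r₂ s s₂ (1≤r : 1 ≤ r) (1≤s : 1 ≤ s) → r₂ ≤ r → s₂ ≤ s →
    ι (Totals.total r (just r₂) s (just s₂) 1≤r 1≤s) ≡ formula₂ r r₂ s s₂
  formula₂-total r r₂ s s₂ 1≤r 1≤s r₂≤r s₂≤s = begin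
    ι total
      ≡⟨ total-formula ⟩
    ℚ∑.∑ (range M) (λ k → ℚ∑.when (divides⁴ k r (just r₂) s (just s₂)) ((ι (φ k) * inv k) * Λ k))
      ≡⟨ ℚ∑.∑-map suc (upTo M) _ ⟩
    ℚ∑.∑ (upTo M) (λ j → ℚ∑.when (divides⁴ (suc j) r (just r₂) s (just s₂)) ((ι (φ (suc j)) * inv (suc j)) * Λ (suc j)))
      ≡⟨ ℚ∑.∑-cong′ (upTo M) (λ j → term (suc j) (s≤s z≤n)) ⟩
    formula₂ r r₂ s s₂ ∎
    where
    open ≡-Reasoning
    open Totals r (just r₂) s (just s₂) 1≤r 1≤s
    module _ (k : ℕ) where
      summand : ℕ → ℕ → ℚ
      summand i j = if ⌊ i ℕ.+ j ℕ.≟ 0 ⌋ then 0ℚ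
                    else (sgn (i ℕ.+ j) ÷ℚ (2 ℕ.* (i ℕ.+ j))) * ⟦ mult k r r₂ i ⟧ * ⟦ mult k s s₂ j ⟧
      X : ℚ
      X = (⟦ φ k ⟧ ÷ℚ k) * sgn ((r ℕ.+ r₂ ℕ.+ s ℕ.+ s₂) ÷ₙ k) * ℚ∑.∑ (upTo (suc r)) (λ i → ℚ∑.∑ (upTo (suc s)) (summand i))
    term : ∀ k → 1 ≤ k → ℚ∑.when (divides⁴ k r (just r₂) s (just s₂)) ((ι (φ k) * inv k) * Λ k) ≡
           (if (k ∣ᵇ r) ∧ (k ∣ᵇ r₂) ∧ (k ∣ᵇ s) ∧ (k ∣ᵇ s₂) then X k else 0ℚ)
    term k 1≤k = cases (k ∣? r) (k ∣? r₂) (k ∣? s) (k ∣? s₂)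
      where
      cases : (p : Dec (k ∣ r)) (q : Dec (k ∣ r₂)) (p′ : Dec (k ∣ s)) (q′ : Dec (k ∣ s₂)) →
        ℚ∑.when (does p ∧ does q ∧ does p′ ∧ does q′) ((ι (φ k) * inv k) * Λ k) ≡ (if does p ∧ does q ∧ does p′ ∧ does q′ then X k else 0ℚ)
      cases (no _) _ _ _ = refl
      cases (yes _) (no _) _ _ = refl
      cases (yes _) (yes _) (no _) _ = refl
      cases (yes _) (yes _) (yes _) (no _) = refl
      cases (yes k∣r) (yes k∣r₂) (yes k∣s) (yes k∣s₂) = begin
        (ι (φ k) * inv k) * Λ k
          ≡⟨ cong₂ _*_ (trans (cong (_* inv k) (ι-⟦⟧ (φ k))) (sym (÷ℚ≡*inv ⟦ φ k ⟧ k))) sums ⟩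
        (⟦ φ k ⟧ ÷ℚ k) * (sgn E * Y)
          ≡⟨ sym (*-assoc (⟦ φ k ⟧ ÷ℚ k) (sgn E) Y) ⟩
        X k ∎
        where
        E = (r ℕ.+ r₂ ℕ.+ s ℕ.+ s₂) ÷ₙ k
        Y = ℚ∑.∑ (upTo (suc r)) (λ i → ℚ∑.∑ (upTo (suc s)) (summand k i))
        a = r ÷ₙ k
        z = r₂ ÷ₙ k
        b = s ÷ₙ k
        y = s₂ ÷ₙ k
        L : ℕ → ℕ → ℚ
        L = logTerm a (just z) b (just y)
        ÷≤ : ∀ {n} → k ∣ n → n ÷ₙ k ≤ n
        ÷≤ {n} k∣n = subst (n ÷ₙ k ≤_) (∣⇒÷ₙ 1≤k k∣n) (ℕₚ.m≤m*n (n ÷ₙ k) k {{ℕ.>-nonZero 1≤k}})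
        ÷mono : ∀ {m n} → k ∣ m → k ∣ n → m ≤ n → m ÷ₙ k ≤ n ÷ₙ k
        ÷mono k∣m k∣n m≤n = ℕₚ.*-cancelʳ-≤ _ _ k {{ℕ.>-nonZero 1≤k}} (subst₂ _≤_ (sym (∣⇒÷ₙ 1≤k k∣m)) (sym (∣⇒÷ₙ 1≤k k∣n)) m≤n)
        E≡ : E ≡ a ℕ.+ z ℕ.+ (b ℕ.+ y)
        E≡ = trans (cong (_÷ₙ k) (ℕₚ.+-assoc (r ℕ.+ r₂) s s₂)) (trans (÷ₙ-+ 1≤k (∣m∣n⇒∣m+n k∣r k∣r₂) (∣m∣n⇒∣m+n k∣s k∣s₂)) (cong₂ ℕ._+_ (÷ₙ-+ 1≤k k∣r k∣r₂) (÷ₙ-+ 1≤k k∣s k∣s₂)))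
        M≡ : ∀ i → ι (multi i a z (a ∸ z)) ≡ ⟦ mult k r r₂ i ⟧
        M≡ i = trans (cong (λ c → ι (multi i a z c)) (sym (÷ₙ-∸ 1≤k k∣r k∣r₂))) (ι-⟦⟧ (mult k r r₂ i))
        M′≡ : ∀ j → ι (multi j b y (b ∸ y)) ≡ ⟦ mult k s s₂ j ⟧
        M′≡ j = trans (cong (λ c → ι (multi j b y c)) (sym (÷ₙ-∸ 1≤k k∣s k∣s₂))) (ι-⟦⟧ (mult k s s₂ j))
        expandL : ∀ i j → L i j ≡ sgn E * ((sgn (i ℕ.+ j) * inv (2 ℕ.* (i ℕ.+ j))) * ⟦ mult k r r₂ i ⟧ * ⟦ mult k s s₂ j ⟧)
        expandL i j = begin
          (τ i a z * τ j b y) * ((ι (B i i) * ι (B j j)) * v)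
            ≡⟨ solve 5 (λ t u x y v → (t :* u) :* ((x :* y) :* v) := ((x :* t) :* (y :* u)) :* v) refl (τ i a z) (τ j b y) (ι (B i i)) (ι (B j j)) v ⟩
          ((ι (B i i) * τ i a z) * (ι (B j j) * τ j b y)) * v
            ≡⟨ cong (_* v) (cong₂ _*_ (trans (B*τ i a z (÷mono k∣r₂ k∣r r₂≤r)) (cong₂ _*_ (sgn-+ (a ℕ.+ z) i) (M≡ i)))
                                       (trans (B*τ j b y (÷mono k∣s₂ k∣s s₂≤s)) (cong₂ _*_ (sgn-+ (b ℕ.+ y) j) (M′≡ j)))) ⟩
          (((sgn (a ℕ.+ z) * sgn i) * m) * ((sgn (b ℕ.+ y) * sgn j) * m′)) * v
            ≡⟨ solve 7 (λ p i q j m n v → (((p :* i) :* m) :* ((q :* j) :* n)) :* v := (p :* q) :* ((((i :* j) :* v) :* m) :* n))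
                 refl (sgn (a ℕ.+ z)) (sgn i) (sgn (b ℕ.+ y)) (sgn j) m m′ v ⟩
          (sgn (a ℕ.+ z) * sgn (b ℕ.+ y)) * ((((sgn i * sgn j) * v) * m) * m′)
            ≡⟨ cong₂ (λ p q → p * (((q * v) * m) * m′)) (trans (sym (sgn-+ (a ℕ.+ z) (b ℕ.+ y))) (cong sgn (sym E≡))) (sym (sgn-+ i j)) ⟩
          sgn E * (((sgn (i ℕ.+ j) * v) * m) * m′) ∎
          where
          v = inv (2 ℕ.* (i ℕ.+ j))
          m = ⟦ mult k r r₂ i ⟧
          m′ = ⟦ mult k s s₂ j ⟧
        summand≡ : ∀ i j → L i j ≡ sgn E * summand k i j
        summand≡ i j = cases′ (i ℕ.+ j ℕ.≟ 0)
          where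
          cases′ : (d : Dec (i ℕ.+ j ≡ 0)) → L i j ≡ sgn E * (if ⌊ d ⌋ then 0ℚ
                   else (sgn (i ℕ.+ j) ÷ℚ (2 ℕ.* (i ℕ.+ j))) * ⟦ mult k r r₂ i ⟧ * ⟦ mult k s s₂ j ⟧)
          cases′ (no _) = trans (expandL i j) (cong (sgn E *_)
            (cong (λ x → x * ⟦ mult k r r₂ i ⟧ * ⟦ mult k s s₂ j ⟧) (sym (÷ℚ≡*inv (sgn (i ℕ.+ j)) (2 ℕ.* (i ℕ.+ j))))))
          -- The pair (0,0), skipped by the formula, vanishes on the left as well because `inv 0` is
          -- 0.
          cases′ (yes e) = begin
            L i j
              ≡⟨ cong (λ n → (τ i a z * τ j b y) * ((ι (B i i) * ι (B j j)) * inv (2 ℕ.* n))) e ⟩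
            (τ i a z * τ j b y) * ((ι (B i i) * ι (B j j)) * inv 0)
              ≡⟨ cong (λ x → (τ i a z * τ j b y) * ((ι (B i i) * ι (B j j)) * x)) inv-0 ⟩
            (τ i a z * τ j b y) * ((ι (B i i) * ι (B j j)) * 0ℚ)
              ≡⟨ trans (cong ((τ i a z * τ j b y) *_) (*-zeroʳ (ι (B i i) * ι (B j j)))) (*-zeroʳ (τ i a z * τ j b y)) ⟩
            0ℚ
              ≡⟨ sym (*-zeroʳ (sgn E)) ⟩
            sgn E * 0ℚ ∎
        sums : Λ k ≡ sgn E * Y
        sums = begin
          ℚ∑.∑ (upTo (suc a)) (λ i → ℚ∑.∑ (upTo (suc b)) (L i))
            -- The formula lets i run up to r and j up to s; beyond r/k and s/k the coefficients `τ`
            -- are 0.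
            ≡⟨ sym (ℚ∑.∑-upTo-extend (s≤s (÷≤ k∣r)) (λ i → ℚ∑.∑ (upTo (suc b)) (L i)) (λ i a<i → ℚ∑.∑-zero (upTo (suc b)) (λ j _ →
                 logTerm-zeroˡ a (just z) b (just y) i j (τ-high i a z (ℕₚ.≤-trans a<i (ℕₚ.m≤m+n i z)))))) ⟩
          ℚ∑.∑ (upTo (suc r)) (λ i → ℚ∑.∑ (upTo (suc b)) (L i))
            ≡⟨ ℚ∑.∑-cong′ (upTo (suc r)) (λ i → sym (ℚ∑.∑-upTo-extend (s≤s (÷≤ k∣s)) (L i) (λ j b<j →
                 logTerm-zeroʳ a (just z) b (just y) i j (τ-high j b y (ℕₚ.≤-trans b<j (ℕₚ.m≤m+n j y)))))) ⟩
          ℚ∑.∑ (upTo (suc r)) (λ i → ℚ∑.∑ (upTo (suc s)) (L i))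
            ≡⟨ ℚ∑.∑-cong′ (upTo (suc r)) (λ i → trans (ℚ∑.∑-cong′ (upTo (suc s)) (summand≡ i)) (sym (ℚ∑.∑-*ˡ (sgn E) (upTo (suc s)) (summand k i)))) ⟩
          ℚ∑.∑ (upTo (suc r)) (λ i → sgn E * ℚ∑.∑ (upTo (suc s)) (summand k i))
            ≡⟨ sym (ℚ∑.∑-*ˡ (sgn E) (upTo (suc r)) (λ i → ℚ∑.∑ (upTo (suc s)) (summand k i))) ⟩
          sgn E * Y ∎

-- Cyclic positions, base arrows and induced cycles.

module Cycles where

  open Sums
  open import Data.Fin using (Fin; zero; suc; toℕ)
  open import Data.Fin.Properties using (toℕ-fromℕ<; toℕ-injective; toℕ<n) renaming (_≟_ to _≟ᶠ_)
  open import Data.List.Relation.Unary.Unique.Propositional.Properties using (allFin⁺)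
  open import Data.Nat as ℕ using (ℕ; zero; suc; _+_; _*_; _∸_; _≤_; z≤n; s≤s; _%_; _/_)
  open import Data.Nat.DivMod using (_mod_; m%n<n; %-distribˡ-+; m%n%n≡m%n; m≡m%n+[m/n]*n; [m+n]%n≡m%n; m<n⇒m%n≡m)
  open import Data.Nat.Properties
  open import Data.Sum using (swap)

  ⌊⌋-true : ∀ {P : Set} (d : Dec P) → P → ⌊ d ⌋ ≡ true
  ⌊⌋-true (yes _) p = refl
  ⌊⌋-true (no ¬p) p = ⊥-elim (¬p p)

  ⌊⌋-false : ∀ {P : Set} (d : Dec P) → ¬ P → ⌊ d ⌋ ≡ false
  ⌊⌋-false (yes p) ¬p = ⊥-elim (¬p p)
  ⌊⌋-false (no _) ¬p = refl

  ⌊⌋-true⁻ : ∀ {P : Set} (d : Dec P) → ⌊ d ⌋ ≡ true → P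
  ⌊⌋-true⁻ (yes p) _ = p

  1≤𝟙 : ∀ {b} → 1 ≤ 𝟙 b → b ≡ true
  1≤𝟙 {true} _ = refl

  1≤𝟙∧ : ∀ a {b} → 1 ≤ 𝟙 (a ∧ b) → a ≡ true × b ≡ true
  1≤𝟙∧ true p = refl , 1≤𝟙 p

  1≤+ : ∀ a {b} → 1 ≤ a + b → 1 ≤ a ⊎ 1 ≤ b
  1≤+ zero p = inj₂ p
  1≤+ (suc a) p = inj₁ (s≤s z≤n)

  ∑-positive : ∀ {X : Set} (xs : List X) f → 1 ≤ ∑ xs f → ∃[ x ] 1 ≤ f x
  ∑-positive (x ∷ xs) f p = [ (λ q → x , q) , ∑-positive xs f ]′ (1≤+ (f x) p)

  ∑-member : ∀ {X : Set} {xs : List X} {x} f → x ∈ xs → f x ≤ ∑ xs f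
  ∑-member f (here refl) = m≤m+n _ _
  ∑-member f (there x∈) = ≤-trans (∑-member f x∈) (m≤n+m _ _)

  module Cyclic (m₀ : ℕ) where

    m : ℕ
    m = suc (suc m₀)

    step : ℕ → Fin m → Fin m
    step k i = (toℕ i + k) mod m

    toℕ-mod : ∀ a → toℕ (a mod m) ≡ a % m
    toℕ-mod a = toℕ-fromℕ< (m%n<n a m)

    toℕ-step : ∀ k i → toℕ (step k i) ≡ (toℕ i + k) % m
    toℕ-step k i = toℕ-mod (toℕ i + k)

    step-+ : ∀ k l i → step k (step l i) ≡ step (l + k) i
    step-+ k l i = toℕ-injective (begin
      toℕ (step k (step l i)) ≡⟨ toℕ-step k (step l i) ⟩
      (toℕ (step l i) + k) % m ≡⟨ cong (λ z → (z + k) % m) (toℕ-step l i) ⟩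
      ((toℕ i + l) % m + k) % m ≡⟨ %-distribˡ-+ ((toℕ i + l) % m) k m ⟩
      ((toℕ i + l) % m % m + k % m) % m ≡⟨ cong (λ z → (z + k % m) % m) (m%n%n≡m%n (toℕ i + l) m) ⟩
      ((toℕ i + l) % m + k % m) % m ≡⟨ sym (%-distribˡ-+ (toℕ i + l) k m) ⟩
      (toℕ i + l + k) % m ≡⟨ cong (_% m) (+-assoc (toℕ i) l k) ⟩
      (toℕ i + (l + k)) % m ≡⟨ sym (toℕ-step (l + k) i) ⟩
      toℕ (step (l + k) i) ∎)
      where open ≡-Reasoning

    step-m : ∀ i → step m i ≡ i
    step-m i = toℕ-injective (trans (toℕ-step m i) (trans ([m+n]%n≡m%n (toℕ i) m) (m<n⇒m%n≡m (toℕ<n i))))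

    step-0 : ∀ i → step 0 i ≡ i
    step-0 i = toℕ-injective (trans (toℕ-step 0 i) (trans (cong (_% m) (+-identityʳ (toℕ i))) (m<n⇒m%n≡m (toℕ<n i))))

    next≡step : ∀ i → next i ≡ step 1 i
    next≡step i = cong (_mod m) (+-comm 1 (toℕ i))

    prev : Fin m → Fin m
    prev = step (suc m₀)

    next-prev : ∀ i → next (prev i) ≡ i
    next-prev i = trans (next≡step (prev i)) (trans (step-+ 1 (suc m₀) i) (trans (cong (λ k → step k i) (+-comm (suc m₀) 1)) (step-m i)))

    prev-next : ∀ i → prev (next i) ≡ i
    prev-next i = trans (cong prev (next≡step i)) (trans (step-+ (suc m₀) 1 i) (step-m i))

    next-injective : ∀ {i j} → next i ≡ next j → i ≡ j
    next-injective {i} {j} e = trans (sym (prev-next i)) (trans (cong prev e) (prev-next j))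

    -- The step k is then a multiple of m, and a positive one.
    step-fix : ∀ k i → step k i ≡ i → 1 ≤ k → m ≤ k
    step-fix k i e 1≤k = subst (m ≤_) (sym k≡) (m≤n*m m ((toℕ i + k) / m) {{ℕ.≢-nonZero q≢0}})
      where
      k≡ : k ≡ (toℕ i + k) / m * m
      k≡ = +-cancelˡ-≡ (toℕ i) _ _ (trans (m≡m%n+[m/n]*n (toℕ i + k) m)
        (cong (_+ (toℕ i + k) / m * m) (trans (sym (toℕ-step k i)) (cong toℕ e))))
      q≢0 : (toℕ i + k) / m ≢ 0
      q≢0 q≡0 = <⇒≢ 1≤k (sym (trans k≡ (cong (_* m) q≡0)))

    next≢ : ∀ i → next i ≢ i
    next≢ i e with step-fix 1 i (trans (sym (next≡step i)) e) (s≤s z≤n)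
    ... | s≤s ()

    next²≡ : ∀ i → next (next i) ≡ step 2 i
    next²≡ i = trans (next≡step (next i)) (trans (cong (step 1) (next≡step i)) (step-+ 1 1 i))

    next²-fix : ∀ i → next (next i) ≡ i → m₀ ≡ 0
    next²-fix i e = n≤0⇒n≡0 (≤-pred (≤-pred (step-fix 2 i (trans (sym (next²≡ i)) e) (s≤s z≤n))))

    next³-fix : ∀ i → next (next (next i)) ≡ i → m₀ ≤ 1
    next³-fix i e = ≤-pred (≤-pred (step-fix 3 i (trans (sym (trans (next≡step (next (next i))) (trans (cong (step 1) (next²≡ i)) (step-+ 1 2 i)))) e) (s≤s z≤n)))

    -- Induction around the cycle. Going j + (m - i) steps leads from i to j without comparing the
    -- two.
    next-closed : (P : Fin m → Set) → (∀ i → P i → P (next i)) → ∀ i → P i → ∀ j → P j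
    next-closed P cl i Pi j = subst P reach (walk (toℕ j + (m ∸ toℕ i)))
      where
      walk : ∀ k → P (step k i)
      walk zero = subst P (sym (step-0 i)) Pi
      walk (suc k) = subst P (trans (next≡step (step k i)) (trans (step-+ 1 k i) (cong (λ l → step l i) (+-comm k 1)))) (cl (step k i) (walk k))
      reach : step (toℕ j + (m ∸ toℕ i)) i ≡ j
      reach = toℕ-injective (begin
        toℕ (step (toℕ j + (m ∸ toℕ i)) i) ≡⟨ toℕ-step _ i ⟩
        (toℕ i + (toℕ j + (m ∸ toℕ i))) % m ≡⟨ cong (_% m) (trans (sym (+-assoc (toℕ i) (toℕ j) _)) (trans (cong (_+ (m ∸ toℕ i)) (+-comm (toℕ i) (toℕ j))) (+-assoc (toℕ j) (toℕ i) _))) ⟩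
        (toℕ j + (toℕ i + (m ∸ toℕ i))) % m ≡⟨ cong (λ z → (toℕ j + z) % m) (m+[n∸m]≡n (<⇒≤ (toℕ<n i))) ⟩
        (toℕ j + m) % m ≡⟨ [m+n]%n≡m%n (toℕ j) m ⟩
        toℕ j % m ≡⟨ m<n⇒m%n≡m (toℕ<n j) ⟩
        toℕ j ∎)
        where open ≡-Reasoning

    module Oriented (w : Fin m → Bool) where

      base : Fin m → Fin m → ℕ
      base = baseCount w

      baseCount⁻ : ∀ {i j} → 1 ≤ base i j → ∃[ t ] tailB w t ≡ i × headB w t ≡ j
      baseCount⁻ {i} {j} p with ∑-positive (allFin m) (λ t → 𝟙 (⌊ tailB w t ≟ᶠ i ⌋ ∧ ⌊ headB w t ≟ᶠ j ⌋)) p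
      ... | t , q with 1≤𝟙∧ ⌊ tailB w t ≟ᶠ i ⌋ q
      ... | u , v = t , ⌊⌋-true⁻ (tailB w t ≟ᶠ i) u , ⌊⌋-true⁻ (headB w t ≟ᶠ j) v

      baseCount⁺ : ∀ t → 1 ≤ base (tailB w t) (headB w t)
      baseCount⁺ t = ≤-trans (≤-reflexive (sym (cong₂ (λ a b → 𝟙 (a ∧ b)) (⌊⌋-true (tailB w t ≟ᶠ tailB w t) refl) (⌊⌋-true (headB w t ≟ᶠ headB w t) refl))))
        (∑-member (λ s → 𝟙 (⌊ tailB w s ≟ᶠ tailB w t ⌋ ∧ ⌊ headB w s ≟ᶠ headB w t ⌋)) (∈-allFin t))

      tail≢head : ∀ t → tailB w t ≢ headB w t
      tail≢head t with w t
      ... | true = next≢ t ∘ sym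
      ... | false = next≢ t

      ends : ∀ {t i j} → tailB w t ≡ i → headB w t ≡ j → (t ≡ i × next t ≡ j × w t ≡ true) ⊎ (t ≡ j × next t ≡ i × w t ≡ false)
      ends {t} p q with w t
      ... | true = inj₁ (p , q , refl)
      ... | false = inj₂ (q , p , refl)

      base-loop : ∀ i → base i i ≡ 0
      base-loop i = n≤0⇒n≡0 (≮⇒≥ λ p → let (t , u , v) = baseCount⁻ {i} {i} p in tail≢head t (trans u (sym v)))

      arrow-adjacent : ∀ {i j} → 1 ≤ base i j → j ≡ next i ⊎ i ≡ next j
      arrow-adjacent {i} {j} p = let (t , u , v) = baseCount⁻ {i} {j} p in
        [ (λ (a , b , _) → inj₁ (trans (sym b) (cong next a))) , (λ (a , b , _) → inj₂ (trans (sym b) (cong next a))) ]′ (ends {t} u v)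

      adjacent : ∀ {i j} → 1 ≤ base i j + base j i → j ≡ next i ⊎ i ≡ next j
      adjacent {i} {j} p = [ arrow-adjacent {i} {j} , swap ∘ arrow-adjacent {j} {i} ]′ (1≤+ (base i j) p)

      adjacent-next : ∀ i → 1 ≤ base i (next i) + base (next i) i
      adjacent-next i = lem (w i) refl
        where
        lem : ∀ b → w i ≡ b → 1 ≤ base i (next i) + base (next i) i
        lem true e = ≤-trans (subst (1 ≤_) (cong₂ base (cong (λ c → if c then i else next i) e) (cong (λ c → if c then next i else i) e)) (baseCount⁺ i)) (m≤m+n _ _)
        lem false e = ≤-trans (subst (1 ≤_) (cong₂ base (cong (λ c → if c then i else next i) e) (cong (λ c → if c then next i else i) e)) (baseCount⁺ i)) (m≤n+m _ (base i (next i)))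

      -- For m ≥ 3 the only base arrow between i and next i is the one at position i.
      forward : ∀ i → m₀ ≢ 0 → 1 ≤ base i (next i) → w i ≡ true
      forward i m₀≢0 p = let (t , u , v) = baseCount⁻ {i} {next i} p in
        [ (λ (a , _ , c) → trans (cong w (sym a)) c) , (λ (a , b , _) → ⊥-elim (m₀≢0 (next²-fix i (trans (cong next (sym a)) b)))) ]′ (ends {t} u v)

      backward : ∀ i → m₀ ≢ 0 → 1 ≤ base (next i) i → w i ≡ false
      backward i m₀≢0 p = let (t , u , v) = baseCount⁻ {next i} {i} p in
        [ (λ (a , b , _) → ⊥-elim (m₀≢0 (next²-fix i (trans (cong next (sym a)) b)))) , (λ (a , _ , c) → trans (cong w (sym a)) c) ]′ (ends {t} u v)

      single-arrow : ∀ i → m₀ ≢ 0 → base i (next i) + base (next i) i ≤ 1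
      single-arrow i m₀≢0 = ≤-reflexive (begin
        base i (next i) + base (next i) i ≡⟨ sym (∑-+ (allFin m) (λ t → 𝟙 (⌊ tailB w t ≟ᶠ i ⌋ ∧ ⌊ headB w t ≟ᶠ next i ⌋)) (λ t → 𝟙 (⌊ tailB w t ≟ᶠ next i ⌋ ∧ ⌊ headB w t ≟ᶠ i ⌋))) ⟩
        ∑ (allFin m) f ≡⟨ ∑-delta (allFin⁺ m) (∈-allFin i) f other ⟩
        f i ≡⟨ atI (w i) refl ⟩
        1 ∎)
        where
        open ≡-Reasoning
        f : Fin m → ℕ
        f t = 𝟙 (⌊ tailB w t ≟ᶠ i ⌋ ∧ ⌊ headB w t ≟ᶠ next i ⌋) + 𝟙 (⌊ tailB w t ≟ᶠ next i ⌋ ∧ ⌊ headB w t ≟ᶠ i ⌋)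
        atI : ∀ b → w i ≡ b → f i ≡ 1
        atI true e rewrite e | ⌊⌋-true (i ≟ᶠ i) refl | ⌊⌋-true (next i ≟ᶠ next i) refl | ⌊⌋-false (i ≟ᶠ next i) (next≢ i ∘ sym) = refl
        atI false e rewrite e | ⌊⌋-true (i ≟ᶠ i) refl | ⌊⌋-true (next i ≟ᶠ next i) refl | ⌊⌋-false (next i ≟ᶠ i) (next≢ i) = refl
        other : ∀ t → t ∈ allFin m → t ≢ i → f t ≡ 0
        other t _ t≢i = n≤0⇒n≡0 (≮⇒≥ λ p → absurd p)
          where
          contra : ∀ {x y} → tailB w t ≡ x → headB w t ≡ y → (x ≡ i × y ≡ next i) ⊎ (x ≡ next i × y ≡ i) → ⊥
          contra u v c with ends {t} u v | c
          ... | inj₁ (p , e , _) | inj₁ (refl , refl) = t≢i p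
          ... | inj₁ (p , e , _) | inj₂ (refl , refl) = m₀≢0 (next²-fix i (trans (cong next (sym p)) e))
          ... | inj₂ (p , e , _) | inj₁ (refl , refl) = m₀≢0 (next²-fix i (trans (cong next (sym p)) e))
          ... | inj₂ (p , e , _) | inj₂ (refl , refl) = t≢i p
          absurd : 1 ≤ f t → ⊥
          absurd p with 1≤+ (𝟙 (⌊ tailB w t ≟ᶠ i ⌋ ∧ ⌊ headB w t ≟ᶠ next i ⌋)) p
          ... | inj₁ q with 1≤𝟙∧ ⌊ tailB w t ≟ᶠ i ⌋ q
          ... | u , v = contra (⌊⌋-true⁻ (tailB w t ≟ᶠ i) u) (⌊⌋-true⁻ (headB w t ≟ᶠ next i) v) (inj₁ (refl , refl))
          absurd p | inj₂ q with 1≤𝟙∧ ⌊ tailB w t ≟ᶠ next i ⌋ q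
          ... | u , v = contra (⌊⌋-true⁻ (tailB w t ≟ᶠ next i) u) (⌊⌋-true⁻ (headB w t ≟ᶠ i) v) (inj₂ (refl , refl))

  -- In a 2-cycle both positions join the same pair of vertices.
  double-arrow : ∀ (w : Fin 2 → Bool) i → baseCount w i (next i) + baseCount w (next i) i ≡ 2
  double-arrow w zero with w zero | w (suc zero)
  ... | true | true = refl
  ... | true | false = refl
  ... | false | true = refl
  ... | false | false = refl
  double-arrow w (suc zero) with w zero | w (suc zero)
  ... | true | true = refl
  ... | true | false = refl
  ... | false | true = refl
  ... | false | false = refl

  -- The vertex v can be eliminated when a and b are its only neighbours on the cycle.
  record Simplicial {V : Set} (A : V → V → ℕ) (v a b : V) : Set where
    field
      single-a : A v a + A a v ≤ 1
      single-b : A v b + A b v ≤ 1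
      shape : a ≡ b ⊎ (1 ≤ A v a × 1 ≤ A a b × 1 ≤ A b v)

  module InducedCycle {V : Set} (A : V → V → ℕ) (m₀ : ℕ) (c : Fin (suc (suc m₀)) → V) (w : Fin (suc (suc m₀)) → Bool)
    (inj : ∀ i j → c i ≡ c j → i ≡ j) (mixed : ∃[ i ] ∃[ j ] w i ≢ w j)
    (full : ∀ i j → A (c i) (c j) ≡ baseCount w i j) where

    open Cyclic m₀
    open Oriented w

    adj : V → V → ℕ
    adj u v = A u v + A v u

    adj-next : ∀ i → 1 ≤ adj (c i) (c (next i))
    adj-next i = subst (1 ≤_) (sym (cong₂ _+_ (full i (next i)) (full (next i) i))) (adjacent-next i)

    adj-prev : ∀ i → 1 ≤ adj (c i) (c (prev i))
    adj-prev i = subst (λ j → 1 ≤ adj (c j) (c (prev i))) (next-prev i)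
      (subst (1 ≤_) (+-comm (A (c (prev i)) (c (next (prev i)))) _) (adj-next (prev i)))

    -- Three consecutive equal orientations exhaust a 3-cycle, against `mixed`.
    constant : m₀ ≡ 1 → ∀ i b → w i ≡ b → w (next i) ≡ b → w (next (next i)) ≡ b → ⊥
    constant refl i b p q r = let (j , k , ne) = mixed in ne (trans (all j) (sym (all k)))
      where
      all : ∀ j → w j ≡ b
      all j = proj₁ (next-closed (λ j → w j ≡ b × w (next j) ≡ b × w (next (next j)) ≡ b)
        (λ j (x , y , z) → y , z , subst (λ k → w k ≡ b) (sym (next³ j)) x) i (p , q , r) j)
        where
        next³ : ∀ (j : Fin 3) → next (next (next j)) ≡ j
        next³ zero = refl
        next³ (suc zero) = refl
        next³ (suc (suc zero)) = refl

    -- On a 2-cycle a vertex has a double arrow, against the bounds of `Simplicial`. On a longer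
    -- cycle its two neighbours are distinct, hence are a and b; the oriented 3-cycle through them
    -- then closes up the cycle, which has length 3 and is oriented.
    no-simplicial : ∀ i a b → Simplicial A (c i) a b → (∀ j → 1 ≤ adj (c i) (c j) → c j ≡ a ⊎ c j ≡ b) → ⊥
    no-simplicial i a b S nbr = short (m₀ ℕ.≟ 0)
      where
      open Simplicial S
      short : Dec (m₀ ≡ 0) → ⊥
      short (yes refl) = case-double (nbr (next i) (adj-next i))
        where
        two : adj (c i) (c (next i)) ≡ 2
        two = trans (cong₂ _+_ (full i (next i)) (full (next i) i)) (double-arrow w i)
        case-double : c (next i) ≡ a ⊎ c (next i) ≡ b → ⊥
        case-double (inj₁ e) = <-irrefl refl (≤-trans (≤-reflexive (trans (sym two) (cong (adj (c i)) e))) single-a)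
        case-double (inj₂ e) = <-irrefl refl (≤-trans (≤-reflexive (trans (sym two) (cong (adj (c i)) e))) single-b)
      short (no m₀≢0) = long (nbr (next i) (adj-next i)) (nbr (prev i) (adj-prev i)) shape
        where
        next≢prev : next i ≢ prev i
        next≢prev e = m₀≢0 (next²-fix i (trans (cong next e) (next-prev i)))
        closing : 1 ≤ base (next i) (prev i) + base (prev i) (next i) → next (next i) ≡ prev i
        closing p = [ sym , (λ e → ⊥-elim (next≢ i (trans e (next-prev i)))) ]′ (adjacent {next i} {prev i} p)
        three : next (next i) ≡ prev i → m₀ ≡ 1
        three e = ≤-antisym (next³-fix i (trans (cong next e) (next-prev i))) (n≢0⇒n>0 m₀≢0)
        next³ : next (next i) ≡ prev i → next (next (next i)) ≡ i
        next³ e = trans (cong next e) (next-prev i)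
        long : c (next i) ≡ a ⊎ c (next i) ≡ b → c (prev i) ≡ a ⊎ c (prev i) ≡ b →
               a ≡ b ⊎ (1 ≤ A (c i) a × 1 ≤ A a b × 1 ≤ A b (c i)) → ⊥
        long (inj₁ refl) (inj₁ e) _ = next≢prev (inj (next i) (prev i) (sym e))
        long (inj₂ refl) (inj₂ e) _ = next≢prev (inj (next i) (prev i) (sym e))
        long (inj₁ refl) (inj₂ refl) (inj₁ e) = next≢prev (inj (next i) (prev i) e)
        long (inj₂ refl) (inj₁ refl) (inj₁ e) = next≢prev (inj (next i) (prev i) (sym e))
        -- The 3-cycle runs forward here, and backward in the last clause, where a and b trade
        -- places.
        long (inj₁ refl) (inj₂ refl) (inj₂ (p , q , r)) = constant (three e) i true
          (forward i m₀≢0 (subst (1 ≤_) (full i (next i)) p))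
          (forward (next i) m₀≢0 (subst (λ j → 1 ≤ base (next i) j) (sym e) q′))
          (forward (next (next i)) m₀≢0 (subst₂ (λ j k → 1 ≤ base j k) (sym e) (sym (next³ e)) (subst (1 ≤_) (full (prev i) i) r)))
          where
          q′ = subst (1 ≤_) (full (next i) (prev i)) q
          e = closing (≤-trans q′ (m≤m+n _ _))
        long (inj₂ refl) (inj₁ refl) (inj₂ (p , q , r)) = constant (three e) i false
          (backward i m₀≢0 (subst (1 ≤_) (full (next i) i) r))
          (backward (next i) m₀≢0 (subst (λ j → 1 ≤ base j (next i)) (sym e) q′))
          (backward (next (next i)) m₀≢0 (subst₂ (λ j k → 1 ≤ base j k) (sym (next³ e)) (sym e) (subst (1 ≤_) (full i (prev i)) p)))
          where
          q′ = subst (1 ≤_) (full (prev i) (next i)) q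
          e = closing (≤-trans q′ (m≤n+m _ (base (next i) (prev i))))

  -- A cycle of base vertices inside the base cycle runs all the way round it.
  module CycleInCycle (M₀ : ℕ) (W : Fin (suc (suc M₀)) → Bool) (m₀ : ℕ) (w : Fin (suc (suc m₀)) → Bool)
    (f : Fin (suc (suc m₀)) → Fin (suc (suc M₀))) (f-inj : ∀ i j → f i ≡ f j → i ≡ j)
    (full : ∀ i j → baseCount W (f i) (f j) ≡ baseCount w i j) where

    module I = Cyclic m₀
    module O = Cyclic M₀
    module IO = I.Oriented w
    module OO = O.Oriented W

    Hit : Fin (suc (suc M₀)) → Set
    Hit k = ∃[ j ] f j ≡ k

    adj-f : ∀ j k → 1 ≤ baseCount w j k + baseCount w k j → f k ≡ next (f j) ⊎ f j ≡ next (f k)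
    adj-f j k p = OO.adjacent {f j} {f k} (subst (1 ≤_) (sym (cong₂ _+_ (full j k) (full k j))) p)

    -- Neighbours on the inner cycle go to neighbours on the base cycle. If neither neighbour of j
    -- goes to the successor of f j, both go to its predecessor and coincide. The inner cycle is
    -- then a double arrow, so the base cycle has length 2, where predecessor and successor agree.
    hit-next : ∀ j → Hit (next (f j))
    hit-next j = [ (λ e → next j , e) , (λ e → [ turned e , (λ e′ → I.prev j , e′) ]′ before) ]′ (adj-f j (next j) (IO.adjacent-next j))
      where
      before : f j ≡ next (f (I.prev j)) ⊎ f (I.prev j) ≡ next (f j)
      before = adj-f (I.prev j) j (subst (λ k → 1 ≤ baseCount w (I.prev j) k + baseCount w k (I.prev j)) (I.next-prev j) (IO.adjacent-next (I.prev j)))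
      double : m₀ ≡ 0 → f j ≡ next (f (next j)) → Dec (M₀ ≡ 0) → Hit (next (f j))
      double refl e (yes refl) = next j , sym (trans (cong next e) (next² (f (next j))))
        where
        next² : ∀ (k : Fin 2) → next (next k) ≡ k
        next² zero = refl
        next² (suc zero) = refl
      double refl e (no M₀≢0) = ⊥-elim (<-irrefl refl (≤-trans (≤-reflexive two) (OO.single-arrow (f (next j)) M₀≢0)))
        where
        two : 2 ≡ baseCount W (f (next j)) (next (f (next j))) + baseCount W (next (f (next j))) (f (next j))
        two = sym (trans (cong (λ k → baseCount W (f (next j)) k + baseCount W k (f (next j))) (sym e))
          (trans (cong₂ _+_ (full (next j) j) (full j (next j))) (trans (+-comm (baseCount w (next j) j) _) (double-arrow w j))))
      turned : f j ≡ next (f (next j)) → f j ≡ next (f (I.prev j)) → Hit (next (f j))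
      turned e e′ = double (I.next²-fix j (trans (cong next (f-inj (next j) (I.prev j) (O.next-injective (trans (sym e) e′)))) (I.next-prev j))) e (M₀ ℕ.≟ 0)

    hit-all : ∀ k → Hit k
    hit-all = O.next-closed Hit (λ { _ (j , refl) → hit-next j }) (f zero) (zero , refl)

-- The rooted quiver of a binary tree and its 3-cycles.

module TreeQuivers where

  open Sums
  open Forests using (BT; leaf; node; isLeaf; leaves; cherries; 𝟙-∧)
  open Cycles
  open import Data.Bool using (not)
  import Data.Bool.Properties as Boolₚ
  open import Data.Fin using (Fin)
  open import Data.List using (map; filter)
  open import Data.List.Membership.Propositional.Properties using (∈-++⁺ˡ; ∈-++⁺ʳ; ∈-++⁻)
  open import Data.List.Relation.Unary.All as All using (All; []; _∷_)
  open import Data.List.Relation.Unary.AllPairs using ([]; _∷_)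
  import Data.List.Relation.Unary.Unique.Propositional.Properties as Uniqueₚ
  open import Data.Nat as ℕ using (ℕ; suc; _+_; _*_)
  open import Data.Nat.Properties
  open import Data.Nat.Solver using () renaming (module +-*-Solver to ℕS)

  -- The internal nodes of a binary tree are the vertices of a rooted quiver of
  -- type A: a node points to its left child, its right child points to it, and
  -- the left child points to the right one.
  data Node : BT → Set where
    top : ∀ {l r} → Node (node l r)
    inl : ∀ {l r} → Node l → Node (node l r)
    inr : ∀ {l r} → Node r → Node (node l r)

  isTop : ∀ {t} → Node t → Bool
  isTop top = true
  isTop (inl _) = false
  isTop (inr _) = false

  arrT : ∀ {t} → Node t → Node t → ℕ
  arrT top top = 0
  arrT top (inl x) = 𝟙 (isTop x)
  arrT top (inr y) = 0
  arrT (inl x) top = 0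
  arrT (inl x) (inl y) = arrT x y
  arrT (inl x) (inr y) = 𝟙 (isTop x ∧ isTop y)
  arrT (inr x) top = 𝟙 (isTop x)
  arrT (inr x) (inl y) = 0
  arrT (inr x) (inr y) = arrT x y

  isTop-unique : ∀ {t} (x y : Node t) → isTop x ≡ true → isTop y ≡ true → x ≡ y
  isTop-unique top top _ _ = refl

  arrT-loop : ∀ {t} (x : Node t) → arrT x x ≡ 0
  arrT-loop top = refl
  arrT-loop (inl x) = arrT-loop x
  arrT-loop (inr x) = arrT-loop x

  arrT-2cycle : ∀ {t} (x y : Node t) → arrT x y ≡ 0 ⊎ arrT y x ≡ 0
  arrT-2cycle top top = inj₁ refl
  arrT-2cycle top (inl y) = inj₂ refl
  arrT-2cycle top (inr y) = inj₁ refl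
  arrT-2cycle (inl x) top = inj₁ refl
  arrT-2cycle (inl x) (inl y) = arrT-2cycle x y
  arrT-2cycle (inl x) (inr y) = inj₂ refl
  arrT-2cycle (inr x) top = inj₂ refl
  arrT-2cycle (inr x) (inl y) = inj₁ refl
  arrT-2cycle (inr x) (inr y) = arrT-2cycle x y

  nodes : ∀ t → List (Node t)
  nodes leaf = []
  nodes (node l r) = top ∷ map inl (nodes l) ++ map inr (nodes r)

  ∈-nodes : ∀ {t} (x : Node t) → x ∈ nodes t
  ∈-nodes top = here refl
  ∈-nodes (inl x) = there (∈-++⁺ˡ (∈-map⁺ inl (∈-nodes x)))
  ∈-nodes {node l r} (inr x) = there (∈-++⁺ʳ (map inl (nodes l)) (∈-map⁺ inr (∈-nodes x)))

  nodes-unique : ∀ t → Unique (nodes t)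
  nodes-unique leaf = []
  nodes-unique (node l r) = All.tabulate (λ {x} x∈ e → notTop x∈ (sym e)) ∷
    Uniqueₚ.++⁺ (Uniqueₚ.map⁺ (λ { refl → refl }) (nodes-unique l)) (Uniqueₚ.map⁺ (λ { refl → refl }) (nodes-unique r)) disj
    where
    notTop : ∀ {x} → x ∈ map inl (nodes l) ++ map inr (nodes r) → x ≡ top → ⊥
    notTop x∈ refl with ∈-++⁻ (map inl (nodes l)) x∈
    ... | inj₁ p with ∈-map⁻ inl p
    ... | _ , _ , ()
    notTop x∈ refl | inj₂ p with ∈-map⁻ inr p
    ... | _ , _ , ()
    disj : ∀ {x} → (x ∈ map inl (nodes l) × x ∈ map inr (nodes r)) → ⊥
    disj (p , q) with ∈-map⁻ inl p | ∈-map⁻ inr q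
    ... | _ , _ , refl | _ , _ , ()

  ∑-node : ∀ l r (f : Node (node l r) → ℕ) → ∑ (nodes (node l r)) f ≡ f top + (∑ (nodes l) (f ∘ inl) + ∑ (nodes r) (f ∘ inr))
  ∑-node l r f = cong (f top +_) (trans (∑-++ (map inl (nodes l)) (map inr (nodes r)) f) (cong₂ _+_ (∑-map inl (nodes l) f) (∑-map inr (nodes r) f)))

  ∑-top : ∀ t → ∑ (nodes t) (λ x → 𝟙 (isTop x)) ≡ 𝟙 (not (isLeaf t))
  ∑-top leaf = refl
  ∑-top (node l r) = trans (∑-node l r (λ x → 𝟙 (isTop x))) (cong suc (cong₂ _+_ (∑-zero (nodes l) (λ _ _ → refl)) (∑-zero (nodes r) (λ _ _ → refl))))

  -- A node with two internal children spans one oriented 3-cycle with them; a node with one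
  -- internal child is joined to it by an arrow in no 3-cycle.
  triCount freeCount : BT → ℕ
  triCount leaf = 0
  triCount (node l r) = 𝟙 (not (isLeaf l) ∧ not (isLeaf r)) + (triCount l + triCount r)
  freeCount leaf = 0
  freeCount (node l r) = 𝟙 (not (isLeaf l) ∧ isLeaf r) + 𝟙 (isLeaf l ∧ not (isLeaf r)) + (freeCount l + freeCount r)

  -- In a tree with an internal node, cherries outnumber nodes with two internal children by one.
  -- The extra cherry stands for the 3-cycle through the base arrow.
  cherries≡ : ∀ t → cherries t ≡ 𝟙 (not (isLeaf t)) + triCount t
  cherries≡ leaf = refl
  cherries≡ (node leaf leaf) = refl
  cherries≡ (node leaf r@(node _ _)) = cherries≡ r
  cherries≡ (node l@(node _ _) leaf) = trans (+-identityʳ (cherries l)) (trans (cherries≡ l) (cong suc (sym (+-identityʳ (triCount l)))))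
  cherries≡ (node l@(node _ _) r@(node _ _)) = trans (cong₂ _+_ (cherries≡ l) (cherries≡ r)) (cong suc (+-suc (triCount l) (triCount r)))

  -- This is what makes leaves measure r₁ + 2 r₂: the first summand is the base arrow itself, free
  -- exactly when the tree is a leaf.
  leaves≡ : ∀ t → leaves t ≡ (𝟙 (isLeaf t) + freeCount t) + 2 * cherries t
  leaves≡ leaf = refl
  leaves≡ (node leaf leaf) = refl
  leaves≡ (node leaf r@(node _ _)) = cong suc (leaves≡ r)
  leaves≡ (node l@(node _ _) leaf) = trans (+-comm (leaves l) 1) (trans (cong suc (leaves≡ l))
    (cong₂ (λ f c → suc f + 2 * c) (sym (+-identityʳ (freeCount l))) (sym (+-identityʳ (cherries l)))))
  leaves≡ (node l@(node _ _) r@(node _ _)) = trans (cong₂ _+_ (leaves≡ l) (leaves≡ r))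
    (ℕS.solve 4 (λ f c g d → (f ℕS.:+ ℕS.con 2 ℕS.:* c) ℕS.:+ (g ℕS.:+ ℕS.con 2 ℕS.:* d) ℕS.:= (f ℕS.:+ g) ℕS.:+ ℕS.con 2 ℕS.:* (c ℕS.:+ d)) refl (freeCount l) (cherries l) (freeCount r) (cherries r))

  pos : ℕ → Bool
  pos x = ⌊ 1 ℕ.≤? x ⌋

  tri₃ : ℕ → ℕ → ℕ → ℕ
  tri₃ x y z = 𝟙 (pos x ∧ pos y ∧ pos z)

  tri₃-zero₂ : ∀ x z → tri₃ x 0 z ≡ 0
  tri₃-zero₂ x z = cong 𝟙 (Boolₚ.∧-zeroʳ (pos x))

  tri₃-zero₃ : ∀ x y → tri₃ x y 0 ≡ 0
  tri₃-zero₃ x y = cong 𝟙 (trans (cong (pos x ∧_) (Boolₚ.∧-zeroʳ (pos y))) (Boolₚ.∧-zeroʳ (pos x)))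

  tri₃-top : ∀ a b → (tri₃ (𝟙 a) (𝟙 (a ∧ b)) (𝟙 b) ≡ 𝟙 a * 𝟙 b) × (tri₃ (𝟙 (a ∧ b)) (𝟙 b) (𝟙 a) ≡ 𝟙 a * 𝟙 b) × (tri₃ (𝟙 b) (𝟙 a) (𝟙 (a ∧ b)) ≡ 𝟙 a * 𝟙 b)
  tri₃-top true true = refl , refl , refl
  tri₃-top true false = refl , refl , refl
  tri₃-top false true = refl , refl , refl
  tri₃-top false false = refl , refl , refl

  triples : BT → ℕ
  triples t = ∑ (nodes t) (λ a → ∑ (nodes t) (λ b → ∑ (nodes t) (λ c → tri₃ (arrT a b) (arrT b c) (arrT c a))))

  -- A 3-cycle shows up as three ordered triples, one per starting vertex, whence the division by 3
  -- in `triangles`. The 3-cycle at the root is met once from the root and once from each child.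
  triples≡ : ∀ t → triples t ≡ triCount t * 3
  triples≡ leaf = refl
  triples≡ (node l r) = begin
    triples (node l r)
      ≡⟨ ∑-node l r _ ⟩
    row top + (∑ L (row ∘ inl) + ∑ R (row ∘ inr))
      ≡⟨ cong₂ _+_ rowTop (cong₂ _+_ (trans (∑-cong′ L rowL) (∑-+ L _ _)) (trans (∑-cong′ R rowR) (∑-+ R _ _))) ⟩
    K + ((triples l + ∑ L (λ x → ∑ R (λ y → k x y))) + (∑ R (λ y → ∑ L (λ x → k x y)) + triples r))
      ≡⟨ cong₂ (λ u v → K + ((u + K) + (v + triples r))) (triples≡ l) (∑-swap R L (λ y x → k x y)) ⟩
    K + ((triCount l * 3 + K) + (K + triples r))
      ≡⟨ cong₂ (λ u v → u + ((triCount l * 3 + u) + (u + v))) K≡ (triples≡ r) ⟩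
    κ + ((triCount l * 3 + κ) + (κ + triCount r * 3))
      ≡⟨ ℕS.solve 3 (λ k a b → k ℕS.:+ ((a ℕS.:* ℕS.con 3 ℕS.:+ k) ℕS.:+ (k ℕS.:+ b ℕS.:* ℕS.con 3)) ℕS.:= (k ℕS.:+ (a ℕS.:+ b)) ℕS.:* ℕS.con 3) refl κ (triCount l) (triCount r) ⟩
    triCount (node l r) * 3 ∎
    where
    open ≡-Reasoning
    L = nodes l
    R = nodes r
    h : Node (node l r) → Node (node l r) → Node (node l r) → ℕ
    h a b c = tri₃ (arrT a b) (arrT b c) (arrT c a)
    row : Node (node l r) → ℕ
    row a = ∑ (nodes (node l r)) (λ b → ∑ (nodes (node l r)) (h a b))
    k : Node l → Node r → ℕ
    k x y = 𝟙 (isTop x) * 𝟙 (isTop y)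
    κ = 𝟙 (not (isLeaf l) ∧ not (isLeaf r))
    K = ∑ L (λ x → ∑ R (k x))
    K≡ : K ≡ κ
    K≡ = trans (sym (∑-*-∑ L R (λ x → 𝟙 (isTop x)) (λ y → 𝟙 (isTop y)))) (trans (cong₂ _*_ (∑-top l) (∑-top r)) (sym (𝟙-∧ (not (isLeaf l)) (not (isLeaf r)))))
    inner : ∀ a b x y z → h a b top ≡ x → ∑ L (h a b ∘ inl) ≡ y → ∑ R (h a b ∘ inr) ≡ z → ∑ (nodes (node l r)) (h a b) ≡ x + (y + z)
    inner a b x y z p q s = trans (∑-node l r (h a b)) (cong₂ _+_ p (cong₂ _+_ q s))
    outer : ∀ a x y z → ∑ (nodes (node l r)) (h a top) ≡ x → ∑ L (λ b → ∑ (nodes (node l r)) (h a (inl b))) ≡ y →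
            ∑ R (λ b → ∑ (nodes (node l r)) (h a (inr b))) ≡ z → row a ≡ x + (y + z)
    outer a x y z p q s = trans (∑-node l r (λ b → ∑ (nodes (node l r)) (h a b))) (cong₂ _+_ p (cong₂ _+_ q s))
    0L : ∀ {f : Node l → ℕ} → (∀ x → f x ≡ 0) → ∑ L f ≡ 0
    0L z = ∑-zero L (λ x _ → z x)
    0R : ∀ {f : Node r → ℕ} → (∀ x → f x ≡ 0) → ∑ R f ≡ 0
    0R z = ∑-zero R (λ x _ → z x)
    zeros : ∀ a b → arrT a b ≡ 0 → ∑ (nodes (node l r)) (h a b) ≡ 0
    zeros a b e = ∑-zero (nodes (node l r)) (λ c _ → cong (λ n → tri₃ n (arrT b c) (arrT c a)) e)
    rowTop : row top ≡ K
    rowTop = trans (outer top 0 K 0 (zeros top top refl)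
      (∑-cong′ L (λ x → trans (inner top (inl x) 0 0 (∑ R (k x)) (tri₃-zero₂ (𝟙 (isTop x)) 0) (0L (λ x′ → tri₃-zero₃ (𝟙 (isTop x)) (arrT x x′)))
        (∑-cong′ R (λ y → proj₁ (tri₃-top (isTop x) (isTop y))))) refl))
      (0R (λ y → zeros top (inr y) refl))) (+-identityʳ K)
    rowL : ∀ x → row (inl x) ≡ ∑ L (λ b → ∑ L (λ c → tri₃ (arrT x b) (arrT b c) (arrT c x))) + ∑ R (k x)
    rowL x = outer (inl x) 0 _ _ (zeros (inl x) top refl)
      (∑-cong′ L (λ x′ → trans (inner (inl x) (inl x′) 0 (∑ L (λ c → tri₃ (arrT x x′) (arrT x′ c) (arrT c x))) 0 (tri₃-zero₂ (arrT x x′) (𝟙 (isTop x))) refl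
        (0R (λ y → tri₃-zero₃ (arrT x x′) (𝟙 (isTop x′ ∧ isTop y))))) (+-identityʳ _)))
      (∑-cong′ R (λ y → trans (inner (inl x) (inr y) (k x y) 0 0 (proj₁ (proj₂ (tri₃-top (isTop x) (isTop y))))
        (0L (λ x′ → tri₃-zero₂ (𝟙 (isTop x ∧ isTop y)) (arrT x′ x))) (0R (λ y′ → tri₃-zero₃ (𝟙 (isTop x ∧ isTop y)) (arrT y y′)))) (+-identityʳ (k x y))))
    rowR : ∀ y → row (inr y) ≡ ∑ L (λ x → k x y) + ∑ R (λ b → ∑ R (λ c → tri₃ (arrT y b) (arrT b c) (arrT c y)))
    rowR y = trans (outer (inr y) (∑ L (λ x → k x y)) 0 _
      (trans (inner (inr y) top 0 (∑ L (λ x → k x y)) 0 (tri₃-zero₂ (𝟙 (isTop y)) (𝟙 false)) (∑-cong′ L (λ x → proj₂ (proj₂ (tri₃-top (isTop x) (isTop y)))))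
        (0R (λ y′ → tri₃-zero₂ (𝟙 (isTop y)) (arrT y′ y)))) (+-identityʳ _))
      (0L (λ x → zeros (inr y) (inl x) refl))
      (∑-cong′ R (λ y′ → trans (inner (inr y) (inr y′) 0 0 (∑ R (λ c → tri₃ (arrT y y′) (arrT y′ c) (arrT c y)))
        (tri₃-zero₃ (arrT y y′) (𝟙 (isTop y′))) (0L (λ x → tri₃-zero₂ (arrT y y′) (𝟙 (isTop x ∧ isTop y)))) refl) refl))) refl

  -- the arrows that lie in no oriented 3-cycle
  fr : ∀ {t} → Node t → Node t → ℕ
  fr {node l r} top (inl x) = 𝟙 (isTop x ∧ isLeaf r)
  fr {node l r} (inr y) top = 𝟙 (isTop y ∧ isLeaf l)
  fr (inl x) (inl y) = fr x y
  fr (inr x) (inr y) = fr x y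
  fr _ _ = 0

  ∑-fr : ∀ t → ∑ (nodes t) (λ a → ∑ (nodes t) (fr a)) ≡ freeCount t
  ∑-fr leaf = refl
  ∑-fr (node l r) = begin
    ∑ (nodes (node l r)) (λ a → ∑ (nodes (node l r)) (fr a))
      ≡⟨ ∑-node l r _ ⟩
    ∑ (nodes (node l r)) (fr top) + (∑ L (λ x → ∑ (nodes (node l r)) (fr (inl x))) + ∑ R (λ y → ∑ (nodes (node l r)) (fr (inr y))))
      ≡⟨ cong₂ _+_ rowTop (cong₂ _+_ (∑-cong′ L rowL) (trans (∑-cong′ R rowR) (trans (∑-+ R _ _) (cong (_+ ∑ R (λ y → ∑ R (fr y))) (count r (isLeaf l)))))) ⟩
    p + (∑ L (λ x → ∑ L (fr x)) + (q + ∑ R (λ y → ∑ R (fr y))))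
      ≡⟨ cong₂ (λ u v → p + (u + (q + v))) (∑-fr l) (∑-fr r) ⟩
    p + (freeCount l + (q + freeCount r))
      ≡⟨ cong (λ b → p + (freeCount l + (𝟙 b + freeCount r))) (Boolₚ.∧-comm (not (isLeaf r)) (isLeaf l)) ⟩
    p + (freeCount l + (q′ + freeCount r))
      ≡⟨ ℕS.solve 4 (λ p a q b → p ℕS.:+ (a ℕS.:+ (q ℕS.:+ b)) ℕS.:= p ℕS.:+ q ℕS.:+ (a ℕS.:+ b)) refl p (freeCount l) q′ (freeCount r) ⟩
    freeCount (node l r) ∎
    where
    open ≡-Reasoning
    L = nodes l
    R = nodes r
    p = 𝟙 (not (isLeaf l) ∧ isLeaf r)
    q = 𝟙 (not (isLeaf r) ∧ isLeaf l)
    q′ = 𝟙 (isLeaf l ∧ not (isLeaf r))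
    count : ∀ t b → ∑ (nodes t) (λ x → 𝟙 (isTop x ∧ b)) ≡ 𝟙 (not (isLeaf t) ∧ b)
    count t b = trans (∑-cong′ (nodes t) (λ x → 𝟙-∧ (isTop x) b)) (trans (sym (∑-*ʳ (𝟙 b) (nodes t) (λ x → 𝟙 (isTop x)))) (trans (cong (_* 𝟙 b) (∑-top t)) (sym (𝟙-∧ (not (isLeaf t)) b))))
    rowTop : ∑ (nodes (node l r)) (fr top) ≡ p
    rowTop = trans (∑-node l r (fr top)) (trans (cong₂ _+_ (count l (isLeaf r)) (∑-zero R (λ _ _ → refl))) (+-identityʳ p))
    rowL : ∀ x → ∑ (nodes (node l r)) (fr (inl x)) ≡ ∑ L (fr x)
    rowL x = trans (∑-node l r (fr (inl x))) (trans (cong (∑ L (fr x) +_) (∑-zero R (λ _ _ → refl))) (+-identityʳ _))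
    rowR : ∀ y → ∑ (nodes (node l r)) (fr (inr y)) ≡ 𝟙 (isTop y ∧ isLeaf l) + ∑ R (fr y)
    rowR y = trans (∑-node l r (fr (inr y))) (cong (𝟙 (isTop y ∧ isLeaf l) +_) (cong (_+ ∑ R (fr y)) (∑-zero L (λ _ _ → refl))))

  -- Certificates for the outcome of the search made by `no3cyc`, as far as it stays inside the
  -- tree.
  data ArrowKind {t} (a b : Node t) : Set where
    none : arrT a b ≡ 0 → fr a b ≡ 0 → ArrowKind a b
    isFree : arrT a b ≡ 1 → fr a b ≡ 1 → (∀ z → arrT b z ≡ 0 ⊎ arrT z a ≡ 0) → ArrowKind a b
    in3cyc : arrT a b ≡ 1 → fr a b ≡ 0 → ∀ z → arrT b z ≡ 1 → arrT z a ≡ 1 → ArrowKind a b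

  arrowKind : ∀ {t} (a b : Node t) → ArrowKind a b
  arrowKind top top = none refl refl
  arrowKind {node l leaf} top (inl top) = isFree refl refl λ { top → inj₁ refl ; (inl z) → inj₂ refl ; (inr ()) }
  arrowKind {node l (node _ _)} top (inl top) = in3cyc refl refl (inr top) refl refl
  arrowKind top (inl (inl _)) = none refl refl
  arrowKind top (inl (inr _)) = none refl refl
  arrowKind top (inr _) = none refl refl
  arrowKind (inl _) top = none refl refl
  arrowKind {node leaf r} (inr top) top = isFree refl refl λ { top → inj₁ refl ; (inl ()) ; (inr z) → inj₁ refl }
  arrowKind {node (node _ _) r} (inr top) top = in3cyc refl refl (inl top) refl refl
  arrowKind (inr (inl _)) top = none refl refl
  arrowKind (inr (inr _)) top = none refl refl
  arrowKind (inl top) (inr top) = in3cyc refl refl top refl refl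
  arrowKind (inl top) (inr (inl _)) = none refl refl
  arrowKind (inl top) (inr (inr _)) = none refl refl
  arrowKind (inl (inl _)) (inr _) = none refl refl
  arrowKind (inl (inr _)) (inr _) = none refl refl
  arrowKind (inr _) (inl _) = none refl refl
  arrowKind (inl x) (inl y) with arrowKind x y
  ... | none p q = none p q
  ... | isFree p q f = isFree p q λ { top → inj₁ refl ; (inl z) → f z ; (inr z) → inj₂ refl }
  ... | in3cyc p q z u v = in3cyc p q (inl z) u v
  arrowKind (inr x) (inr y) with arrowKind x y
  ... | none p q = none p q
  ... | isFree p q f = isFree p q λ { top → inj₂ refl ; (inl z) → inj₁ refl ; (inr z) → f z }
  ... | in3cyc p q z u v = in3cyc p q (inr z) u v

  -- The partial inverse `loc` is part of the data, so that membership in S can be decided by it.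
  record Emb {n} (arr : Arrows n) (S : Fin n → Bool) (t : BT) : Set where
    field
      emb : Node t → Fin n
      loc : Fin n → Maybe (Node t)
      loc-emb : ∀ x → loc (emb x) ≡ just x
      emb-loc : ∀ {v x} → loc v ≡ just x → emb x ≡ v
      mem : ∀ v → S v ≡ is-just (loc v)
      arr-emb : ∀ x y → arr (emb x) (emb y) ≡ arrT x y

    emb-injective : ∀ {x y} → emb x ≡ emb y → x ≡ y
    emb-injective {x} {y} e = just-injective (trans (sym (loc-emb x)) (trans (cong loc e) (loc-emb y)))

    emb∈ : ∀ x → S (emb x) ≡ true
    emb∈ x = trans (mem (emb x)) (cong is-just (loc-emb x))

    emb-surjective : ∀ v → S v ≡ true → ∃[ x ] emb x ≡ v
    emb-surjective v p with loc v in eq | mem v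
    ... | just x | _ = x , emb-loc eq
    ... | nothing | q with trans (sym p) q
    ... | ()

    -- Carries the sums over vertices in `Params` to sums over tree nodes, where recursion on the
    -- tree applies.
    ∑-emb : ∀ g → ∑ (allFin n) (λ v → 𝟙 (S v) * g v) ≡ ∑ (nodes t) (g ∘ emb)
    ∑-emb g = begin
      ∑ (allFin n) (λ v → 𝟙 (S v) * g v) ≡⟨ ∑-cong′ (allFin n) (λ v → lem (S v) (g v)) ⟩
      ∑ (allFin n) (λ v → when (does (S v Boolₚ.≟ true)) (g v)) ≡⟨ sym (∑-filter (λ v → S v Boolₚ.≟ true) (allFin n) g) ⟩
      ∑ (filter (λ v → S v Boolₚ.≟ true) (allFin n)) g ≡⟨ ∑-same (Uniqueₚ.filter⁺ (λ v → S v Boolₚ.≟ true) (Uniqueₚ.allFin⁺ n)) (Uniqueₚ.map⁺ emb-injective (nodes-unique t)) to from g ⟩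
      ∑ (map emb (nodes t)) g ≡⟨ ∑-map emb (nodes t) g ⟩
      ∑ (nodes t) (g ∘ emb) ∎
      where
      open ≡-Reasoning
      lem : ∀ b x → 𝟙 b * x ≡ when (does (b Boolₚ.≟ true)) x
      lem true x = *-identityˡ x
      lem false x = refl
      to : ∀ {v} → v ∈ filter (λ v → S v Boolₚ.≟ true) (allFin n) → v ∈ map emb (nodes t)
      to {v} v∈ = let (x , e) = emb-surjective v (proj₂ (∈-filter⁻ (λ v → S v Boolₚ.≟ true) {xs = allFin n} v∈)) in
        subst (_∈ map emb (nodes t)) e (∈-map⁺ emb (∈-nodes x))
      from : ∀ {v} → v ∈ map emb (nodes t) → v ∈ filter (λ v → S v Boolₚ.≟ true) (allFin n)
      from v∈ with ∈-map⁻ emb v∈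
      ... | x , _ , refl = ∈-filter⁺ (λ v → S v Boolₚ.≟ true) (∈-allFin (emb x)) (emb∈ x)

  open Emb public

  rootOf : ∀ {n} {arr : Arrows n} {S} t → Emb arr S t → Maybe (Fin n)
  rootOf leaf E = nothing
  rootOf (node _ _) E = just (emb E top)

-- Rooted quivers of type A as binary trees, and elimination of tree vertices.

module RootedTrees where

  open Forests using (BT; leaf; node)
  open Cycles
  open TreeQuivers
  open import Data.Bool using (_∨_)
  import Data.Bool.Properties as Boolₚ
  open import Data.Fin using (Fin)
  open import Data.Fin.Properties using () renaming (_≟_ to _≟ᶠ_)
  open import Data.Nat using (ℕ; zero; suc; _+_; _≤_; z≤n; s≤s)
  open import Data.Nat.Properties
  open import Data.Product using (Σ)

  ⌊emb≟top⌋ : ∀ {n} {arr : Arrows n} {S l r} (E : Emb arr S (node l r)) x → ⌊ emb E x ≟ᶠ emb E top ⌋ ≡ isTop x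
  ⌊emb≟top⌋ E top = ⌊⌋-true (emb E top ≟ᶠ emb E top) refl
  ⌊emb≟top⌋ E (inl x) = ⌊⌋-false (emb E (inl x) ≟ᶠ emb E top) (λ e → case-absurd (emb-injective E e))
    where
    case-absurd : inl x ≡ top → ⊥
    case-absurd ()
  ⌊emb≟top⌋ E (inr x) = ⌊⌋-false (emb E (inr x) ≟ᶠ emb E top) (λ e → case-absurd (emb-injective E e))
    where
    case-absurd : inr x ≡ top → ⊥
    case-absurd ()

  module _ {n} (arr : Arrows n) where

    empty : Emb arr (λ _ → false) leaf
    empty = record { emb = λ () ; loc = λ _ → nothing ; loc-emb = λ () ; emb-loc = λ () ; mem = λ _ → refl ; arr-emb = λ () }

    -- With `empty` in place of a missing subtree, this one construction serves all three clauses of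
    -- `RootedA`; the arrow hypotheses are the clauses of `arrT` that meet the new root or cross
    -- between the subtrees.
    module Graft {S S₁ S₂ : Fin n → Bool} {l r} (ρ : Fin n) (E₁ : Emb arr S₁ l) (E₂ : Emb arr S₂ r)
      (ρ∉₁ : S₁ ρ ≡ false) (ρ∉₂ : S₂ ρ ≡ false) (disjoint : ∀ x → (S₁ x ∧ S₂ x) ≡ false)
      (S≡ : ∀ x → S x ≡ (⌊ x ≟ᶠ ρ ⌋ ∨ (S₁ x ∨ S₂ x)))
      (ρρ : arr ρ ρ ≡ 0)
      (ρ₁ : ∀ x → arr ρ (emb E₁ x) ≡ 𝟙 (isTop x)) (₁ρ : ∀ x → arr (emb E₁ x) ρ ≡ 0)
      (ρ₂ : ∀ y → arr ρ (emb E₂ y) ≡ 0) (₂ρ : ∀ y → arr (emb E₂ y) ρ ≡ 𝟙 (isTop y))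
      (₁₂ : ∀ x y → arr (emb E₁ x) (emb E₂ y) ≡ 𝟙 (isTop x ∧ isTop y)) (₂₁ : ∀ x y → arr (emb E₂ y) (emb E₁ x) ≡ 0) where

      e : Node (node l r) → Fin n
      e top = ρ
      e (inl x) = emb E₁ x
      e (inr y) = emb E₂ y

      findD : ∀ {v} → Dec (v ≡ ρ) → Maybe (Node l) → Maybe (Node r) → Maybe (Node (node l r))
      findD (yes _) _ _ = just top
      findD (no _) (just x) _ = just (inl x)
      findD (no _) nothing (just y) = just (inr y)
      findD (no _) nothing nothing = nothing

      find : Fin n → Maybe (Node (node l r))
      find v = findD (v ≟ᶠ ρ) (loc E₁ v) (loc E₂ v)

      outside : ∀ {T t} (E : Emb arr T t) {v} → T v ≡ false → loc E v ≡ nothing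
      outside E {v} p with loc E v | mem E v
      ... | nothing | _ = refl
      ... | just _ | q with trans (sym p) q
      ... | ()

      ≢ρ : ∀ {T t} (E : Emb arr T t) → T ρ ≡ false → ∀ x → emb E x ≢ ρ
      ≢ρ {T} E ρ∉ x eq with trans (sym (emb∈ E x)) (trans (cong T eq) ρ∉)
      ... | ()

      find-e : ∀ x → find (e x) ≡ just x
      find-e top with ρ ≟ᶠ ρ
      ... | yes _ = refl
      ... | no ne = ⊥-elim (ne refl)
      find-e (inl x) with emb E₁ x ≟ᶠ ρ
      ... | yes eq = ⊥-elim (≢ρ E₁ ρ∉₁ x eq)
      ... | no _ rewrite loc-emb E₁ x = refl
      find-e (inr y) with emb E₂ y ≟ᶠ ρ
      ... | yes eq = ⊥-elim (≢ρ E₂ ρ∉₂ y eq)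
      ... | no _ rewrite outside E₁ {emb E₂ y} (trans (sym (Boolₚ.∧-identityʳ _)) (trans (cong (S₁ (emb E₂ y) ∧_) (sym (emb∈ E₂ y))) (disjoint (emb E₂ y)))) | loc-emb E₂ y = refl

      e-findD : ∀ {v x} (d : Dec (v ≡ ρ)) m₁ m₂ → loc E₁ v ≡ m₁ → loc E₂ v ≡ m₂ → findD d m₁ m₂ ≡ just x → e x ≡ v
      e-findD (yes p) _ _ _ _ refl = sym p
      e-findD (no _) (just x) _ p _ refl = emb-loc E₁ p
      e-findD (no _) nothing (just y) _ p refl = emb-loc E₂ p

      mem-findD : ∀ {v} (d : Dec (v ≡ ρ)) m₁ m₂ → (⌊ d ⌋ ∨ (is-just m₁ ∨ is-just m₂)) ≡ is-just (findD d m₁ m₂)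
      mem-findD (yes _) _ _ = refl
      mem-findD (no _) (just _) _ = refl
      mem-findD (no _) nothing (just _) = refl
      mem-findD (no _) nothing nothing = refl

      arrows : ∀ x y → arr (e x) (e y) ≡ arrT x y
      arrows top top = ρρ
      arrows top (inl x) = ρ₁ x
      arrows top (inr y) = ρ₂ y
      arrows (inl x) top = ₁ρ x
      arrows (inl x) (inl y) = arr-emb E₁ x y
      arrows (inl x) (inr y) = ₁₂ x y
      arrows (inr y) top = ₂ρ y
      arrows (inr y) (inl x) = ₂₁ x y
      arrows (inr x) (inr y) = arr-emb E₂ x y

      grafted : Emb arr S (node l r)
      grafted = record
        { emb = e ; loc = find ; loc-emb = find-e
        ; emb-loc = λ {v} → e-findD (v ≟ᶠ ρ) (loc E₁ v) (loc E₂ v) refl refl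
        ; mem = λ v → trans (S≡ v) (trans (cong₂ (λ p q → ⌊ v ≟ᶠ ρ ⌋ ∨ (p ∨ q)) (mem E₁ v) (mem E₂ v)) (mem-findD (v ≟ᶠ ρ) (loc E₁ v) (loc E₂ v)))
        ; arr-emb = arrows }

    Embedded : (Fin n → Bool) → Fin n → Set
    Embedded S ρ = ∃[ l ] ∃[ r ] Σ (Emb arr S (node l r)) λ E → emb E top ≡ ρ

    -- An edge ρ — v becomes a left child when it points away from ρ, a right child otherwise.
    embed-edge : ∀ {S S′ ρ v} → arr ρ ρ ≡ 0 → Embedded S′ v → S′ ρ ≡ false → (∀ x → S x ≡ (⌊ x ≟ᶠ ρ ⌋ ∨ S′ x)) →
                 (∀ x → x ∈ₛ S′ → arr ρ x + arr x ρ ≡ 𝟙 ⌊ x ≟ᶠ v ⌋) → Embedded S ρ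
    embed-edge {S} {S′} {ρ} ρρ (l , r , E , refl) ρ∉ S≡ cond = orient (arr ρ (emb E top)) refl
      where
      sum : ∀ x → arr ρ (emb E x) + arr (emb E x) ρ ≡ 𝟙 (isTop x)
      sum x = trans (cond (emb E x) (emb∈ E x)) (cong 𝟙 (⌊emb≟top⌋ E x))
      zeroˡ : ∀ x → isTop x ≡ false → arr ρ (emb E x) ≡ 0
      zeroˡ x p = m+n≡0⇒m≡0 (arr ρ (emb E x)) (trans (sum x) (cong 𝟙 p))
      zeroʳ : ∀ x → isTop x ≡ false → arr (emb E x) ρ ≡ 0
      zeroʳ x p = m+n≡0⇒n≡0 (arr ρ (emb E x)) (trans (sum x) (cong 𝟙 p))
      away : arr ρ (emb E top) ≡ 0 → ∀ x → arr ρ (emb E x) ≡ 0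
      away p top = p
      away p (inl x) = zeroˡ (inl x) refl
      away p (inr x) = zeroˡ (inr x) refl
      orient : ∀ k → arr ρ (emb E top) ≡ k → Embedded S ρ
      orient zero p = leaf , node l r , Graft.grafted ρ empty E refl ρ∉ (λ _ → refl) S≡ ρρ (λ ()) (λ ())
        (away p) (λ x → trans (cong (_+ arr (emb E x) ρ) (sym (away p x))) (sum x)) (λ ()) (λ ()) , refl
      orient (suc k) p = node l r , leaf , Graft.grafted ρ E empty ρ∉ refl (λ x → Boolₚ.∧-zeroʳ (S′ x))
        (λ x → trans (S≡ x) (cong (⌊ x ≟ᶠ ρ ⌋ ∨_) (sym (Boolₚ.∨-identityʳ (S′ x))))) ρρ
        (λ x → trans (sym (+-identityʳ _)) (trans (cong (arr ρ (emb E x) +_) (sym (back x))) (sum x))) back (λ ()) (λ ()) (λ _ ()) (λ _ ()) , refl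
        where
        back : ∀ x → arr (emb E x) ρ ≡ 0
        back top = n≤0⇒n≡0 (≤-pred (subst (suc (arr (emb E top) ρ) ≤_) (sum top) (+-monoˡ-≤ (arr (emb E top) ρ) (subst (1 ≤_) (sym p) (s≤s z≤n)))))
        back (inl x) = zeroʳ (inl x) refl
        back (inr x) = zeroʳ (inr x) refl

    embed : (∀ a → arr a a ≡ 0) → ∀ {S ρ} → RootedA arr S ρ → Embedded S ρ
    embed loop {S} {ρ} (single S≡) = leaf , leaf ,
      Graft.grafted ρ empty empty refl refl (λ _ → refl) (λ x → trans (S≡ x) (sym (Boolₚ.∨-identityʳ _))) (loop ρ)
        (λ ()) (λ ()) (λ ()) (λ ()) (λ ()) (λ ()) , refl
    embed loop {S} {ρ} (edge R ρ∉ S≡ cond) = embed-edge (loop ρ) (embed loop R) ρ∉ S≡ cond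
    embed loop {S} {ρ} (tri {S₁ = S₁} {S₂} {u = u} {w} R₁ R₂ ρ∉₁ ρ∉₂ disj S≡ ρu uρ uw wu wρ ρw nbr₁ nbr₂ cross) =
      combine (embed loop R₁) (embed loop R₂)
      where
      combine : Embedded S₁ u → Embedded S₂ w → Embedded S ρ
      combine (l₁ , r₁ , E₁ , refl) (l₂ , r₂ , E₂ , refl) = node l₁ r₁ , node l₂ r₂ ,
        Graft.grafted ρ E₁ E₂ ρ∉₁ ρ∉₂ disj S≡ (loop ρ) ρ₁ ₁ρ ρ₂ ₂ρ ₁₂ ₂₁ , refl
        where
        ≢top : ∀ {T l r} (E : Emb arr T (node l r)) x → isTop x ≡ false → emb E x ≢ emb E top
        ≢top E x p e with trans (sym p) (cong isTop (emb-injective E {x} {top} e))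
        ... | ()
        off₁ : ∀ x → isTop x ≡ false → arr ρ (emb E₁ x) + arr (emb E₁ x) ρ ≡ 0
        off₁ x p = nbr₁ (emb E₁ x) (emb∈ E₁ x) (≢top E₁ x p)
        off₂ : ∀ x → isTop x ≡ false → arr ρ (emb E₂ x) + arr (emb E₂ x) ρ ≡ 0
        off₂ x p = nbr₂ (emb E₂ x) (emb∈ E₂ x) (≢top E₂ x p)
        ρ₁ : ∀ x → arr ρ (emb E₁ x) ≡ 𝟙 (isTop x)
        ρ₁ top = ρu
        ρ₁ x@(inl _) = m+n≡0⇒m≡0 _ (off₁ x refl)
        ρ₁ x@(inr _) = m+n≡0⇒m≡0 _ (off₁ x refl)
        ₁ρ : ∀ x → arr (emb E₁ x) ρ ≡ 0
        ₁ρ top = uρ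
        ₁ρ x@(inl _) = m+n≡0⇒n≡0 (arr ρ (emb E₁ x)) (off₁ x refl)
        ₁ρ x@(inr _) = m+n≡0⇒n≡0 (arr ρ (emb E₁ x)) (off₁ x refl)
        ρ₂ : ∀ x → arr ρ (emb E₂ x) ≡ 0
        ρ₂ top = ρw
        ρ₂ x@(inl _) = m+n≡0⇒m≡0 _ (off₂ x refl)
        ρ₂ x@(inr _) = m+n≡0⇒m≡0 _ (off₂ x refl)
        ₂ρ : ∀ x → arr (emb E₂ x) ρ ≡ 𝟙 (isTop x)
        ₂ρ top = wρ
        ₂ρ x@(inl _) = m+n≡0⇒n≡0 (arr ρ (emb E₂ x)) (off₂ x refl)
        ₂ρ x@(inr _) = m+n≡0⇒n≡0 (arr ρ (emb E₂ x)) (off₂ x refl)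
        sum : ∀ x y → arr (emb E₁ x) (emb E₂ y) + arr (emb E₂ y) (emb E₁ x) ≡ 𝟙 (isTop x ∧ isTop y)
        sum x y = trans (cross (emb E₁ x) (emb E₂ y) (emb∈ E₁ x) (emb∈ E₂ y)) (cong₂ (λ p q → 𝟙 (p ∧ q)) (⌊emb≟top⌋ E₁ x) (⌊emb≟top⌋ E₂ y))
        ₂₁ : ∀ x y → arr (emb E₂ y) (emb E₁ x) ≡ 0
        ₂₁ top top = wu
        ₂₁ x@(inl _) y = m+n≡0⇒n≡0 (arr (emb E₁ x) (emb E₂ y)) (sum x y)
        ₂₁ x@(inr _) y = m+n≡0⇒n≡0 (arr (emb E₁ x) (emb E₂ y)) (sum x y)
        ₂₁ top y@(inl _) = m+n≡0⇒n≡0 (arr (emb E₁ top) (emb E₂ y)) (sum top y)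
        ₂₁ top y@(inr _) = m+n≡0⇒n≡0 (arr (emb E₁ top) (emb E₂ y)) (sum top y)
        ₁₂ : ∀ x y → arr (emb E₁ x) (emb E₂ y) ≡ 𝟙 (isTop x ∧ isTop y)
        ₁₂ x y = trans (sym (+-identityʳ _)) (trans (cong (arr (emb E₁ x) (emb E₂ y) +_) (sym (₂₁ x y))) (sum x y))

    unL : ∀ {l r} → Maybe (Node (node l r)) → Maybe (Node l)
    unL (just (inl x)) = just x
    unL _ = nothing

    unR : ∀ {l r} → Maybe (Node (node l r)) → Maybe (Node r)
    unR (just (inr x)) = just x
    unR _ = nothing

    module Split {S : Fin n → Bool} {l r} (E : Emb arr S (node l r)) where

      SL SR : Fin n → Bool
      SL v = is-just (unL (loc E v))
      SR v = is-just (unR (loc E v))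

      subL : Emb arr SL l
      subL = record
        { emb = emb E ∘ inl ; loc = unL ∘ loc E ; loc-emb = λ x → cong unL (loc-emb E (inl x))
        ; emb-loc = λ {v} {x} p → emb-loc E (unL-just (loc E v) p)
        ; mem = λ _ → refl ; arr-emb = λ x y → arr-emb E (inl x) (inl y) }
        where
        unL-just : ∀ (m : Maybe (Node (node l r))) {x} → unL m ≡ just x → m ≡ just (inl x)
        unL-just (just (inl x)) refl = refl

      subR : Emb arr SR r
      subR = record
        { emb = emb E ∘ inr ; loc = unR ∘ loc E ; loc-emb = λ x → cong unR (loc-emb E (inr x))
        ; emb-loc = λ {v} {x} p → emb-loc E (unR-just (loc E v) p)
        ; mem = λ _ → refl ; arr-emb = λ x y → arr-emb E (inr x) (inr y) }
        where
        unR-just : ∀ (m : Maybe (Node (node l r))) {x} → unR m ≡ just x → m ≡ just (inr x)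
        unR-just (just (inr x)) refl = refl

      split : ∀ v → S v ≡ (⌊ v ≟ᶠ emb E top ⌋ ∨ (SL v ∨ SR v))
      split v = trans (mem E v) (lem (loc E v) refl)
        where
        not-top : ∀ {x} → loc E v ≡ just x → isTop x ≡ false → ⌊ v ≟ᶠ emb E top ⌋ ≡ false
        not-top {x} p q = ⌊⌋-false (v ≟ᶠ emb E top) λ { refl → absurd (trans (sym q) (cong isTop (just-injective (trans (sym p) (loc-emb E top))))) }
          where
          absurd : false ≡ true → ⊥
          absurd ()
        lem : ∀ m → loc E v ≡ m → is-just m ≡ (⌊ v ≟ᶠ emb E top ⌋ ∨ (is-just (unL m) ∨ is-just (unR m)))
        lem (just top) p = sym (cong (_∨ false) (⌊⌋-true (v ≟ᶠ emb E top) (sym (emb-loc E p))))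
        lem (just (inl x)) p = sym (cong (_∨ true) (not-top p refl))
        lem (just (inr x)) p = sym (cong (_∨ true) (not-top p refl))
        lem nothing p = sym (trans (Boolₚ.∨-identityʳ _) (⌊⌋-false (v ≟ᶠ emb E top) λ { refl → absurd (trans (sym p) (loc-emb E top)) }))
          where
          absurd : nothing ≡ just top → ⊥
          absurd ()

      top∉L : SL (emb E top) ≡ false
      top∉L = cong (is-just ∘ unL) (loc-emb E top)

      top∉R : SR (emb E top) ≡ false
      top∉R = cong (is-just ∘ unR) (loc-emb E top)

      disjoint : ∀ v → (SL v ∧ SR v) ≡ false
      disjoint v with loc E v
      ... | just top = refl
      ... | just (inl _) = refl
      ... | just (inr _) = refl
      ... | nothing = refl

    no-nodes : ∀ (m : Maybe (Node leaf)) → is-just m ≡ false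
    no-nodes nothing = refl

    -- The converse of `embed`. A lone left child and a lone right child give the two orientations
    -- of an edge at the root.
    unembed : ∀ l r {S : Fin n → Bool} (E : Emb arr S (node l r)) → RootedA arr S (emb E top)
    unembed leaf leaf E = single (λ v → trans (split v) (trans (cong₂ (λ p q → ⌊ v ≟ᶠ emb E top ⌋ ∨ (p ∨ q)) (no-nodes (unL (loc E v))) (no-nodes (unR (loc E v)))) (Boolₚ.∨-identityʳ _)))
      where open Split E
    unembed (node l₁ r₁) leaf E = edge (unembed l₁ r₁ subL) top∉L
      (λ v → trans (split v) (cong (⌊ v ≟ᶠ emb E top ⌋ ∨_) (trans (cong (SL v ∨_) (no-nodes (unR (loc E v)))) (Boolₚ.∨-identityʳ _))))
      (λ v p → nbr v (emb-surjective subL v p))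
      where
      open Split E
      nbr : ∀ v → (∃[ x ] emb E (inl x) ≡ v) → arr (emb E top) v + arr v (emb E top) ≡ 𝟙 ⌊ v ≟ᶠ emb E (inl top) ⌋
      nbr v (x , refl) = trans (cong₂ _+_ (arr-emb E top (inl x)) (arr-emb E (inl x) top)) (trans (+-identityʳ _) (cong 𝟙 (sym (⌊emb≟top⌋ subL x))))
    unembed leaf (node l₂ r₂) E = edge (unembed l₂ r₂ subR) top∉R
      (λ v → trans (split v) (cong (λ b → ⌊ v ≟ᶠ emb E top ⌋ ∨ (b ∨ SR v)) (no-nodes (unL (loc E v)))))
      (λ v p → nbr v (emb-surjective subR v p))
      where
      open Split E
      nbr : ∀ v → (∃[ x ] emb E (inr x) ≡ v) → arr (emb E top) v + arr v (emb E top) ≡ 𝟙 ⌊ v ≟ᶠ emb E (inr top) ⌋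
      nbr v (x , refl) = trans (cong₂ _+_ (arr-emb E top (inr x)) (arr-emb E (inr x) top)) (cong 𝟙 (sym (⌊emb≟top⌋ subR x)))
    unembed (node l₁ r₁) (node l₂ r₂) E = tri (unembed l₁ r₁ subL) (unembed l₂ r₂ subR) top∉L top∉R disjoint split
      (arr-emb E top (inl top)) (arr-emb E (inl top) top) (arr-emb E (inl top) (inr top)) (arr-emb E (inr top) (inl top))
      (arr-emb E (inr top) top) (arr-emb E top (inr top))
      (λ v p → nbr₁ v (emb-surjective subL v p)) (λ v p → nbr₂ v (emb-surjective subR v p))
      (λ u v p q → cross u v (emb-surjective subL u p) (emb-surjective subR v q))
      where
      open Split E
      nbr₁ : ∀ v → (∃[ x ] emb E (inl x) ≡ v) → v ≢ emb E (inl top) → arr (emb E top) v + arr v (emb E top) ≡ 0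
      nbr₁ v (top , refl) ne = ⊥-elim (ne refl)
      nbr₁ v (inl x , refl) ne = cong₂ _+_ (arr-emb E top (inl (inl x))) (arr-emb E (inl (inl x)) top)
      nbr₁ v (inr x , refl) ne = cong₂ _+_ (arr-emb E top (inl (inr x))) (arr-emb E (inl (inr x)) top)
      nbr₂ : ∀ v → (∃[ x ] emb E (inr x) ≡ v) → v ≢ emb E (inr top) → arr (emb E top) v + arr v (emb E top) ≡ 0
      nbr₂ v (top , refl) ne = ⊥-elim (ne refl)
      nbr₂ v (inl x , refl) ne = cong₂ _+_ (arr-emb E top (inr (inl x))) (arr-emb E (inr (inl x)) top)
      nbr₂ v (inr x , refl) ne = cong₂ _+_ (arr-emb E top (inr (inr x))) (arr-emb E (inr (inr x)) top)
      cross : ∀ u v → (∃[ x ] emb E (inl x) ≡ u) → (∃[ y ] emb E (inr y) ≡ v) →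
              arr u v + arr v u ≡ 𝟙 (⌊ u ≟ᶠ emb E (inl top) ⌋ ∧ ⌊ v ≟ᶠ emb E (inr top) ⌋)
      cross u v (x , refl) (y , refl) = trans (cong₂ _+_ (arr-emb E (inl x) (inr y)) (arr-emb E (inr y) (inl x)))
        (trans (+-identityʳ _) (cong₂ (λ p q → 𝟙 (p ∧ q)) (sym (⌊emb≟top⌋ subL x)) (sym (⌊emb≟top⌋ subR y))))

  -- The root of the sibling subtree, or the parent as fallback d. For an only child the two outer
  -- neighbours thus coincide, the case a ≡ b of `Simplicial`.
  topOr : ∀ t {V : Set} → (Node t → V) → V → V
  topOr leaf f d = d
  topOr (node _ _) f d = f top

  topOr-top : ∀ {t} {V : Set} (f : Node t → V) d x → isTop x ≡ true → f x ≡ topOr t f d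
  topOr-top f d top _ = refl

  module Eliminate {V : Set} (A : V → V → ℕ) (m₀ : ℕ) (c : Fin (suc (suc m₀)) → V) (w : Fin (suc (suc m₀)) → Bool)
    (inj : ∀ i j → c i ≡ c j → i ≡ j) (mixed : ∃[ i ] ∃[ j ] w i ≢ w j)
    (full : ∀ i j → A (c i) (c j) ≡ baseCount w i j) where

    open InducedCycle A m₀ c w inj mixed full

    -- Working up from the leaves, each vertex of the tree is simplicial among the
    -- remaining ones, so none of them lies on the cycle.
    eliminate : ∀ t (e : Node t → V) (a b : V) → (∀ x y → A (e x) (e y) ≡ arrT x y) →
      (∀ x → isTop x ≡ true → Simplicial A (e x) a b) →
      (∀ x v → 1 ≤ adj (e x) v → (∃[ y ] v ≡ e y) ⊎ (isTop x ≡ true × (v ≡ a ⊎ v ≡ b))) →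
      ∀ x j → c j ≢ e x
    eliminate (node l r) e a b ar si nb = λ { top → atTop ; (inl x) → left x ; (inr x) → right x }
      where
      ρ = e top
      adj≡ : ∀ x y → adj (e x) (e y) ≡ arrT x y + arrT y x
      adj≡ x y = cong₂ _+_ (ar x y) (ar y x)
      left : ∀ x j → c j ≢ e (inl x)
      -- Once the subtree is gone, its root has only the sibling and the parent as neighbours. They
      -- are listed in the order of the 3-cycle: left child, right child, parent; for the right
      -- child below the order is parent, left child.
      left = eliminate l (e ∘ inl) (topOr r (e ∘ inr) ρ) ρ (λ x y → ar (inl x) (inl y)) simp nbr
        where
        simp : ∀ x → isTop x ≡ true → Simplicial A (e (inl x)) (topOr r (e ∘ inr) ρ) ρ
        simp x@top _ = record
          { single-a = sa r e ar
          ; single-b = ≤-reflexive (adj≡ (inl x) top)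
          ; shape = sh r e ar }
          where
          sa : ∀ r (e : Node (node _ r) → V) → (∀ x y → A (e x) (e y) ≡ arrT x y) → adj (e (inl top)) (topOr r (e ∘ inr) (e top)) ≤ 1
          sa leaf e ar = ≤-reflexive (cong₂ _+_ (ar (inl top) top) (ar top (inl top)))
          sa (node _ _) e ar = ≤-reflexive (cong₂ _+_ (ar (inl top) (inr top)) (ar (inr top) (inl top)))
          sh : ∀ r (e : Node (node _ r) → V) → (∀ x y → A (e x) (e y) ≡ arrT x y) → let a = topOr r (e ∘ inr) (e top) in
               a ≡ e top ⊎ (1 ≤ A (e (inl top)) a × 1 ≤ A a (e top) × 1 ≤ A (e top) (e (inl top)))
          sh leaf e ar = inj₁ refl
          sh (node _ _) e ar = inj₂ (≤-reflexive (sym (ar (inl top) (inr top))) , ≤-reflexive (sym (ar (inr top) top)) , ≤-reflexive (sym (ar top (inl top))))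
        nbr : ∀ x v → 1 ≤ adj (e (inl x)) v → (∃[ y ] v ≡ e (inl y)) ⊎ (isTop x ≡ true × (v ≡ topOr r (e ∘ inr) ρ ⊎ v ≡ ρ))
        nbr x v p with nb (inl x) v p
        ... | inj₁ (top , refl) = inj₂ (1≤𝟙 (subst (1 ≤_) (adj≡ (inl x) top) p) , inj₂ refl)
        ... | inj₁ (inl y , refl) = inj₁ (y , refl)
        ... | inj₁ (inr y , refl) with 1≤𝟙∧ (isTop x) (subst (1 ≤_) (trans (adj≡ (inl x) (inr y)) (+-identityʳ _)) p)
        ... | tx , ty = inj₂ (tx , inj₁ (topOr-top (e ∘ inr) ρ y ty))
      right : ∀ x j → c j ≢ e (inr x)
      right = eliminate r (e ∘ inr) ρ (topOr l (e ∘ inl) ρ) (λ x y → ar (inr x) (inr y)) simp nbr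
        where
        simp : ∀ x → isTop x ≡ true → Simplicial A (e (inr x)) ρ (topOr l (e ∘ inl) ρ)
        simp x@top _ = record
          { single-a = ≤-reflexive (adj≡ (inr x) top)
          ; single-b = sb l e ar
          ; shape = sh l e ar }
          where
          sb : ∀ l (e : Node (node l _) → V) → (∀ x y → A (e x) (e y) ≡ arrT x y) → adj (e (inr top)) (topOr l (e ∘ inl) (e top)) ≤ 1
          sb leaf e ar = ≤-reflexive (cong₂ _+_ (ar (inr top) top) (ar top (inr top)))
          sb (node _ _) e ar = ≤-reflexive (cong₂ _+_ (ar (inr top) (inl top)) (ar (inl top) (inr top)))
          sh : ∀ l (e : Node (node l _) → V) → (∀ x y → A (e x) (e y) ≡ arrT x y) → let b = topOr l (e ∘ inl) (e top) in
               e top ≡ b ⊎ (1 ≤ A (e (inr top)) (e top) × 1 ≤ A (e top) b × 1 ≤ A b (e (inr top)))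
          sh leaf e ar = inj₁ refl
          sh (node _ _) e ar = inj₂ (≤-reflexive (sym (ar (inr top) top)) , ≤-reflexive (sym (ar top (inl top))) , ≤-reflexive (sym (ar (inl top) (inr top))))
        nbr : ∀ x v → 1 ≤ adj (e (inr x)) v → (∃[ y ] v ≡ e (inr y)) ⊎ (isTop x ≡ true × (v ≡ ρ ⊎ v ≡ topOr l (e ∘ inl) ρ))
        nbr x v p with nb (inr x) v p
        ... | inj₁ (top , refl) = inj₂ (1≤𝟙 (subst (1 ≤_) (trans (adj≡ (inr x) top) (+-identityʳ _)) p) , inj₁ refl)
        ... | inj₁ (inr y , refl) = inj₁ (y , refl)
        ... | inj₁ (inl y , refl) with 1≤𝟙∧ (isTop y) (subst (1 ≤_) (adj≡ (inr x) (inl y)) p)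
        ... | ty , tx = inj₂ (tx , inj₂ (topOr-top (e ∘ inl) ρ y ty))
      atTop : ∀ j → c j ≢ e top
      atTop j eq = no-simplicial j a b (subst (λ v → Simplicial A v a b) (sym eq) (si top refl))
        (λ k p → near k (nb top (c k) (subst (λ v → 1 ≤ adj v (c k)) eq p)) (subst (λ v → 1 ≤ adj v (c k)) eq p))
        where
        near : ∀ k → (∃[ y ] c k ≡ e y) ⊎ (true ≡ true × (c k ≡ a ⊎ c k ≡ b)) → 1 ≤ adj ρ (c k) → c k ≡ a ⊎ c k ≡ b
        near k (inj₂ (_ , q)) p = q
        near k (inj₁ (top , q)) p with subst (1 ≤_) (trans (cong (adj ρ) q) (adj≡ top top)) p
        ... | ()
        near k (inj₁ (inl y , q)) p = ⊥-elim (left y k q)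
        near k (inj₁ (inr y , q)) p = ⊥-elim (right y k q)

  root? : ∀ t {X : Set} → (Node t → X) → Maybe X
  root? leaf e = nothing
  root? (node _ _) e = just (e top)

  root?-top : ∀ {t} {X : Set} (e : Node t → X) x → isTop x ≡ true → root? t e ≡ just (e x)
  root?-top e top _ = refl

  -- A tree is read off from the graph it spans, given its root and the context K
  -- through which the root is attached to the rest.
  module _ {X : Set} (A : X → X → ℕ) where

    record Attached (K : X → Set) (t : BT) (e : Node t → X) : Set where
      field
        arrows : ∀ x y → A (e x) (e y) ≡ arrT x y
        injective : ∀ {x y} → e x ≡ e y → x ≡ y
        closed : ∀ x v → 1 ≤ A (e x) v + A v (e x) → (∃[ y ] v ≡ e y) ⊎ (isTop x ≡ true × K v)
        disjoint : ∀ x → ¬ K (e x)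

    open Attached

    -- Seen from a subtree, the outside world is the parent together with the root of the sibling
    -- subtree.
    KL KR : ∀ {l r} → (Node (node l r) → X) → X → Set
    KL {l} {r} e v = v ≡ e top ⊎ root? r (e ∘ inr) ≡ just v
    KR {l} {r} e v = v ≡ e top ⊎ root? l (e ∘ inl) ≡ just v

    attachL : ∀ {K l r} {e : Node (node l r) → X} → Attached K (node l r) e → Attached (KL e) l (e ∘ inl)
    attachL {K} {l} {r} {e} T = record
      { arrows = λ x y → arrows T (inl x) (inl y)
      ; injective = λ p → inl-inj (injective T p)
      ; closed = cl
      ; disjoint = λ { x (inj₁ p) → absurd₁ (injective T p) ; x (inj₂ p) → absurd₂ r (e ∘ inr) (λ y q → absurd₃ (injective T q)) p } }
      where
      inl-inj : ∀ {x y : Node l} → inl {r = r} x ≡ inl y → x ≡ y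
      inl-inj refl = refl
      absurd₁ : ∀ {x : Node l} → inl {r = r} x ≡ top → ⊥
      absurd₁ ()
      absurd₃ : ∀ {x : Node l} {y : Node r} → inr {l = l} y ≡ inl x → ⊥
      absurd₃ ()
      absurd₂ : ∀ r (f : Node r → X) {v} → (∀ y → f y ≢ v) → root? r f ≢ just v
      absurd₂ (node _ _) f ne refl = ne top refl
      cl : ∀ x v → 1 ≤ A (e (inl x)) v + A v (e (inl x)) → (∃[ y ] v ≡ e (inl y)) ⊎ (isTop x ≡ true × KL e v)
      cl x v p with closed T (inl x) v p
      ... | inj₁ (top , refl) = inj₂ (1≤𝟙 (subst (1 ≤_) (cong₂ _+_ (arrows T (inl x) top) (arrows T top (inl x))) p) , inj₁ refl)
      ... | inj₁ (inl y , refl) = inj₁ (y , refl)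
      ... | inj₁ (inr y , refl) with 1≤𝟙∧ (isTop x) (subst (1 ≤_) (trans (cong₂ _+_ (arrows T (inl x) (inr y)) (arrows T (inr y) (inl x))) (+-identityʳ _)) p)
      ... | tx , ty = inj₂ (tx , inj₂ (root?-top (e ∘ inr) y ty))

    attachR : ∀ {K l r} {e : Node (node l r) → X} → Attached K (node l r) e → Attached (KR e) r (e ∘ inr)
    attachR {K} {l} {r} {e} T = record
      { arrows = λ x y → arrows T (inr x) (inr y)
      ; injective = λ p → inr-inj (injective T p)
      ; closed = cl
      ; disjoint = λ { x (inj₁ p) → absurd₁ (injective T p) ; x (inj₂ p) → absurd₂ l (e ∘ inl) (λ y q → absurd₃ (injective T q)) p } }
      where
      inr-inj : ∀ {x y : Node r} → inr {l = l} x ≡ inr y → x ≡ y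
      inr-inj refl = refl
      absurd₁ : ∀ {x : Node r} → inr {l = l} x ≡ top → ⊥
      absurd₁ ()
      absurd₃ : ∀ {x : Node r} {y : Node l} → inl {r = r} y ≡ inr x → ⊥
      absurd₃ ()
      absurd₂ : ∀ l (f : Node l → X) {v} → (∀ y → f y ≢ v) → root? l f ≢ just v
      absurd₂ (node _ _) f ne refl = ne top refl
      cl : ∀ x v → 1 ≤ A (e (inr x)) v + A v (e (inr x)) → (∃[ y ] v ≡ e (inr y)) ⊎ (isTop x ≡ true × KR e v)
      cl x v p with closed T (inr x) v p
      ... | inj₁ (top , refl) = inj₂ (1≤𝟙 (subst (1 ≤_) (trans (cong₂ _+_ (arrows T (inr x) top) (arrows T top (inr x))) (+-identityʳ _)) p) , inj₁ refl)
      ... | inj₁ (inr y , refl) = inj₁ (y , refl)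
      ... | inj₁ (inl y , refl) with 1≤𝟙∧ (isTop y) (subst (1 ≤_) (cong₂ _+_ (arrows T (inr x) (inl y)) (arrows T (inl y) (inr x))) p)
      ... | ty , tx = inj₂ (tx , inj₂ (root?-top (e ∘ inl) y ty))

    -- the left child is the out-neighbour of the root, the right child the in-neighbour
    child : ∀ {K t l′ r′} {e : Node t → X} {e′ : Node (node l′ r′) → X} → Attached K t e → Attached K (node l′ r′) e′ → ∀ x →
      (1 ≤ A (e′ top) (e x) → root? l′ (e′ ∘ inl) ≡ just (e x)) × (1 ≤ A (e x) (e′ top) → root? r′ (e′ ∘ inr) ≡ just (e x))
    child {l′ = l′} {r′} {e} {e′} T T′ x = left , right
      where
      find : 1 ≤ A (e′ top) (e x) + A (e x) (e′ top) → ∃[ y ] e x ≡ e′ y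
      find p with closed T′ top (e x) p
      ... | inj₁ q = q
      ... | inj₂ (_ , k) = ⊥-elim (disjoint T x k)
      left : 1 ≤ A (e′ top) (e x) → root? l′ (e′ ∘ inl) ≡ just (e x)
      left p = go (find (≤-trans p (m≤m+n _ _)))
        where
        hit : ∀ y → e x ≡ e′ y → 1 ≤ arrT top y
        hit y q = subst (1 ≤_) (trans (cong (A (e′ top)) q) (arrows T′ top y)) p
        go : (∃[ y ] e x ≡ e′ y) → root? l′ (e′ ∘ inl) ≡ just (e x)
        go (inl y , q) = trans (root?-top (e′ ∘ inl) y (1≤𝟙 (hit (inl y) q))) (cong just (sym q))
        go (top , q) with () ← hit top q
        go (inr y , q) with () ← hit (inr y) q
      right : 1 ≤ A (e x) (e′ top) → root? r′ (e′ ∘ inr) ≡ just (e x)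
      right p = go (find (≤-trans p (m≤n+m _ (A (e′ top) (e x)))))
        where
        hit : ∀ y → e x ≡ e′ y → 1 ≤ arrT y top
        hit y q = subst (1 ≤_) (trans (cong (λ v → A v (e′ top)) q) (arrows T′ y top)) p
        go : (∃[ y ] e x ≡ e′ y) → root? r′ (e′ ∘ inr) ≡ just (e x)
        go (inr y , q) = trans (root?-top (e′ ∘ inr) y (1≤𝟙 (hit (inr y) q))) (cong just (sym q))
        go (top , q) with () ← hit top q
        go (inl y , q) with () ← hit (inl y) q

    K-cong : ∀ {K K′ : X → Set} {t} {e : Node t → X} → (∀ v → K v → K′ v) → (∀ v → K′ v → K v) → Attached K t e → Attached K′ t e
    K-cong f g T = record { arrows = arrows T ; injective = injective T
      ; closed = λ x v p → [ inj₁ , (λ (q , k) → inj₂ (q , f v k)) ]′ (closed T x v p)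
      ; disjoint = λ x k → disjoint T x (g _ k) }

    -- Once the roots agree, `child` makes the roots of both subtrees agree, and with them the
    -- contexts of the recursive calls.
    tree-unique : ∀ t t′ {K e e′} → Attached K t e → Attached K t′ e′ → root? t e ≡ root? t′ e′ → t ≡ t′
    tree-unique leaf leaf T T′ p = refl
    tree-unique leaf (node _ _) T T′ ()
    tree-unique (node _ _) leaf T T′ ()
    tree-unique (node l r) (node l′ r′) {K} {e} {e′} T T′ p = cong₂ node
      (tree-unique l l′ (attachL T) (K-cong
        (λ { v (inj₁ q) → inj₁ (trans q (sym ρ≡)) ; v (inj₂ q) → inj₂ (trans right≡ q) })
        (λ { v (inj₁ q) → inj₁ (trans q ρ≡) ; v (inj₂ q) → inj₂ (trans (sym right≡) q) }) (attachL T′)) left≡)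
      (tree-unique r r′ (attachR T) (K-cong
        (λ { v (inj₁ q) → inj₁ (trans q (sym ρ≡)) ; v (inj₂ q) → inj₂ (trans left≡ q) })
        (λ { v (inj₁ q) → inj₁ (trans q ρ≡) ; v (inj₂ q) → inj₂ (trans (sym left≡) q) }) (attachR T′)) right≡)
      where
      ρ≡ : e top ≡ e′ top
      ρ≡ = just-injective p
      left≡ : root? l (e ∘ inl) ≡ root? l′ (e′ ∘ inl)
      left≡ = lem l l′ e e′ T T′ ρ≡
        where
        lem : ∀ l l′ (e : Node (node l r) → X) (e′ : Node (node l′ r′) → X) → Attached K _ e → Attached K _ e′ → e top ≡ e′ top → root? l (e ∘ inl) ≡ root? l′ (e′ ∘ inl)
        lem leaf leaf e e′ T T′ q = refl
        lem (node _ _) l′ e e′ T T′ q = sym (proj₁ (child T T′ (inl top)) (subst (λ v → 1 ≤ A v (e (inl top))) q (≤-reflexive (sym (arrows T top (inl top))))))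
        lem leaf (node _ _) e e′ T T′ q = proj₁ (child T′ T (inl top)) (subst (λ v → 1 ≤ A v (e′ (inl top))) (sym q) (≤-reflexive (sym (arrows T′ top (inl top)))))
      right≡ : root? r (e ∘ inr) ≡ root? r′ (e′ ∘ inr)
      right≡ = lem r r′ e e′ T T′ ρ≡
        where
        lem : ∀ r r′ (e : Node (node l r) → X) (e′ : Node (node l′ r′) → X) → Attached K _ e → Attached K _ e′ → e top ≡ e′ top → root? r (e ∘ inr) ≡ root? r′ (e′ ∘ inr)
        lem leaf leaf e e′ T T′ q = refl
        lem (node _ _) r′ e e′ T T′ q = sym (proj₂ (child T T′ (inr top)) (subst (λ v → 1 ≤ A (e (inr top)) v) q (≤-reflexive (sym (arrows T (inr top) top)))))
        lem leaf (node _ _) e e′ T T′ q = proj₂ (child T′ T (inr top)) (subst (λ v → 1 ≤ A (e′ (inr top)) v) (sym q) (≤-reflexive (sym (arrows T′ (inr top) top))))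

-- From realizations to words of trees, and the meaning of the parameters.

module Models where

  open Sums
  open Forests using (BT; leaf; node; isLeaf; leaves; cherries; leavesF; cherriesF; Bead; pick)
  open Necklaces using (beadStat; ∑-pick)
  open Cycles
  open TreeQuivers
  open RootedTrees
  open import Data.Bool using (_∨_; not)
  import Data.Bool.Properties as Boolₚ
  open import Data.Fin using (Fin; zero; suc)
  open import Data.Fin.Properties using () renaming (_≟_ to _≟ᶠ_)
  open import Data.List using (foldr; map)
  import Data.List.Properties as Listₚ
  open import Data.Maybe using (is-nothing)
  open import Data.Maybe.Properties using (≡-dec)
  open import Data.Nat as ℕ using (ℕ; zero; suc; _+_; _*_; _≤_; z≤n; s≤s)
  open import Data.Nat.DivMod using (m*n/n≡m)
  open import Data.Nat.Properties
  open import Data.Product using (Σ)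

  -- Kept apart from the realization because trees arise in two ways, extracted from a given
  -- realization or prescribed in a construction.
  record Model {n} (R : RData n) (tr : Fin (suc (suc (m₀ R))) → BT) : Set where
    field
      part-emb : ∀ i → Emb (arr R) (inPart R i) (tr i)
      att-root : ∀ i → att R i ≡ rootOf (tr i) (part-emb i)

    word : List Bead
    word = tabulate (λ i → cw R i , tr i)

  open Model public

  module Realized {n} (R : RData n) (isR : IsRealization R) where

    loop : ∀ a → arr R a a ≡ 0
    loop = proj₁ (proj₁ isR)

    private
      cycle = proj₁ (proj₂ isR)
      rest₁ = proj₂ (proj₂ (proj₂ isR))
      rest₂ = proj₂ (proj₂ rest₁)
      rest₃ = proj₂ (proj₂ rest₂)

    cyc-injective : ∀ i j → cyc R i ≡ cyc R j → i ≡ j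
    cyc-injective = proj₁ cycle

    cyc-full : ∀ i j → arr R (cyc R i) (cyc R j) ≡ baseCount (cw R) i j
    cyc-full = proj₂ (proj₂ cycle)

    part-cyc : ∀ i → part R (cyc R i) ≡ nothing
    part-cyc = proj₁ rest₁

    part-nothing : ∀ v → part R v ≡ nothing → ∃[ i ] cyc R i ≡ v
    part-nothing = proj₁ (proj₂ rest₁)

    part-att : ∀ v i → part R v ≡ just i → ∃[ z ] att R i ≡ just z
    part-att = proj₁ (proj₂ rest₂)

    arr-cyc : ∀ v i j → part R v ≡ just i →
       arr R (cyc R j) v ≡ 𝟙 (⌊ ≡-dec _≟ᶠ_ (att R i) (just v) ⌋ ∧ ⌊ headB (cw R) i ≟ᶠ j ⌋) ×
       arr R v (cyc R j) ≡ 𝟙 (⌊ ≡-dec _≟ᶠ_ (att R i) (just v) ⌋ ∧ ⌊ tailB (cw R) i ≟ᶠ j ⌋)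
    arr-cyc = proj₁ rest₃

    arr-parts : ∀ u v i j → part R u ≡ just i → part R v ≡ just j → i ≢ j → arr R u v ≡ 0
    arr-parts = proj₁ (proj₂ rest₃)

    rooted : ∀ i z → att R i ≡ just z → RootedA (arr R) (inPart R i) z
    rooted = proj₂ (proj₂ rest₃)

    -- Without z_α no vertex lies in the part, which is then a leaf; otherwise `embed` supplies the
    -- tree.
    model-at : ∀ i → Σ BT λ t → Σ (Emb (arr R) (inPart R i) t) λ E → att R i ≡ rootOf t E
    model-at i = lem (att R i) refl
      where
      lem : ∀ m → att R i ≡ m → Σ BT λ t → Σ (Emb (arr R) (inPart R i) t) λ E → m ≡ rootOf t E
      lem (just z) p = let (l , r , E , q) = embed (arr R) loop (rooted i z p) in node l r , E , cong just (sym q)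
      lem nothing p = leaf , record { emb = λ () ; loc = λ _ → nothing ; loc-emb = λ () ; emb-loc = λ () ; mem = outside ; arr-emb = λ () } , refl
        where
        outside : ∀ v → inPart R i v ≡ false
        outside v = ⌊⌋-false (≡-dec _≟ᶠ_ (part R v) (just i)) (λ q → absurd (trans (sym p) (proj₂ (part-att v i q))))
          where
          absurd : ∀ {z : Fin n} → nothing ≡ just z → ⊥
          absurd ()

    shape : Fin (suc (suc (m₀ R))) → BT
    shape i = proj₁ (model-at i)

    model : Model R shape
    model = record { part-emb = λ i → proj₁ (proj₂ (model-at i)) ; att-root = λ i → proj₂ (proj₂ (model-at i)) }

    module WithModel {tr : Fin (suc (suc (m₀ R))) → BT} (M : Model R tr) where

      e : ∀ i → Node (tr i) → Fin n
      e i = emb (part-emb M i)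

      part-e : ∀ i x → part R (e i x) ≡ just i
      part-e i x = ⌊⌋-true⁻ (≡-dec _≟ᶠ_ (part R (e i x)) (just i)) (emb∈ (part-emb M i) x)

      cyc≢e : ∀ j i x → cyc R j ≢ e i x
      cyc≢e j i x p with trans (sym (part-cyc j)) (trans (cong (part R) p) (part-e i x))
      ... | ()

      e-part : ∀ {i j x y} → e i x ≡ e j y → i ≡ j
      e-part {i} {j} {x} {y} p = just-injective (trans (sym (part-e i x)) (trans (cong (part R) p) (part-e j y)))

      locate : ∀ v → (∃[ i ] cyc R i ≡ v) ⊎ (∃[ i ] ∃[ x ] e i x ≡ v)
      locate v = lem (part R v) refl
        where
        lem : ∀ m → part R v ≡ m → (∃[ i ] cyc R i ≡ v) ⊎ (∃[ i ] ∃[ x ] e i x ≡ v)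
        lem nothing p = inj₁ (part-nothing v p)
        lem (just i) p = inj₂ (i , emb-surjective (part-emb M i) v (⌊⌋-true (≡-dec _≟ᶠ_ (part R v) (just i)) p))

      ⌊att≟e⌋ : ∀ i x → ⌊ ≡-dec _≟ᶠ_ (att R i) (just (e i x)) ⌋ ≡ isTop x
      ⌊att≟e⌋ i x = trans (cong (λ m → ⌊ ≡-dec _≟ᶠ_ m (just (e i x)) ⌋) (att-root M i)) (lem (tr i) (part-emb M i) x)
        where
        lem : ∀ t (E : Emb (arr R) (inPart R i) t) x → ⌊ ≡-dec _≟ᶠ_ (rootOf t E) (just (emb E x)) ⌋ ≡ isTop x
        lem (node l r) E top = ⌊⌋-true (≡-dec _≟ᶠ_ (just (emb E top)) (just (emb E top))) refl
        lem (node l r) E (inl x) = ⌊⌋-false (≡-dec _≟ᶠ_ (just (emb E top)) (just (emb E (inl x)))) (λ p → absurd (emb-injective E (just-injective p)))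
          where
          absurd : top ≡ inl x → ⊥
          absurd ()
        lem (node l r) E (inr x) = ⌊⌋-false (≡-dec _≟ᶠ_ (just (emb E top)) (just (emb E (inr x)))) (λ p → absurd (emb-injective E (just-injective p)))
          where
          absurd : top ≡ inr x → ⊥
          absurd ()

      arr-cyc-e : ∀ j i x → arr R (cyc R j) (e i x) ≡ 𝟙 (isTop x ∧ ⌊ headB (cw R) i ≟ᶠ j ⌋)
      arr-cyc-e j i x = trans (proj₁ (arr-cyc (e i x) i j (part-e i x))) (cong (λ b → 𝟙 (b ∧ ⌊ headB (cw R) i ≟ᶠ j ⌋)) (⌊att≟e⌋ i x))

      arr-e-cyc : ∀ j i x → arr R (e i x) (cyc R j) ≡ 𝟙 (isTop x ∧ ⌊ tailB (cw R) i ≟ᶠ j ⌋)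
      arr-e-cyc j i x = trans (proj₂ (arr-cyc (e i x) i j (part-e i x))) (cong (λ b → 𝟙 (b ∧ ⌊ tailB (cw R) i ≟ᶠ j ⌋)) (⌊att≟e⌋ i x))

      arr-e-e : ∀ i x j y → i ≢ j → arr R (e i x) (e j y) ≡ 0
      arr-e-e i x j y = arr-parts (e i x) (e j y) i j (part-e i x) (part-e j y)

      neighbour : ∀ i x v → 1 ≤ arr R (e i x) v + arr R v (e i x) → (∃[ y ] v ≡ e i y) ⊎ (isTop x ≡ true × ∃[ j ] cyc R j ≡ v)
      neighbour i x v p = lem (locate v)
        where
        lem : (∃[ j ] cyc R j ≡ v) ⊎ (∃[ j ] ∃[ y ] e j y ≡ v) → (∃[ y ] v ≡ e i y) ⊎ (isTop x ≡ true × ∃[ j ] cyc R j ≡ v)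
        lem (inj₁ (j , refl)) = inj₂ ([ (λ q → proj₁ (1≤𝟙∧ (isTop x) (subst (1 ≤_) (arr-e-cyc j i x) q)))
                                      , (λ q → proj₁ (1≤𝟙∧ (isTop x) (subst (1 ≤_) (arr-cyc-e j i x) q))) ]′ (1≤+ (arr R (e i x) (cyc R j)) p) , j , refl)
        lem (inj₂ (j , y , refl)) with i ≟ᶠ j
        ... | yes refl = inj₁ (y , refl)
        ... | no i≢j with subst (1 ≤_) (cong₂ _+_ (arr-e-e i x j y i≢j) (arr-e-e j y i x (i≢j ∘ sym))) p
        ... | ()

      attached : ∀ i → Attached (arr R) (λ v → ∃[ j ] cyc R j ≡ v) (tr i) (e i)
      attached i = record
        { arrows = arr-emb (part-emb M i) ; injective = emb-injective (part-emb M i)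
        ; closed = neighbour i ; disjoint = λ x (j , p) → cyc≢e j i x p }

      open Params R

      triangles≡ : ∀ i → triangles i ≡ triCount (tr i)
      triangles≡ i = trans (cong (ℕ._/ 3) (trans count (triples≡ (tr i)))) (m*n/n≡m (triCount (tr i)) 3)
        where
        open ≡-Reasoning
        S = inPart R i
        X : Fin n → Fin n → Fin n → Bool
        X a b c = pos (arr R a b) ∧ pos (arr R b c) ∧ pos (arr R c a)
        E = part-emb M i
        shift : ∀ p q s t → 𝟙 (p ∧ q ∧ s ∧ t) ≡ 𝟙 p * (𝟙 q * (𝟙 s * 𝟙 t))
        shift false q s t = refl
        shift true false s t = refl
        shift true true false t = refl
        shift true true true t = sym (trans (*-identityˡ _) (trans (*-identityˡ _) (*-identityˡ _)))
        count : (∑ᶠ λ a → ∑ᶠ λ b → ∑ᶠ λ c → 𝟙 (S a ∧ S b ∧ S c ∧ X a b c)) ≡ triples (tr i)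
        count = begin
          ∑ (allFin n) (λ a → ∑ (allFin n) (λ b → ∑ (allFin n) (λ c → 𝟙 (S a ∧ S b ∧ S c ∧ X a b c))))
            ≡⟨ ∑-cong′ (allFin n) (λ a → ∑-cong′ (allFin n) (λ b → ∑-cong′ (allFin n) (λ c → shift (S a) (S b) (S c) (X a b c)))) ⟩
          ∑ (allFin n) (λ a → ∑ (allFin n) (λ b → ∑ (allFin n) (λ c → 𝟙 (S a) * (𝟙 (S b) * (𝟙 (S c) * 𝟙 (X a b c))))))
            ≡⟨ ∑-cong′ (allFin n) (λ a → trans (∑-cong′ (allFin n) (λ b → trans (sym (∑-*ˡ (𝟙 (S a)) (allFin n) _)) (cong (𝟙 (S a) *_) (trans (sym (∑-*ˡ (𝟙 (S b)) (allFin n) _)) (cong (𝟙 (S b) *_) (∑-emb E (λ c → 𝟙 (X a b c)))))))) (sym (∑-*ˡ (𝟙 (S a)) (allFin n) _))) ⟩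
          ∑ (allFin n) (λ a → 𝟙 (S a) * ∑ (allFin n) (λ b → 𝟙 (S b) * ∑ (nodes (tr i)) (λ z → 𝟙 (X a b (e i z)))))
            ≡⟨ ∑-emb E (λ a → ∑ (allFin n) (λ b → 𝟙 (S b) * ∑ (nodes (tr i)) (λ z → 𝟙 (X a b (e i z))))) ⟩
          ∑ (nodes (tr i)) (λ x → ∑ (allFin n) (λ b → 𝟙 (S b) * ∑ (nodes (tr i)) (λ z → 𝟙 (X (e i x) b (e i z)))))
            ≡⟨ ∑-cong′ (nodes (tr i)) (λ x → ∑-emb E (λ b → ∑ (nodes (tr i)) (λ z → 𝟙 (X (e i x) b (e i z))))) ⟩
          ∑ (nodes (tr i)) (λ x → ∑ (nodes (tr i)) (λ y → ∑ (nodes (tr i)) (λ z → 𝟙 (X (e i x) (e i y) (e i z)))))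
            ≡⟨ ∑-cong′ (nodes (tr i)) (λ x → ∑-cong′ (nodes (tr i)) (λ y → ∑-cong′ (nodes (tr i)) (λ z →
                 cong₂ (λ u v → 𝟙 (pos u ∧ v)) (arr-emb E x y) (cong₂ (λ u v → pos u ∧ pos v) (arr-emb E y z) (arr-emb E z x))))) ⟩
          triples (tr i) ∎

      fold-∨ : ∀ {X : Set} (f : X → Bool) (xs : List X) → Bool
      fold-∨ f xs = foldr (λ c acc → f c ∨ acc) false xs

      fold-∨-true : ∀ {X : Set} (f : X → Bool) {xs x} → x ∈ xs → f x ≡ true → fold-∨ f xs ≡ true
      fold-∨-true f {x ∷ xs} (here refl) p = cong (_∨ fold-∨ f xs) p
      fold-∨-true f {y ∷ xs} (there x∈) p = trans (cong (f y ∨_) (fold-∨-true f x∈ p)) (Boolₚ.∨-zeroʳ (f y))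

      fold-∨-false : ∀ {X : Set} (f : X → Bool) xs → (∀ x → f x ≡ false) → fold-∨ f xs ≡ false
      fold-∨-false f [] p = refl
      fold-∨-false f (x ∷ xs) p = cong₂ _∨_ (p x) (fold-∨-false f xs p)

      pos-1 : ∀ {k} → k ≡ 1 → pos k ≡ true
      pos-1 refl = refl

      not-both : ∀ {j k} → (1 ≤ j → 1 ≤ k → ⊥) → pos j ∧ pos k ≡ false
      not-both {zero} f = refl
      not-both {suc j} {zero} f = refl
      not-both {suc j} {suc k} f = ⊥-elim (f (s≤s z≤n) (s≤s z≤n))

      -- The search in `no3cyc` ranges over the whole quiver, also outside the tree. A third vertex
      -- on the base cycle would force both ends of the arrow to be the root, and there is no loop
      -- there.
      no3cyc-fr : ∀ i x y → 𝟙 (no3cyc (e i x) (e i y)) * arr R (e i x) (e i y) ≡ fr x y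
      no3cyc-fr i x y with arrowKind x y
      ... | none p q = trans (cong (𝟙 (no3cyc (e i x) (e i y)) *_) (trans (arr-emb (part-emb M i) x y) p)) (trans (*-zeroʳ (𝟙 (no3cyc (e i x) (e i y)))) (sym q))
      ... | in3cyc p q z u v = trans (cong (λ b → 𝟙 (not b) * arr R (e i x) (e i y))
        (fold-∨-true (λ c → pos (arr R (e i y) c) ∧ pos (arr R c (e i x))) (∈-allFin (e i z))
          (cong₂ _∧_ (pos-1 (trans (arr-emb (part-emb M i) y z) u)) (pos-1 (trans (arr-emb (part-emb M i) z x) v))))) (sym q)
      ... | isFree p q f = trans (cong₂ (λ b k → 𝟙 (not b) * k)
        (fold-∨-false (λ c → pos (arr R (e i y) c) ∧ pos (arr R c (e i x))) (allFin n) (λ c → not-both (apart c)))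
        (trans (arr-emb (part-emb M i) x y) p)) (sym q)
        where
        apart : ∀ c → 1 ≤ arr R (e i y) c → 1 ≤ arr R c (e i x) → ⊥
        apart c s t with neighbour i y c (≤-trans s (m≤m+n _ _))
        ... | inj₁ (z , refl) = [ (λ k → absurd (subst (1 ≤_) (trans (arr-emb (part-emb M i) y z) k) s))
                                , (λ k → absurd (subst (1 ≤_) (trans (arr-emb (part-emb M i) z x) k) t)) ]′ (f z)
          where
          absurd : 1 ≤ 0 → ⊥
          absurd ()
        ... | inj₂ (ty , j , refl) with isTop-unique x y (proj₁ (1≤𝟙∧ (isTop x) (subst (1 ≤_) (arr-cyc-e j i x) t))) ty
        ... | refl with trans (sym p) (arrT-loop x)
        ... | ()

      freeArrows≡ : ∀ i → freeArrows i ≡ freeCount (tr i)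
      freeArrows≡ i = begin
        ∑ (allFin n) (λ a → ∑ (allFin n) (λ b → 𝟙 (S a ∧ S b ∧ no3cyc a b) * arr R a b))
          ≡⟨ ∑-cong′ (allFin n) (λ a → trans (∑-cong′ (allFin n) (λ b → shift (S a) (S b) (no3cyc a b) (arr R a b))) (sym (∑-*ˡ (𝟙 (S a)) (allFin n) _))) ⟩
        ∑ (allFin n) (λ a → 𝟙 (S a) * ∑ (allFin n) (λ b → 𝟙 (S b) * (𝟙 (no3cyc a b) * arr R a b)))
          ≡⟨ ∑-emb E (λ a → ∑ (allFin n) (λ b → 𝟙 (S b) * (𝟙 (no3cyc a b) * arr R a b))) ⟩
        ∑ (nodes (tr i)) (λ x → ∑ (allFin n) (λ b → 𝟙 (S b) * (𝟙 (no3cyc (e i x) b) * arr R (e i x) b)))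
          ≡⟨ ∑-cong′ (nodes (tr i)) (λ x → ∑-emb E (λ b → 𝟙 (no3cyc (e i x) b) * arr R (e i x) b)) ⟩
        ∑ (nodes (tr i)) (λ x → ∑ (nodes (tr i)) (λ y → 𝟙 (no3cyc (e i x) (e i y)) * arr R (e i x) (e i y)))
          ≡⟨ ∑-cong′ (nodes (tr i)) (λ x → ∑-cong′ (nodes (tr i)) (λ y → no3cyc-fr i x y)) ⟩
        ∑ (nodes (tr i)) (λ x → ∑ (nodes (tr i)) (fr x))
          ≡⟨ ∑-fr (tr i) ⟩
        freeCount (tr i) ∎
        where
        open ≡-Reasoning
        S = inPart R i
        E = part-emb M i
        shift : ∀ p q s k → 𝟙 (p ∧ q ∧ s) * k ≡ 𝟙 p * (𝟙 q * (𝟙 s * k))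
        shift false q s k = refl
        shift true false s k = refl
        shift true true s k = sym (trans (*-identityˡ (1 * (𝟙 s * k))) (*-identityˡ (𝟙 s * k)))

      is-nothing-att : ∀ i → is-nothing (att R i) ≡ isLeaf (tr i)
      is-nothing-att i = trans (cong is-nothing (att-root M i)) (lem (tr i) (part-emb M i))
        where
        lem : ∀ t (E : Emb (arr R) (inPart R i) t) → is-nothing (rootOf t E) ≡ isLeaf t
        lem leaf E = refl
        lem (node _ _) E = refl

      is-just-att : ∀ i → is-just (att R i) ≡ not (isLeaf (tr i))
      is-just-att i = trans (cong is-just (att-root M i)) (lem (tr i) (part-emb M i))
        where
        lem : ∀ t (E : Emb (arr R) (inPart R i) t) → is-just (rootOf t E) ≡ not (isLeaf t)
        lem leaf E = refl
        lem (node _ _) E = refl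

      beadStat≡ : ∀ b c v t → beadStat c v (b , t) ≡ 𝟙 ⌊ Boolₚ._≟_ b c ⌋ * v t
      beadStat≡ false false v t = sym (*-identityˡ (v t))
      beadStat≡ true false v t = refl
      beadStat≡ false true v t = refl
      beadStat≡ true true v t = sym (*-identityˡ (v t))

      ∑-word : ∀ c v → ∑ (pick c (word M)) v ≡ ∑ (allFin (suc (suc (m₀ R)))) (λ i → 𝟙 ⌊ Boolₚ._≟_ (cw R i) c ⌋ * v (tr i))
      ∑-word c v = begin
        ∑ (pick c (word M)) v ≡⟨ ∑-pick c v (word M) ⟩
        ∑ (tabulate (λ i → cw R i , tr i)) (beadStat c v) ≡⟨ cong (λ xs → ∑ xs (beadStat c v)) (sym (Listₚ.map-tabulate (λ i → i) (λ i → cw R i , tr i))) ⟩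
        ∑ (map (λ i → cw R i , tr i) (allFin _)) (beadStat c v) ≡⟨ ∑-map (λ i → cw R i , tr i) (allFin _) (beadStat c v) ⟩
        ∑ (allFin _) (λ i → beadStat c v (cw R i , tr i)) ≡⟨ ∑-cong′ (allFin _) (λ i → beadStat≡ (cw R i) c v (tr i)) ⟩
        ∑ (allFin _) (λ i → 𝟙 ⌊ Boolₚ._≟_ (cw R i) c ⌋ * v (tr i)) ∎
        where open ≡-Reasoning

      cycles3≡ : ∀ o → cherriesF (pick o (word M)) ≡ cycles3 o
      cycles3≡ o = trans (∑-word o cherries) (∑-cong′ (allFin _) (λ i → cong (𝟙 ⌊ Boolₚ._≟_ (cw R i) o ⌋ *_)
        (trans (cherries≡ (tr i)) (cong₂ _+_ (cong 𝟙 (sym (is-just-att i))) (sym (triangles≡ i))))))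

      leaves-stat : ∀ o → leavesF (pick o (word M)) ≡ free o + 2 * cycles3 o
      leaves-stat o = begin
        leavesF (pick o (word M)) ≡⟨ ∑-word o leaves ⟩
        ∑ (allFin m) (λ i → k i * leaves (tr i)) ≡⟨ ∑-cong′ (allFin m) (λ i → trans (cong (k i *_) (leaves≡ (tr i))) (trans (*-distribˡ-+ (k i) _ _) (cong (k i * (𝟙 (isLeaf (tr i)) + freeCount (tr i)) +_) (swap (k i) (cherries (tr i)))))) ⟩
        ∑ (allFin m) (λ i → k i * (𝟙 (isLeaf (tr i)) + freeCount (tr i)) + 2 * (k i * cherries (tr i)))
                                                                        ≡⟨ trans (∑-+ (allFin m) (λ i → k i * (𝟙 (isLeaf (tr i)) + freeCount (tr i))) (λ i → 2 * (k i * cherries (tr i)))) (cong (∑ (allFin m) (λ i → k i * (𝟙 (isLeaf (tr i)) + freeCount (tr i))) +_) (sym (∑-*ˡ 2 (allFin m) (λ i → k i * cherries (tr i))))) ⟩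
        ∑ (allFin m) (λ i → k i * (𝟙 (isLeaf (tr i)) + freeCount (tr i))) + 2 * ∑ (allFin m) (λ i → k i * cherries (tr i))
                                                                        ≡⟨ cong₂ (λ a b → a + 2 * b) (∑-cong′ (allFin m) (λ i → cong (k i *_) (cong₂ _+_ (cong 𝟙 (sym (is-nothing-att i))) (sym (freeArrows≡ i)))))
                                                                             (trans (sym (∑-word o cherries)) (cycles3≡ o)) ⟩
        free o + 2 * cycles3 o ∎
        where
        open ≡-Reasoning
        m = suc (suc (m₀ R))
        k : Fin m → ℕ
        k i = 𝟙 ⌊ Boolₚ._≟_ (cw R i) o ⌋
        swap : ∀ x y → x * (2 * y) ≡ 2 * (x * y)
        swap x y = trans (sym (*-assoc x 2 y)) (trans (cong (_* y) (*-comm x 2)) (*-assoc 2 x y))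

-- Identification of realizations is rotation of words.

module Identification where

  open Sums
  open Forests using (BT; leaf; node; Bead)
  open Rotations using (_%%_)
  open Necklaces using (at; nth; rotate; at-ext; at-rotate; length-rotate)
  open Cycles
  open TreeQuivers
  open RootedTrees
  open Models
  open import Data.Fin using (Fin; zero; suc; toℕ)
  open import Data.Fin.Properties using (toℕ-injective; toℕ<n) renaming (_≟_ to _≟ᶠ_)
  open import Data.List using (map)
  import Data.List.Properties as Listₚ
  import Data.List.Relation.Unary.Unique.Propositional.Properties as Uniqueₚ
  import Data.Maybe as Maybe
  open import Data.Nat as ℕ using (ℕ; zero; suc; _+_; _*_; _∸_; _≤_; _%_)
  open import Data.Nat.DivMod using (_mod_; %-distribˡ-+; m%n%n≡m%n; m<n⇒m%n≡m)
  open import Data.Nat.Properties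
  open import Function.Bundles using (Inverse; mk↔ₛ′)

  at-tabulate : ∀ {m₀} (f : Fin (suc (suc m₀)) → Bead) k → at (tabulate f) k ≡ f (k mod suc (suc m₀))
  at-tabulate {m₀} f k = trans (cong (λ n → nth (tabulate f) (k %% n)) (Listₚ.length-tabulate f))
    (trans (cong (nth (tabulate f)) (sym (Cyclic.toℕ-mod m₀ k))) (nth-tabulate f (k mod suc (suc m₀))))
    where
    nth-tabulate : ∀ {n} (f : Fin n → Bead) i → nth (tabulate f) (toℕ i) ≡ f i
    nth-tabulate f zero = refl
    nth-tabulate f (suc i) = nth-tabulate (f ∘ suc) i

  -- Rotation between index sets whose sizes are only propositionally equal; the equality is used up
  -- once, in `rot`.
  record Rot (m₀ m₀′ t : ℕ) : Set where
    field
      to : Fin (suc (suc m₀)) → Fin (suc (suc m₀′))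
      from : Fin (suc (suc m₀′)) → Fin (suc (suc m₀))
      toℕ-to : ∀ i → toℕ (to i) ≡ (toℕ i + t) % suc (suc m₀)
      to-mod : ∀ k → to (k mod suc (suc m₀)) ≡ (k + t) mod suc (suc m₀′)
      from-to : ∀ i → from (to i) ≡ i
      to-from : ∀ j → to (from j) ≡ j
      to-next : ∀ i → to (next i) ≡ next (to i)

  rot : ∀ {m₀ m₀′} → m₀ ≡ m₀′ → ∀ t → Rot m₀ m₀′ t
  rot {m₀} refl t = record
    { to = step t ; from = step s ; toℕ-to = toℕ-step t
    ; to-mod = λ k → toℕ-injective (trans (toℕ-step t (k mod m)) (trans (cong (λ z → (z + t) % m) (toℕ-mod k)) (trans (%-distribˡ-+ (k % m) t m)
        (trans (cong (λ z → (z + t % m) % m) (m%n%n≡m%n k m)) (trans (sym (%-distribˡ-+ k t m)) (sym (toℕ-mod (k + t))))))))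
    ; from-to = λ i → trans (step-+ s t i) (trans (cong (λ k → step k i) (m+[n∸m]≡n t≤tm)) (step-* t i))
    ; to-from = λ i → trans (step-+ t s i) (trans (cong (λ k → step k i) (m∸n+n≡m t≤tm)) (step-* t i))
    ; to-next = λ i → trans (cong (step t) (next≡step i)) (trans (step-+ t 1 i) (trans (cong (λ k → step k i) (+-comm 1 t)) (trans (sym (step-+ 1 t i)) (sym (next≡step (step t i)))))) }
    where
    open Cyclic m₀
    -- Completes t to t full turns.
    s = t * m ∸ t
    t≤tm : t ≤ t * m
    t≤tm = m≤m*n t m
    step-* : ∀ q i → step (q * m) i ≡ i
    step-* zero i = step-0 i
    step-* (suc q) i = trans (sym (step-+ (q * m) m i)) (trans (cong (step (q * m)) (step-m i)) (step-* q i))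

  -- `σ` acts on the description of a vertex found by `locate`. Descriptions are unique, so `σ-cyc`
  -- and `σ-e` hold for any given one.
  module Transport {n} (R R′ : RData n) (isR : IsRealization R) {tr tr′} (M : Model R tr) (M′ : Model R′ tr′)
    (τ : Fin (suc (suc (m₀ R))) → Fin (suc (suc (m₀ R′)))) (tr≡ : ∀ i → tr′ (τ i) ≡ tr i) where

    open Realized R isR
    open WithModel M

    e′ : ∀ i → Node (tr i) → Fin n
    e′ i x = emb (part-emb M′ (τ i)) (subst Node (sym (tr≡ i)) x)

    move : ∀ {v} → (∃[ i ] cyc R i ≡ v) ⊎ (∃[ i ] ∃[ x ] e i x ≡ v) → Fin n
    move (inj₁ (i , _)) = cyc R′ (τ i)
    move (inj₂ (i , x , _)) = e′ i x

    σ : Fin n → Fin n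
    σ v = move (locate v)

    σ-cyc : ∀ i → σ (cyc R i) ≡ cyc R′ (τ i)
    σ-cyc i = lem (locate (cyc R i))
      where
      lem : (l : (∃[ j ] cyc R j ≡ cyc R i) ⊎ (∃[ j ] ∃[ x ] e j x ≡ cyc R i)) → move l ≡ cyc R′ (τ i)
      lem (inj₁ (j , p)) = cong (cyc R′ ∘ τ) (cyc-injective j i p)
      lem (inj₂ (j , x , p)) = ⊥-elim (cyc≢e i j x (sym p))

    σ-e : ∀ i x → σ (e i x) ≡ e′ i x
    σ-e i x = lem (locate (e i x))
      where
      lem : (l : (∃[ j ] cyc R j ≡ e i x) ⊎ (∃[ j ] ∃[ y ] e j y ≡ e i x)) → move l ≡ e′ i x
      lem (inj₁ (j , p)) = ⊥-elim (cyc≢e j i x p)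
      lem (inj₂ (j , y , p)) with e-part {j} {i} {y} {x} p
      ... | refl = cong (e′ i) (emb-injective (part-emb M i) p)

  subst-isTop : ∀ {t t′} (p : t′ ≡ t) (x : Node t) → isTop (subst Node (sym p) x) ≡ isTop x
  subst-isTop refl x = refl

  subst-arrT : ∀ {t t′} (p : t′ ≡ t) (x y : Node t) → arrT (subst Node (sym p) x) (subst Node (sym p) y) ≡ arrT x y
  subst-arrT refl x y = refl

  emb-back : ∀ {I : Set} {n} {T : I → BT} (f : ∀ i → Node (T i) → Fin n) {t} i i′ (p : t ≡ T i) (q : T i′ ≡ t) → i′ ≡ i → ∀ x →
                  f i′ (subst Node (sym q) (subst Node (sym p) x)) ≡ f i x
  emb-back f i .i refl q refl x with q
  ... | refl = refl

  module _ {n} (R R′ : RData n) (isR : IsRealization R) (isR′ : IsRealization R′)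
    {tr : Fin (suc (suc (m₀ R))) → BT} {tr′ : Fin (suc (suc (m₀ R′))) → BT} (M : Model R tr) (M′ : Model R′ tr′) where

    private
      module A = Realized R isR
      module A′ = Realized R′ isR′
      module B = A.WithModel M
      module B′ = A′.WithModel M′

    -- A rotation matches equal beads, so cycle vertices and tree nodes can be carried over in both
    -- directions by `Transport`; the arrows follow since a model determines all of them.
    identify : ∀ t → m₀ R ≡ m₀ R′ → rotate t (word M′) ≡ word M → Identified (R , isR) (R′ , isR′)
    identify t m≡ rw = m≡ , mk↔ₛ′ F.σ G.σ to-from′ from-to′ , to , t , toℕ-to , arr≡ , F.σ-cyc , cw≡ , att≡
      where
      open Rot (rot m≡ t)
      bead≡ : ∀ i → (cw R′ (to i) , tr′ (to i)) ≡ (cw R i , tr i)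
      bead≡ i = begin
        (cw R′ (to i) , tr′ (to i)) ≡⟨ cong (λ j → cw R′ j , tr′ j) (trans (cong to (sym (i-mod i))) (to-mod (toℕ i))) ⟩
        (cw R′ k , tr′ k) ≡⟨ sym (at-tabulate (λ j → cw R′ j , tr′ j) (toℕ i + t)) ⟩
        at (word M′) (toℕ i + t) ≡⟨ sym (at-rotate t (word M′) (toℕ i)) ⟩
        at (rotate t (word M′)) (toℕ i) ≡⟨ cong (λ w → at w (toℕ i)) rw ⟩
        at (word M) (toℕ i) ≡⟨ at-tabulate (λ j → cw R j , tr j) (toℕ i) ⟩
        (cw R (toℕ i mod suc (suc (m₀ R))) , tr (toℕ i mod suc (suc (m₀ R)))) ≡⟨ cong (λ j → cw R j , tr j) (i-mod i) ⟩
        (cw R i , tr i) ∎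
        where
        open ≡-Reasoning
        k = (toℕ i + t) mod suc (suc (m₀ R′))
        i-mod : ∀ (i : Fin (suc (suc (m₀ R)))) → toℕ i mod suc (suc (m₀ R)) ≡ i
        i-mod i = toℕ-injective (trans (Cyclic.toℕ-mod (m₀ R) (toℕ i)) (m<n⇒m%n≡m (toℕ<n i)))
      cw≡ : ∀ i → cw R′ (to i) ≡ cw R i
      cw≡ i = cong proj₁ (bead≡ i)
      tr≡ : ∀ i → tr′ (to i) ≡ tr i
      tr≡ i = cong proj₂ (bead≡ i)
      tr≡′ : ∀ j → tr (from j) ≡ tr′ j
      tr≡′ j = trans (sym (tr≡ (from j))) (cong tr′ (to-from j))
      module F = Transport R R′ isR M M′ to tr≡
      module G = Transport R′ R isR′ M′ M from tr≡′
      from-to′ : ∀ v → G.σ (F.σ v) ≡ v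
      from-to′ v = lem (B.locate v)
        where
        lem : (∃[ i ] cyc R i ≡ v) ⊎ (∃[ i ] ∃[ x ] B.e i x ≡ v) → G.σ (F.σ v) ≡ v
        lem (inj₁ (i , p)) = begin
          G.σ (F.σ v) ≡⟨ cong (G.σ ∘ F.σ) (sym p) ⟩
          G.σ (F.σ (cyc R i)) ≡⟨ cong G.σ (F.σ-cyc i) ⟩
          G.σ (cyc R′ (to i)) ≡⟨ G.σ-cyc (to i) ⟩
          cyc R (from (to i)) ≡⟨ cong (cyc R) (from-to i) ⟩
          cyc R i ≡⟨ p ⟩
          v ∎
          where open ≡-Reasoning
        lem (inj₂ (i , x , p)) = begin
          G.σ (F.σ v) ≡⟨ cong (G.σ ∘ F.σ) (sym p) ⟩
          G.σ (F.σ (B.e i x)) ≡⟨ cong G.σ (F.σ-e i x) ⟩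
          G.σ (F.e′ i x) ≡⟨ G.σ-e (to i) (subst Node (sym (tr≡ i)) x) ⟩
          G.e′ (to i) (subst Node (sym (tr≡ i)) x) ≡⟨ emb-back B.e i (from (to i)) (tr≡ i) (tr≡′ (to i)) (from-to i) x ⟩
          B.e i x ≡⟨ p ⟩
          v ∎
          where open ≡-Reasoning
      to-from′ : ∀ v → F.σ (G.σ v) ≡ v
      to-from′ v = lem (B′.locate v)
        where
        lem : (∃[ i ] cyc R′ i ≡ v) ⊎ (∃[ i ] ∃[ x ] B′.e i x ≡ v) → F.σ (G.σ v) ≡ v
        lem (inj₁ (i , p)) = begin
          F.σ (G.σ v) ≡⟨ cong (F.σ ∘ G.σ) (sym p) ⟩
          F.σ (G.σ (cyc R′ i)) ≡⟨ cong F.σ (G.σ-cyc i) ⟩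
          F.σ (cyc R (from i)) ≡⟨ F.σ-cyc (from i) ⟩
          cyc R′ (to (from i)) ≡⟨ cong (cyc R′) (to-from i) ⟩
          cyc R′ i ≡⟨ p ⟩
          v ∎
          where open ≡-Reasoning
        lem (inj₂ (i , x , p)) = begin
          F.σ (G.σ v) ≡⟨ cong (F.σ ∘ G.σ) (sym p) ⟩
          F.σ (G.σ (B′.e i x)) ≡⟨ cong F.σ (G.σ-e i x) ⟩
          F.σ (G.e′ i x) ≡⟨ F.σ-e (from i) (subst Node (sym (tr≡′ i)) x) ⟩
          F.e′ (from i) (subst Node (sym (tr≡′ i)) x) ≡⟨ emb-back B′.e i (to (from i)) (tr≡′ i) (tr≡ (from i)) (to-from i) x ⟩
          B′.e i x ≡⟨ p ⟩
          v ∎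
          where open ≡-Reasoning
      to-injective : ∀ {i j} → to i ≡ to j → i ≡ j
      to-injective {i} {j} p = trans (sym (from-to i)) (trans (cong from p) (from-to j))
      tail≡ : ∀ i → tailB (cw R′) (to i) ≡ to (tailB (cw R) i)
      tail≡ i rewrite cw≡ i with cw R i
      ... | true = refl
      ... | false = sym (to-next i)
      head≡ : ∀ i → headB (cw R′) (to i) ≡ to (headB (cw R) i)
      head≡ i rewrite cw≡ i with cw R i
      ... | true = sym (to-next i)
      ... | false = refl
      ⌊to≟to⌋ : ∀ i j → ⌊ to i ≟ᶠ to j ⌋ ≡ ⌊ i ≟ᶠ j ⌋
      ⌊to≟to⌋ i j with i ≟ᶠ j
      ... | yes refl = ⌊⌋-true (to i ≟ᶠ to i) refl
      ... | no ne = ⌊⌋-false (to i ≟ᶠ to j) (ne ∘ to-injective)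
      base≡ : ∀ i j → baseCount (cw R′) (to i) (to j) ≡ baseCount (cw R) i j
      base≡ i j = begin
        ∑ (allFin _) f ≡⟨ ∑-same (Uniqueₚ.allFin⁺ _) (Uniqueₚ.map⁺ to-injective (Uniqueₚ.allFin⁺ _))
                                                               (λ {k} _ → subst (_∈ map to (allFin _)) (to-from k) (∈-map⁺ to (∈-allFin (from k)))) (λ {k} _ → ∈-allFin k) f ⟩
        ∑ (map to (allFin _)) f ≡⟨ ∑-map to (allFin _) f ⟩
        ∑ (allFin _) (f ∘ to) ≡⟨ ∑-cong′ (allFin _) (λ k → cong₂ (λ p q → 𝟙 (p ∧ q))
                                                               (trans (cong (λ z → ⌊ z ≟ᶠ to i ⌋) (tail≡ k)) (⌊to≟to⌋ (tailB (cw R) k) i))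
                                                               (trans (cong (λ z → ⌊ z ≟ᶠ to j ⌋) (head≡ k)) (⌊to≟to⌋ (headB (cw R) k) j))) ⟩
        baseCount (cw R) i j ∎
        where
        open ≡-Reasoning
        f : Fin (suc (suc (m₀ R′))) → ℕ
        f k = 𝟙 (⌊ tailB (cw R′) k ≟ᶠ to i ⌋ ∧ ⌊ headB (cw R′) k ≟ᶠ to j ⌋)
      arr≡ : ∀ a b → arr R′ (F.σ a) (F.σ b) ≡ arr R a b
      arr≡ a b = lem (B.locate a) (B.locate b)
        where
        within : ∀ {i j} → Dec (i ≡ j) → ∀ x y → arr R′ (F.σ (B.e i x)) (F.σ (B.e j y)) ≡ arr R (B.e i x) (B.e j y)
        within {i} (yes refl) x y = trans (cong₂ (arr R′) (F.σ-e i x) (F.σ-e i y)) (trans (arr-emb (part-emb M′ (to i)) _ _)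
          (trans (subst-arrT (tr≡ i) x y) (sym (arr-emb (part-emb M i) x y))))
        within {i} {j} (no i≢j) x y = trans (cong₂ (arr R′) (F.σ-e i x) (F.σ-e j y)) (trans (B′.arr-e-e (to i) _ (to j) _ (i≢j ∘ to-injective)) (sym (B.arr-e-e i x j y i≢j)))
        lem : (la : (∃[ i ] cyc R i ≡ a) ⊎ (∃[ i ] ∃[ x ] B.e i x ≡ a)) (lb : (∃[ i ] cyc R i ≡ b) ⊎ (∃[ i ] ∃[ x ] B.e i x ≡ b)) →
              arr R′ (F.σ a) (F.σ b) ≡ arr R a b
        lem (inj₁ (i , refl)) (inj₁ (j , refl)) = trans (cong₂ (arr R′) (F.σ-cyc i) (F.σ-cyc j))
          (trans (A′.cyc-full (to i) (to j)) (trans (base≡ i j) (sym (A.cyc-full i j))))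
        lem (inj₁ (j , refl)) (inj₂ (i , x , refl)) = trans (cong₂ (arr R′) (F.σ-cyc j) (F.σ-e i x))
          (trans (B′.arr-cyc-e (to j) (to i) _) (trans (cong₂ (λ p q → 𝟙 (p ∧ q)) (subst-isTop (tr≡ i) x)
            (trans (cong (λ z → ⌊ z ≟ᶠ to j ⌋) (head≡ i)) (⌊to≟to⌋ (headB (cw R) i) j))) (sym (B.arr-cyc-e j i x))))
        lem (inj₂ (i , x , refl)) (inj₁ (j , refl)) = trans (cong₂ (arr R′) (F.σ-e i x) (F.σ-cyc j))
          (trans (B′.arr-e-cyc (to j) (to i) _) (trans (cong₂ (λ p q → 𝟙 (p ∧ q)) (subst-isTop (tr≡ i) x)
            (trans (cong (λ z → ⌊ z ≟ᶠ to j ⌋) (tail≡ i)) (⌊to≟to⌋ (tailB (cw R) i) j))) (sym (B.arr-e-cyc j i x))))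
        lem (inj₂ (i , x , refl)) (inj₂ (j , y , refl)) = within (i ≟ᶠ j) x y
      att≡ : ∀ i → att R′ (to i) ≡ Maybe.map F.σ (att R i)
      att≡ i = trans (att-root M′ (to i)) (trans (lem (tr≡ i) (part-emb M′ (to i)) (part-emb M i) (F.σ-e i)) (cong (Maybe.map F.σ) (sym (att-root M i))))
        where
        lem : ∀ {S S′ t t′} (p : t′ ≡ t) (E′ : Emb (arr R′) S′ t′) (E : Emb (arr R) S t) →
              (∀ x → F.σ (emb E x) ≡ emb E′ (subst Node (sym p) x)) → rootOf t′ E′ ≡ Maybe.map F.σ (rootOf t E)
        lem {t = leaf} refl E′ E h = refl
        lem {t = node _ _} refl E′ E h = cong just (sym (h top))

    identified⇒rotation : Identified (R , isR) (R′ , isR′) → ∃[ t ] rotate t (word M′) ≡ word M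
    identified⇒rotation (m≡ , σ , τ , t , toℕ-τ , arr≡ , cyc≡ , cw≡ , att≡) = t , at-ext
      (trans (length-rotate t (word M′)) (trans (Listₚ.length-tabulate (λ j → cw R′ j , tr′ j)) (trans (cong (λ k → ℕ.suc (ℕ.suc k)) (sym m≡)) (sym (Listₚ.length-tabulate (λ j → cw R j , tr j))))))
      (λ k → begin
        at (rotate t (word M′)) k ≡⟨ at-rotate t (word M′) k ⟩
        at (word M′) (k + t) ≡⟨ at-tabulate (λ j → cw R′ j , tr′ j) (k + t) ⟩
        (cw R′ ((k + t) mod _) , tr′ ((k + t) mod _)) ≡⟨ cong (λ j → cw R′ j , tr′ j) (sym (trans (τ≡ (k mod _)) (to-mod k))) ⟩
        (cw R′ (τ (k mod _)) , tr′ (τ (k mod _))) ≡⟨ cong₂ _,_ (cw≡ (k mod _)) (sym (tr≡ (k mod _))) ⟩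
        (cw R (k mod _) , tr (k mod _)) ≡⟨ sym (at-tabulate (λ j → cw R j , tr j) k) ⟩
        at (word M) k ∎)
      where
      open ≡-Reasoning
      open Rot (rot m≡ t)
      f = Inverse.to σ
      g = Inverse.from σ
      f-g : ∀ v → f (g v) ≡ v
      f-g = Inverse.strictlyInverseˡ σ
      g-f : ∀ v → g (f v) ≡ v
      g-f = Inverse.strictlyInverseʳ σ
      f-injective : ∀ {u v} → f u ≡ f v → u ≡ v
      f-injective {u} {v} p = trans (sym (g-f u)) (trans (cong g p) (g-f v))
      τ≡ : ∀ i → τ i ≡ to i
      τ≡ i = toℕ-injective (trans (toℕ-τ i) (sym (toℕ-to i)))
      attached′ : ∀ i → Attached (arr R′) (λ v → ∃[ j ] cyc R′ j ≡ v) (tr i) (f ∘ B.e i)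
      attached′ i = record
        { arrows = λ x y → trans (arr≡ (B.e i x) (B.e i y)) (arr-emb (part-emb M i) x y)
        ; injective = λ p → emb-injective (part-emb M i) (f-injective p)
        ; closed = λ x v p → near x v (B.neighbour i x (g v) (subst (1 ≤_) (cong₂ _+_ (pull (B.e i x) v) (pull′ v (B.e i x))) p))
        ; disjoint = λ x (j , p) → B.cyc≢e (from j) i x (f-injective (trans (cyc≡ (from j)) (trans (cong (cyc R′) (trans (τ≡ (from j)) (to-from j))) p))) }
        where
        pull : ∀ u v → arr R′ (f u) v ≡ arr R u (g v)
        pull u v = trans (cong (arr R′ (f u)) (sym (f-g v))) (arr≡ u (g v))
        pull′ : ∀ v u → arr R′ v (f u) ≡ arr R (g v) u
        pull′ v u = trans (cong (λ z → arr R′ z (f u)) (sym (f-g v))) (arr≡ (g v) u)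
        near : ∀ x v → (∃[ y ] g v ≡ B.e i y) ⊎ (isTop x ≡ true × ∃[ j ] cyc R j ≡ g v) →
               (∃[ y ] v ≡ f (B.e i y)) ⊎ (isTop x ≡ true × ∃[ j ] cyc R′ j ≡ v)
        near x v (inj₁ (y , p)) = inj₁ (y , trans (sym (f-g v)) (cong f p))
        near x v (inj₂ (q , j , p)) = inj₂ (q , τ j , trans (sym (cyc≡ j)) (trans (cong f p) (f-g v)))
      tr≡ : ∀ i → tr i ≡ tr′ (τ i)
      tr≡ i = tree-unique (arr R′) (tr i) (tr′ (τ i)) (attached′ i) (B′.attached (τ i))
        (trans (lemma (part-emb M i)) (trans (cong (Maybe.map f) (sym (att-root M i))) (trans (sym (att≡ i)) (trans (att-root M′ (τ i)) (lemma′ (part-emb M′ (τ i)))))))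
        where
        lemma : ∀ {S t} (E : Emb (arr R) S t) → root? t (f ∘ emb E) ≡ Maybe.map f (rootOf t E)
        lemma {t = leaf} E = refl
        lemma {t = node _ _} E = refl
        lemma′ : ∀ {S t} (E : Emb (arr R′) S t) → rootOf t E ≡ root? t (emb E)
        lemma′ {t = leaf} E = refl
        lemma′ {t = node _ _} E = refl

-- Building a realization from a word.

module Construction where

  open Forests using (BT; leaf; node; leaves)
  open Cycles
  open TreeQuivers
  open RootedTrees
  open Models
  import Data.Bool.Properties as Boolₚ
  open import Data.Fin using (Fin; zero; suc)
  open import Data.Fin.Properties using (+↔⊎) renaming (_≟_ to _≟ᶠ_)
  open import Data.Maybe.Properties using (≡-dec)
  open import Data.Nat using (ℕ; zero; suc; _+_; _≤_; z≤n; s≤s)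
  open import Data.Nat.Properties using (≤-reflexive)
  open import Data.Product using (Σ)
  open import Data.Sum.Function.Propositional using (_⊎-↔_)
  open import Function.Bundles using (_↔_; Inverse; mk↔ₛ′)
  open import Function.Properties.Inverse using (↔-trans; ↔-sym)

  -- A bead owns its internal nodes and one cycle vertex, written `nothing`: together as many as it
  -- has leaves. In the recursion the top takes the spare place of the right subtree.
  cells : ∀ t → Maybe (Node t) ↔ Fin (leaves t)
  cells leaf = mk↔ₛ′ (λ _ → zero) (λ _ → nothing) (λ { zero → refl }) (λ { nothing → refl ; (just ()) })
  cells (node l r) = ↔-trans (mk↔ₛ′ to from to-from from-to) (↔-trans (cells l ⊎-↔ cells r) (↔-sym +↔⊎))
    where
    to : Maybe (Node (node l r)) → Maybe (Node l) ⊎ Maybe (Node r)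
    to nothing = inj₁ nothing
    to (just top) = inj₂ nothing
    to (just (inl x)) = inj₁ (just x)
    to (just (inr x)) = inj₂ (just x)
    from : Maybe (Node l) ⊎ Maybe (Node r) → Maybe (Node (node l r))
    from (inj₁ nothing) = nothing
    from (inj₁ (just x)) = just (inl x)
    from (inj₂ nothing) = just top
    from (inj₂ (just x)) = just (inr x)
    to-from : ∀ y → to (from y) ≡ y
    to-from (inj₁ nothing) = refl
    to-from (inj₁ (just _)) = refl
    to-from (inj₂ nothing) = refl
    to-from (inj₂ (just _)) = refl
    from-to : ∀ x → from (to x) ≡ x
    from-to nothing = refl
    from-to (just top) = refl
    from-to (just (inl _)) = refl
    from-to (just (inr _)) = refl

  total : ∀ {m} → (Fin m → ℕ) → ℕ
  total {zero} f = 0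
  total {suc m} f = f zero + total (f ∘ suc)

  Σ-Fin : ∀ {m} {P : Fin m → Set} (f : Fin m → ℕ) → (∀ i → P i ↔ Fin (f i)) → Σ (Fin m) P ↔ Fin (total f)
  Σ-Fin {zero} f b = mk↔ₛ′ (λ { (() , _) }) (λ ()) (λ ()) (λ { (() , _) })
  Σ-Fin {suc m} {P} f b = ↔-trans (mk↔ₛ′ to from to-from from-to) (↔-trans (b zero ⊎-↔ Σ-Fin (f ∘ suc) (b ∘ suc)) (↔-sym +↔⊎))
    where
    to : Σ (Fin (suc m)) P → P zero ⊎ Σ (Fin m) (P ∘ suc)
    to (zero , x) = inj₁ x
    to (suc i , x) = inj₂ (i , x)
    from : P zero ⊎ Σ (Fin m) (P ∘ suc) → Σ (Fin (suc m)) P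
    from (inj₁ x) = zero , x
    from (inj₂ (i , x)) = suc i , x
    to-from : ∀ y → to (from y) ≡ y
    to-from (inj₁ _) = refl
    to-from (inj₂ _) = refl
    from-to : ∀ x → from (to x) ≡ x
    from-to (zero , _) = refl
    from-to (suc _ , _) = refl

  module _ {n} {arr : Arrows n} where

    reach-trans : ∀ {a b c} → Reach arr a b → Reach arr b c → Reach arr a c
    reach-trans here q = q
    reach-trans (fwd x p) q = fwd x (reach-trans p q)
    reach-trans (bwd x p) q = bwd x (reach-trans p q)

    reach-sym : ∀ {a b} → Reach arr a b → Reach arr b a
    reach-sym here = here
    reach-sym (fwd x p) = reach-trans (reach-sym p) (bwd x here)
    reach-sym (bwd x p) = reach-trans (reach-sym p) (fwd x here)

    reach-top : ∀ t (e : Node t → Fin n) → (∀ x y → arr (e x) (e y) ≡ arrT x y) → ∀ x y → isTop y ≡ true → Reach arr (e x) (e y)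
    reach-top (node l r) e ar top top _ = here
    reach-top (node l r) e ar (inl x) top _ = climb l (e ∘ inl) (reach-top l (e ∘ inl) (λ u v → ar (inl u) (inl v))) (λ v p → ≤-reflexive (sym (trans (ar top (inl v)) (cong 𝟙 p)))) x
      where
      climb : ∀ l (f : Node l → Fin n) → (∀ x y → isTop y ≡ true → Reach arr (f x) (f y)) → (∀ y → isTop y ≡ true → 1 ≤ arr (e top) (f y)) → ∀ x → Reach arr (f x) (e top)
      climb (node _ _) f reach up x = reach-trans (reach x top refl) (bwd (up top refl) here)
    reach-top (node l r) e ar (inr x) top _ = climb r (e ∘ inr) (reach-top r (e ∘ inr) (λ u v → ar (inr u) (inr v))) (λ v p → ≤-reflexive (sym (trans (ar (inr v) top) (cong 𝟙 p)))) x
      where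
      climb : ∀ r (f : Node r → Fin n) → (∀ x y → isTop y ≡ true → Reach arr (f x) (f y)) → (∀ y → isTop y ≡ true → 1 ≤ arr (f y) (e top)) → ∀ x → Reach arr (f x) (e top)
      climb (node _ _) f reach up x = reach-trans (reach x top refl) (fwd (up top refl) here)

  -- Opposite arrows between i and j come from different positions, so the cycle has length 2, and
  -- both run the same way round it, against the mixed orientation.
  base-2cycle : ∀ {m₀} (w : Fin (suc (suc m₀)) → Bool) → (∃[ i ] ∃[ j ] w i ≢ w j) → ∀ i j → baseCount w i j ≡ 0 ⊎ baseCount w j i ≡ 0
  base-2cycle {m₀} w (p , q , w≢) i j with baseCount w i j in e | baseCount w j i in e′
  ... | zero | _ = inj₁ refl
  ... | suc _ | zero = inj₂ refl
  ... | suc _ | suc _ = ⊥-elim (absurd (baseCount⁻ {i} {j} (subst (1 ≤_) (sym e) (s≤s z≤n))) (baseCount⁻ {j} {i} (subst (1 ≤_) (sym e′) (s≤s z≤n))))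
    where
    open Cyclic m₀
    open Oriented w
    monochrome : ∀ b → next i ≡ j → next j ≡ i → w i ≡ b → w j ≡ b → ⊥
    monochrome b ij ji wi wj = w≢ (trans (all p) (sym (all q)))
      where
      all : ∀ k → w k ≡ b
      all k = [ (λ { refl → wi }) , (λ { refl → wj }) ]′ (next-closed (λ k → k ≡ i ⊎ k ≡ j) (λ { _ (inj₁ refl) → inj₂ ij ; _ (inj₂ refl) → inj₁ ji }) i (inj₁ refl) k)
    true≢false : ∀ {b} → b ≡ true → b ≡ false → ⊥
    true≢false refl ()
    absurd : (∃[ t ] tailB w t ≡ i × headB w t ≡ j) → (∃[ t ] tailB w t ≡ j × headB w t ≡ i) → ⊥
    absurd (t , u , v) (t′ , u′ , v′) with ends {t} u v | ends {t′} u′ v′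
    ... | inj₁ (refl , ij , wi) | inj₁ (refl , ji , wj) = monochrome true ij ji wi wj
    ... | inj₁ (refl , ij , wi) | inj₂ (refl , _ , wi′) = true≢false wi wi′
    ... | inj₂ (refl , ji , wj) | inj₁ (refl , _ , wj′) = true≢false wj′ wj
    ... | inj₂ (refl , ji , wj) | inj₂ (refl , ij , wi) = monochrome false ij ji wi wj

  module Build {n} (m₀ : ℕ) (cw : Fin (suc (suc m₀)) → Bool) (tr : Fin (suc (suc m₀)) → BT)
    (mixed : ∃[ i ] ∃[ j ] cw i ≢ cw j)
    (bij : Σ (Fin (suc (suc m₀))) (λ i → Maybe (Node (tr i))) ↔ Fin n) where

    open Cyclic m₀
    open Oriented cw

    V : Set
    V = Σ (Fin m) (λ i → Maybe (Node (tr i)))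

    g : V → Fin n
    g = Inverse.to bij

    h : Fin n → V
    h = Inverse.from bij

    hg : ∀ v → h (g v) ≡ v
    hg = Inverse.strictlyInverseʳ bij

    gh : ∀ v → g (h v) ≡ v
    gh = Inverse.strictlyInverseˡ bij

    -- The equality test is an argument because nodes of the two trees can be compared only after i
    -- and j have been unified.
    same : ∀ {i j} → Dec (i ≡ j) → Node (tr i) → Node (tr j) → ℕ
    same (yes refl) x y = arrT x y
    same (no _) x y = 0

    -- Arrows between abstract positions, with `nothing` for the cycle vertex, so that most checks
    -- do not involve the numbering `bij`.
    gA : V → V → ℕ
    gA (i , nothing) (j , nothing) = baseCount cw i j
    gA (j , nothing) (i , just x) = 𝟙 (isTop x ∧ ⌊ headB cw i ≟ᶠ j ⌋)
    gA (i , just x) (j , nothing) = 𝟙 (isTop x ∧ ⌊ tailB cw i ≟ᶠ j ⌋)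
    gA (i , just x) (j , just y) = same (i ≟ᶠ j) x y

    same-part : ∀ i x y → gA (i , just x) (i , just y) ≡ arrT x y
    same-part i x y with i ≟ᶠ i
    ... | yes refl = refl
    ... | no ne = ⊥-elim (ne refl)

    diff-part : ∀ {i j} → i ≢ j → ∀ x y → gA (i , just x) (j , just y) ≡ 0
    diff-part {i} {j} i≢j x y with i ≟ᶠ j
    ... | yes p = ⊥-elim (i≢j p)
    ... | no _ = refl

    A : Arrows n
    A a b = gA (h a) (h b)

    A-g : ∀ u v → A (g u) (g v) ≡ gA u v
    A-g u v = cong₂ gA (hg u) (hg v)

    partV : V → Maybe (Fin m)
    partV (i , nothing) = nothing
    partV (i , just _) = just i

    S : Fin m → Fin n → Bool
    S i v = ⌊ ≡-dec _≟ᶠ_ (partV (h v)) (just i) ⌋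

    locD : ∀ {i j} → Dec (j ≡ i) → Node (tr j) → Maybe (Node (tr i))
    locD (yes refl) x = just x
    locD (no _) x = nothing

    locV : ∀ i → V → Maybe (Node (tr i))
    locV i (j , nothing) = nothing
    locV i (j , just x) = locD (j ≟ᶠ i) x

    embedding : ∀ i → Emb A (S i) (tr i)
    embedding i = record
      { emb = λ x → g (i , just x)
      ; loc = locV i ∘ h
      ; loc-emb = λ x → trans (cong (locV i) (hg (i , just x))) (locV-self x)
      ; emb-loc = λ {v} {x} p → trans (cong g (sym (locV-just (h v) p))) (gh v)
      ; mem = λ v → memV (h v)
      ; arr-emb = λ x y → trans (A-g (i , just x) (i , just y)) (same-part i x y) }
      where
      locV-self : ∀ x → locV i (i , just x) ≡ just x
      locV-self x with i ≟ᶠ i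
      ... | yes refl = refl
      ... | no ne = ⊥-elim (ne refl)
      locV-just : ∀ u {x} → locV i u ≡ just x → u ≡ (i , just x)
      locV-just (j , just y) p with j ≟ᶠ i
      locV-just (j , just y) refl | yes refl = refl
      memV : ∀ u → ⌊ ≡-dec _≟ᶠ_ (partV u) (just i) ⌋ ≡ is-just (locV i u)
      memV (j , nothing) = ⌊⌋-false (≡-dec _≟ᶠ_ nothing (just i)) (λ ())
      memV (j , just x) with j ≟ᶠ i
      ... | yes refl = refl
      ... | no ne = refl

    R : RData n
    R = record { arr = A ; m₀ = m₀ ; cyc = λ i → g (i , nothing) ; cw = cw
               ; att = λ i → rootOf (tr i) (embedding i) ; part = partV ∘ h }

    modelR : Model R tr
    modelR = record { part-emb = embedding ; att-root = λ _ → refl }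

    private
      C : Fin m → Fin n
      C i = g (i , nothing)

    gA-loop : ∀ v → gA v v ≡ 0
    gA-loop (i , nothing) = base-loop i
    gA-loop (i , just x) = trans (same-part i x x) (arrT-loop x)

    gA-2cycle : ∀ u v → gA u v ≡ 0 ⊎ gA v u ≡ 0
    gA-2cycle (i , nothing) (j , nothing) = base-2cycle cw mixed i j
    gA-2cycle (j , nothing) (i , just x) with headB cw i ≟ᶠ j
    ... | yes refl = inj₂ (cong 𝟙 (trans (cong (isTop x ∧_) (⌊⌋-false (tailB cw i ≟ᶠ j) (tail≢head i))) (Boolₚ.∧-zeroʳ (isTop x))))
    ... | no _ = inj₁ (cong 𝟙 (Boolₚ.∧-zeroʳ (isTop x)))
    gA-2cycle (i , just x) (j , nothing) with tailB cw i ≟ᶠ j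
    ... | yes refl = inj₂ (cong 𝟙 (trans (cong (isTop x ∧_) (⌊⌋-false (headB cw i ≟ᶠ j) (tail≢head i ∘ sym))) (Boolₚ.∧-zeroʳ (isTop x))))
    ... | no _ = inj₁ (cong 𝟙 (Boolₚ.∧-zeroʳ (isTop x)))
    gA-2cycle (i , just x) (j , just y) = lem (i ≟ᶠ j)
      where
      lem : Dec (i ≡ j) → gA (i , just x) (j , just y) ≡ 0 ⊎ gA (j , just y) (i , just x) ≡ 0
      lem (yes refl) = [ (λ p → inj₁ (trans (same-part i x y) p)) , (λ p → inj₂ (trans (same-part i y x) p)) ]′ (arrT-2cycle x y)
      lem (no ne) = inj₁ (diff-part ne x y)

    reach-base : ∀ i j → Reach A (C i) (C j)
    reach-base i = next-closed (λ j → Reach A (C i) (C j)) (λ j p → reach-trans p (hop j)) i here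
      where
      hop : ∀ j → Reach A (C j) (C (next j))
      hop j with 1≤+ (baseCount cw j (next j)) (adjacent-next j)
      ... | inj₁ p = fwd (subst (1 ≤_) (sym (A-g (j , nothing) (next j , nothing))) p) here
      ... | inj₂ p = bwd (subst (1 ≤_) (sym (A-g (next j , nothing) (j , nothing))) p) here

    reach-zero : ∀ v → Reach A (g v) (C zero)
    reach-zero (i , nothing) = reach-base i zero
    reach-zero (i , just x) = reach-trans (climb (tr i) (λ x → g (i , just x)) (arr-emb (embedding i))
        (λ y p → ≤-reflexive (sym (trans (A-g (i , just y) (tailB cw i , nothing)) (cong₂ (λ a b → 𝟙 (a ∧ b)) p (⌊⌋-true (tailB cw i ≟ᶠ tailB cw i) refl))))) x)
        (reach-base (tailB cw i) zero)
      where
      climb : ∀ t (e : Node t → Fin n) → (∀ x y → A (e x) (e y) ≡ arrT x y) → (∀ y → isTop y ≡ true → 1 ≤ A (e y) (C (tailB cw i))) → ∀ x → Reach A (e x) (C (tailB cw i))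
      climb t@(node _ _) e ar out x = reach-trans (reach-top t e ar x top refl) (fwd (out top refl) here)

    reach-all : ∀ a b → Reach A a b
    reach-all a b = reach-trans (toZero a) (reach-sym (toZero b))
      where
      toZero : ∀ v → Reach A v (C zero)
      toZero v = subst (λ u → Reach A u (C zero)) (gh v) (reach-zero (h v))

    -- By elimination a non-oriented cycle avoids all trees, so it lies on the base cycle, and
    -- `CycleInCycle` shows that it runs all the way round.
    unique-cycle : ∀ m₀′ c′ w′ → IsNonOrientedCycle A m₀′ c′ w′ → (∀ j → ∃[ i ] c′ j ≡ C i) × (∀ i → ∃[ j ] C i ≡ c′ j)
    unique-cycle m₀′ c′ w′ (c′-inj , mixed′ , full′) =
      (λ j → f j , c′≡ j) , (λ i → let (j , p) = hit-all i in j , trans (cong C (sym p)) (sym (c′≡ j)))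
      where
      cV : Fin (suc (suc m₀′)) → V
      cV j = h (c′ j)
      cV-inj : ∀ i j → cV i ≡ cV j → i ≡ j
      cV-inj i j p = c′-inj i j (trans (sym (gh (c′ i))) (trans (cong g p) (gh (c′ j))))
      open Eliminate gA m₀′ cV w′ cV-inj mixed′ full′
      -- What remains around a tree root after elimination is the 3-cycle from the root to the tail,
      -- along the base arrow to the head, and back. Even if the base arrow is one of a double
      -- arrow, the root has single arrows to both ends.
      simplicial : ∀ i x → isTop x ≡ true → Simplicial gA (i , just x) (tailB cw i , nothing) (headB cw i , nothing)
      simplicial i x tx = record
        { single-a = ≤-reflexive (cong₂ _+_ out (trans (cong (λ b → 𝟙 (isTop x ∧ b)) (⌊⌋-false (headB cw i ≟ᶠ tailB cw i) (tail≢head i ∘ sym))) (cong 𝟙 (Boolₚ.∧-zeroʳ (isTop x)))))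
        ; single-b = ≤-reflexive (cong₂ _+_ (trans (cong (λ b → 𝟙 (isTop x ∧ b)) (⌊⌋-false (tailB cw i ≟ᶠ headB cw i) (tail≢head i))) (cong 𝟙 (Boolₚ.∧-zeroʳ (isTop x)))) into)
        ; shape = inj₂ (≤-reflexive (sym out) , baseCount⁺ i , ≤-reflexive (sym into)) }
        where
        out : gA (i , just x) (tailB cw i , nothing) ≡ 1
        out = cong₂ (λ a b → 𝟙 (a ∧ b)) tx (⌊⌋-true (tailB cw i ≟ᶠ tailB cw i) refl)
        into : gA (headB cw i , nothing) (i , just x) ≡ 1
        into = cong₂ (λ a b → 𝟙 (a ∧ b)) tx (⌊⌋-true (headB cw i ≟ᶠ headB cw i) refl)
      neighbour : ∀ i x v → 1 ≤ gA (i , just x) v + gA v (i , just x) →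
                  (∃[ y ] v ≡ (i , just y)) ⊎ (isTop x ≡ true × (v ≡ (tailB cw i , nothing) ⊎ v ≡ (headB cw i , nothing)))
      neighbour i x (j , nothing) p with 1≤+ (𝟙 (isTop x ∧ ⌊ tailB cw i ≟ᶠ j ⌋)) p
      ... | inj₁ q = let (tx , e) = 1≤𝟙∧ (isTop x) q in inj₂ (tx , inj₁ (cong (_, nothing) (sym (⌊⌋-true⁻ (tailB cw i ≟ᶠ j) e))))
      ... | inj₂ q = let (tx , e) = 1≤𝟙∧ (isTop x) q in inj₂ (tx , inj₂ (cong (_, nothing) (sym (⌊⌋-true⁻ (headB cw i ≟ᶠ j) e))))
      neighbour i x (j , just y) p = lem (i ≟ᶠ j)
        where
        lem : Dec (i ≡ j) → _
        lem (yes refl) = inj₁ (y , refl)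
        lem (no ne) with subst (1 ≤_) (cong₂ _+_ (diff-part ne x y) (diff-part (ne ∘ sym) y x)) p
        ... | ()
      off-tree : ∀ j i x → cV j ≢ (i , just x)
      off-tree j i x = eliminate (tr i) (λ y → i , just y) (tailB cw i , nothing) (headB cw i , nothing) (same-part i) (simplicial i) (neighbour i) x j
      f : Fin (suc (suc m₀′)) → Fin m
      f j = proj₁ (cV j)
      cV≡ : ∀ j → cV j ≡ (f j , nothing)
      cV≡ j = lem (cV j) (off-tree j)
        where
        lem : ∀ v → (∀ i x → v ≢ (i , just x)) → v ≡ (proj₁ v , nothing)
        lem (i , nothing) ne = refl
        lem (i , just x) ne = ⊥-elim (ne i x refl)
      c′≡ : ∀ j → c′ j ≡ C (f j)
      c′≡ j = trans (sym (gh (c′ j))) (cong g (cV≡ j))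
      f-inj : ∀ i j → f i ≡ f j → i ≡ j
      f-inj i j p = cV-inj i j (trans (cV≡ i) (trans (cong (_, nothing) p) (sym (cV≡ j))))
      open CycleInCycle m₀ cw m₀′ w′ f f-inj (λ i j → trans (cong₂ gA (sym (cV≡ i)) (sym (cV≡ j))) (full′ i j))

    partV⁻ : ∀ v i → partV (h v) ≡ just i → ∃[ x ] v ≡ g (i , just x)
    partV⁻ v i p = lem (h v) refl p
      where
      lem : ∀ u → h v ≡ u → partV u ≡ just i → ∃[ x ] v ≡ g (i , just x)
      lem (i , just x) q refl = x , trans (sym (gh v)) (cong g q)

    partV-g : ∀ u → partV (h (g u)) ≡ partV u
    partV-g u = cong partV (hg u)

    root-top : ∀ {t S} (E : Emb A S t) {z} → rootOf t E ≡ just z → ∃[ x ] z ≡ emb E x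
    root-top {node _ _} E refl = top , refl

    root-exists : ∀ {t S} (E : Emb A S t) → Node t → ∃[ z ] rootOf t E ≡ just z
    root-exists {node _ _} E _ = emb E top , refl

    root-rooted : ∀ {t S} (E : Emb A S t) {z} → rootOf t E ≡ just z → RootedA A S z
    root-rooted {node l r} E refl = unembed A l r E

    root-isTop : ∀ {t S} (E : Emb A S t) x → ⌊ ≡-dec _≟ᶠ_ (rootOf t E) (just (emb E x)) ⌋ ≡ isTop x
    root-isTop {node l r} E x = trans (dec-just (emb E top) (emb E x)) (⌊emb≟top⌋ E x)
      where
      dec-just : ∀ (a b : Fin n) → ⌊ ≡-dec _≟ᶠ_ (just a) (just b) ⌋ ≡ ⌊ b ≟ᶠ a ⌋
      dec-just a b with b ≟ᶠ a
      ... | yes refl = ⌊⌋-true (≡-dec _≟ᶠ_ (just a) (just a)) refl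
      ... | no ne = ⌊⌋-false (≡-dec _≟ᶠ_ (just a) (just b)) (λ p → ne (sym (just-injective p)))

    isRealization : IsRealization R
    isRealization =
      ((λ a → gA-loop (h a)) , (λ a b → gA-2cycle (h a) (h b)) , reach-all) ,
      ((λ i j p → cong proj₁ (trans (sym (hg (i , nothing))) (trans (cong h p) (hg (j , nothing))))) , mixed , (λ i j → A-g (i , nothing) (j , nothing))) ,
      unique-cycle ,
      (λ i → partV-g (i , nothing)) ,
      (λ v p → onCycle v (h v) refl p) ,
      (λ i z p → let (x , q) = root-top (embedding i) p in trans (cong (partV ∘ h) q) (partV-g (i , just x))) ,
      (λ v i p → root-exists (embedding i) (proj₁ (partV⁻ v i p))) ,
      (λ v i j p → let (x , q) = partV⁻ v i p in
         trans (cong (A (C j)) q) (trans (A-g (j , nothing) (i , just x)) (cong (λ b → 𝟙 (b ∧ ⌊ headB cw i ≟ᶠ j ⌋)) (attTop v i x q))) ,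
         trans (cong (λ u → A u (C j)) q) (trans (A-g (i , just x) (j , nothing)) (cong (λ b → 𝟙 (b ∧ ⌊ tailB cw i ≟ᶠ j ⌋)) (attTop v i x q)))) ,
      (λ u v i j p q i≢j → let (x , a) = partV⁻ u i p; (y , b) = partV⁻ v j q in
         trans (cong₂ A a b) (trans (A-g (i , just x) (j , just y)) (diff-part i≢j x y))) ,
      (λ i z p → root-rooted (embedding i) p)
      where
      onCycle : ∀ v u → h v ≡ u → partV u ≡ nothing → ∃[ i ] C i ≡ v
      onCycle v (i , nothing) q refl = i , trans (cong g (sym q)) (gh v)
      attTop : ∀ v i x → v ≡ g (i , just x) → isTop x ≡ ⌊ ≡-dec _≟ᶠ_ (rootOf (tr i) (embedding i)) (just v) ⌋
      attTop v i x q = sym (trans (cong (λ u → ⌊ ≡-dec _≟ᶠ_ (rootOf (tr i) (embedding i)) (just u) ⌋) q) (root-isTop (embedding i) x))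

-- Realizations up to identification are counted by necklaces.

module Classification where

  open Sums
  open Forests
  open Rotations using (_%%_)
  open Necklaces
  open Summation using (module Totals)
  open Formulas
  open Cycles
  open TreeQuivers using (Node)
  open Models
  open Identification
  open Construction
  open import Data.Fin using (Fin; zero; suc; toℕ; fromℕ<)
  open import Data.Fin.Properties using (toℕ-fromℕ<)
  import Data.List.Properties as Listₚ
  open import Data.List.Relation.Unary.All as All using (All; []; _∷_)
  import Data.List.Relation.Unary.All.Properties as Allₚ
  open import Data.List.Relation.Unary.AllPairs using (AllPairs; []; _∷_)
  import Data.List.Relation.Unary.AllPairs.Properties as AllPairsₚ
  open import Data.List.Relation.Unary.Any using (Any)
  open import Data.Nat using (ℕ; zero; suc; _+_; _*_; _≤_; _<_; z≤n; s≤s)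
  open import Data.Nat.Properties
  open import Data.Product using (Σ)
  open import Function.Bundles using (_↔_)

  pick-nonempty : ∀ c w → 1 ≤ length (pick c w) → ∃[ k ] k < length w × proj₁ (nth w k) ≡ c
  pick-nonempty false ((false , t) ∷ w) p = 0 , s≤s z≤n , refl
  pick-nonempty true ((true , t) ∷ w) p = 0 , s≤s z≤n , refl
  pick-nonempty false ((true , t) ∷ w) p = let (k , k< , e) = pick-nonempty false w p in suc k , s≤s k< , e
  pick-nonempty true ((false , t) ∷ w) p = let (k , k< , e) = pick-nonempty true w p in suc k , s≤s k< , e

  leavesF-pick : ∀ w → ∑ w (leaves ∘ proj₂) ≡ leavesF (pick false w) + leavesF (pick true w)
  leavesF-pick [] = refl
  leavesF-pick ((false , t) ∷ w) = trans (cong (leaves t +_) (leavesF-pick w)) (sym (+-assoc (leaves t) _ _))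
  leavesF-pick ((true , t) ∷ w) = trans (cong (leaves t +_) (leavesF-pick w))
    (trans (sym (+-assoc (leaves t) (leavesF (pick false w)) _)) (trans (cong (_+ leavesF (pick true w)) (+-comm (leaves t) _)) (+-assoc (leavesF (pick false w)) _ _)))

  ∑-tabulate : ∀ {m} (f : Fin m → Bead) v → ∑ (tabulate f) v ≡ total (v ∘ f)
  ∑-tabulate {zero} f v = refl
  ∑-tabulate {suc m} f v = cong (v (f zero) +_) (∑-tabulate (f ∘ suc) v)

  1≤leavesF : ∀ f → 1 ≤ leavesF f → 1 ≤ length f
  1≤leavesF (_ ∷ _) _ = s≤s z≤n

  module Count (r : ℕ) (ma : Maybe ℕ) (s : ℕ) (mb : Maybe ℕ) (1≤r : 1 ≤ r) (1≤s : 1 ≤ s) where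

    open Totals r ma s mb 1≤r 1≤s using () renaming (total to count)

    Good : List Bead → Set
    Good w = fits r ma s mb w ≡ true

    good-leaves : ∀ w → Good w → leavesF (pick false w) ≡ r × leavesF (pick true w) ≡ s
    good-leaves w fw =
      let (p , q) = ∧-true⁻ (match (just r) (leavesF (pick false w)) ∧ match ma (cherriesF (pick false w))) fw
      in match-just r _ (proj₁ (∧-true⁻ (match (just r) (leavesF (pick false w))) p)) ,
         match-just s _ (proj₁ (∧-true⁻ (match (just s) (leavesF (pick true w))) q))

    good-length : ∀ w → Good w → length w ≤ r + s
    good-length w fw = let (p , q) = good-leaves w fw in
      subst₂ _≤_ (length-pick w) (cong₂ _+_ p q) (+-mono-≤ (length≤leavesF (pick false w)) (length≤leavesF (pick true w)))

    record Built (w : List Bead) : Set where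
      field
        data-of : RData (r + s)
        real : IsRealization data-of
        trees : Fin (suc (suc (m₀ data-of))) → BT
        modeled : Model data-of trees
        word≡ : word modeled ≡ w

    -- Since r, s ≥ 1, both colours occur, which gives at least two beads and a mixed orientation.
    -- The leaves add up to r + s, the number of vertices.
    build : ∀ w → Good w → Built w
    build w fw = go (length w) refl
      where
      nonempty : ∀ c → 1 ≤ length (pick c w)
      nonempty false = 1≤leavesF (pick false w) (subst (1 ≤_) (sym (proj₁ (good-leaves w fw))) 1≤r)
      nonempty true = 1≤leavesF (pick true w) (subst (1 ≤_) (sym (proj₂ (good-leaves w fw))) 1≤s)
      2≤ : 2 ≤ length w
      2≤ = subst (2 ≤_) (length-pick w) (+-mono-≤ (nonempty false) (nonempty true))
      go : ∀ k → length w ≡ k → Built w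
      go zero e = ⊥-elim (<⇒≱ 2≤ (subst (_≤ 1) (sym e) z≤n))
      go (suc zero) e = ⊥-elim (<⇒≱ 2≤ (≤-reflexive e))
      go (suc (suc k)) e = record { data-of = R ; real = isRealization ; trees = tr ; modeled = modelR ; word≡ = tab≡ }
        where
        f : Fin (suc (suc k)) → Bead
        f i = at w (toℕ i)
        cwf : Fin (suc (suc k)) → Bool
        cwf i = proj₁ (f i)
        tr : Fin (suc (suc k)) → BT
        tr i = proj₂ (f i)
        tab≡ : tabulate f ≡ w
        tab≡ = at-ext (trans (Listₚ.length-tabulate f) (sym e)) (λ i → trans (at-tabulate f i)
          (trans (cong (at w) (trans (Cyclic.toℕ-mod k i) (cong (i %%_) (sym e)))) (at-%% w i)))
        colour : ∀ c → ∃[ i ] cwf i ≡ c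
        colour c = let (j , j< , p) = pick-nonempty c w (nonempty c); j<′ = subst (j <_) e j< in
          fromℕ< j<′ , trans (cong (proj₁ ∘ at w) (toℕ-fromℕ< j<′)) (trans (cong proj₁ (at< w j<)) p)
        mixed : ∃[ i ] ∃[ j ] cwf i ≢ cwf j
        mixed = let (i , p) = colour false; (j , q) = colour true in i , j , λ x → absurd (trans (sym p) (trans x q))
          where
          absurd : false ≡ true → ⊥
          absurd ()
        size : total (leaves ∘ tr) ≡ r + s
        size = trans (sym (∑-tabulate f (leaves ∘ proj₂))) (trans (cong (λ v → ∑ v (leaves ∘ proj₂)) tab≡)
          (trans (leavesF-pick w) (cong₂ _+_ (proj₁ (good-leaves w fw)) (proj₂ (good-leaves w fw)))))
        bij : Σ (Fin (suc (suc k))) (λ i → Maybe (Node (tr i))) ↔ Fin (r + s)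
        bij = subst (λ n → Σ (Fin (suc (suc k))) (λ i → Maybe (Node (tr i))) ↔ Fin n) size (Σ-Fin (leaves ∘ tr) (cells ∘ tr))
        open Build k cwf tr mixed bij

    realization : ∀ w → Good w → Realization (r + s)
    realization w fw = Built.data-of (build w fw) , Built.real (build w fw)

    classes : List (List Bead)
    classes = concatMap (λ i → necklaces (suc i) r ma s mb (s≤s z≤n)) (upTo (r + s))

    necklace-member : ∀ i {w} → w ∈ necklaces (suc i) r ma s mb (s≤s z≤n) → length w ≡ suc i × Good w
    necklace-member i w∈ = fitting⁻ (suc i) r ma s mb (Burnside.reps⊆ _≟ʷ_ (suc i) (s≤s z≤n) (fitting (suc i) r ma s mb) w∈)

    classes-good : All Good classes
    classes-good = All.tabulate (λ w∈ → let (i , _ , w∈′) = ∈-concatMap⁻′ _ {xs = upTo (r + s)} w∈ in proj₂ (necklace-member i w∈′))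

    length-classes : length classes ≡ count
    length-classes = trans (length≡∑1 classes) (trans (∑-concatMap (λ i → necklaces (suc i) r ma s mb (s≤s z≤n)) (upTo (r + s)) (λ _ → 1))
      (∑-cong′ (upTo (r + s)) (λ i → sym (length≡∑1 (necklaces (suc i) r ma s mb (s≤s z≤n))))))

    Rotated : List Bead → List Bead → Set
    Rotated x y = ∃[ t ] rotate t y ≡ x

    -- Within one length the representatives are separated by construction, and rotation preserves
    -- length.
    classes-distinct : AllPairs (λ x y → ¬ Rotated x y) classes
    classes-distinct = AllPairsₚ.concat⁺
      (Allₚ.map⁺ (All.tabulate (λ {i} _ → Burnside.reps-pairs _≟ʷ_ (suc i) (s≤s z≤n) (fitting (suc i) r ma s mb))))
      (AllPairsₚ.map⁺ (AllPairsₚ.applyUpTo⁺₁ (λ i → i) (r + s) (λ {i} {j} i<j _ →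
        All.tabulate (λ x∈ → All.tabulate (λ {y} y∈ (t , e) →
          <⇒≢ i<j (suc-injective (trans (sym (proj₁ (necklace-member i x∈))) (trans (cong length (sym e)) (trans (length-rotate t y) (proj₁ (necklace-member j y∈)))))))))))

    classes-cover : ∀ w → Good w → ∃[ y ] y ∈ classes × Rotated w y
    classes-cover w fw = go (length w) refl
      where
      go : ∀ k → length w ≡ k → ∃[ y ] y ∈ classes × Rotated w y
      go zero e = ⊥-elim (<⇒≱ (subst (1 ≤_) (trans (+-comm (length (pick true w)) _) (trans (length-pick w) e))
        (≤-trans (1≤leavesF (pick true w) (subst (1 ≤_) (sym (proj₂ (good-leaves w fw))) 1≤s)) (m≤m+n _ (length (pick false w))))) z≤n)
      go (suc i) e = let (y , y∈ , w~y) = Burnside.reps-cover _≟ʷ_ (suc i) (s≤s z≤n) (fitting (suc i) r ma s mb) (proj₁ ∘ fitting⁻ (suc i) r ma s mb) (fitting⁺ (suc i) r ma s mb e fw) in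
        y , ∈-concatMap⁺′ (λ i → necklaces (suc i) r ma s mb (s≤s z≤n)) {x = i} (∈-upTo⁺ (subst (_≤ r + s) e (good-length w fw))) y∈ , w~y

    module _ (P : RData (r + s) → Set)
      (P⇒good : ∀ {R tr} → IsRealization R → (M : Model R tr) → P R → Good (word M))
      (good⇒P : ∀ {R tr} → IsRealization R → (M : Model R tr) → Good (word M) → P R) where

      realize : ∀ {ws} → All Good ws → List (Realization (r + s))
      realize [] = []
      realize (_∷_ {x = w} g gs) = realization w g ∷ realize gs

      length-realize : ∀ {ws} (gs : All Good ws) → length (realize gs) ≡ length ws
      length-realize [] = refl
      length-realize (g ∷ gs) = cong suc (length-realize gs)

      realize-P : ∀ {ws} (gs : All Good ws) → All (λ R → P (proj₁ R)) (realize gs)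
      realize-P [] = []
      realize-P (_∷_ {x = w} g gs) = good⇒P real modeled (subst Good (sym word≡) g) ∷ realize-P gs
        where open Built (build w g)

      distinct : ∀ x y (gx : Good x) (gy : Good y) → ¬ Rotated x y → ¬ Identified (realization x gx) (realization y gy)
      distinct x y gx gy ne id = ne (proj₁ turn , trans (cong (rotate (proj₁ turn)) (sym Y.word≡)) (trans (proj₂ turn) X.word≡))
        where
        module X = Built (build x gx)
        module Y = Built (build y gy)
        turn = identified⇒rotation X.data-of Y.data-of X.real Y.real X.modeled Y.modeled id

      realize-distinct : ∀ {ws} (gs : All Good ws) → AllPairs (λ x y → ¬ Rotated x y) ws → AllPairs (λ R R′ → ¬ Identified R R′) (realize gs)
      realize-distinct [] [] = []
      realize-distinct (_∷_ {x = x} g gs) (p ∷ ps) = against gs p ∷ realize-distinct gs ps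
        where
        against : ∀ {ws} (hs : All Good ws) → All (λ y → ¬ Rotated x y) ws → All (λ R′ → ¬ Identified (realization x g) R′) (realize hs)
        against [] [] = []
        against (_∷_ {x = y} h hs) (n ∷ ns) = distinct x y g h n ∷ against hs ns

      realize-cover : ∀ {ws} (gs : All Good ws) {y} → y ∈ ws → ∀ R (isR : IsRealization R) {tr} (M : Model R tr) → Rotated (word M) y → Any (Identified (R , isR)) (realize gs)
      realize-cover (_∷_ {x = w} g gs) (here refl) R isR {tr} M (t , e) = here (identify R Y.data-of isR Y.real M Y.modeled t m≡ (trans (cong (rotate t) Y.word≡) e))
        where
        module Y = Built (build w g)
        m≡ : m₀ R ≡ m₀ Y.data-of
        m≡ = suc-injective (suc-injective (trans (sym (Listₚ.length-tabulate (λ i → cw R i , tr i))) (trans (cong length (sym e)) (trans (length-rotate t w)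
          (trans (cong length (sym Y.word≡)) (Listₚ.length-tabulate (λ i → cw Y.data-of i , Y.trees i)))))))
      realize-cover (g ∷ gs) (there y∈) R isR M rot = there (realize-cover gs y∈ R isR M rot)

      -- The property P enters only through the words of models, so both counts share this argument:
      -- one realization is built for each necklace, and every other realization has a word that
      -- rotates to one of these.
      hasCount : ∀ q → ι count ≡ q → HasCount (r + s) P q
      hasCount q e = realize classes-good , realize-P classes-good , realize-distinct classes-good classes-distinct , cover ,
        trans (sym (ι-⟦⟧ _)) (trans (cong ι (trans (length-realize classes-good) length-classes)) e)
        where
        cover : ∀ R → P (proj₁ R) → Any (Identified R) (realize classes-good)
        cover (R , isR) p = let open Realized R isR; (y , y∈ , w~y) = classes-cover (word model) (P⇒good isR model p) in
          realize-cover classes-good y∈ R isR model w~y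

  module Stats {n} {R : RData n} {tr} (isR : IsRealization R) (M : Model R tr) where
    open Realized R isR
    open WithModel M

    anticlockwise-leaves : leavesF (pick false (word M)) ≡ r₁ R + 2 * r₂ R
    anticlockwise-leaves = leaves-stat false
    anticlockwise-cherries : cherriesF (pick false (word M)) ≡ r₂ R
    anticlockwise-cherries = cycles3≡ false
    clockwise-leaves : leavesF (pick true (word M)) ≡ s₁ R + 2 * s₂ R
    clockwise-leaves = leaves-stat true
    clockwise-cherries : cherriesF (pick true (word M)) ≡ s₂ R
    clockwise-cherries = cycles3≡ true

  module _ (r s : ℕ) (1≤r : 1 ≤ r) (1≤s : 1 ≤ s) where

    count-by-size : HasCount (r + s) (λ R → r₁ R + 2 * r₂ R ≡ r × s₁ R + 2 * s₂ R ≡ s) (formula₁ r s)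
    count-by-size = Count.hasCount r nothing s nothing 1≤r 1≤s _
      (λ isR M (p , q) → let open Stats isR M in
        cong₂ _∧_ (cong (_∧ true) (match-just⁺ r (trans anticlockwise-leaves p))) (cong (_∧ true) (match-just⁺ s (trans clockwise-leaves q))))
      (λ isR M fw → let open Stats isR M; (p , q) = Count.good-leaves r nothing s nothing 1≤r 1≤s (word M) fw in
        trans (sym anticlockwise-leaves) p , trans (sym clockwise-leaves) q)
      (formula₁ r s) (formula₁-total r s 1≤r 1≤s)

    -- Leaves and cherries determine all four parameters, because r₁ and s₁ are recovered from r and
    -- s by subtracting twice the cherries.
    count-by-parameters : ∀ a₁ a₂ b₁ b₂ → r ≡ a₁ + 2 * a₂ → s ≡ b₁ + 2 * b₂ →
      HasCount (r + s) (λ R → r₁ R ≡ a₁ × r₂ R ≡ a₂ × s₁ R ≡ b₁ × s₂ R ≡ b₂) (formula₂ r a₂ s b₂)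
    count-by-parameters a₁ a₂ b₁ b₂ r≡ s≡ = hasCount _
      (λ isR M (p , p′ , q , q′) → let open Stats isR M in
        cong₂ _∧_ (cong₂ _∧_ (match-just⁺ r (trans anticlockwise-leaves (trans (cong₂ (λ x y → x + 2 * y) p p′) (sym r≡)))) (match-just⁺ a₂ (trans anticlockwise-cherries p′)))
                  (cong₂ _∧_ (match-just⁺ s (trans clockwise-leaves (trans (cong₂ (λ x y → x + 2 * y) q q′) (sym s≡)))) (match-just⁺ b₂ (trans clockwise-cherries q′))))
      (λ isR M fw → let open Stats isR M; (p , q) = good-leaves (word M) fw; (p′ , q′) = good-cherries (word M) fw in
        cancel (trans (sym anticlockwise-leaves) p) r≡ (trans (sym anticlockwise-cherries) p′) , trans (sym anticlockwise-cherries) p′ ,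
        cancel (trans (sym clockwise-leaves) q) s≡ (trans (sym clockwise-cherries) q′) , trans (sym clockwise-cherries) q′)
      (formula₂ r a₂ s b₂) (formula₂-total r a₂ s b₂ 1≤r 1≤s (subst (a₂ ≤_) (sym r≡) (half a₁ a₂)) (subst (b₂ ≤_) (sym s≡) (half b₁ b₂)))
      where
      open Count r (just a₂) s (just b₂) 1≤r 1≤s using (Good; good-leaves; hasCount)
      half : ∀ x y → y ≤ x + 2 * y
      half x y = ≤-trans (m≤m+n y (y + 0)) (m≤n+m (2 * y) x)
      cancel : ∀ {x y z a b} → x + 2 * y ≡ z → z ≡ a + 2 * b → y ≡ b → x ≡ a
      cancel {x} {y} {a = a} e e′ refl = +-cancelʳ-≡ (2 * y) x a (trans e e′)
      good-cherries : ∀ w → Good w → cherriesF (pick false w) ≡ a₂ × cherriesF (pick true w) ≡ b₂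
      good-cherries w fw =
        let (p , q) = ∧-true⁻ (match (just r) (leavesF (pick false w)) ∧ match (just a₂) (cherriesF (pick false w))) fw
        in match-just a₂ _ (proj₂ (∧-true⁻ (match (just r) (leavesF (pick false w))) p)) ,
           match-just b₂ _ (proj₂ (∧-true⁻ (match (just s) (leavesF (pick true w))) q))

open import Data.Nat using (ℕ; _+_; _*_; _≤_)
open import Data.Product using (_×_)
open Classification using (count-by-size; count-by-parameters)

theorem3p5 : (r s : ℕ) → 1 ≤ r → 1 ≤ s →
    HasCount (r + s) (λ R → r₁ R + 2 * r₂ R ≡ r × s₁ R + 2 * s₂ R ≡ s) (formula₁ r s)
    × ((a₁ a₂ b₁ b₂ : ℕ) → r ≡ a₁ + 2 * a₂ → s ≡ b₁ + 2 * b₂ →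
    HasCount (r + s) (λ R → r₁ R ≡ a₁ × r₂ R ≡ a₂ × s₁ R ≡ b₁ × s₂ R ≡ b₂)
    (formula₂ r a₂ s b₂))
theorem3p5 r s 1≤r 1≤s = count-by-size r s 1≤r 1≤s , count-by-parameters r s 1≤r 1≤s
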